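{- Let $\zeta_7$ be a primitive seventh root of unity and write $c_1=\zeta_7+\zeta_7^6$, $c_2=\zeta_7^2+\zeta_7^5$. Then $$\frac{1}{(q;q)_\infty}\left(\sum_{n=-\infty}^\infty\frac{q^{3n^2+2n}}{(1-\zeta_7q^{3n})(1-\zeta_7^{ -1}q^{3n})}-\sum_{n=-\infty}^\infty \frac{q^{3n^2+4n+1}}{(1-\zeta_7q^{3n+1})(1-\zeta_7^{ -1}q^{3n+1})}\right)=(q^{49};q^{49})_\infty\sum_{j=0}^{6}q^jA_{37j}(q^7),$$ where $$A_{370}(q)=\frac{6+3c_1+c_2}{7}\frac{[q^3;q^7]_\infty}{[q,q^2;q^7]_\infty}-q^2(1+c_1)\frac{1}{[q^6,q^7,q^8;q^{21}]_\infty},\qquad A_{371}(q)=\frac{ -1+3c_1+c_2}{7}\frac{1}{[q;q^7]_\infty},$$ $$A_{372}(q)=\frac{5-c_1+2c_2}{7}\frac{[q^2;q^7]_\infty}{[q,q^3;q^7]_\infty}-q(1+c_2)\frac{1}{[q^3,q^7,q^{10};q^{21}]_\infty},\qquad A_{373}(q)=\frac{ -3+2c_1-4c_2}{7}\frac{1}{[q^2;q^7]_\infty},$$ $$A_{374}(q)=\frac{2+c_1+5c_2}{7}\frac{1}{[q^3;q^7]_\infty},\qquad A_{375}(q)=c_1\frac{[q^5;q^{21}]_\infty}{[q^3,q^4,q^7,q^7;q^{21}]_\infty}+q^2c_1\frac{[q^2;q^{21}]_\infty}{[q^3,q^7,q^7,q^{10};q^{21}]_\infty},$$ $$A_{376}(q)=\frac{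 -4-2c_1-3c_2}{7}\frac{[q;q^7]_\infty}{[q^2,q^3;q^7]_\infty}+\frac{1+(1+c_2)}{[q^2,q^7,q^9;q^{21}]_\infty}.$$
   Context: $(a;q)_\infty=\prod_{j\ge0}(1-aq^j)$; $[z;q]_\infty=(z;q)_\infty(q/z;q)_\infty$ and $[z_1,\dots,z_k;q]_\infty=[z_1;q]_\infty\cdots[z_k;q]_\infty$. -}

module Defs where

open import Level using (Level; _⊔_) renaming (suc to lsuc)
open import Data.Nat as ℕ using (ℕ; zero; suc; _∸_; _<_)
open import Data.Nat.DivMod using (_%_; _/_)
open import Data.Integer using (ℤ; +_; -[1+_])
open import Relation.Nullary using (¬_; yes; no)
open import Algebra.Bundles using (CommutativeRing)

-- A field: a commutative ring with 0 ≠ 1 in which every nonzero element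
-- has a multiplicative inverse (the inverse function is total; its value
-- at 0 is irrelevant).
record Field (c ℓ : Level) : Set (lsuc (c ⊔ ℓ)) where
  field
    commutativeRing : CommutativeRing c ℓ
  open CommutativeRing commutativeRing public
  field
    _⁻¹       : Carrier → Carrier
    ⁻¹-inverse : ∀ x → ¬ (x ≈ 0#) → (x * (x ⁻¹)) ≈ 1#
    0≉1       : ¬ (0# ≈ 1#)

module FieldNotions {c ℓ : Level} (F : Field c ℓ) where
  open Field F

  pow : Carrier → ℕ → Carrier
  pow x zero    = 1#
  pow x (suc n) = x * pow x n

  nat : ℕ → Carrier
  nat zero    = 0#
  nat (suc n) = 1# + nat n

  CharZero : Set ℓ
  CharZero = ∀ n → ¬ (nat (suc n) ≈ 0#)

  record IsPrimitiveRoot (n : ℕ) (ζ : Carrier) : Set ℓ where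
    field
      root      : pow ζ n ≈ 1#
      isPrimitive : ∀ k → 0 < k → k < n → ¬ (pow ζ k ≈ 1#)

module Series {c ℓ : Level} (F : Field c ℓ) where
  open Field F
  open FieldNotions F public

  PS : Set c
  PS = ℕ → Carrier

  _≋_ : PS → PS → Set ℓ
  f ≋ g = ∀ n → f n ≈ g n

  sumTo : ℕ → (ℕ → Carrier) → Carrier
  sumTo zero    h = h 0
  sumTo (suc n) h = sumTo n h + h (suc n)

  one : PS
  one zero    = 1#
  one (suc n) = 0#

  shift : ℕ → PS → PS
  shift zero    f         = f
  shift (suc k) f zero    = 0#
  shift (suc k) f (suc n) = shift k f n

  mono : ℕ → PS
  mono k = shift k one

  _⊕_ : PS → PS → PS
  (f ⊕ g) n = f n + g n

  _⊖_ : PS → PS → PS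
  (f ⊖ g) n = f n + (- g n)

  _·_ : Carrier → PS → PS
  (a · f) n = a * f n

  _⊛_ : PS → PS → PS
  (f ⊛ g) n = sumTo n (λ i → f i * g (n ∸ i))

  infixl 6 _⊕_ _⊖_
  infixl 7 _⊛_
  infixr 8 _·_

  -- multiplicative inverse of a power series (meaningful when the constant
  -- term is nonzero): g₀ = f₀⁻¹, gₙ = - f₀⁻¹ Σ_{i=1}^{n} fᵢ g_{n-i}.
  -- invTab f n m = g m for m ≤ n.
  invTab : PS → ℕ → ℕ → Carrier
  invTab f zero    m = (f 0) ⁻¹
  invTab f (suc n) m with m ℕ.≤? n
  ... | yes _ = invTab f n m
  ... | no  _ = - ((f 0) ⁻¹ * sumTo n (λ i → f (suc i) * invTab f n (n ∸ i)))

  inv : PS → PS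
  inv f n = invTab f n n

  -- (q^a ; q^d)_∞ for a ≥ 1, d ≥ 1: its coefficient of q^n only involves
  -- the factors (1 - q^{a+dj}) with j ≤ n.
  prodTo : ℕ → (ℕ → PS) → PS
  prodTo zero    h = h 0
  prodTo (suc n) h = prodTo n h ⊛ h (suc n)

  poch : ℕ → ℕ → PS
  poch a d n = prodTo n (λ j → one ⊖ mono (a ℕ.+ d ℕ.* j)) n

  -- [q^a ; q^b]_∞ = (q^a;q^b)_∞ (q^{b-a};q^b)_∞   (0 < a < b)
  theta : ℕ → ℕ → PS
  theta a b = poch a b ⊛ poch (b ∸ a) b

  dilate7 : PS → PS
  dilate7 f n with n % 7 ℕ.≟ 0
  ... | yes _ = f (n / 7)
  ... | no  _ = 0#

  -- Bilateral sum Σ_{n∈ℤ} T n of a family whose n-th member has order ≥ |n|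
  -- (so only |n| ≤ N contributes to the coefficient of q^N).
  bisum : (ℤ → PS) → PS
  bisum T N = sumTo N (λ k → T (+ k) N) + sumTo N (λ k → T (-[1+ k ]) N)

  sum7 : (ℕ → PS) → PS
  sum7 h N = sumTo 6 (λ j → h j N)

module Thm7 {c ℓ : Level} (F : Field c ℓ) (ζ : Field.Carrier F) where
  open Field F
  open Series F public

  ζ⁻¹ : Carrier
  ζ⁻¹ = ζ ⁻¹

  c₁ c₂ : Carrier
  c₁ = ζ + pow ζ 6
  c₂ = pow ζ 2 + pow ζ 5

  _/7 : Carrier → Carrier
  x /7 = x * (nat 7 ⁻¹)

  D : ℕ → PS
  D m = inv ((one ⊖ ζ · mono m) ⊛ (one ⊖ ζ⁻¹ · mono m))

  -- n-th term of the first sum: q^{3n²+2n} / ((1-ζq^{3n})(1-ζ⁻¹q^{3n})).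
  -- For n = -k (k ≥ 1) the rational function is rewritten with positive
  -- powers: q^{3k²-2k}/((1-ζq^{-3k})(1-ζ⁻¹q^{-3k})) = q^{3k²+4k} D(3k).
  term₁ : ℤ → PS
  term₁ (+ n)      = shift (3 ℕ.* n ℕ.* n ℕ.+ 2 ℕ.* n) (D (3 ℕ.* n))
  term₁ (-[1+ j ]) = let k = suc j in
    shift (3 ℕ.* k ℕ.* k ℕ.+ 4 ℕ.* k) (D (3 ℕ.* k))

  -- n-th term of the second sum: q^{3n²+4n+1}/((1-ζq^{3n+1})(1-ζ⁻¹q^{3n+1})).
  -- For n = -k (k ≥ 1): = q^{3k²+2k-1} D(3k-1).
  term₂ : ℤ → PS
  term₂ (+ n)      = shift (3 ℕ.* n ℕ.* n ℕ.+ 4 ℕ.* n ℕ.+ 1) (D (3 ℕ.* n ℕ.+ 1))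
  term₂ (-[1+ j ]) = let k = suc j in
    shift (3 ℕ.* k ℕ.* k ℕ.+ 2 ℕ.* k ∸ 1) (D (3 ℕ.* k ∸ 1))

  LHS : PS
  LHS = inv (poch 1 1) ⊛ (bisum term₁ ⊖ bisum term₂)

  A : ℕ → PS
  A 0 = ((nat 6 + nat 3 * c₁ + c₂) /7) · (theta 3 7 ⊛ inv (theta 1 7 ⊛ theta 2 7))
        ⊖ (1# + c₁) · shift 2 (inv (theta 6 21 ⊛ theta 7 21 ⊛ theta 8 21))
  A 1 = ((- 1# + nat 3 * c₁ + c₂) /7) · inv (theta 1 7)
  A 2 = ((nat 5 - c₁ + nat 2 * c₂) /7) · (theta 2 7 ⊛ inv (theta 1 7 ⊛ theta 3 7))
        ⊖ (1# + c₂) · shift 1 (inv (theta 3 21 ⊛ theta 7 21 ⊛ theta 10 21))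
  A 3 = ((- nat 3 + nat 2 * c₁ - nat 4 * c₂) /7) · inv (theta 2 7)
  A 4 = ((nat 2 + c₁ + nat 5 * c₂) /7) · inv (theta 3 7)
  A 5 = c₁ · (theta 5 21 ⊛ inv (theta 3 21 ⊛ theta 4 21 ⊛ theta 7 21 ⊛ theta 7 21))
        ⊕ c₁ · shift 2 (theta 2 21 ⊛ inv (theta 3 21 ⊛ theta 7 21 ⊛ theta 7 21 ⊛ theta 10 21))
  A 6 = ((- nat 4 - nat 2 * c₁ - nat 3 * c₂) /7) · (theta 1 7 ⊛ inv (theta 2 7 ⊛ theta 3 7))
        ⊕ (1# + (1# + c₂)) · inv (theta 2 21 ⊛ theta 7 21 ⊛ theta 9 21)
  A (suc (suc (suc (suc (suc (suc (suc _))))))) = λ _ → 0#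

  RHS : PS
  RHS = poch 49 49 ⊛ sum7 (λ j → shift j (dilate7 (A j)))

{-# OPTIONS --safe #-}
-- Put δ_m = (1 - ζq^m)(1 - ζ⁻¹q^m), P = ∏_{m≥0} δ_m, E = (q;q)_∞, and let S be the difference of the two Lambert series.
-- Partial fractions give C P = E² for C = Σ_m v_m/δ_m with explicit v_m. Multiplying C by
-- Y = Σ_n (-1)^n q^{n(3n+1)/2} (ζ^{n+1} + ζ^{-n})/(1 + ζ) turns each v_m/δ_m into a theta series over δ_m, which is E times a
-- monomial or 0 according to m mod 3, so that Y C = E S. Hence S P = Y E, and it remains to show RHS · P = Y.
-- Now P E, Y and E are theta series, whose 7-dissections are read off from Jacobi's triple product. With t_a = [q^a; q^7],
-- α = t₂/t₁, β = t₃/t₂, γ = t₁/t₃, the seven residue classes become polynomial identities modulo the minimal polynomial of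
-- ζ + ζ⁻¹ and the Klein quartic α = β² + qβγ²; the quartic and the relations between level 7 and level 21 are all instances of
-- the three-term relation for theta products.
module Submission where

open import Defs
open import Level using (Level) renaming (suc to lsuc; _⊔_ to _⊔ˡ_)
open import Data.Nat as ℕ using (ℕ; zero; suc; _∸_; _≤_; _<_; _⊔_; z≤n; s≤s)
import Data.Nat.Properties as ℕP
open import Data.Nat.DivMod as ℕD using (_%_; _/_)
open import Data.Nat.Tactic.RingSolver using () renaming (solve-∀ to ℕ-solve-∀)
open import Data.Integer as ℤ using (ℤ; +_; -[1+_])
import Data.Integer.Properties as ℤP
open import Data.Integer.Tactic.RingSolver using (solve-∀)
open import Data.Empty using (⊥-elim)
open import Data.Maybe using (Maybe; just; nothing)
open import Data.Product using (∃; _×_; _,_; proj₁; proj₂)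
open import Data.Sum using (_⊎_; inj₁; inj₂)
open import Relation.Nullary using (¬_; yes; no)
open import Relation.Binary.PropositionalEquality as ≡ using (_≡_)
open import Relation.Binary.Structures using (IsEquivalence)
open import Algebra.Bundles using (CommutativeRing)
open import Algebra.Solver.Ring.AlmostCommutativeRing using (_-Raw-AlmostCommutative⟶_; fromCommutativeRing)
import Algebra.Properties.Ring
import Algebra.Properties.Semiring.Exp as Exp
import Algebra.Solver.Ring
import Relation.Binary.Reasoning.Setoid

module RingTools {c ℓ} (R : CommutativeRing c ℓ) where

  open CommutativeRing R
  open Algebra.Properties.Ring ring
  open Relation.Binary.Reasoning.Setoid setoid

  fromℕ : ℕ → Carrier
  fromℕ zero = 0#
  fromℕ (suc zero) = 1#
  fromℕ (suc (suc n)) = 1# + fromℕ (suc n)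

  fromℕ-suc : ∀ n → fromℕ (suc n) ≈ 1# + fromℕ n
  fromℕ-suc zero = sym (+-identityʳ 1#)
  fromℕ-suc (suc n) = refl

  fromℤ : ℤ → Carrier
  fromℤ (+ n) = fromℕ n
  fromℤ -[1+ n ] = - fromℕ (suc n)

  fromℕ-+ : ∀ m n → fromℕ (m ℕ.+ n) ≈ fromℕ m + fromℕ n
  fromℕ-+ zero n = sym (+-identityˡ _)
  fromℕ-+ (suc m) n = trans (fromℕ-suc (m ℕ.+ n))
    (trans (+-congˡ (fromℕ-+ m n)) (trans (sym (+-assoc _ _ _)) (+-congʳ (sym (fromℕ-suc m)))))

  fromℕ-* : ∀ m n → fromℕ (m ℕ.* n) ≈ fromℕ m * fromℕ n
  fromℕ-* zero n = sym (zeroˡ _)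
  fromℕ-* (suc m) n = begin
    fromℕ (n ℕ.+ m ℕ.* n)          ≈⟨ fromℕ-+ n (m ℕ.* n) ⟩
    fromℕ n + fromℕ (m ℕ.* n)      ≈⟨ +-cong (sym (*-identityˡ _)) (fromℕ-* m n) ⟩
    1# * fromℕ n + fromℕ m * fromℕ n ≈⟨ distribʳ _ _ _ ⟨
    (1# + fromℕ m) * fromℕ n       ≈⟨ *-congʳ (fromℕ-suc m) ⟨
    fromℕ (suc m) * fromℕ n        ∎

  fromℤ-⊖ : ∀ m n → fromℤ (m ℤ.⊖ n) ≈ fromℕ m + - fromℕ n
  fromℤ-⊖ m zero = sym (trans (+-congˡ -0#≈0#) (+-identityʳ _))
  fromℤ-⊖ zero (suc n) = sym (+-identityˡ _)
  fromℤ-⊖ (suc m) (suc n) = begin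
    fromℤ (suc m ℤ.⊖ suc n)                 ≡⟨ ≡.cong fromℤ (ℤP.[1+m]⊖[1+n]≡m⊖n m n) ⟩
    fromℤ (m ℤ.⊖ n)                         ≈⟨ fromℤ-⊖ m n ⟩
    fromℕ m + - fromℕ n                     ≈⟨ +-congʳ (+-identityʳ _) ⟨
    fromℕ m + 0# + - fromℕ n                ≈⟨ +-congʳ (+-congˡ (-‿inverseʳ 1#)) ⟨
    fromℕ m + (1# + - 1#) + - fromℕ n       ≈⟨ +-congʳ (+-assoc _ _ _) ⟨
    fromℕ m + 1# + - 1# + - fromℕ n         ≈⟨ +-assoc _ _ _ ⟩
    fromℕ m + 1# + (- 1# + - fromℕ n)       ≈⟨ +-cong (+-comm _ _) (-‿+-comm 1# _) ⟩
    1# + fromℕ m + - (1# + fromℕ n)         ≈⟨ +-cong (fromℕ-suc m) (-‿cong (fromℕ-suc n)) ⟨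
    fromℕ (suc m) + - fromℕ (suc n)         ∎

  fromℤ-neg : ∀ i → fromℤ (ℤ.- i) ≈ - fromℤ i
  fromℤ-neg (+ zero) = sym -0#≈0#
  fromℤ-neg (+ suc n) = refl
  fromℤ-neg -[1+ n ] = sym (-‿involutive _)

  fromℤ-+ : ∀ i j → fromℤ (i ℤ.+ j) ≈ fromℤ i + fromℤ j
  fromℤ-+ (+ m) (+ n) = fromℕ-+ m n
  fromℤ-+ (+ m) -[1+ n ] = fromℤ-⊖ m (suc n)
  fromℤ-+ -[1+ m ] (+ n) = trans (fromℤ-⊖ n (suc m)) (+-comm _ _)
  fromℤ-+ -[1+ m ] -[1+ n ] = begin
    - fromℕ (suc (suc (m ℕ.+ n)))           ≡⟨ ≡.cong (λ k → - fromℕ (suc k)) (≡.sym (ℕP.+-suc m n)) ⟩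
    - fromℕ (suc m ℕ.+ suc n)               ≈⟨ -‿cong (fromℕ-+ (suc m) (suc n)) ⟩
    - (fromℕ (suc m) + fromℕ (suc n))       ≈⟨ -‿+-comm _ _ ⟨
    - fromℕ (suc m) + - fromℕ (suc n)       ∎

  fromℤ-* : ∀ i j → fromℤ (i ℤ.* j) ≈ fromℤ i * fromℤ j
  fromℤ-* (+ m) (+ n) = trans (reflexive (≡.cong fromℤ (≡.sym (ℤP.pos-* m n)))) (fromℕ-* m n)
  fromℤ-* (+ m) -[1+ n ] = begin
    fromℤ (+ m ℤ.* (ℤ.- + suc n))   ≡⟨ ≡.cong fromℤ (≡.sym (ℤP.neg-distribʳ-* (+ m) (+ suc n))) ⟩
    fromℤ (ℤ.- (+ m ℤ.* + suc n))   ≈⟨ fromℤ-neg (+ m ℤ.* + suc n) ⟩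
    - fromℤ (+ m ℤ.* + suc n)       ≈⟨ -‿cong (fromℤ-* (+ m) (+ suc n)) ⟩
    - (fromℕ m * fromℕ (suc n))     ≈⟨ -‿distribʳ-* _ _ ⟩
    fromℕ m * - fromℕ (suc n)       ∎
  fromℤ-* -[1+ m ] (+ n) = begin
    fromℤ ((ℤ.- + suc m) ℤ.* + n)   ≡⟨ ≡.cong fromℤ (≡.sym (ℤP.neg-distribˡ-* (+ suc m) (+ n))) ⟩
    fromℤ (ℤ.- (+ suc m ℤ.* + n))   ≈⟨ fromℤ-neg (+ suc m ℤ.* + n) ⟩
    - fromℤ (+ suc m ℤ.* + n)       ≈⟨ -‿cong (fromℤ-* (+ suc m) (+ n)) ⟩
    - (fromℕ (suc m) * fromℕ n)     ≈⟨ -‿distribˡ-* _ _ ⟩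
    - fromℕ (suc m) * fromℕ n       ∎
  fromℤ-* -[1+ m ] -[1+ n ] = begin
    fromℕ (suc m ℕ.* suc n)              ≈⟨ fromℕ-* (suc m) (suc n) ⟩
    fromℕ (suc m) * fromℕ (suc n)        ≈⟨ -‿involutive _ ⟨
    - - (fromℕ (suc m) * fromℕ (suc n))  ≈⟨ -‿cong (-‿distribˡ-* _ _) ⟩
    - (- fromℕ (suc m) * fromℕ (suc n))  ≈⟨ -‿distribʳ-* _ _ ⟩
    - fromℕ (suc m) * - fromℕ (suc n)    ∎

  ℤ⟶R : CommutativeRing.rawRing ℤP.+-*-commutativeRing -Raw-AlmostCommutative⟶ fromCommutativeRing R
  ℤ⟶R = record
    { ⟦_⟧ = fromℤ ; +-homo = fromℤ-+ ; *-homo = fromℤ-* ; -‿homo = fromℤ-neg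
    ; 0-homo = refl ; 1-homo = refl }

  fromℤ-≟ : (i j : ℤ) → Maybe (fromℤ i ≈ fromℤ j)
  fromℤ-≟ i j with i ℤ.≟ j
  ... | yes p = just (reflexive (≡.cong fromℤ p))
  ... | no _ = nothing

  open Algebra.Solver.Ring _ (fromCommutativeRing R) ℤ⟶R fromℤ-≟ public
    using (Polynomial; solve; con; _:=_; _:+_; _:*_; _:-_; :-_; _:^_)

module FiniteSums {c ℓ} (R : CommutativeRing c ℓ) where

  open CommutativeRing R
  open RingTools R
  open Relation.Binary.Reasoning.Setoid setoid

  triangle : ℕ → ℕ
  triangle zero = 0
  triangle (suc k) = triangle k ℕ.+ k

  partial : (ℕ → Carrier) → ℕ → Carrier
  partial T zero = 0#
  partial T (suc M) = partial T M + T M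

  product : (ℕ → Carrier) → ℕ → Carrier
  product T zero = 1#
  product T (suc M) = product T M * T M

  partial-cong : ∀ {T U} M → (∀ n → n < M → T n ≈ U n) → partial T M ≈ partial U M
  partial-cong zero e = refl
  partial-cong (suc M) e = +-cong (partial-cong M (λ n p → e n (ℕP.m≤n⇒m≤1+n p))) (e M ℕP.≤-refl)

  product-cong : ∀ {T U} M → (∀ n → T n ≈ U n) → product T M ≈ product U M
  product-cong zero e = refl
  product-cong (suc M) e = *-cong (product-cong M e) (e M)

  product-* : ∀ T U M → product (λ n → T n * U n) M ≈ product T M * product U M
  product-* T U zero = sym (*-identityˡ _)
  product-* T U (suc M) = trans (*-congʳ (product-* T U M))
    (solve 4 (λ a b x y → (a :* b) :* (x :* y) := (a :* x) :* (b :* y)) refl _ _ _ _)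

  partial-+ : ∀ T U M → partial (λ n → T n + U n) M ≈ partial T M + partial U M
  partial-+ T U zero = sym (+-identityˡ _)
  partial-+ T U (suc M) = trans (+-congʳ (partial-+ T U M))
    (solve 4 (λ a b x y → (a :+ b) :+ (x :+ y) := (a :+ x) :+ (b :+ y)) refl _ _ _ _)

  partial-*ˡ : ∀ x T M → partial (λ n → x * T n) M ≈ x * partial T M
  partial-*ˡ x T zero = sym (zeroʳ _)
  partial-*ˡ x T (suc M) = trans (+-congʳ (partial-*ˡ x T M)) (sym (distribˡ _ _ _))

  partial-0 : ∀ T M → (∀ n → n < M → T n ≈ 0#) → partial T M ≈ 0#
  partial-0 T zero e = refl
  partial-0 T (suc M) e = trans (+-cong (partial-0 T M (λ n p → e n (ℕP.m≤n⇒m≤1+n p))) (e M ℕP.≤-refl)) (+-identityˡ _)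

  partial-head : ∀ T M → partial T (suc M) ≈ T 0 + partial (λ n → T (suc n)) M
  partial-head T zero = trans (+-identityˡ _) (sym (+-identityʳ _))
  partial-head T (suc M) = trans (+-congʳ (partial-head T M)) (+-assoc _ _ _)

  partial-++ : ∀ T M K → partial T (M ℕ.+ K) ≈ partial T M + partial (λ n → T (M ℕ.+ n)) K
  partial-++ T M zero = trans (reflexive (≡.cong (partial T) (ℕP.+-identityʳ M))) (sym (+-identityʳ _))
  partial-++ T M (suc K) = trans (reflexive (≡.cong (partial T) (ℕP.+-suc M K)))
    (trans (+-congʳ (partial-++ T M K)) (+-assoc _ _ _))

  partial-swap : ∀ (T : ℕ → ℕ → Carrier) M K →
    partial (λ m → partial (T m) K) M ≈ partial (λ k → partial (λ m → T m k) M) K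
  partial-swap T zero K = sym (partial-0 _ K (λ _ _ → refl))
  partial-swap T (suc M) K = trans (+-congʳ (partial-swap T M K)) (sym (partial-+ _ _ K))

  partial-blocks : ∀ T d M → partial T (M ℕ.* d) ≈ partial (λ k → partial (λ i → T (k ℕ.* d ℕ.+ i)) d) M
  partial-blocks T d zero = refl
  partial-blocks T d (suc M) = begin
    partial T (d ℕ.+ M ℕ.* d)   ≡⟨ ≡.cong (partial T) (ℕP.+-comm d (M ℕ.* d)) ⟩
    partial T (M ℕ.* d ℕ.+ d)   ≈⟨ partial-++ T (M ℕ.* d) d ⟩
    partial T (M ℕ.* d) + partial (λ i → T (M ℕ.* d ℕ.+ i)) d ≈⟨ +-congʳ (partial-blocks T d M) ⟩
    partial (λ k → partial (λ i → T (k ℕ.* d ℕ.+ i)) d) (suc M) ∎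

  partial-reverse : ∀ T M → partial T M ≈ partial (λ i → T (M ℕ.∸ suc i)) M
  partial-reverse T zero = refl
  partial-reverse T (suc M) = trans (+-congʳ (partial-reverse T M)) (trans (+-comm _ _) (sym (partial-head _ M)))

-- x ≈[ N ] y stands for x - y ∈ Iₙ, for ideals Iₙ with zero intersection.
record FilteredRing (c ℓ : Level) : Set (lsuc (c ⊔ˡ ℓ)) where
  field
    commutativeRing : CommutativeRing c ℓ
  open CommutativeRing commutativeRing public
  infix 4 _≈[_]_
  field
    _≈[_]_ : Carrier → ℕ → Carrier → Set ℓ
    ≈⇒≈[] : ∀ {N x y} → x ≈ y → x ≈[ N ] y
    ≈[]-sym : ∀ {N x y} → x ≈[ N ] y → y ≈[ N ] x
    ≈[]-trans : ∀ {N x y z} → x ≈[ N ] y → y ≈[ N ] z → x ≈[ N ] z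
    +-cong[] : ∀ {N x x′ y y′} → x ≈[ N ] x′ → y ≈[ N ] y′ → x + y ≈[ N ] x′ + y′
    *-cong[] : ∀ {N x x′ y y′} → x ≈[ N ] x′ → y ≈[ N ] y′ → x * y ≈[ N ] x′ * y′
    -‿cong[] : ∀ {N x y} → x ≈[ N ] y → - x ≈[ N ] - y
    separated : ∀ {x y} → (∀ N → x ≈[ N ] y) → x ≈ y

module Limits {c ℓ} (A : FilteredRing c ℓ) where

  open FilteredRing A
  open RingTools commutativeRing
  open FiniteSums commutativeRing
  open Relation.Binary.Reasoning.Setoid setoid
  partial-cong[] : ∀ {N T U} M → (∀ n → n < M → T n ≈[ N ] U n) → partial T M ≈[ N ] partial U M
  partial-cong[] zero e = ≈⇒≈[] refl
  partial-cong[] (suc M) e = +-cong[] (partial-cong[] M (λ n p → e n (ℕP.m≤n⇒m≤1+n p))) (e M ℕP.≤-refl)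

  infix 4 _⟶_ _⇓_
  _⟶_ : (ℕ → Carrier) → Carrier → Set ℓ
  a ⟶ S = ∀ N → ∃ λ B → ∀ M → B ≤ M → a M ≈[ N ] S

  _⇓_ : (ℕ → Carrier) → Carrier → Set ℓ
  T ⇓ S = partial T ⟶ S

  ⟶-unique : ∀ {a S S′} → a ⟶ S → a ⟶ S′ → S ≈ S′
  ⟶-unique p p′ = separated λ N → let (B , e) = p N ; (B′ , e′) = p′ N in
    ≈[]-trans (≈[]-sym (e (B ⊔ B′) (ℕP.m≤m⊔n B B′))) (e′ (B ⊔ B′) (ℕP.m≤n⊔m B B′))

  ⟶-cong : ∀ {a b S S′} → (∀ M → a M ≈ b M) → S ≈ S′ → a ⟶ S → b ⟶ S′
  ⟶-cong e e′ p N = let (B , f) = p N in B , λ M q → ≈[]-trans (≈⇒≈[] (sym (e M))) (≈[]-trans (f M q) (≈⇒≈[] e′))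

  ⟶-zip : ∀ (_∙_ : Carrier → Carrier → Carrier) → (∀ {N x x′ y y′} → x ≈[ N ] x′ → y ≈[ N ] y′ → (x ∙ y) ≈[ N ] (x′ ∙ y′)) →
    ∀ {a b S S′} → a ⟶ S → b ⟶ S′ → (λ M → a M ∙ b M) ⟶ (S ∙ S′)
  ⟶-zip _∙_ ∙-cong p p′ N = let (B , e) = p N ; (B′ , e′) = p′ N in
    B ⊔ B′ , λ M q → ∙-cong (e M (ℕP.m⊔n≤o⇒m≤o B B′ q)) (e′ M (ℕP.m⊔n≤o⇒n≤o B B′ q))

  ⟶-+ : ∀ {a b S S′} → a ⟶ S → b ⟶ S′ → (λ M → a M + b M) ⟶ S + S′
  ⟶-+ = ⟶-zip _+_ +-cong[]

  ⟶-* : ∀ {a b S S′} → a ⟶ S → b ⟶ S′ → (λ M → a M * b M) ⟶ S * S′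
  ⟶-* = ⟶-zip _*_ *-cong[]

  ⟶-neg : ∀ {a S} → a ⟶ S → (λ M → - a M) ⟶ - S
  ⟶-neg p N = let (B , e) = p N in B , λ M q → -‿cong[] (e M q)

  ⟶-const : ∀ {S} → (λ _ → S) ⟶ S
  ⟶-const N = 0 , λ _ _ → ≈⇒≈[] refl

  ⟶-subseq : ∀ {a S} (f : ℕ → ℕ) → (∀ M → M ≤ f M) → a ⟶ S → (λ M → a (f M)) ⟶ S
  ⟶-subseq f g p N = let (B , e) = p N in B , λ M q → e (f M) (ℕP.≤-trans q (g M))

  ⟶-shift : ∀ {a S} → (λ M → a (suc M)) ⟶ S → a ⟶ S
  ⟶-shift p N = let (B , e) = p N in suc B , λ { (suc M) (s≤s q) → e M q }

  ⇓-unique : ∀ {T S S′} → T ⇓ S → T ⇓ S′ → S ≈ S′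
  ⇓-unique = ⟶-unique

  ⇓-cong : ∀ {T U S S′} → (∀ n → T n ≈ U n) → S ≈ S′ → T ⇓ S → U ⇓ S′
  ⇓-cong e = ⟶-cong (λ M → partial-cong M (λ n _ → e n))

  ⇓-+ : ∀ {T U S S′} → T ⇓ S → U ⇓ S′ → (λ n → T n + U n) ⇓ S + S′
  ⇓-+ p p′ = ⟶-cong (λ M → sym (partial-+ _ _ M)) refl (⟶-+ p p′)

  ⇓-*ˡ : ∀ x {T S} → T ⇓ S → (λ n → x * T n) ⇓ x * S
  ⇓-*ˡ x p = ⟶-cong (λ M → sym (partial-*ˡ x _ M)) refl (⟶-* ⟶-const p)

  ⇓-neg : ∀ {T S} → T ⇓ S → (λ n → - T n) ⇓ - S
  ⇓-neg p = ⇓-cong (λ n → -1* _) (-1* _) (⇓-*ˡ (- 1#) p)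
    where
    -1* : ∀ x → - 1# * x ≈ - x
    -1* = solve 1 (λ x → con -[1+ 0 ] :* x := :- x) refl

  ⇓-0 : (λ _ → 0#) ⇓ 0#
  ⇓-0 N = 0 , λ M _ → ≈⇒≈[] (partial-0 _ M (λ _ _ → refl))

  ⇓-terms : ∀ {T S} → T ⇓ S → T ⟶ 0#
  ⇓-terms {T} {S} p = ⟶-cong
    (λ M → solve 2 (λ a b → (a :+ b) :+ :- a := b) refl (partial T M) (T M))
    (-‿inverseʳ S)
    (⟶-+ (⟶-subseq suc (λ M → ℕP.n≤1+n M) p) (⟶-neg p))

  ⇓-blocks : ∀ {T S} d → T ⇓ S → (λ k → partial (λ i → T (k ℕ.* suc d ℕ.+ i)) (suc d)) ⇓ S
  ⇓-blocks {T} d p = ⟶-cong (λ M → partial-blocks T (suc d) M) refl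
    (⟶-subseq (ℕ._* suc d) (λ M → ℕP.m≤m*n M (suc d)) p)

  partial-stable : ∀ {N T} B K → (∀ n → B ≤ n → T n ≈[ N ] 0#) → partial T (B ℕ.+ K) ≈[ N ] partial T B
  partial-stable {N} {T} B zero v = ≈⇒≈[] (reflexive (≡.cong (partial T) (ℕP.+-identityʳ B)))
  partial-stable {N} {T} B (suc K) v = ≈[]-trans (≈⇒≈[] (reflexive (≡.cong (partial T) (ℕP.+-suc B K))))
    (≈[]-trans (+-cong[] (partial-stable B K v) (v (B ℕ.+ K) (ℕP.m≤m+n B K))) (≈⇒≈[] (+-identityʳ _)))

  ⇓-at : ∀ {N T S} B → (∀ n → B ≤ n → T n ≈[ N ] 0#) → T ⇓ S → partial T B ≈[ N ] S
  ⇓-at {N} {T} B v p = let (B′ , e) = p N in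
    ≈[]-trans (≈[]-sym (partial-stable B B′ v)) (e (B ℕ.+ B′) (ℕP.m≤n+m B′ B))

  ⇓-from : ∀ {T S} → (∀ N → ∃ λ B → (∀ n → B ≤ n → T n ≈[ N ] 0#) × partial T B ≈[ N ] S) → T ⇓ S
  ⇓-from {T} {S} h N = let (B , v , e) = h N in B , λ M q →
    ≡.subst (λ K → partial T K ≈[ N ] S) (ℕP.m+[n∸m]≡n q) (≈[]-trans (partial-stable B (M ℕ.∸ B) v) e)

  JointlyNull : (ℕ → ℕ → Carrier) → Set ℓ
  JointlyNull T = ∀ N → ∃ λ B → ∀ m n → B ≤ m ⊎ B ≤ n → T m n ≈[ N ] 0#

  fubini : ∀ {T : ℕ → ℕ → Carrier} {R C S} → JointlyNull T → (∀ m → T m ⇓ R m) → (∀ n → (λ m → T m n) ⇓ C n) →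
    R ⇓ S → C ⇓ S
  fubini {T} {R} {C} {S} null rows columns total = ⇓-from λ N →
    let (B , v) = null N
        colNull : ∀ n → B ≤ n → C n ≈[ N ] 0#
        colNull n q = ≈[]-sym (⇓-at 0 (λ m _ → v m n (inj₂ q)) (columns n))
        rowNull : ∀ m → B ≤ m → R m ≈[ N ] 0#
        rowNull m q = ≈[]-sym (⇓-at 0 (λ n _ → v m n (inj₁ q)) (rows m))
    in B , colNull ,
      ≈[]-trans (partial-cong[] B (λ n _ → ≈[]-sym (⇓-at B (λ m q → v m n (inj₁ q)) (columns n))))
      (≈[]-trans (≈⇒≈[] (sym (partial-swap T B B)))
      (≈[]-trans (partial-cong[] B (λ m _ → ⇓-at B (λ n q → v m n (inj₂ q)) (rows m)))
      (⇓-at B rowNull total)))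

  tannery : ∀ {T : ℕ → ℕ → Carrier} {U S} → (∀ N → ∃ λ B → ∀ M → B ≤ M → ∀ n → n < M → T M n ≈[ N ] U n) →
    U ⇓ S → (λ M → partial (T M) M) ⟶ S
  tannery h p N = let (B , e) = h N ; (B′ , e′) = p N in B ⊔ B′ , λ M q →
    ≈[]-trans (partial-cong[] M (e M (ℕP.m⊔n≤o⇒m≤o B B′ q))) (e′ M (ℕP.m⊔n≤o⇒n≤o B B′ q))

module ZSums {c ℓ} (A : FilteredRing c ℓ) where

  open FilteredRing A
  open RingTools commutativeRing
  open FiniteSums commutativeRing
  open Limits A
  open Algebra.Properties.Ring ring using (-0#≈0#)
  open Relation.Binary.Reasoning.Setoid setoid

  ‖_‖ : ℤ → ℕ
  ‖ + n ‖ = n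
  ‖ -[1+ n ] ‖ = n

  Null : (ℤ → Carrier) → Set ℓ
  Null T = ∀ N → ∃ λ B → ∀ n → B ≤ ‖ n ‖ → T n ≈[ N ] 0#

  pair : (ℤ → Carrier) → ℕ → Carrier
  pair T k = T (+ k) + T -[1+ k ]

  infix 4 _⇓ℤ_
  record _⇓ℤ_ (T : ℤ → Carrier) (S : Carrier) : Set ℓ where
    field
      null : Null T
      pairs : pair T ⇓ S
  open _⇓ℤ_ public

  null⁺ : ∀ {T} → Null T → (λ k → T (+ k)) ⟶ 0#
  null⁺ v N = let (B , e) = v N in B , λ M → e (+ M)

  null⁻ : ∀ {T} → Null T → (λ k → T -[1+ k ]) ⟶ 0#
  null⁻ v N = let (B , e) = v N in B , λ M → e -[1+ M ]

  Null-halves : ∀ {T} → (λ k → T (+ k)) ⟶ 0# → (λ k → T -[1+ k ]) ⟶ 0# → Null T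
  Null-halves p p′ N = let (B , e) = p N ; (B′ , e′) = p′ N in
    B ⊔ B′ , λ { (+ k) q → e k (ℕP.m⊔n≤o⇒m≤o B B′ q) ; -[1+ k ] q → e′ k (ℕP.m⊔n≤o⇒n≤o B B′ q) }

  Null-cong : ∀ {T U} → (∀ n → T n ≈ U n) → Null T → Null U
  Null-cong e v N = let (B , f) = v N in B , λ n q → ≈[]-trans (≈⇒≈[] (sym (e n))) (f n q)

  Null-*ˡ : ∀ x {T} → Null T → Null (λ n → x * T n)
  Null-*ˡ x v N = let (B , f) = v N in B , λ n q → ≈[]-trans (*-cong[] (≈⇒≈[] refl) (f n q)) (≈⇒≈[] (zeroʳ x))

  ⇓ℤ-unique : ∀ {T S S′} → T ⇓ℤ S → T ⇓ℤ S′ → S ≈ S′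
  ⇓ℤ-unique p p′ = ⇓-unique (pairs p) (pairs p′)

  ⇓ℤ-cong : ∀ {T U S S′} → (∀ n → T n ≈ U n) → S ≈ S′ → T ⇓ℤ S → U ⇓ℤ S′
  ⇓ℤ-cong e e′ p .null = Null-cong e (null p)
  ⇓ℤ-cong e e′ p .pairs = ⇓-cong (λ k → +-cong (e _) (e _)) e′ (pairs p)

  ⇓ℤ-*ˡ : ∀ x {T S} → T ⇓ℤ S → (λ n → x * T n) ⇓ℤ x * S
  ⇓ℤ-*ˡ x p .null = Null-*ˡ x (null p)
  ⇓ℤ-*ˡ x p .pairs = ⇓-cong (λ k → distribˡ _ _ _) refl (⇓-*ˡ x (pairs p))

  ρ : ℤ → ℤ
  ρ (+ k) = -[1+ k ]
  ρ -[1+ k ] = + k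

  ρ-≡ : ∀ n → ρ n ≡ -[1+ 0 ] ℤ.+ ℤ.- n
  ρ-≡ (+ zero) = ≡.refl
  ρ-≡ (+ suc k) = ≡.refl
  ρ-≡ -[1+ k ] = ≡.refl

  ⇓ℤ-reflect : ∀ {T S} → T ⇓ℤ S → (λ n → T (ρ n)) ⇓ℤ S
  ⇓ℤ-reflect p .null = Null-halves (null⁻ (null p)) (null⁺ (null p))
  ⇓ℤ-reflect p .pairs = ⇓-cong (λ k → +-comm _ _) refl (pairs p)

  ⇓ℤ-suc : ∀ {T S} → T ⇓ℤ S → (λ n → T (ℤ.suc n)) ⇓ℤ S
  ⇓ℤ-suc {T} {S} p .null N = let (B , e) = null p N in suc B ,
    λ { (+ k) q → e (+ suc k) (ℕP.≤-trans (ℕP.n≤1+n B) (ℕP.m≤n⇒m≤1+n q))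
      ; -[1+ zero ] ()
      ; -[1+ suc k ] (s≤s q) → e -[1+ k ] q }
  ⇓ℤ-suc {T} {S} p .pairs = ⟶-shift (⟶-cong
    (λ M → telescope M)
    (trans (+-congˡ (trans (+-congˡ -0#≈0#) (+-identityˡ _))) (+-identityʳ _))
    (⟶-+ (⟶-subseq suc ℕP.n≤1+n (pairs p)) (⟶-+ (⟶-subseq suc ℕP.n≤1+n (null⁺ (null p))) (⟶-neg (null⁻ (null p))))))
    where
    telescope : ∀ M → partial (pair T) (suc M) + (T (+ suc M) + - T -[1+ M ]) ≈ partial (pair (λ n → T (ℤ.suc n))) (suc M)
    telescope zero = solve 3 (λ a b d → (con (+ 0) :+ (a :+ b)) :+ (d :+ :- b) := con (+ 0) :+ (d :+ a)) refl _ _ _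
    telescope (suc M) = trans
      (solve 5 (λ s a b d e → (s :+ (a :+ b)) :+ (d :+ :- b) := (s :+ (a :+ :- e)) :+ (d :+ e)) refl
        (partial (pair T) (suc M)) (T (+ suc M)) (T -[1+ suc M ]) (T (+ suc (suc M))) (T -[1+ M ]))
      (+-congʳ (telescope M))

  ⇓ℤ-pred : ∀ {T S} → T ⇓ℤ S → (λ n → T (ℤ.pred n)) ⇓ℤ S
  ⇓ℤ-pred {T} p = ⇓ℤ-cong (λ n → reflexive (≡.cong T (lemma n))) refl (⇓ℤ-reflect (⇓ℤ-suc (⇓ℤ-reflect p)))
    where
    lemma : ∀ n → ρ (ℤ.suc (ρ n)) ≡ ℤ.pred n
    lemma (+ zero) = ≡.refl
    lemma (+ suc k) = ≡.refl
    lemma -[1+ k ] = ≡.refl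

  ⇓ℤ-shift : ∀ {T S} s → T ⇓ℤ S → (λ n → T (s ℤ.+ n)) ⇓ℤ S
  ⇓ℤ-shift {T} (+ zero) p = ⇓ℤ-cong (λ n → reflexive (≡.cong T (≡.sym (ℤP.+-identityˡ n)))) refl p
  ⇓ℤ-shift {T} (+ suc k) p = ⇓ℤ-cong (λ n → reflexive (≡.cong T (lemma (+ k) n))) refl (⇓ℤ-suc (⇓ℤ-shift (+ k) p))
    where
    lemma : ∀ x n → x ℤ.+ (+ 1 ℤ.+ n) ≡ (+ 1 ℤ.+ x) ℤ.+ n
    lemma = solve-∀
  ⇓ℤ-shift -[1+ zero ] p = ⇓ℤ-pred p
  ⇓ℤ-shift {T} -[1+ suc k ] p = ⇓ℤ-cong (λ n → reflexive (≡.cong T (lemma -[1+ k ] n))) refl (⇓ℤ-pred (⇓ℤ-shift -[1+ k ] p))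
    where
    lemma : ∀ x n → x ℤ.+ (-[1+ 0 ] ℤ.+ n) ≡ (-[1+ 0 ] ℤ.+ x) ℤ.+ n
    lemma = solve-∀

  fold : (ℤ → Carrier) → ℕ → Carrier
  fold T zero = T (+ 0)
  fold T (suc n) = T (+ suc n) + T -[1+ n ]

  ⇓ℤ-fold : ∀ {T S} → T ⇓ℤ S → fold T ⇓ S
  ⇓ℤ-fold {T} {S} p = ⟶-shift (⟶-cong rotate (+-identityʳ S) (⟶-+ (pairs p) (null⁺ (null p))))
    where
    rotate : ∀ M → partial (pair T) M + T (+ M) ≈ partial (fold T) (suc M)
    rotate zero = refl
    rotate (suc M) = trans
      (solve 4 (λ s a b d → (s :+ (a :+ b)) :+ d := (s :+ a) :+ (d :+ b)) refl (partial (pair T) M) (T (+ M)) (T -[1+ M ]) (T (+ suc M)))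
      (+-congʳ (rotate M))

  ⇓ℤ-substitute : ∀ {T U S} s → (∀ n → T (s ℤ.+ n) ≈ U n) → U ⇓ℤ S → T ⇓ℤ S
  ⇓ℤ-substitute {T} s e p = ⇓ℤ-cong (λ n → trans (sym (e (ℤ.- s ℤ.+ n))) (reflexive (≡.cong T (cancel s n)))) refl (⇓ℤ-shift (ℤ.- s) p)
    where
    cancel : ∀ s n → s ℤ.+ (ℤ.- s ℤ.+ n) ≡ n
    cancel = solve-∀

  ⇓ℤ-substitute⁻ : ∀ {T U S} s → (∀ n → T (s ℤ.- n) ≈ U n) → U ⇓ℤ S → T ⇓ℤ S
  ⇓ℤ-substitute⁻ {T} {U} s e p = ⇓ℤ-substitute (s ℤ.+ + 1) (λ n → trans (reflexive (≡.cong T (index s n))) (e (ρ n))) (⇓ℤ-reflect p)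
    where
    lemma : ∀ s n → s ℤ.+ + 1 ℤ.+ n ≡ s ℤ.- (ℤ.- + 1 ℤ.+ ℤ.- n)
    lemma = solve-∀
    index : ∀ s n → s ℤ.+ + 1 ℤ.+ n ≡ s ℤ.- ρ n
    index s n = ≡.trans (lemma s n) (≡.cong (λ t → s ℤ.- t) (≡.sym (ρ-≡ n)))

  ⇓ℤ-antisymmetric : ∀ {T S} (½ : Carrier) → ½ * (1# + 1#) ≈ 1# → ∀ s → (∀ n → T (s ℤ.- n) ≈ - T n) → T ⇓ℤ S → S ≈ 0#
  ⇓ℤ-antisymmetric {T} {S} ½ half s e p = begin
    S                  ≈⟨ trans (sym (*-identityˡ S)) (*-congʳ (sym half)) ⟩
    ½ * (1# + 1#) * S  ≈⟨ solve 2 (λ h s → h :* con (+ 2) :* s := h :* (s :+ s)) refl ½ S ⟩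
    ½ * (S + S)        ≈⟨ *-congˡ (+-congʳ S≈-S) ⟩
    ½ * (- S + S)      ≈⟨ solve 2 (λ h s → h :* (:- s :+ s) := con (+ 0)) refl ½ S ⟩
    0#                 ∎
    where
    S≈-S : S ≈ - S
    S≈-S = ⇓ℤ-unique p (⇓ℤ-substitute⁻ s e (⇓ℤ-cong (λ n → solve 1 (λ x → con (-[1+ 0 ]) :* x := :- x) refl _) (solve 1 (λ x → con (-[1+ 0 ]) :* x := :- x) refl _) (⇓ℤ-*ˡ (- 1#) p)))

  ⇓ℤ-split : ∀ {T S} d (Sᵣ : ℕ → Carrier) → T ⇓ℤ S → (∀ r → r < suc d → (λ k → T (k ℤ.* + suc d ℤ.+ + r)) ⇓ℤ Sᵣ r) →
    S ≈ partial Sᵣ (suc d)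
  ⇓ℤ-split {T} {S} d Sᵣ p classes = ⇓-unique (⇓-cong block refl (⇓-blocks d (pairs p))) (sums (suc d) ℕP.≤-refl)
    where
    D = suc d
    Tᵣ : ℕ → ℤ → Carrier
    Tᵣ r k = T (k ℤ.* + D ℤ.+ + r)
    sums : ∀ R → R ≤ D → (λ k → partial (λ r → pair (Tᵣ r) k) R) ⇓ partial Sᵣ R
    sums zero q = ⇓-0
    sums (suc R) q = ⇓-+ (sums R (ℕP.<⇒≤ q)) (pairs (classes R q))
    posIndex : ∀ k r → + (k ℕ.* D ℕ.+ r) ≡ + k ℤ.* + D ℤ.+ + r
    posIndex k r = ≡.trans (ℤP.pos-+ (k ℕ.* D) r) (≡.cong (ℤ._+ + r) (ℤP.pos-* k D))
    negIndex : ∀ k r → r < D → -[1+ k ℕ.* D ℕ.+ (D ℕ.∸ suc r) ] ≡ -[1+ k ] ℤ.* + D ℤ.+ + r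
    negIndex k r (s≤s q) = ≡.trans (≡.cong (λ z → ℤ.- (+ 1 ℤ.+ z)) (posIndex k (d ℕ.∸ r)))
      (lemma (+ k) (+ (d ℕ.∸ r)) (+ r) (≡.cong +_ (≡.cong suc (≡.sym (ℕP.m∸n+n≡m q)))))
      where
      identity : ∀ x z r → ℤ.- (+ 1 ℤ.+ (x ℤ.* ((+ 1 ℤ.+ z) ℤ.+ r) ℤ.+ z)) ≡ ℤ.- (+ 1 ℤ.+ x) ℤ.* ((+ 1 ℤ.+ z) ℤ.+ r) ℤ.+ r
      identity = solve-∀
      lemma : ∀ x z r {y} → y ≡ (+ 1 ℤ.+ z) ℤ.+ r → ℤ.- (+ 1 ℤ.+ (x ℤ.* y ℤ.+ z)) ≡ ℤ.- (+ 1 ℤ.+ x) ℤ.* y ℤ.+ r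
      lemma x z r ≡.refl = identity x z r
    block : ∀ k → partial (λ i → pair T (k ℕ.* D ℕ.+ i)) D ≈ partial (λ r → pair (Tᵣ r) k) D
    block k = begin
      partial (λ i → pair T (k ℕ.* D ℕ.+ i)) D
        ≈⟨ partial-+ _ _ D ⟩
      partial (λ i → T (+ (k ℕ.* D ℕ.+ i))) D + partial (λ i → T -[1+ k ℕ.* D ℕ.+ i ]) D
        ≈⟨ +-cong (partial-cong D (λ i _ → reflexive (≡.cong T (posIndex k i))))
                  (trans (partial-reverse _ D) (partial-cong D (λ r q → reflexive (≡.cong T (negIndex k r q))))) ⟩
      partial (λ r → Tᵣ r (+ k)) D + partial (λ r → Tᵣ r -[1+ k ]) D
        ≈⟨ partial-+ _ _ D ⟨
      partial (λ r → pair (Tᵣ r) k) D ∎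

  JointlyNullℤ : (ℤ → ℤ → Carrier) → Set ℓ
  JointlyNullℤ T = ∀ N → ∃ λ B → ∀ m n → B ≤ ‖ m ‖ ⊎ B ≤ ‖ n ‖ → T m n ≈[ N ] 0#

  fubiniℤ : ∀ {T : ℤ → ℤ → Carrier} {R C S} → JointlyNullℤ T → (∀ m → T m ⇓ℤ R m) → (∀ n → (λ m → T m n) ⇓ℤ C n) →
    R ⇓ℤ S → C ⇓ℤ S
  fubiniℤ {T} {R} {C} {S} joint rows columns total .null N = let (B , v) = joint N in
    B , λ n q → ≈[]-sym (⇓-at 0 (λ m _ → ≈[]-trans (+-cong[] (v (+ m) n (inj₂ q)) (v -[1+ m ] n (inj₂ q))) (≈⇒≈[] (+-identityʳ _)))
                          (pairs (columns n)))
  fubiniℤ {T} {R} {C} {S} joint rows columns total .pairs = fubini {P}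
    (λ N → let (B , v) = joint N in B , λ m n → λ
      { (inj₁ q) → zeros (v _ _ (inj₁ q)) (v _ _ (inj₁ q)) (v _ _ (inj₁ q)) (v _ _ (inj₁ q))
      ; (inj₂ q) → zeros (v _ _ (inj₂ q)) (v _ _ (inj₂ q)) (v _ _ (inj₂ q)) (v _ _ (inj₂ q)) })
    (λ m → ⇓-+ (pairs (rows (+ m))) (pairs (rows -[1+ m ])))
    (λ n → ⇓-cong (λ m → solve 4 (λ a b x y → (a :+ b) :+ (x :+ y) := (a :+ x) :+ (b :+ y)) refl _ _ _ _) refl
      (⇓-+ (pairs (columns (+ n))) (pairs (columns -[1+ n ]))))
    (pairs total)
    where
    P : ℕ → ℕ → Carrier
    P m n = (T (+ m) (+ n) + T (+ m) -[1+ n ]) + (T -[1+ m ] (+ n) + T -[1+ m ] -[1+ n ])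
    zeros : ∀ {N x y z w} → x ≈[ N ] 0# → y ≈[ N ] 0# → z ≈[ N ] 0# → w ≈[ N ] 0# → (x + y) + (z + w) ≈[ N ] 0#
    zeros p q r s = ≈[]-trans (+-cong[] (+-cong[] p q) (+-cong[] r s))
      (≈⇒≈[] (trans (+-cong (+-identityʳ _) (+-identityʳ _)) (+-identityʳ _)))

  ‖‖-triangle : ∀ s m → ‖ s ‖ ≤ suc (‖ m ‖ ℕ.+ ‖ ℤ.- m ℤ.+ s ‖)
  ‖‖-triangle s m = ≡.subst (λ t → ‖ t ‖ ≤ suc (‖ m ‖ ℕ.+ ‖ ℤ.- m ℤ.+ s ‖)) (cancel m s) (subadd m (ℤ.- m ℤ.+ s))
    where
    cancel : ∀ m s → m ℤ.+ (ℤ.- m ℤ.+ s) ≡ s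
    cancel = solve-∀
    ⊖-bound : ∀ x y → ‖ x ℤ.⊖ suc y ‖ ≤ suc (x ℕ.+ y)
    ⊖-bound zero y = ℕP.n≤1+n y
    ⊖-bound (suc x) zero = ≡.subst (λ t → ‖ t ‖ ≤ suc (suc x ℕ.+ 0)) (≡.sym (ℤP.[1+m]⊖[1+n]≡m⊖n x 0)) (ℕP.≤-trans (ℕP.m≤m+n x 0) (ℕP.≤-trans (ℕP.n≤1+n _) (ℕP.n≤1+n _)))
    ⊖-bound (suc x) (suc y) = ≡.subst (λ t → ‖ t ‖ ≤ suc (suc x ℕ.+ suc y)) (≡.sym (ℤP.[1+m]⊖[1+n]≡m⊖n x (suc y)))
      (ℕP.≤-trans (⊖-bound x y) (s≤s (ℕP.≤-trans (ℕP.+-monoʳ-≤ x (ℕP.n≤1+n y)) (ℕP.n≤1+n _))))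
    subadd : ∀ a b → ‖ a ℤ.+ b ‖ ≤ suc (‖ a ‖ ℕ.+ ‖ b ‖)
    subadd (+ x) (+ y) = ℕP.n≤1+n _
    subadd (+ x) -[1+ y ] = ⊖-bound x y
    subadd -[1+ x ] (+ y) = ≡.subst (λ t → ‖ y ℤ.⊖ suc x ‖ ≤ suc t) (ℕP.+-comm y x) (⊖-bound y x)
    subadd -[1+ x ] -[1+ y ] = ℕP.≤-refl

  JointlyNull-convolution : ∀ {U W} → Null U → Null W → JointlyNullℤ (λ m s → U m * W (ℤ.- m ℤ.+ s))
  JointlyNull-convolution {U} {W} u w N = bound , λ m s h → negligible m s (small m s h)
    where
    B = proj₁ (u N) ⊔ proj₁ (w N)
    bound = suc (B ℕ.+ B)
    left : ∀ m s → B ≤ ‖ m ‖ → U m * W (ℤ.- m ℤ.+ s) ≈[ N ] 0#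
    left m s q = ≈[]-trans (*-cong[] (proj₂ (u N) m (ℕP.m⊔n≤o⇒m≤o (proj₁ (u N)) (proj₁ (w N)) q)) (≈⇒≈[] refl)) (≈⇒≈[] (zeroˡ _))
    right : ∀ m s → B ≤ ‖ ℤ.- m ℤ.+ s ‖ → U m * W (ℤ.- m ℤ.+ s) ≈[ N ] 0#
    right m s q = ≈[]-trans (*-cong[] (≈⇒≈[] refl) (proj₂ (w N) _ (ℕP.m⊔n≤o⇒n≤o (proj₁ (u N)) (proj₁ (w N)) q))) (≈⇒≈[] (zeroʳ _))
    small : ∀ m s → bound ≤ ‖ m ‖ ⊎ bound ≤ ‖ s ‖ → B ≤ ‖ m ‖ ⊎ B ≤ ‖ ℤ.- m ℤ.+ s ‖
    small m s (inj₁ q) = inj₁ (ℕP.≤-trans (ℕP.m≤n⇒m≤1+n (ℕP.m≤m+n B B)) q)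
    small m s (inj₂ q) with B ℕ.≤? ‖ m ‖
    ... | yes p = inj₁ p
    ... | no p = inj₂ (ℕP.+-cancelˡ-≤ B _ _ (ℕP.≤-trans (ℕ.s≤s⁻¹ (ℕP.≤-trans q (‖‖-triangle s m)))
                        (ℕP.+-monoˡ-≤ _ (ℕP.<⇒≤ (ℕP.≰⇒> p)))))
    negligible : ∀ m s → B ≤ ‖ m ‖ ⊎ B ≤ ‖ ℤ.- m ℤ.+ s ‖ → U m * W (ℤ.- m ℤ.+ s) ≈[ N ] 0#
    negligible m s (inj₁ q) = left m s q
    negligible m s (inj₂ q) = right m s q

module FiniteIdentities {c ℓ} (R : CommutativeRing c ℓ) where

  open CommutativeRing R
  open Exp semiring
  open RingTools R
  open FiniteSums R
  open Relation.Binary.Reasoning.Setoid setoid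

  module QFactorial (Q : Carrier) (u : ℕ → Carrier) (u-inverse : ∀ i → (1# - Q ^ suc i) * u i ≈ 1#) where

    ^-+ : ∀ x m n → x ^ (m ℕ.+ n) ≈ x ^ m * x ^ n
    ^-+ = ^-homo-*

    factorial : ℕ → Carrier
    factorial = product (λ i → 1# - Q ^ suc i)

    r : ℕ → Carrier
    r = product u

    r⁻ : ℕ → Carrier
    r⁻ zero = 0#
    r⁻ (suc k) = r k

    r-step : ∀ k → (1# - Q ^ k) * r k ≈ r⁻ k
    r-step zero = trans (*-congʳ (-‿inverseʳ 1#)) (zeroˡ _)
    r-step (suc k) = trans (solve 3 (λ a b c → a :* (b :* c) := b :* (a :* c)) refl _ _ _)
      (trans (*-congˡ (u-inverse k)) (*-identityʳ _))

    r-factorial : ∀ k → r k * factorial k ≈ 1#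
    r-factorial k = trans (sym (product-* u _ k)) (trans (product-cong k (λ i → trans (*-comm _ _) (u-inverse i))) (ones k))
      where
      ones : ∀ k → product (λ _ → 1#) k ≈ 1#
      ones zero = refl
      ones (suc k) = trans (*-identityʳ _) (ones k)

    -- 1 / ((Q)_{N-n} (Q)_{N+n}), which is 0 for n > N.
    G : ℕ → ℕ → Carrier
    G N n = r⁻ (suc N ∸ n) * r (N ℕ.+ n)

    G-≤ : ∀ N n → n ≤ N → G N n ≈ r (N ∸ n) * r (N ℕ.+ n)
    G-≤ N n p = *-congʳ (reflexive (≡.cong r⁻ (ℕP.+-∸-assoc 1 p)))

    module TripleProduct (x y : Carrier) (xy≈Q : x * y ≈ Q) where

      f e : ℕ → Carrier
      f n = Q ^ triangle n * (x ^ n + y ^ n)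
      e zero = 1#
      e (suc n) = f (suc n)

      h : ℕ → ℕ → Carrier
      h N zero = (1# + 1#) * (Q ^ suc N * G N 1)
      h N (suc n) = Q ^ (N ∸ n) * G N n + Q ^ (N ℕ.+ (2 ℕ.+ n)) * G N (2 ℕ.+ n)

      raise : ∀ N K → suc K ≤ N → (x + y) * Q ^ N * e (suc K) ≈ Q ^ (N ∸ suc K) * e (2 ℕ.+ K) + Q ^ (N ℕ.+ suc K) * f K
      raise N K p = begin
        (x + y) * Q ^ N * (Q ^ triangle (suc K) * (x * x ^ K + y * y ^ K))
          ≈⟨ solve 6 (λ x y n t a b → (x :+ y) :* n :* (t :* (x :* a :+ y :* b)) :=
               n :* t :* (x :* (x :* a) :+ y :* (y :* b)) :+ n :* t :* ((x :* y) :* (a :+ b))) refl x y (Q ^ N) (Q ^ triangle (suc K)) (x ^ K) (y ^ K) ⟩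
        Q ^ N * Q ^ triangle (suc K) * (x ^ (2 ℕ.+ K) + y ^ (2 ℕ.+ K)) + Q ^ N * Q ^ triangle (suc K) * ((x * y) * (x ^ K + y ^ K))
          ≈⟨ +-cong (trans (*-congʳ up) (*-assoc _ _ _))
                    (trans (*-congˡ (*-congʳ xy≈Q)) (trans (sym (*-assoc _ _ _)) (trans (*-congʳ down) (*-assoc _ _ _)))) ⟩
        Q ^ (N ∸ suc K) * e (2 ℕ.+ K) + Q ^ (N ℕ.+ suc K) * f K ∎
        where
        up : Q ^ N * Q ^ triangle (suc K) ≈ Q ^ (N ∸ suc K) * Q ^ triangle (2 ℕ.+ K)
        up = begin
          Q ^ N * Q ^ triangle (suc K)    ≡⟨ ≡.cong (λ m → Q ^ m * Q ^ triangle (suc K)) (≡.sym (ℕP.m∸n+n≡m p)) ⟩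
          Q ^ (N ∸ suc K ℕ.+ suc K) * Q ^ triangle (suc K) ≈⟨ *-congʳ (^-+ Q (N ∸ suc K) (suc K)) ⟩
          Q ^ (N ∸ suc K) * Q ^ suc K * Q ^ triangle (suc K) ≈⟨ solve 3 (λ a b c → a :* b :* c := a :* (c :* b)) refl _ _ _ ⟩
          Q ^ (N ∸ suc K) * (Q ^ triangle (suc K) * Q ^ suc K) ≈⟨ *-congˡ (^-+ Q (triangle (suc K)) (suc K)) ⟨
          Q ^ (N ∸ suc K) * Q ^ triangle (2 ℕ.+ K) ∎
        down : Q ^ N * Q ^ triangle (suc K) * Q ≈ Q ^ (N ℕ.+ suc K) * Q ^ triangle K
        down = begin
          Q ^ N * Q ^ (triangle K ℕ.+ K) * Q           ≈⟨ *-congʳ (*-congˡ (^-+ Q (triangle K) K)) ⟩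
          Q ^ N * (Q ^ triangle K * Q ^ K) * Q         ≈⟨ solve 4 (λ a b c d → a :* (b :* c) :* d := (a :* (d :* c)) :* b) refl _ _ _ _ ⟩
          (Q ^ N * (Q * Q ^ K)) * Q ^ triangle K       ≈⟨ *-congʳ (^-+ Q N (suc K)) ⟨
          Q ^ (N ℕ.+ suc K) * Q ^ triangle K           ∎

      -- Multiplication by x + y moves weight to the neighbouring terms; the last two summands are the boundary effect at K.
      transfer : ∀ N K → K ≤ N → partial (λ n → (x + y) * Q ^ N * e n * G N n) (suc K) + Q ^ (N ℕ.+ suc K) * G N (suc K) * f K ≈
        partial (λ n → e n * h N n) (suc K) + Q ^ (N ∸ K) * G N K * e (suc K)
      transfer N zero p = begin
        0# + (x + y) * Q ^ N * 1# * G N 0 + Q ^ (N ℕ.+ 1) * G N 1 * (1# * (1# + 1#))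
          ≡⟨ ≡.cong (λ m → 0# + (x + y) * Q ^ N * 1# * G N 0 + Q ^ m * G N 1 * (1# * (1# + 1#))) (ℕP.+-comm N 1) ⟩
        0# + (x + y) * Q ^ N * 1# * G N 0 + Q ^ suc N * G N 1 * (1# * (1# + 1#))
          ≈⟨ solve 7 (λ o x y n g m g′ → con (+ 0) :+ (x :+ y) :* n :* o :* g :+ m :* g′ :* (o :* (o :+ o))
               := con (+ 0) :+ o :* ((o :+ o) :* (m :* g′)) :+ n :* g :* (o :* (x :+ y)))
               refl 1# x y (Q ^ N) (G N 0) (Q ^ suc N) (G N 1) ⟩
        0# + 1# * ((1# + 1#) * (Q ^ suc N * G N 1)) + Q ^ N * G N 0 * (1# * (x + y))
          ≈⟨ +-congˡ (*-congˡ (*-congˡ (+-cong (*-identityʳ _) (*-identityʳ _)))) ⟨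
        0# + 1# * ((1# + 1#) * (Q ^ suc N * G N 1)) + Q ^ N * G N 0 * (1# * (x * 1# + y * 1#)) ∎
      transfer N (suc K) p = begin
        (partial L (suc K) + (x + y) * Q ^ N * e (suc K) * G N (suc K)) + Q ^ (N ℕ.+ suc (suc K)) * G N (2 ℕ.+ K) * f (suc K)
          ≈⟨ +-congʳ (+-congˡ (*-congʳ (raise N K p))) ⟩
        (partial L (suc K) + (a * e (2 ℕ.+ K) + b * f K) * G N (suc K)) + d * G N (2 ℕ.+ K) * f (suc K)
          ≈⟨ solve 9 (λ l a e b f g d g′ f′ → (l :+ (a :* e :+ b :* f) :* g) :+ d :* g′ :* f′ :=
                (l :+ b :* g :* f) :+ (d :* g′ :* f′ :+ a :* g :* e)) refl (partial L (suc K)) a (e (2 ℕ.+ K)) b (f K) (G N (suc K)) d (G N (2 ℕ.+ K)) (f (suc K)) ⟩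
        (partial L (suc K) + b * G N (suc K) * f K) + (d * G N (2 ℕ.+ K) * f (suc K) + a * G N (suc K) * e (2 ℕ.+ K))
          ≈⟨ +-congʳ (transfer N K (ℕP.≤-trans (ℕP.n≤1+n K) p)) ⟩
        (partial H (suc K) + Q ^ (N ∸ K) * G N K * f (suc K)) + (d * G N (2 ℕ.+ K) * f (suc K) + a * G N (suc K) * e (2 ℕ.+ K))
          ≈⟨ solve 8 (λ l a e g d g′ f′ w → (l :+ w :* f′) :+ (d :* g′ :* f′ :+ a :* g :* e) :=
                (l :+ f′ :* (w :+ d :* g′)) :+ a :* g :* e) refl (partial H (suc K)) a (e (2 ℕ.+ K)) (G N (suc K)) d (G N (2 ℕ.+ K)) (f (suc K)) (Q ^ (N ∸ K) * G N K) ⟩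
        (partial H (suc K) + e (suc K) * h N (suc K)) + a * G N (suc K) * e (2 ℕ.+ K) ∎
        where
        L H : ℕ → Carrier
        L n = (x + y) * Q ^ N * e n * G N n
        H n = e n * h N n
        a = Q ^ (N ∸ suc K)
        b = Q ^ (N ℕ.+ suc K)
        d = Q ^ (N ℕ.+ (2 ℕ.+ K))

      F : ℕ → Carrier
      F N = partial (λ n → e n * G N n) (suc N)

      private
        pascal-poly : ∀ L S → (1# - Q * (L * S)) * (1# - Q * (Q * (L * S))) ≈
          (1# + Q * (L * S)) * ((1# - Q * L) * (1# - Q * S)) + ((Q * L) * ((1# - S) * (1# - Q * S)) + (Q * S) * ((1# - L) * (1# - Q * L)))
        pascal-poly = solve 3 (λ q l s →
          (con (+ 1) :- q :* (l :* s)) :* (con (+ 1) :- q :* (q :* (l :* s))) :=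
          (con (+ 1) :+ q :* (l :* s)) :* ((con (+ 1) :- q :* l) :* (con (+ 1) :- q :* s))
          :+ ((q :* l) :* ((con (+ 1) :- s) :* (con (+ 1) :- q :* s)) :+ (q :* s) :* ((con (+ 1) :- l) :* (con (+ 1) :- q :* l)))) refl Q

      -- With L = Q^{N-n} and S = Q^{N+n} every factor is a multiple of r (suc (N-n)) * r (suc (N+n)).
      pascal : ∀ l s → (1# - Q ^ suc (l ℕ.+ s)) * (1# - Q ^ suc (suc (l ℕ.+ s))) * (r (suc l) * r (suc s)) ≈
        (1# + Q ^ suc (l ℕ.+ s)) * (r l * r s) + (Q ^ suc l * (r (suc l) * r⁻ s) + Q ^ suc s * (r⁻ l * r (suc s)))
      pascal l s = begin
        (1# - Q * Q ^ (l ℕ.+ s)) * (1# - Q * (Q * Q ^ (l ℕ.+ s))) * (R₁ * R₂)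
          ≈⟨ *-congʳ (*-cong (+-congˡ (-‿cong (*-congˡ (^-+ Q l s)))) (+-congˡ (-‿cong (*-congˡ (*-congˡ (^-+ Q l s)))))) ⟩
        (1# - Q * (L * S)) * (1# - Q * (Q * (L * S))) * (R₁ * R₂)
          ≈⟨ *-congʳ (pascal-poly L S) ⟩
        ((1# + Q * (L * S)) * ((1# - Q * L) * (1# - Q * S)) + ((Q * L) * ((1# - S) * (1# - Q * S)) + (Q * S) * ((1# - L) * (1# - Q * L)))) * (R₁ * R₂)
          ≈⟨ solve 11 (λ w a b c d e f g h x y → (w :* (a :* b) :+ (c :* (d :* e) :+ f :* (g :* h))) :* (x :* y) :=
               w :* ((a :* x) :* (b :* y)) :+ (c :* (x :* (d :* (e :* y))) :+ f :* ((g :* (h :* x)) :* y)))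
               refl (1# + Q * (L * S)) (1# - Q * L) (1# - Q * S) (Q * L) (1# - S) (1# - Q * S) (Q * S) (1# - L) (1# - Q * L) R₁ R₂ ⟩
        (1# + Q * (L * S)) * (((1# - Q * L) * R₁) * ((1# - Q * S) * R₂)) +
          ((Q * L) * (R₁ * ((1# - S) * ((1# - Q * S) * R₂))) + (Q * S) * (((1# - L) * ((1# - Q * L) * R₁)) * R₂))
          ≈⟨ +-cong (*-cong (+-congˡ (*-congˡ (sym (^-+ Q l s)))) (*-cong (r-step (suc l)) (r-step (suc s))))
               (+-cong (*-congˡ (*-congˡ (trans (*-congˡ (r-step (suc s))) (r-step s))))
                       (*-congˡ (*-congʳ (trans (*-congˡ (r-step (suc l))) (r-step l))))) ⟩
        (1# + Q ^ suc (l ℕ.+ s)) * (r l * r s) + (Q ^ suc l * (R₁ * r⁻ s) + Q ^ suc s * (r⁻ l * R₂)) ∎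
        where
        L = Q ^ l
        S = Q ^ s
        R₁ = r (suc l)
        R₂ = r (suc s)

      scale : ℕ → Carrier
      scale N = (1# - Q ^ suc (N ℕ.+ N)) * (1# - Q ^ suc (suc (N ℕ.+ N)))

      G-recurrence : ∀ N n → n ≤ N → scale N * G (suc N) n ≈ (1# + Q ^ suc (N ℕ.+ N)) * G N n + h N n
      G-recurrence N zero p = begin
        scale N * (r (suc N) * r (suc N ℕ.+ 0))
          ≡⟨ ≡.cong (λ m → scale N * (r (suc N) * r (suc m))) (ℕP.+-identityʳ N) ⟩
        scale N * (r (suc N) * r (suc N))
          ≈⟨ pascal N N ⟩
        (1# + Q ^ suc (N ℕ.+ N)) * (r N * r N) + (Q ^ suc N * (r (suc N) * r⁻ N) + Q ^ suc N * (r⁻ N * r (suc N)))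
          ≈⟨ +-congˡ (solve 3 (λ a b d → a :* (b :* d) :+ a :* (d :* b) := con (+ 2) :* (a :* (d :* b))) refl _ _ _) ⟩
        (1# + Q ^ suc (N ℕ.+ N)) * (r N * r N) + (1# + 1#) * (Q ^ suc N * (r⁻ N * r (suc N)))
          ≡⟨ ≡.cong₂ (λ m m′ → (1# + Q ^ suc (N ℕ.+ N)) * (r N * r m) + (1# + 1#) * (Q ^ suc N * (r⁻ N * r m′))) (≡.sym (ℕP.+-identityʳ N)) (ℕP.+-comm 1 N) ⟩
        (1# + Q ^ suc (N ℕ.+ N)) * G N 0 + h N 0 ∎
      G-recurrence N (suc n) p = begin
        scale N * G (suc N) (suc n)
          ≡⟨ ≡.cong₂ (λ m k → scale N * (r⁻ m * r (suc k))) (ℕP.+-∸-assoc 1 (ℕP.≤-trans (ℕP.n≤1+n n) p)) ≡.refl ⟩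
        scale N * (r l * r (suc s))
          ≡⟨ ≡.cong (λ l → scale N * (r l * r (suc s))) (ℕP.+-∸-assoc 1 p) ⟩
        scale N * (r (suc l′) * r (suc s))
          ≡⟨ ≡.cong (λ m → (1# - Q ^ suc m) * (1# - Q ^ suc (suc m)) * (r (suc l′) * r (suc s))) (≡.sym total) ⟩
        (1# - Q ^ suc (l′ ℕ.+ s)) * (1# - Q ^ suc (suc (l′ ℕ.+ s))) * (r (suc l′) * r (suc s))
          ≈⟨ pascal l′ s ⟩
        (1# + Q ^ suc (l′ ℕ.+ s)) * (r l′ * r s) + (Q ^ suc l′ * (r (suc l′) * r⁻ s) + Q ^ suc s * (r⁻ l′ * r (suc s)))
          ≡⟨ ≡.cong (λ m → (1# + Q ^ suc m) * (r l′ * r s) + (Q ^ suc l′ * (r (suc l′) * r⁻ s) + Q ^ suc s * (r⁻ l′ * r (suc s)))) total ⟩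
        (1# + Q ^ suc (N ℕ.+ N)) * (r l′ * r s) + (Q ^ suc l′ * (r (suc l′) * r⁻ s) + Q ^ suc s * (r⁻ l′ * r (suc s)))
          ≡⟨ ≡.cong₂ (λ m m′ → (1# + Q ^ suc (N ℕ.+ N)) * (r l′ * r s) + (Q ^ m * (r m * r⁻ m′) + Q ^ suc s * (r⁻ l′ * r (suc s))))
               (≡.sym (ℕP.+-∸-assoc 1 p)) (ℕP.+-suc N n) ⟩
        (1# + Q ^ suc (N ℕ.+ N)) * (r l′ * r s) + (Q ^ l * (r l * r (N ℕ.+ n)) + Q ^ suc s * (r⁻ l′ * r (suc s)))
          ≡⟨ ≡.cong₂ (λ m m′ → (1# + Q ^ suc (N ℕ.+ N)) * (r l′ * r s) + (Q ^ l * (r⁻ m * r (N ℕ.+ n)) + Q ^ m′ * (r⁻ l′ * r m′)))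
               (≡.sym (ℕP.+-∸-assoc 1 (ℕP.≤-trans (ℕP.n≤1+n n) p))) (≡.sym (ℕP.+-suc N (suc n))) ⟩
        (1# + Q ^ suc (N ℕ.+ N)) * (r l′ * r s) + h N (suc n)
          ≈⟨ +-congʳ (*-congˡ (G-≤ N (suc n) p)) ⟨
        (1# + Q ^ suc (N ℕ.+ N)) * G N (suc n) + h N (suc n) ∎
        where
        l = N ∸ n
        l′ = N ∸ suc n
        s = N ℕ.+ suc n
        total : l′ ℕ.+ s ≡ N ℕ.+ N
        total = ≡.trans (≡.cong (l′ ℕ.+_) (ℕP.+-comm N (suc n))) (≡.trans (≡.sym (ℕP.+-assoc l′ (suc n) N)) (≡.cong (ℕ._+ N) (ℕP.m∸n+n≡m p)))

      G-top : ∀ N → G N (suc N) ≈ 0#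
      G-top N = trans (*-congʳ (reflexive (≡.cong r⁻ (ℕP.n∸n≡0 (suc N))))) (zeroˡ _)

      G-diagonal : ∀ N → G N N ≈ r (N ℕ.+ N)
      G-diagonal N = trans (G-≤ N N ℕP.≤-refl) (trans (*-congʳ (reflexive (≡.cong r (ℕP.n∸n≡0 N)))) (*-identityˡ _))

      F-recurrence : ∀ N → scale N * F (suc N) ≈ F N * ((1# + x * Q ^ N) * (1# + y * Q ^ N))
      F-recurrence N = begin
        scale N * (partial (λ n → e n * G (suc N) n) (suc N) + e (suc N) * G (suc N) (suc N))
          ≈⟨ distribˡ _ _ _ ⟩
        scale N * partial (λ n → e n * G (suc N) n) (suc N) + scale N * (e (suc N) * G (suc N) (suc N))
          ≈⟨ +-cong (sym (partial-*ˡ _ _ (suc N))) top ⟩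
        partial (λ n → scale N * (e n * G (suc N) n)) (suc N) + Q ^ (N ∸ N) * G N N * e (suc N)
          ≈⟨ +-congʳ (partial-cong (suc N) (λ n p → trans (solve 3 (λ a b d → a :* (b :* d) := b :* (a :* d)) refl _ _ _)
               (trans (*-congˡ (G-recurrence N n (ℕ.s≤s⁻¹ p))) (distribˡ _ _ _)))) ⟩
        partial (λ n → e n * ((1# + Q ^ suc (N ℕ.+ N)) * G N n) + e n * h N n) (suc N) + Q ^ (N ∸ N) * G N N * e (suc N)
          ≈⟨ +-congʳ (partial-+ _ _ (suc N)) ⟩
        partial (λ n → e n * ((1# + Q ^ suc (N ℕ.+ N)) * G N n)) (suc N) + partial (λ n → e n * h N n) (suc N) + Q ^ (N ∸ N) * G N N * e (suc N)
          ≈⟨ +-assoc _ _ _ ⟩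
        partial (λ n → e n * ((1# + Q ^ suc (N ℕ.+ N)) * G N n)) (suc N) + (partial (λ n → e n * h N n) (suc N) + Q ^ (N ∸ N) * G N N * e (suc N))
          ≈⟨ +-congˡ (transfer N N ℕP.≤-refl) ⟨
        partial (λ n → e n * ((1# + Q ^ suc (N ℕ.+ N)) * G N n)) (suc N) + (partial (λ n → (x + y) * Q ^ N * e n * G N n) (suc N) + Q ^ (N ℕ.+ suc N) * G N (suc N) * f N)
          ≈⟨ +-cong (partial-cong (suc N) (λ n _ → solve 3 (λ a b d → a :* (b :* d) := b :* (a :* d)) refl _ _ _))
               (+-cong (partial-cong (suc N) (λ n _ → *-assoc _ _ _)) (trans (*-congʳ (trans (*-congˡ (G-top N)) (zeroʳ _))) (zeroˡ _))) ⟩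
        partial (λ n → (1# + Q ^ suc (N ℕ.+ N)) * (e n * G N n)) (suc N) + (partial (λ n → (x + y) * Q ^ N * (e n * G N n)) (suc N) + 0#)
          ≈⟨ +-cong (partial-*ˡ _ _ (suc N)) (trans (+-identityʳ _) (partial-*ˡ _ _ (suc N))) ⟩
        (1# + Q ^ suc (N ℕ.+ N)) * F N + (x + y) * Q ^ N * F N
          ≈⟨ +-congʳ (*-congʳ (+-congˡ (*-congˡ (^-+ Q N N)))) ⟩
        (1# + Q * (Q ^ N * Q ^ N)) * F N + (x + y) * Q ^ N * F N
          ≈⟨ +-congʳ (*-congʳ (+-congˡ (*-congʳ xy≈Q))) ⟨
        (1# + (x * y) * (Q ^ N * Q ^ N)) * F N + (x + y) * Q ^ N * F N
          ≈⟨ solve 4 (λ x y n f → (con (+ 1) :+ (x :* y) :* (n :* n)) :* f :+ (x :+ y) :* n :* f := f :* ((con (+ 1) :+ x :* n) :* (con (+ 1) :+ y :* n))) refl x y (Q ^ N) (F N) ⟩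
        F N * ((1# + x * Q ^ N) * (1# + y * Q ^ N)) ∎
        where
        top : scale N * (e (suc N) * G (suc N) (suc N)) ≈ Q ^ (N ∸ N) * G N N * e (suc N)
        top = begin
          scale N * (e (suc N) * G (suc N) (suc N))
            ≈⟨ *-congˡ (*-congˡ (trans (G-diagonal (suc N)) (reflexive (≡.cong r (≡.cong suc (ℕP.+-suc N N)))))) ⟩
          scale N * (e (suc N) * r (suc (suc (N ℕ.+ N))))
            ≈⟨ solve 4 (λ a b e r → a :* b :* (e :* r) := (a :* (b :* r)) :* e) refl _ _ _ _ ⟩
          ((1# - Q ^ suc (N ℕ.+ N)) * ((1# - Q ^ suc (suc (N ℕ.+ N))) * r (suc (suc (N ℕ.+ N))))) * e (suc N)
            ≈⟨ *-congʳ (trans (*-congˡ (r-step (suc (suc (N ℕ.+ N))))) (r-step (suc (N ℕ.+ N)))) ⟩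
          r (N ℕ.+ N) * e (suc N)
            ≈⟨ *-congʳ (G-diagonal N) ⟨
          G N N * e (suc N)
            ≈⟨ *-congʳ (trans (*-congʳ (reflexive (≡.cong (Q ^_) (ℕP.n∸n≡0 N)))) (*-identityˡ _)) ⟨
          Q ^ (N ∸ N) * G N N * e (suc N) ∎

      finite-triple-product : ∀ N → product (λ i → (1# + x * Q ^ i) * (1# + y * Q ^ i)) N ≈ factorial (N ℕ.+ N) * F N
      finite-triple-product zero = solve 0 (con (+ 1) := con (+ 1) :* (con (+ 0) :+ con (+ 1) :* (con (+ 1) :* con (+ 1)))) refl
      finite-triple-product (suc N) = begin
        product P N * P N                             ≈⟨ *-congʳ (finite-triple-product N) ⟩
        factorial (N ℕ.+ N) * F N * P N               ≈⟨ *-assoc _ _ _ ⟩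
        factorial (N ℕ.+ N) * (F N * P N)             ≈⟨ *-congˡ (F-recurrence N) ⟨
        factorial (N ℕ.+ N) * (scale N * F (suc N))   ≈⟨ solve 4 (λ a b d f → a :* (b :* d :* f) := (a :* b) :* d :* f) refl _ _ _ _ ⟩
        factorial (suc (suc (N ℕ.+ N))) * F (suc N)   ≡⟨ ≡.cong (λ m → factorial m * F (suc N)) (≡.cong suc (≡.sym (ℕP.+-suc N N))) ⟩
        factorial (suc N ℕ.+ suc N) * F (suc N)       ∎
        where
        P : ℕ → Carrier
        P i = (1# + x * Q ^ i) * (1# + y * Q ^ i)

    module PartialFractions (c : Carrier) (D : ℕ → Carrier)
      (D-inverse : ∀ m → D m * (1# - c * Q ^ m + Q ^ m * Q ^ m) ≈ 1#) where

      δ v σ : ℕ → Carrier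
      δ m = 1# - c * Q ^ m + Q ^ m * Q ^ m
      σ n = (- 1#) ^ n
      v zero = 1#
      v (suc m) = σ (suc m) * (Q ^ triangle (2 ℕ.+ m) * (1# + Q ^ suc m))

      private
        cancel-poly : ∀ L X → (1# - (L * X) * (L * X)) * (1# + X) ≈ (1# + L * X) * (X * (1# - L) + (1# - L * X * X))
        cancel-poly = solve 2 (λ l x → (con (+ 1) :- (l :* x) :* (l :* x)) :* (con (+ 1) :+ x) :=
          (con (+ 1) :+ l :* x) :* (x :* (con (+ 1) :- l) :+ (con (+ 1) :- l :* x :* x))) refl

      vanishing-partial : ∀ M K → K ≤ M → (1# - Q ^ M * Q ^ M) * partial (λ m → v m * G M m * Q ^ (M ∸ m)) (suc K) ≈
        Q ^ M * (1# + Q ^ M) * (σ K * (Q ^ triangle (suc K) * (r⁻ (M ∸ K) * r (M ℕ.+ K))))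
      vanishing-partial M zero p = begin
        (1# - Q ^ M * Q ^ M) * (0# + 1# * (r M * r (M ℕ.+ 0)) * Q ^ M)
          ≈⟨ solve 3 (λ q a b → (con (+ 1) :- q :* q) :* (con (+ 0) :+ con (+ 1) :* (a :* b) :* q) :=
               q :* (con (+ 1) :+ q) :* (con (+ 1) :* (con (+ 1) :* ((con (+ 1) :- q) :* a :* b)))) refl _ _ _ ⟩
        Q ^ M * (1# + Q ^ M) * (1# * (1# * ((1# - Q ^ M) * r M * r (M ℕ.+ 0))))
          ≈⟨ *-congˡ (*-congˡ (*-congˡ (*-congʳ (r-step M)))) ⟩
        Q ^ M * (1# + Q ^ M) * (1# * (1# * (r⁻ M * r (M ℕ.+ 0)))) ∎
      vanishing-partial M (suc K) p = begin
        (1# - q * q) * (partial t (suc K) + v (suc K) * G M (suc K) * Q ^ (M ∸ suc K))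
          ≈⟨ distribˡ _ _ _ ⟩
        (1# - q * q) * partial t (suc K) + (1# - q * q) * (v (suc K) * G M (suc K) * L)
          ≈⟨ +-cong (vanishing-partial M K (ℕP.≤-trans (ℕP.n≤1+n K) p)) (*-congˡ (*-congʳ (*-congˡ (G-≤ M (suc K) p)))) ⟩
        q * (1# + q) * (σ K * (T * (r⁻ (M ∸ K) * r (M ℕ.+ K)))) + (1# - q * q) * (- 1# * σ K * (Q ^ triangle (2 ℕ.+ K) * (1# + X)) * (rl * rs) * L)
          ≈⟨ +-cong
               (*-congˡ (*-congˡ (*-congˡ (*-cong (reflexive (≡.cong r⁻ (ℕP.+-∸-assoc 1 p)))
                 (trans (reflexive (≡.cong r⁻ (≡.sym (ℕP.+-suc M K)))) (trans (sym (r-step (M ℕ.+ suc K))) (*-congʳ (+-congˡ (-‿cong (trans (^-+ Q M (suc K)) (*-congʳ qLX)))))))))))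
               (*-cong (+-congˡ (-‿cong (*-cong qLX qLX))) (*-congʳ (*-congʳ (*-congˡ (*-congʳ (^-+ Q (triangle (suc K)) (suc K))))))) ⟩
        q * (1# + q) * (σ K * (T * (rl * ((1# - L * X * X) * rs)))) + (1# - (L * X) * (L * X)) * (- 1# * σ K * (T * X * (1# + X)) * (rl * rs) * L)
          ≈⟨ +-cong (*-congʳ (*-cong qLX (+-congˡ qLX)))
               (solve 7 (λ a s t x b d l → a :* (:- con (+ 1) :* s :* (t :* x :* b) :* d :* l) := (a :* b) :* (l :* x :* (:- s :* t :* d)))
                 refl (1# - (L * X) * (L * X)) (σ K) T X (1# + X) (rl * rs) L) ⟩
        L * X * (1# + L * X) * (σ K * (T * (rl * ((1# - L * X * X) * rs)))) + ((1# - (L * X) * (L * X)) * (1# + X)) * (L * X * (- σ K * T * (rl * rs)))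
          ≈⟨ +-congˡ (*-congʳ (cancel-poly L X)) ⟩
        L * X * (1# + L * X) * (σ K * (T * (rl * ((1# - L * X * X) * rs)))) + ((1# + L * X) * (X * (1# - L) + (1# - L * X * X))) * (L * X * (- σ K * T * (rl * rs)))
          ≈⟨ solve 6 (λ l x s t a b →
               l :* x :* (con (+ 1) :+ l :* x) :* (s :* (t :* (a :* ((con (+ 1) :- l :* x :* x) :* b)))) :+
               ((con (+ 1) :+ l :* x) :* (x :* (con (+ 1) :- l) :+ (con (+ 1) :- l :* x :* x))) :* (l :* x :* (:- s :* t :* (a :* b))) :=
               l :* x :* (con (+ 1) :+ l :* x) :* (:- con (+ 1) :* s :* (t :* x :* ((con (+ 1) :- l) :* a :* b)))) refl L X (σ K) T rl rs ⟩
        L * X * (1# + L * X) * (- 1# * σ K * (T * X * ((1# - L) * rl * rs)))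
          ≈⟨ *-cong (*-cong (sym qLX) (+-congˡ (sym qLX))) (*-congˡ (*-cong (sym (^-+ Q (triangle (suc K)) (suc K))) (*-congʳ (r-step (M ∸ suc K))))) ⟩
        q * (1# + q) * (- 1# * σ K * (Q ^ triangle (2 ℕ.+ K) * (r⁻ (M ∸ suc K) * rs))) ∎
        where
        t : ℕ → Carrier
        t m = v m * G M m * Q ^ (M ∸ m)
        q = Q ^ M
        L = Q ^ (M ∸ suc K)
        X = Q ^ suc K
        T = Q ^ triangle (suc K)
        rl = r (M ∸ suc K)
        rs = r (M ℕ.+ suc K)
        qLX : q ≈ L * X
        qLX = trans (reflexive (≡.cong (Q ^_) (≡.sym (ℕP.m∸n+n≡m p)))) (^-+ Q (M ∸ suc K) (suc K))

      vanishing : ∀ N → let M = suc N in partial (λ m → v m * G M m * Q ^ (M ∸ m)) (suc M) ≈ 0#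
      vanishing N = begin
        V                                             ≈⟨ *-identityʳ _ ⟨
        V * 1#                                        ≈⟨ *-congˡ (u-inverse (N ℕ.+ M)) ⟨
        V * ((1# - Q ^ (M ℕ.+ M)) * u (N ℕ.+ M))      ≈⟨ solve 3 (λ a b d → a :* (b :* d) := b :* a :* d) refl _ _ _ ⟩
        (1# - Q ^ (M ℕ.+ M)) * V * u (N ℕ.+ M)        ≈⟨ *-congʳ (*-congʳ (+-congˡ (-‿cong (^-+ Q M M)))) ⟩
        (1# - Q ^ M * Q ^ M) * V * u (N ℕ.+ M)        ≈⟨ *-congʳ (vanishing-partial M M ℕP.≤-refl) ⟩
        Q ^ M * (1# + Q ^ M) * (σ M * (Q ^ triangle (suc M) * (r⁻ (M ∸ M) * r (M ℕ.+ M)))) * u (N ℕ.+ M)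
          ≈⟨ *-congʳ (*-congˡ (*-congˡ (*-congˡ (*-congʳ (reflexive (≡.cong r⁻ (ℕP.n∸n≡0 M))))))) ⟩
        Q ^ M * (1# + Q ^ M) * (σ M * (Q ^ triangle (suc M) * (0# * r (M ℕ.+ M)))) * u (N ℕ.+ M)
          ≈⟨ solve 5 (λ a b d e f → a :* (b :* (d :* (con (+ 0) :* e))) :* f := con (+ 0)) refl _ _ _ _ _ ⟩
        0# ∎
        where
        M = suc N
        V = partial (λ m → v m * G M m * Q ^ (M ∸ m)) (suc M)

      A : ℕ → Carrier
      A N = partial (λ m → v m * D m * G N m) (suc N)

      A-recurrence : ∀ N → A (suc N) * δ (suc N) ≈ A N
      A-recurrence N = begin
        A M * δ M
          ≈⟨ *-comm _ _ ⟩
        δ M * A M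
          ≈⟨ partial-*ˡ _ _ (suc M) ⟨
        partial (λ m → δ M * (v m * D m * G M m)) (suc M)
          ≈⟨ partial-cong (suc M) (λ m p → split m (ℕ.s≤s⁻¹ p)) ⟩
        partial (λ m → v m * D m * G N m + v m * G M m * Q ^ (M ∸ m)) (suc M)
          ≈⟨ partial-+ _ _ (suc M) ⟩
        (A N + v M * D M * G N M) + partial (λ m → v m * G M m * Q ^ (M ∸ m)) (suc M)
          ≈⟨ +-cong (trans (+-congˡ (trans (*-congˡ (trans (*-congʳ (reflexive (≡.cong r⁻ (ℕP.n∸n≡0 N)))) (zeroˡ _))) (zeroʳ _))) (+-identityʳ _)) (vanishing N) ⟩
        A N + 0#
          ≈⟨ +-identityʳ _ ⟩
        A N ∎
        where
        M = suc N
        -- At the pole D(m) the factor δ(M) takes the value (1 - Q^{M-m}) (1 - Q^{M+m}).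
        split : ∀ m → m ≤ M → δ M * (v m * D m * G M m) ≈ v m * D m * G N m + v m * G M m * Q ^ (M ∸ m)
        split m p = begin
          δ M * (v m * D m * G M m)
            ≈⟨ *-congʳ (+-cong (+-congˡ (-‿cong (*-congˡ qLX))) (*-cong qLX qLX)) ⟩
          (1# - c * (L * X) + (L * X) * (L * X)) * (v m * D m * G M m)
            ≈⟨ solve 6 (λ l x c v d g → (con (+ 1) :- c :* (l :* x) :+ (l :* x) :* (l :* x)) :* (v :* d :* g) :=
                 v :* d :* ((con (+ 1) :- l) :* (con (+ 1) :- l :* x :* x) :* g) :+ v :* g :* l :* (d :* (con (+ 1) :- c :* x :+ x :* x))) refl L X c (v m) (D m) (G M m) ⟩
          v m * D m * ((1# - L) * (1# - L * X * X) * G M m) + v m * G M m * L * (D m * (1# - c * X + X * X))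
            ≈⟨ +-cong (*-congˡ lower) (trans (*-congˡ (D-inverse m)) (*-identityʳ _)) ⟩
          v m * D m * G N m + v m * G M m * L ∎
          where
          L = Q ^ (M ∸ m)
          X = Q ^ m
          qLX : Q ^ M ≈ L * X
          qLX = trans (reflexive (≡.cong (Q ^_) (≡.sym (ℕP.m∸n+n≡m p)))) (^-+ Q (M ∸ m) m)
          lower : (1# - L) * (1# - L * X * X) * G M m ≈ G N m
          lower = begin
            (1# - L) * (1# - L * X * X) * (r⁻ (suc M ∸ m) * r (M ℕ.+ m))
              ≈⟨ *-cong (*-congˡ (+-congˡ (-‿cong (trans (*-congʳ (sym qLX)) (sym (^-+ Q M m)))))) (*-congʳ (reflexive (≡.cong r⁻ (ℕP.+-∸-assoc 1 p)))) ⟩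
            (1# - L) * (1# - Q ^ (M ℕ.+ m)) * (r (M ∸ m) * r (M ℕ.+ m))
              ≈⟨ solve 4 (λ a b d e → a :* b :* (d :* e) := (a :* d) :* (b :* e)) refl _ _ _ _ ⟩
            ((1# - L) * r (M ∸ m)) * ((1# - Q ^ (M ℕ.+ m)) * r (M ℕ.+ m))
              ≈⟨ *-cong (r-step (M ∸ m)) (r-step (M ℕ.+ m)) ⟩
            G N m ∎

      finite-partial-fractions : ∀ N → A N * product δ (suc N) ≈ 1#
      finite-partial-fractions zero = trans
        (*-congˡ (*-congˡ (+-cong (+-congˡ (-‿cong refl)) refl)))
        (trans (solve 2 (λ d x → (con (+ 0) :+ con (+ 1) :* d :* (con (+ 1) :* con (+ 1))) :* (con (+ 1) :* x) := d :* x) refl (D 0) (δ 0)) (D-inverse 0))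
      finite-partial-fractions (suc N) = begin
        A (suc N) * (product δ (suc N) * δ (suc N))   ≈⟨ solve 3 (λ a b d → a :* (b :* d) := (a :* d) :* b) refl _ _ _ ⟩
        A (suc N) * δ (suc N) * product δ (suc N)     ≈⟨ *-congʳ (A-recurrence N) ⟩
        A N * product δ (suc N)                       ≈⟨ finite-partial-fractions N ⟩
        1#                                            ∎

module Products {c ℓ} (A : FilteredRing c ℓ) where

  open FilteredRing A
  open Exp semiring
  open RingTools commutativeRing
  open FiniteSums commutativeRing
  open FiniteIdentities commutativeRing
  open Limits A
  open ZSums A
  open Relation.Binary.Reasoning.Setoid setoid

  module InfiniteProducts (complete : ∀ T → T ⟶ 0# → ∃ λ S → T ⇓ S)
    (Q : Carrier) (u : ℕ → Carrier) (u-inverse : ∀ i → (1# - Q ^ suc i) * u i ≈ 1#)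
    (E E⁻ : Carrier) (factorial⟶E : QFactorial.factorial Q u u-inverse ⟶ E) (E-inverse : E * E⁻ ≈ 1#) where

    open QFactorial Q u u-inverse

    r⟶E⁻ : r ⟶ E⁻
    r⟶E⁻ N = let (B , h) = factorial⟶E N in B , λ M p →
      ≈[]-trans (≈⇒≈[] (trans (sym (*-identityʳ _)) (*-congˡ (sym E-inverse))))
      (≈[]-trans (*-cong[] (≈⇒≈[] (refl {r M})) (*-cong[] (≈[]-sym (h M p)) (≈⇒≈[] (refl {E⁻}))))
      (≈⇒≈[] (trans (sym (*-assoc _ _ _)) (trans (*-congʳ (r-factorial M)) (*-identityˡ _)))))

    weighted : ∀ {w S} → w ⇓ S → (λ N → partial (λ n → w n * G N n) (suc N)) ⟶ S * (E⁻ * E⁻)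
    weighted {w} {S} p = ⟶-subseq suc ℕP.n≤1+n (tannery {T} uniform (⇓-cong (λ n → *-comm _ _) (*-comm _ _) (⇓-*ˡ (E⁻ * E⁻) p)))
      where
      T : ℕ → ℕ → Carrier
      T zero n = 0#
      T (suc N) n = w n * G N n
      uniform : ∀ N → ∃ λ B → ∀ M → B ≤ M → ∀ n → n < M → T M n ≈[ N ] w n * (E⁻ * E⁻)
      uniform N = suc (B₁ ℕ.+ B₂) , λ { (suc M) (s≤s q) n (s≤s n≤M) → term M q n n≤M }
        where
        B₁ = proj₁ (⇓-terms p N)
        B₂ = proj₁ (r⟶E⁻ N)
        term : ∀ M → B₁ ℕ.+ B₂ ≤ M → ∀ n → n ≤ M → w n * G M n ≈[ N ] w n * (E⁻ * E⁻)
        term M q n n≤M with B₁ ℕ.≤? n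
        ... | yes B₁≤n = ≈[]-trans (*-cong[] (small) (≈⇒≈[] refl)) (≈[]-trans (≈⇒≈[] (trans (zeroˡ _) (sym (zeroˡ _)))) (≈[]-sym (*-cong[] small (≈⇒≈[] refl))))
          where
          small : w n ≈[ N ] 0#
          small = proj₂ (⇓-terms p N) n B₁≤n
        ... | no B₁≰n = *-cong[] (≈⇒≈[] refl) (≈[]-trans (≈⇒≈[] (G-≤ M n n≤M))
          (*-cong[] (proj₂ (r⟶E⁻ N) (M ∸ n) (ℕP.≤-trans (ℕP.≤-reflexive (≡.sym (ℕP.m+n∸m≡n n B₂))) (ℕP.∸-monoˡ-≤ n (ℕP.≤-trans (ℕP.+-monoˡ-≤ B₂ (ℕP.<⇒≤ (ℕP.≰⇒> B₁≰n))) q))))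
                    (proj₂ (r⟶E⁻ N) (M ℕ.+ n) (ℕP.≤-trans (ℕP.≤-trans (ℕP.m≤n+m B₂ B₁) q) (ℕP.m≤m+n M n)))))

    triple-product-limit : ∀ {x y S} → x * y ≈ Q → ∀ {T} → (∀ n → T (+ n) ≈ Q ^ triangle n * x ^ n) → (∀ n → T -[1+ n ] ≈ Q ^ triangle (suc n) * y ^ suc n) →
      T ⇓ℤ S → product (λ i → (1# + x * Q ^ i) * (1# + y * Q ^ i)) ⟶ S * E⁻
    triple-product-limit {x} {y} {S} xy≈Q {T} pos neg sum = ⟶-cong (λ N → sym (finite-triple-product N))
      (trans (solve 3 (λ e s i → e :* (s :* (i :* i)) := s :* ((e :* i) :* i)) refl E S E⁻) (*-congˡ (trans (*-congʳ E-inverse) (*-identityˡ E⁻))))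
      (⟶-* (⟶-subseq (λ M → M ℕ.+ M) (λ M → ℕP.m≤m+n M M) factorial⟶E) (weighted e⇓S))
      where
      open TripleProduct x y xy≈Q
      e⇓S : e ⇓ S
      e⇓S = ⇓-cong (λ { zero → trans (pos 0) (*-identityˡ _) ; (suc n) → trans (+-cong (pos (suc n)) (neg n)) (sym (distribˡ _ _ _)) }) refl (⇓ℤ-fold sum)

    triple-product : ∀ {x y P} → x * y ≈ Q → product (λ i → (1# + x * Q ^ i) * (1# + y * Q ^ i)) ⟶ P →
      ∀ {T} → Null T → (∀ n → T (+ n) ≈ Q ^ triangle n * x ^ n) → (∀ n → T -[1+ n ] ≈ Q ^ triangle (suc n) * y ^ suc n) →
      T ⇓ℤ P * E
    triple-product {x} {y} {P} xy≈Q P-limit {T} T-null pos neg = ⇓ℤ-cong (λ _ → refl) (sym P*E≈S) sum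
      where
      pairs-exist : ∃ λ S → pair T ⇓ S
      pairs-exist = complete (pair T) (⟶-cong (λ _ → refl) (+-identityʳ _) (⟶-+ (null⁺ T-null) (null⁻ T-null)))
      S = proj₁ pairs-exist
      sum : T ⇓ℤ S
      sum = record { null = T-null ; pairs = proj₂ pairs-exist }
      P*E≈S : P * E ≈ S
      P*E≈S = begin
        P * E          ≈⟨ *-congʳ (⟶-unique P-limit (triple-product-limit xy≈Q pos neg sum)) ⟩
        S * E⁻ * E     ≈⟨ trans (*-assoc _ _ _) (*-congˡ (trans (*-comm _ _) E-inverse)) ⟩
        S * 1#         ≈⟨ *-identityʳ S ⟩
        S              ∎

    partial-fractions : ∀ {c D P C} (D-inverse : ∀ m → D m * (1# - c * Q ^ m + Q ^ m * Q ^ m) ≈ 1#) →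
      let open PartialFractions c D D-inverse in
      product δ ⟶ P → (λ m → v m * D m) ⇓ C → C * P ≈ E * E
    partial-fractions {c} {D} {P} {C} D-inverse P-limit C-sum = begin
      C * P                                     ≈⟨ *-identityʳ _ ⟨
      C * P * 1#                                ≈⟨ *-congˡ (trans (*-cong E-inverse E-inverse) (*-identityˡ _)) ⟨
      C * P * ((E * E⁻) * (E * E⁻))             ≈⟨ solve 4 (λ a p e i → a :* p :* ((e :* i) :* (e :* i)) := (a :* (i :* i) :* p) :* (e :* e)) refl C P E E⁻ ⟩
      C * (E⁻ * E⁻) * P * (E * E)               ≈⟨ *-congʳ unit ⟩
      1# * (E * E)                              ≈⟨ *-identityˡ _ ⟩
      E * E                                     ∎
      where
      open PartialFractions c D D-inverse
      unit : C * (E⁻ * E⁻) * P ≈ 1#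
      unit = ⟶-unique (⟶-* (weighted C-sum) (⟶-subseq suc ℕP.n≤1+n P-limit)) (⟶-cong (λ N → sym (finite-partial-fractions N)) refl ⟶-const)

-- The properties of F[[q]] that are used; dil is the substitution q ↦ q⁷ and poch a d is (qᵃ; qᵈ)_∞.
record SeriesAlgebra (c ℓ : Level) : Set (lsuc (c ⊔ˡ ℓ)) where
  field
    filteredRing : FilteredRing c ℓ
  open FilteredRing filteredRing public
  open Limits filteredRing public
  open FiniteSums commutativeRing public
  open Exp semiring public using (_^_; ^-homo-*; ^-assocʳ)
  field
    q : Carrier
    q-null : ∀ N k → N < k → q ^ k ≈[ N ] 0#
    complete : ∀ T → T ⟶ 0# → ∃ λ S → T ⇓ S
    ½ : Carrier
    half : ½ * (1# + 1#) ≈ 1#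
    u : ℕ → Carrier
    u-inverse : ∀ i → (1# - q ^ suc i) * u i ≈ 1#
    poch : ℕ → ℕ → Carrier
    poch-limit : ∀ a d → 1 ≤ a → 1 ≤ d → product (λ i → 1# - q ^ (a ℕ.+ d ℕ.* i)) ⟶ poch a d
    poch-invertible : ∀ a d → 1 ≤ a → 1 ≤ d → ∃ λ i → poch a d * i ≈ 1#
    dil : Carrier → Carrier
    dil-cong : ∀ {x y} → x ≈ y → dil x ≈ dil y
    dil-cong[] : ∀ {N x y} → x ≈[ N ] y → dil x ≈[ N ] dil y
    dil-+ : ∀ x y → dil (x + y) ≈ dil x + dil y
    dil-* : ∀ x y → dil (x * y) ≈ dil x * dil y
    dil-neg : ∀ x → dil (- x) ≈ - dil x
    dil-0 : dil 0# ≈ 0#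
    dil-1 : dil 1# ≈ 1#
    dil-q : dil q ≈ q ^ 7

module Monomials {c ℓ} (A : SeriesAlgebra c ℓ) where

  open SeriesAlgebra A
  open RingTools commutativeRing
  open ZSums filteredRing
  open Relation.Binary.Reasoning.Setoid setoid

  open Algebra.Properties.Ring ring using (-‿distribˡ-*; -‿distribʳ-*; -‿involutive)

  ℤ-induction : ∀ {p} (P : ℤ → Set p) → P (+ 0) → (∀ n → P n → P (ℤ.suc n)) → (∀ n → P n → P (ℤ.pred n)) → ∀ n → P n
  ℤ-induction P z s p (+ zero) = z
  ℤ-induction P z s p (+ suc n) = s (+ n) (ℤ-induction P z s p (+ n))
  ℤ-induction P z s p -[1+ zero ] = p (+ 0) z
  ℤ-induction P z s p -[1+ suc n ] = p -[1+ n ] (ℤ-induction P z s p -[1+ n ])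

  q^ℤ : ℤ → Carrier
  q^ℤ (+ k) = q ^ k
  q^ℤ -[1+ _ ] = 0#

  q^ℤ-+ : ∀ {i j} → + 0 ℤ.≤ i → + 0 ℤ.≤ j → q^ℤ (i ℤ.+ j) ≈ q^ℤ i * q^ℤ j
  q^ℤ-+ {+ i} {+ j} _ _ = ^-homo-* q i j

  q^ℤ-null : ∀ (e : ℤ → ℤ) → (∀ n → + ‖ n ‖ ℤ.≤ e n ℤ.+ + 1) → Null (λ n → q^ℤ (e n))
  q^ℤ-null e bound N = 2 ℕ.+ N , λ n p → small (e n) (ℤP.≤-trans (ℤ.+≤+ p) (bound n))
    where
    small : ∀ i → + (2 ℕ.+ N) ℤ.≤ i ℤ.+ + 1 → q^ℤ i ≈[ N ] 0#
    small (+ k) (ℤ.+≤+ p) = q-null N k (ℕ.s≤s⁻¹ (≡.subst (2 ℕ.+ N ≤_) (ℕP.+-comm k 1) p))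
    small -[1+ k ] p = ≈⇒≈[] refl

  completeℤ : ∀ {T} → Null T → ∃ λ S → T ⇓ℤ S
  completeℤ {T} v = let (S , p) = complete (pair T) (⟶-cong (λ _ → refl) (+-identityʳ _) (⟶-+ (null⁺ v) (null⁻ v)))
    in S , record { null = v ; pairs = p }

  tri : ℤ → ℤ
  tri (+ k) = + triangle k
  tri -[1+ k ] = + triangle (2 ℕ.+ k)

  tri-suc : ∀ n → tri (ℤ.suc n) ≡ tri n ℤ.+ n
  tri-suc (+ k) = ≡.refl
  tri-suc -[1+ zero ] = ≡.refl
  tri-suc -[1+ suc k ] = ≡.sym (cancel (+ triangle (2 ℕ.+ k)) (+ (2 ℕ.+ k)))
    where
    cancel : ∀ x y → x ℤ.+ y ℤ.+ ℤ.- y ≡ x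
    cancel = solve-∀

  tri-+ : ∀ m n → tri (m ℤ.+ n) ≡ tri m ℤ.+ tri n ℤ.+ m ℤ.* n
  tri-+ m n = ℤ-induction (λ m → tri (m ℤ.+ n) ≡ tri m ℤ.+ tri n ℤ.+ m ℤ.* n)
    (≡.trans (≡.cong tri (ℤP.+-identityˡ n)) (base (tri n) n))
    (λ m e → ≡.trans (≡.cong tri (ℤP.+-assoc (+ 1) m n)) (≡.trans (tri-suc (m ℤ.+ n))
      (≡.trans (≡.cong (ℤ._+ (m ℤ.+ n)) e) (≡.trans (up (tri m) (tri n) m n)
        (≡.cong (λ t → t ℤ.+ tri n ℤ.+ ℤ.suc m ℤ.* n) (≡.sym (tri-suc m)))))))
    (λ m e → down (tri (ℤ.pred m ℤ.+ n)) (tri (ℤ.pred m)) (tri m) (tri (m ℤ.+ n)) (tri n) m n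
      (≡.trans (≡.cong tri (≡.sym (step (m) n))) (tri-suc (ℤ.pred m ℤ.+ n)))
      (≡.trans (≡.cong tri (≡.sym (ℤP.suc-pred m))) (tri-suc (ℤ.pred m))) e) m
    where
    base : ∀ t n → t ≡ + 0 ℤ.+ t ℤ.+ + 0 ℤ.* n
    base = solve-∀
    up : ∀ s t m n → s ℤ.+ t ℤ.+ m ℤ.* n ℤ.+ (m ℤ.+ n) ≡ (s ℤ.+ m) ℤ.+ t ℤ.+ (+ 1 ℤ.+ m) ℤ.* n
    up = solve-∀
    step : ∀ m n → + 1 ℤ.+ (ℤ.- + 1 ℤ.+ m ℤ.+ n) ≡ m ℤ.+ n
    step = solve-∀
    down : ∀ x y s u t m n → u ≡ x ℤ.+ (ℤ.pred m ℤ.+ n) → s ≡ y ℤ.+ ℤ.pred m → u ≡ s ℤ.+ t ℤ.+ m ℤ.* n →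
      x ≡ y ℤ.+ t ℤ.+ ℤ.pred m ℤ.* n
    down x y _ _ t m n ≡.refl ≡.refl e = ≡.trans (left x m n) (≡.trans (≡.cong (ℤ._- (ℤ.pred m ℤ.+ n)) e) (right y t m n))
      where
      left : ∀ x m n → x ≡ x ℤ.+ (ℤ.- + 1 ℤ.+ m ℤ.+ n) ℤ.- (ℤ.- + 1 ℤ.+ m ℤ.+ n)
      left = solve-∀
      right : ∀ y t m n → y ℤ.+ (ℤ.- + 1 ℤ.+ m) ℤ.+ t ℤ.+ m ℤ.* n ℤ.- (ℤ.- + 1 ℤ.+ m ℤ.+ n) ≡ y ℤ.+ t ℤ.+ (ℤ.- + 1 ℤ.+ m) ℤ.* n
      right = solve-∀

  tri-neg : ∀ n → tri (ℤ.- n) ≡ tri n ℤ.+ n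
  tri-neg (+ zero) = ≡.refl
  tri-neg (+ suc k) = ≡.refl
  tri-neg -[1+ k ] = ≡.sym (cancel (+ triangle (suc k)) (+ suc k))
    where
    cancel : ∀ x y → x ℤ.+ y ℤ.+ ℤ.- y ≡ x
    cancel = solve-∀

  tri-double : ∀ n → tri n ℤ.+ tri n ≡ n ℤ.* n ℤ.- n
  tri-double n = cancel (tri n) (≡.trans (≡.cong tri (≡.sym (ℤP.+-inverseʳ n))) (≡.trans (tri-+ n (ℤ.- n)) (≡.cong (λ t → tri n ℤ.+ t ℤ.+ n ℤ.* ℤ.- n) (tri-neg n))))
    where
    lemma : ∀ t n → t ℤ.+ t ≡ (t ℤ.+ (t ℤ.+ n) ℤ.+ n ℤ.* ℤ.- n) ℤ.+ (n ℤ.* n ℤ.- n)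
    lemma = solve-∀
    cancel : ∀ t → + 0 ≡ t ℤ.+ (t ℤ.+ n) ℤ.+ n ℤ.* ℤ.- n → t ℤ.+ t ≡ n ℤ.* n ℤ.- n
    cancel t e = ≡.trans (lemma t n) (≡.trans (≡.cong (ℤ._+ (n ℤ.* n ℤ.- n)) (≡.sym e)) (ℤP.+-identityˡ _))

  tri-triple : ∀ n → tri (n ℤ.* + 3) ≡ + 3 ℤ.* tri n ℤ.+ + 3 ℤ.* (n ℤ.* n)
  tri-triple n = ≡.trans (≡.cong tri (split n)) (≡.trans (tri-+ n (n ℤ.+ n))
    (≡.trans (≡.cong (λ t → tri n ℤ.+ t ℤ.+ n ℤ.* (n ℤ.+ n)) (tri-+ n n)) (collect (tri n) n)))
    where
    split : ∀ n → n ℤ.* + 3 ≡ n ℤ.+ (n ℤ.+ n)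
    split = solve-∀
    collect : ∀ t n → t ℤ.+ (t ℤ.+ t ℤ.+ n ℤ.* n) ℤ.+ n ℤ.* (n ℤ.+ n) ≡ + 3 ℤ.* t ℤ.+ + 3 ℤ.* (n ℤ.* n)
    collect = solve-∀

  -- Identities between exponents hold modulo 2 tri P = P² - P.
  modulo-tri : ∀ {x y} k P → x ≡ y ℤ.+ k ℤ.* (tri P ℤ.+ tri P ℤ.- (P ℤ.* P ℤ.- P)) → x ≡ y
  modulo-tri {x} {y} k P e = ≡.trans e (≡.trans (≡.cong (λ t → y ℤ.+ k ℤ.* (t ℤ.- (P ℤ.* P ℤ.- P))) (tri-double P)) (lemma y k (P ℤ.* P ℤ.- P)))
    where
    lemma : ∀ y k z → y ℤ.+ k ℤ.* (z ℤ.- z) ≡ y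
    lemma = solve-∀

  tri-abs : ∀ n → + ℤ.∣ tri n ∣ ≡ tri n
  tri-abs (+ _) = ≡.refl
  tri-abs -[1+ _ ] = ≡.refl

  exponent : ℤ → ℤ → ℤ → ℤ
  exponent p a n = p ℤ.* tri n ℤ.+ a ℤ.* n

  exponent⁺ : ∀ p a k → exponent (+ p) (+ a) (+ k) ≡ + (p ℕ.* triangle k ℕ.+ a ℕ.* k)
  exponent⁺ p a k = ≡.sym (≡.cong₂ ℤ._+_ (ℤP.pos-* p (triangle k)) (ℤP.pos-* a k))

  exponent⁻ : ∀ a a′ k → exponent (+ (a ℕ.+ a′)) (+ a) -[1+ k ] ≡ + ((a ℕ.+ a′) ℕ.* triangle (suc k) ℕ.+ a′ ℕ.* suc k)
  exponent⁻ a a′ k = ≡.trans (lemma (+ a) (+ a′) (+ triangle (suc k)) (+ suc k))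
    (≡.sym (≡.cong₂ ℤ._+_ (ℤP.pos-* (a ℕ.+ a′) (triangle (suc k))) (ℤP.pos-* a′ (suc k))))
    where
    lemma : ∀ a a′ t k → (a ℤ.+ a′) ℤ.* (t ℤ.+ k) ℤ.+ a ℤ.* (ℤ.- k) ≡ (a ℤ.+ a′) ℤ.* t ℤ.+ a′ ℤ.* k
    lemma = solve-∀

  exponent≥0 : ∀ a a′ n → + 0 ℤ.≤ exponent (+ (a ℕ.+ a′)) (+ a) n
  exponent≥0 a a′ (+ k) = ≡.subst (+ 0 ℤ.≤_) (≡.sym (exponent⁺ (a ℕ.+ a′) a k)) (ℤ.+≤+ z≤n)
  exponent≥0 a a′ -[1+ k ] = ≡.subst (+ 0 ℤ.≤_) (≡.sym (exponent⁻ a a′ k)) (ℤ.+≤+ z≤n)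

  k≤triangle[1+k] : ∀ k → k ≤ triangle (suc k)
  k≤triangle[1+k] k = ℕP.m≤n+m k (triangle k)

  exponent-bound : ∀ a a′ → 1 ≤ a ℕ.+ a′ → ∀ n → + ‖ n ‖ ℤ.≤ exponent (+ (a ℕ.+ a′)) (+ a) n ℤ.+ + 1
  exponent-bound a a′ pos (+ k) = ≡.subst (λ t → + k ℤ.≤ t ℤ.+ + 1) (≡.sym (exponent⁺ (a ℕ.+ a′) a k))
    (ℤ.+≤+ (ℕP.≤-trans (k≤ k) (ℕP.+-monoˡ-≤ 1 (ℕP.≤-trans (ℕP.m≤n*m (triangle k) (a ℕ.+ a′) ⦃ ℕ.>-nonZero pos ⦄) (ℕP.m≤m+n _ _)))))
    where
    k≤ : ∀ k → k ≤ triangle k ℕ.+ 1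
    k≤ zero = z≤n
    k≤ (suc k) = ≡.subst (suc k ≤_) (ℕP.+-comm 1 _) (s≤s (k≤triangle[1+k] k))
  exponent-bound a a′ pos -[1+ k ] = ≡.subst (λ t → + k ℤ.≤ t ℤ.+ + 1) (≡.sym (exponent⁻ a a′ k))
    (ℤ.+≤+ (ℕP.≤-trans (k≤triangle[1+k] k) (ℕP.≤-trans (ℕP.m≤n*m _ (a ℕ.+ a′) ⦃ ℕ.>-nonZero pos ⦄) (ℕP.≤-trans (ℕP.m≤m+n _ _) (ℕP.m≤m+n _ 1)))))

  sign : ℤ → Carrier
  sign (+ zero) = 1#
  sign (+ suc k) = - sign (+ k)
  sign -[1+ zero ] = - 1#
  sign -[1+ suc k ] = - sign -[1+ k ]

  sign-suc : ∀ n → sign (ℤ.suc n) ≈ - sign n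
  sign-suc (+ k) = refl
  sign-suc -[1+ zero ] = sym (-‿involutive _)
  sign-suc -[1+ suc k ] = sym (-‿involutive _)

  sign-pred : ∀ n → sign (ℤ.pred n) ≈ - sign n
  sign-pred n = trans (sym (-‿involutive _)) (-‿cong (trans (sym (sign-suc (ℤ.pred n))) (reflexive (≡.cong sign (ℤP.suc-pred n)))))

  antiperiodic : ∀ (f : ℤ → Carrier) d → (∀ n → f (d ℤ.+ n) ≈ - f n) → ∀ k r → f (k ℤ.* d ℤ.+ r) ≈ sign k * f r
  antiperiodic f d h k r = ℤ-induction (λ k → f (k ℤ.* d ℤ.+ r) ≈ sign k * f r)
    (trans (reflexive (≡.cong f (base d r))) (sym (*-identityˡ _)))
    (λ k e → begin
      f (ℤ.suc k ℤ.* d ℤ.+ r)     ≡⟨ ≡.cong f (up k d r) ⟩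
      f (d ℤ.+ (k ℤ.* d ℤ.+ r))   ≈⟨ h _ ⟩
      - f (k ℤ.* d ℤ.+ r)         ≈⟨ -‿cong e ⟩
      - (sign k * f r)            ≈⟨ -‿distribˡ-* _ _ ⟩
      - sign k * f r              ≈⟨ *-congʳ (sign-suc k) ⟨
      sign (ℤ.suc k) * f r        ∎)
    (λ k e → begin
      f (ℤ.pred k ℤ.* d ℤ.+ r)       ≈⟨ -‿involutive _ ⟨
      - - f (ℤ.pred k ℤ.* d ℤ.+ r)   ≈⟨ -‿cong (h _) ⟨
      - f (d ℤ.+ (ℤ.pred k ℤ.* d ℤ.+ r)) ≡⟨ ≡.cong (λ t → - f t) (down k d r) ⟩
      - f (k ℤ.* d ℤ.+ r)            ≈⟨ -‿cong e ⟩
      - (sign k * f r)               ≈⟨ -‿distribˡ-* _ _ ⟩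
      - sign k * f r                 ≈⟨ *-congʳ (sign-pred k) ⟨
      sign (ℤ.pred k) * f r          ∎)
    k
    where
    base : ∀ d r → + 0 ℤ.* d ℤ.+ r ≡ r
    base = solve-∀
    up : ∀ k d r → (+ 1 ℤ.+ k) ℤ.* d ℤ.+ r ≡ d ℤ.+ (k ℤ.* d ℤ.+ r)
    up = solve-∀
    down : ∀ k d r → d ℤ.+ ((ℤ.- + 1 ℤ.+ k) ℤ.* d ℤ.+ r) ≡ k ℤ.* d ℤ.+ r
    down = solve-∀

  sign-+ : ∀ m n → sign (m ℤ.+ n) ≈ sign m * sign n
  sign-+ m n = trans (reflexive (≡.cong (λ t → sign (t ℤ.+ n)) (≡.sym (ℤP.*-identityʳ m)))) (antiperiodic sign (+ 1) sign-suc m n)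

  sign-square : ∀ n → sign n * sign n ≈ 1#
  sign-square = ℤ-induction (λ n → sign n * sign n ≈ 1#) (*-identityˡ _)
    (λ n e → trans (*-cong (sign-suc n) (sign-suc n)) (trans (solve 1 (λ x → :- x :* :- x := x :* x) refl _) e))
    (λ n e → trans (*-cong (sign-pred n) (sign-pred n)) (trans (solve 1 (λ x → :- x :* :- x := x :* x) refl _) e))

  sign-neg : ∀ n → sign (ℤ.- n) ≈ sign n
  sign-neg n = begin
    sign (ℤ.- n)                          ≈⟨ *-identityʳ _ ⟨
    sign (ℤ.- n) * 1#                     ≈⟨ *-congˡ (sign-square n) ⟨
    sign (ℤ.- n) * (sign n * sign n)      ≈⟨ *-assoc _ _ _ ⟨
    sign (ℤ.- n) * sign n * sign n        ≈⟨ *-congʳ (sign-+ (ℤ.- n) n) ⟨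
    sign (ℤ.- n ℤ.+ n) * sign n           ≡⟨ ≡.cong (λ t → sign t * sign n) (ℤP.+-inverseˡ n) ⟩
    1# * sign n                           ≈⟨ *-identityˡ _ ⟩
    sign n                                ∎

  plain : ℕ → ℕ → ℤ → Carrier
  plain p a n = q^ℤ (exponent (+ p) (+ a) n)

  theta-term : ℕ → ℕ → ℤ → Carrier
  theta-term p a n = sign n * plain p a n

  plain-null : ∀ a a′ → 1 ≤ a ℕ.+ a′ → Null (plain (a ℕ.+ a′) a)
  plain-null a a′ pos = q^ℤ-null (exponent (+ (a ℕ.+ a′)) (+ a)) (exponent-bound a a′ pos)

  private
    quadrupleˡ : ∀ a b x y → (a * x) * (b * y) ≈ (a * b) * (x * y)
    quadrupleˡ = solve 4 (λ a b x y → (a :* x) :* (b :* y) := (a :* b) :* (x :* y)) refl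

  -- With m + n = 2u or 2u + 1 the exponent of θ_{a+b}(m) θ_{a-b}(n) separates; here a = b + e and p = 2a + g.
  theta-product : ∀ b e g {X Y χa φb φa χb} → 1 ≤ b ℕ.+ e →
    let a = b ℕ.+ e ; p = (a ℕ.+ a) ℕ.+ g in
    theta-term p (a ℕ.+ b) ⇓ℤ X → theta-term p e ⇓ℤ Y →
    plain (p ℕ.+ p) (a ℕ.+ a) ⇓ℤ χa → plain (p ℕ.+ p) (p ℕ.+ (b ℕ.+ b)) ⇓ℤ φb →
    plain (p ℕ.+ p) (p ℕ.+ (a ℕ.+ a)) ⇓ℤ φa → plain (p ℕ.+ p) (b ℕ.+ b) ⇓ℤ χb →
    X * Y ≈ χa * φb - q ^ e * (φa * χb)
  theta-product b e g {X} {Y} {χa} {φb} {φa} {χb} pos sumX sumY sumχa sumφb sumφa sumχb = begin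
    X * Y ≈⟨ ⇓ℤ-split 1 S column-sum classes ⟩
    0# + χa * φb + - (q ^ e) * (φa * χb)
      ≈⟨ solve 4 (λ x y z w → con (+ 0) :+ x :* y :+ :- z :* w := x :* y :- z :* w) refl χa φb (q ^ e) (φa * χb) ⟩
    χa * φb - q ^ e * (φa * χb) ∎
    where
    a = b ℕ.+ e
    p = (a ℕ.+ a) ℕ.+ g
    U W : ℤ → Carrier
    U = theta-term p (a ℕ.+ b)
    W = theta-term p e
    T : ℤ → ℤ → Carrier
    T m s = U m * W (ℤ.- m ℤ.+ s)
    S : ℕ → Carrier
    S zero = χa * φb
    S (suc _) = - (q ^ e) * (φa * χb)
    joint : JointlyNullℤ T
    joint = JointlyNull-convolution (null sumX) (null sumY)
    column : ∀ s → ∃ λ C → (λ m → T m s) ⇓ℤ C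
    column s = completeℤ (λ N → let (B , v) = joint N in B , λ m h → v m s (inj₁ h))
    row : ∀ m → T m ⇓ℤ U m * Y
    row m = ⇓ℤ-*ˡ (U m) (⇓ℤ-shift (ℤ.- m) sumY)
    total : (λ m → U m * Y) ⇓ℤ X * Y
    total = ⇓ℤ-cong (λ m → *-comm _ _) (*-comm _ _) (⇓ℤ-*ˡ Y sumX)
    column-sum : (λ s → proj₁ (column s)) ⇓ℤ X * Y
    column-sum = fubiniℤ joint row (λ s → proj₂ (column s)) total
    as-sum : ∀ {x} y z → x ≡ y ℕ.+ z → ∀ n → + 0 ℤ.≤ exponent (+ x) (+ y) n
    as-sum y z ≡.refl = exponent≥0 y z
    U≥0 : ∀ n → + 0 ℤ.≤ exponent (+ p) (+ (a ℕ.+ b)) n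
    U≥0 = as-sum (a ℕ.+ b) (e ℕ.+ g) (lemma b e g)
      where
      lemma : ∀ b e g → (b ℕ.+ e) ℕ.+ (b ℕ.+ e) ℕ.+ g ≡ (b ℕ.+ e) ℕ.+ b ℕ.+ (e ℕ.+ g)
      lemma = ℕ-solve-∀
    W≥0 : ∀ n → + 0 ℤ.≤ exponent (+ p) (+ e) n
    W≥0 = as-sum e (b ℕ.+ (b ℕ.+ e) ℕ.+ g) (lemma b e g)
      where
      lemma : ∀ b e g → (b ℕ.+ e) ℕ.+ (b ℕ.+ e) ℕ.+ g ≡ e ℕ.+ (b ℕ.+ (b ℕ.+ e) ℕ.+ g)
      lemma = ℕ-solve-∀
    χ≥0 : ∀ x y → x ℕ.+ y ≡ a → ∀ n → + 0 ℤ.≤ exponent (+ (p ℕ.+ p)) (+ (x ℕ.+ x)) n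
    χ≥0 x y eq = as-sum (x ℕ.+ x) (p ℕ.+ (y ℕ.+ y) ℕ.+ g)
      (≡.subst (λ a → let p = (a ℕ.+ a) ℕ.+ g in p ℕ.+ p ≡ (x ℕ.+ x) ℕ.+ (p ℕ.+ (y ℕ.+ y) ℕ.+ g)) eq (lemma x y g))
      where
      lemma : ∀ x y g → let a = x ℕ.+ y ; p = (a ℕ.+ a) ℕ.+ g in p ℕ.+ p ≡ (x ℕ.+ x) ℕ.+ (p ℕ.+ (y ℕ.+ y) ℕ.+ g)
      lemma = ℕ-solve-∀
    φ≥0 : ∀ x y → x ℕ.+ y ≡ a → ∀ n → + 0 ℤ.≤ exponent (+ (p ℕ.+ p)) (+ (p ℕ.+ (x ℕ.+ x))) n
    φ≥0 x y eq = as-sum (p ℕ.+ (x ℕ.+ x)) ((y ℕ.+ y) ℕ.+ g)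
      (≡.subst (λ a → let p = (a ℕ.+ a) ℕ.+ g in p ℕ.+ p ≡ (p ℕ.+ (x ℕ.+ x)) ℕ.+ ((y ℕ.+ y) ℕ.+ g)) eq (lemma x y g))
      where
      lemma : ∀ x y g → let a = x ℕ.+ y ; p = (a ℕ.+ a) ℕ.+ g in p ℕ.+ p ≡ (p ℕ.+ (x ℕ.+ x)) ℕ.+ ((y ℕ.+ y) ℕ.+ g)
      lemma = ℕ-solve-∀
    even-exponent : ∀ u v → exponent (+ p) (+ (a ℕ.+ b)) (u ℤ.+ v) ℤ.+ exponent (+ p) (+ e) (u ℤ.+ ℤ.- v) ≡
      exponent (+ (p ℕ.+ p)) (+ (a ℕ.+ a)) u ℤ.+ exponent (+ (p ℕ.+ p)) (+ (p ℕ.+ (b ℕ.+ b))) v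
    even-exponent u v rewrite tri-+ u v | tri-+ u (ℤ.- v) | tri-neg v = lemma (+ p) (+ b) (+ e) u v (tri u) (tri v)
      where
      lemma : ∀ p b e u v U V → p ℤ.* (U ℤ.+ V ℤ.+ u ℤ.* v) ℤ.+ (b ℤ.+ e ℤ.+ b) ℤ.* (u ℤ.+ v)
        ℤ.+ (p ℤ.* (U ℤ.+ (V ℤ.+ v) ℤ.+ u ℤ.* (ℤ.- v)) ℤ.+ e ℤ.* (u ℤ.+ ℤ.- v)) ≡
        (p ℤ.+ p) ℤ.* U ℤ.+ ((b ℤ.+ e) ℤ.+ (b ℤ.+ e)) ℤ.* u ℤ.+ ((p ℤ.+ p) ℤ.* V ℤ.+ (p ℤ.+ (b ℤ.+ b)) ℤ.* v)
      lemma = solve-∀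
    odd-exponent : ∀ u v → exponent (+ p) (+ (a ℕ.+ b)) (u ℤ.+ v) ℤ.+ exponent (+ p) (+ e) (+ 1 ℤ.+ (u ℤ.+ ℤ.- v)) ≡
      + e ℤ.+ (exponent (+ (p ℕ.+ p)) (+ (p ℕ.+ (a ℕ.+ a))) u ℤ.+ exponent (+ (p ℕ.+ p)) (+ (b ℕ.+ b)) v)
    odd-exponent u v rewrite tri-suc (u ℤ.+ ℤ.- v) | tri-+ u v | tri-+ u (ℤ.- v) | tri-neg v = lemma (+ p) (+ b) (+ e) u v (tri u) (tri v)
      where
      lemma : ∀ p b e u v U V → p ℤ.* (U ℤ.+ V ℤ.+ u ℤ.* v) ℤ.+ (b ℤ.+ e ℤ.+ b) ℤ.* (u ℤ.+ v)
        ℤ.+ (p ℤ.* (U ℤ.+ (V ℤ.+ v) ℤ.+ u ℤ.* (ℤ.- v) ℤ.+ (u ℤ.+ ℤ.- v)) ℤ.+ e ℤ.* (+ 1 ℤ.+ (u ℤ.+ ℤ.- v))) ≡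
        e ℤ.+ ((p ℤ.+ p) ℤ.* U ℤ.+ (p ℤ.+ ((b ℤ.+ e) ℤ.+ (b ℤ.+ e))) ℤ.* u ℤ.+ ((p ℤ.+ p) ℤ.* V ℤ.+ (b ℤ.+ b) ℤ.* v))
      lemma = solve-∀
    signs : ∀ u v → sign (u ℤ.+ v) * sign (u ℤ.+ ℤ.- v) ≈ 1#
    signs u v = begin
      sign (u ℤ.+ v) * sign (u ℤ.+ ℤ.- v)           ≈⟨ *-cong (sign-+ u v) (trans (sign-+ u (ℤ.- v)) (*-congˡ (sign-neg v))) ⟩
      (sign u * sign v) * (sign u * sign v)         ≈⟨ quadrupleˡ _ _ _ _ ⟩
      (sign u * sign u) * (sign v * sign v)         ≈⟨ *-cong (sign-square u) (sign-square v) ⟩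
      1# * 1#                                       ≈⟨ *-identityˡ _ ⟩
      1#                                            ∎
    even-term : ∀ u v → T (u ℤ.+ v) (u ℤ.* + 2 ℤ.+ + 0) ≈ plain (p ℕ.+ p) (a ℕ.+ a) u * plain (p ℕ.+ p) (p ℕ.+ (b ℕ.+ b)) v
    even-term u v = begin
      U (u ℤ.+ v) * W (ℤ.- (u ℤ.+ v) ℤ.+ (u ℤ.* + 2 ℤ.+ + 0))
        ≡⟨ ≡.cong (λ t → U (u ℤ.+ v) * W t) (index u v) ⟩
      U (u ℤ.+ v) * W (u ℤ.+ ℤ.- v)
        ≈⟨ quadrupleˡ _ _ _ _ ⟩
      (sign (u ℤ.+ v) * sign (u ℤ.+ ℤ.- v)) * (plain p (a ℕ.+ b) (u ℤ.+ v) * plain p e (u ℤ.+ ℤ.- v))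
        ≈⟨ *-cong (signs u v) (sym (q^ℤ-+ (U≥0 (u ℤ.+ v)) (W≥0 (u ℤ.+ ℤ.- v)))) ⟩
      1# * q^ℤ (exponent (+ p) (+ (a ℕ.+ b)) (u ℤ.+ v) ℤ.+ exponent (+ p) (+ e) (u ℤ.+ ℤ.- v))
        ≈⟨ *-identityˡ _ ⟩
      q^ℤ (exponent (+ p) (+ (a ℕ.+ b)) (u ℤ.+ v) ℤ.+ exponent (+ p) (+ e) (u ℤ.+ ℤ.- v))
        ≡⟨ ≡.cong q^ℤ (even-exponent u v) ⟩
      q^ℤ (exponent (+ (p ℕ.+ p)) (+ (a ℕ.+ a)) u ℤ.+ exponent (+ (p ℕ.+ p)) (+ (p ℕ.+ (b ℕ.+ b))) v)
        ≈⟨ q^ℤ-+ (χ≥0 a 0 (ℕP.+-identityʳ a) u) (φ≥0 b e ≡.refl v) ⟩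
      plain (p ℕ.+ p) (a ℕ.+ a) u * plain (p ℕ.+ p) (p ℕ.+ (b ℕ.+ b)) v ∎
      where
      index : ∀ u v → ℤ.- (u ℤ.+ v) ℤ.+ (u ℤ.* + 2 ℤ.+ + 0) ≡ u ℤ.+ ℤ.- v
      index = solve-∀
    odd-term : ∀ u v → T (u ℤ.+ v) (u ℤ.* + 2 ℤ.+ + 1) ≈
      (- (q ^ e) * plain (p ℕ.+ p) (p ℕ.+ (a ℕ.+ a)) u) * plain (p ℕ.+ p) (b ℕ.+ b) v
    odd-term u v = begin
      U (u ℤ.+ v) * W (ℤ.- (u ℤ.+ v) ℤ.+ (u ℤ.* + 2 ℤ.+ + 1))
        ≡⟨ ≡.cong (λ t → U (u ℤ.+ v) * W t) (index u v) ⟩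
      U (u ℤ.+ v) * W (+ 1 ℤ.+ (u ℤ.+ ℤ.- v))
        ≈⟨ quadrupleˡ _ _ _ _ ⟩
      (sign (u ℤ.+ v) * sign (+ 1 ℤ.+ (u ℤ.+ ℤ.- v))) * (plain p (a ℕ.+ b) (u ℤ.+ v) * plain p e (+ 1 ℤ.+ (u ℤ.+ ℤ.- v)))
        ≈⟨ *-cong (trans (*-congˡ (sign-suc (u ℤ.+ ℤ.- v))) (trans (sym (-‿distribʳ-* _ _)) (-‿cong (signs u v))))
                  (sym (q^ℤ-+ (U≥0 (u ℤ.+ v)) (W≥0 (+ 1 ℤ.+ (u ℤ.+ ℤ.- v))))) ⟩
      - 1# * q^ℤ (exponent (+ p) (+ (a ℕ.+ b)) (u ℤ.+ v) ℤ.+ exponent (+ p) (+ e) (+ 1 ℤ.+ (u ℤ.+ ℤ.- v)))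
        ≡⟨ ≡.cong (λ t → - 1# * q^ℤ t) (odd-exponent u v) ⟩
      - 1# * q^ℤ (+ e ℤ.+ (exponent (+ (p ℕ.+ p)) (+ (p ℕ.+ (a ℕ.+ a))) u ℤ.+ exponent (+ (p ℕ.+ p)) (+ (b ℕ.+ b)) v))
        ≈⟨ *-congˡ (trans (q^ℤ-+ (ℤ.+≤+ z≤n) (ℤP.+-mono-≤ (φ≥0 a 0 (ℕP.+-identityʳ a) u) (χ≥0 b e ≡.refl v)))
                          (*-congˡ (q^ℤ-+ (φ≥0 a 0 (ℕP.+-identityʳ a) u) (χ≥0 b e ≡.refl v)))) ⟩
      - 1# * (q ^ e * (plain (p ℕ.+ p) (p ℕ.+ (a ℕ.+ a)) u * plain (p ℕ.+ p) (b ℕ.+ b) v))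
        ≈⟨ trans (sym (-‿distribˡ-* _ _)) (trans (-‿cong (*-identityˡ _))
            (solve 3 (λ x y z → :- (x :* (y :* z)) := (:- x :* y) :* z) refl _ _ _)) ⟩
      (- (q ^ e) * plain (p ℕ.+ p) (p ℕ.+ (a ℕ.+ a)) u) * plain (p ℕ.+ p) (b ℕ.+ b) v ∎
      where
      index : ∀ u v → ℤ.- (u ℤ.+ v) ℤ.+ (u ℤ.* + 2 ℤ.+ + 1) ≡ + 1 ℤ.+ (u ℤ.+ ℤ.- v)
      index = solve-∀
    classes : ∀ r → r < 2 → (λ k → proj₁ (column (k ℤ.* + 2 ℤ.+ + r))) ⇓ℤ S r
    classes zero _ = ⇓ℤ-cong
      (λ u → trans (*-comm _ _) (⇓ℤ-unique
        (⇓ℤ-cong (λ v → sym (even-term u v)) refl (⇓ℤ-*ˡ (plain (p ℕ.+ p) (a ℕ.+ a) u) sumφb))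
        (⇓ℤ-shift u (proj₂ (column (u ℤ.* + 2 ℤ.+ + 0))))))
      (*-comm _ _) (⇓ℤ-*ˡ φb sumχa)
    classes (suc zero) _ = ⇓ℤ-cong
      (λ u → ⇓ℤ-unique
        (⇓ℤ-cong (λ v → sym (odd-term u v)) (solve 3 (λ x y z → (:- x :* y) :* z := (:- x :* z) :* y) refl _ _ _)
          (⇓ℤ-*ˡ (- (q ^ e) * plain (p ℕ.+ p) (p ℕ.+ (a ℕ.+ a)) u) sumχb))
        (⇓ℤ-shift u (proj₂ (column (u ℤ.* + 2 ℤ.+ + 1)))))
      (solve 3 (λ x y z → (:- x :* z) :* y := :- x :* (y :* z)) refl _ _ _) (⇓ℤ-*ˡ (- (q ^ e) * χb) sumφa)
    classes (suc (suc r)) (s≤s (s≤s ()))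

module ChebyshevPolynomials {c ℓ} (R : CommutativeRing c ℓ) (x : CommutativeRing.Carrier R) where

  open CommutativeRing R
  open RingTools R
  open Relation.Binary.Reasoning.Setoid setoid

  -- U n (x + 1/x) = (xⁿ - x⁻ⁿ) / (x - x⁻¹).
  U : ℕ → Carrier
  U zero = 0#
  U (suc zero) = 1#
  U (suc (suc n)) = x * U (suc n) - U n

  V : ℕ → Carrier
  V κ = U (suc κ) - U κ

  Vℤ : ℤ → Carrier
  Vℤ (+ κ) = V κ
  Vℤ -[1+ κ ] = V κ

  -- x is a root of the minimal polynomial of 2 cos (2π/7).
  module Period7 (root : x * x * x + x * x - (1# + 1#) * x - 1# ≈ 0#) where

    private
      Root : Polynomial 1 → Polynomial 1
      Root x = x :* x :* x :+ x :* x :- con (+ 2) :* x :- con (+ 1)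
      U₂ U₃ U₄ U₅ U₆ U₇ U₈ : Polynomial 1 → Polynomial 1
      U₂ x = x :* con (+ 1) :- con (+ 0)
      U₃ x = x :* U₂ x :- con (+ 1)
      U₄ x = x :* U₃ x :- U₂ x
      U₅ x = x :* U₄ x :- U₃ x
      U₆ x = x :* U₅ x :- U₄ x
      U₇ x = x :* U₆ x :- U₅ x
      U₈ x = x :* U₇ x :- U₆ x
      modulo : ∀ a {y} → y + a * (x * x * x + x * x - (1# + 1#) * x - 1#) ≈ y
      modulo a = trans (+-congˡ (trans (*-congˡ root) (zeroʳ a))) (+-identityʳ _)

    U7≈0 : U 7 ≈ 0#
    U7≈0 = trans (solve 1 (λ x → U₇ x := con (+ 0) :+ (x :* x :* x :- x :* x :- con (+ 2) :* x :+ con (+ 1)) :* Root x) refl x) (modulo _)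

    U8≈1 : U 8 ≈ 1#
    U8≈1 = trans (solve 1 (λ x → U₈ x := con (+ 1) :+ (x :* x :* x :* x :- x :* x :* x :- con (+ 3) :* (x :* x) :+ con (+ 2) :* x :+ con (+ 1)) :* Root x) refl x) (modulo _)

    V4≈V2 : V 4 ≈ V 2
    V4≈V2 = trans (solve 1 (λ x → U₅ x :- U₄ x := U₃ x :- U₂ x :+ (x :- con (+ 2)) :* Root x) refl x) (modulo _)

    V5≈V1 : V 5 ≈ V 1
    V5≈V1 = trans (solve 1 (λ x → U₆ x :- U₅ x := U₂ x :- con (+ 1) :+ (x :* x :- con (+ 2) :* x) :* Root x) refl x) (modulo _)

    V6≈V0 : V 6 ≈ V 0
    V6≈V0 = trans (solve 1 (λ x → U₇ x :- U₆ x := con (+ 1) :- con (+ 0) :+ (x :* x :* x :- con (+ 2) :* (x :* x) :- x :+ con (+ 2)) :* Root x) refl x) (modulo _)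

    U-period : ∀ n → U (7 ℕ.+ n) ≈ U n
    U-period zero = U7≈0
    U-period (suc zero) = U8≈1
    U-period (suc (suc n)) = +-cong (*-congˡ (U-period (suc n))) (-‿cong (U-period n))

    V-period : ∀ n → V (7 ℕ.+ n) ≈ V n
    V-period n = +-cong (U-period (suc n)) (-‿cong (U-period n))

    Vℤ-period : ∀ n → Vℤ (+ 7 ℤ.+ n) ≈ Vℤ n
    Vℤ-period (+ n) = V-period n
    Vℤ-period -[1+ 0 ] = V6≈V0
    Vℤ-period -[1+ 1 ] = V5≈V1
    Vℤ-period -[1+ 2 ] = V4≈V2
    Vℤ-period -[1+ 3 ] = refl
    Vℤ-period -[1+ 4 ] = sym V4≈V2
    Vℤ-period -[1+ 5 ] = sym V5≈V1
    Vℤ-period -[1+ 6 ] = sym V6≈V0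
    Vℤ-period -[1+ suc (suc (suc (suc (suc (suc (suc n)))))) ] = sym (V-period n)

module Lambert {c ℓ} (A : SeriesAlgebra c ℓ) where

  open SeriesAlgebra A
  open RingTools commutativeRing
  open ZSums filteredRing
  open Monomials A
  open Relation.Binary.Reasoning.Setoid setoid

  module LambertProduct (c : Carrier) (D : ℕ → Carrier) (D-inverse : ∀ m → D m * (1# - c * q ^ m + q ^ m * q ^ m) ≈ 1#) where

    open ChebyshevPolynomials commutativeRing c using (U; V)

    module Telescoping (x D : Carrier) (Dδ : D * (1# - c * x + x * x) ≈ 1#) where
      δ = 1# - c * x + x * x

      ascending : ∀ κ → δ * partial (λ i → U (suc i) * x ^ i) κ ≈ 1# - U (suc κ) * x ^ κ + U κ * x ^ suc κ
      ascending zero = solve 2 (λ d x → d :* con (+ 0) := con (+ 1) :- con (+ 1) :* con (+ 1) :+ con (+ 0) :* (x :* con (+ 1))) refl δ x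
      ascending (suc κ) = begin
        δ * (partial (λ i → U (suc i) * x ^ i) κ + U (suc κ) * x ^ κ)
          ≈⟨ distribˡ _ _ _ ⟩
        δ * partial (λ i → U (suc i) * x ^ i) κ + δ * (U (suc κ) * x ^ κ)
          ≈⟨ +-congʳ (ascending κ) ⟩
        1# - U (suc κ) * x ^ κ + U κ * x ^ suc κ + δ * (U (suc κ) * x ^ κ)
          ≈⟨ solve 5 (λ c x p u u′ → con (+ 1) :- u′ :* p :+ u :* (x :* p) :+ (con (+ 1) :- c :* x :+ x :* x) :* (u′ :* p) :=
               con (+ 1) :- (c :* u′ :- u) :* (x :* p) :+ u′ :* (x :* (x :* p))) refl c x (x ^ κ) (U κ) (U (suc κ)) ⟩
        1# - U (2 ℕ.+ κ) * x ^ suc κ + U (suc κ) * x ^ (2 ℕ.+ κ) ∎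

      descending-sum : ℕ → Carrier
      descending-sum κ = partial (λ i → U (suc i) * x ^ (κ ∸ suc i)) κ

      descending-step : ∀ κ → descending-sum (suc κ) ≈ x * descending-sum κ + U (suc κ)
      descending-step κ = +-cong
        (trans (partial-cong κ (λ i p → trans (*-congˡ (reflexive (≡.cong (x ^_) (ℕP.+-∸-assoc 1 p)))) (solve 3 (λ a b c → a :* (b :* c) := b :* (a :* c)) refl _ _ _)))
               (partial-*ˡ x _ κ))
        (trans (*-congˡ (reflexive (≡.cong (x ^_) (ℕP.n∸n≡0 κ)))) (*-identityʳ _))

      descending : ∀ κ → δ * descending-sum κ ≈ x ^ suc κ - U (suc κ) * x + U κ
      descending zero = solve 2 (λ d x → d :* con (+ 0) := (x :* con (+ 1)) :- con (+ 1) :* x :+ con (+ 0)) refl δ x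
      descending (suc κ) = begin
        δ * descending-sum (suc κ)                     ≈⟨ *-congˡ (descending-step κ) ⟩
        δ * (x * descending-sum κ + U (suc κ))         ≈⟨ solve 4 (λ d x b u → d :* (x :* b :+ u) := x :* (d :* b) :+ d :* u) refl _ _ _ _ ⟩
        x * (δ * descending-sum κ) + δ * U (suc κ)     ≈⟨ +-congʳ (*-congˡ (descending κ)) ⟩
        x * (x ^ suc κ - U (suc κ) * x + U κ) + δ * U (suc κ)
          ≈⟨ solve 5 (λ c x p u u′ → x :* (p :- u′ :* x :+ u) :+ (con (+ 1) :- c :* x :+ x :* x) :* u′ :=
               (x :* p) :- (c :* u′ :- u) :* x :+ u′) refl c x (x ^ suc κ) (U κ) (U (suc κ)) ⟩
        x ^ (2 ℕ.+ κ) - U (2 ℕ.+ κ) * x + U (suc κ) ∎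

      cancel-δ : ∀ s t → δ * s ≈ t → s ≈ t * D
      cancel-δ s t e = begin
        s               ≈⟨ trans (sym (*-identityʳ s)) (*-congˡ (sym Dδ)) ⟩
        s * (D * δ)     ≈⟨ solve 3 (λ s d e → s :* (d :* e) := (e :* s) :* d) refl _ _ _ ⟩
        δ * s * D       ≈⟨ *-congʳ e ⟩
        t * D           ∎

      Z : ℕ → Carrier
      Z κ = partial (λ i → U (suc i) * (x ^ (κ ℕ.+ (κ ∸ suc i)) + x ^ i)) κ

      Z-closed : ∀ κ → (1# + x) * (U (suc κ) - U κ) * x ^ κ * D + Z κ ≈ (1# + x ^ (κ ℕ.+ suc κ)) * D
      Z-closed κ = begin
        (1# + x) * (U (suc κ) - U κ) * x ^ κ * D + Z κ
          ≈⟨ +-congˡ (trans (partial-cong κ (λ i _ → trans (*-congˡ (+-congʳ (^-homo-* x κ _))) (solve 4 (λ u a b d → u :* (a :* b :+ d) := a :* (u :* b) :+ u :* d) refl _ _ _ _)))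
               (trans (partial-+ _ _ κ) (+-congʳ (partial-*ˡ _ _ κ)))) ⟩
        (1# + x) * (U (suc κ) - U κ) * x ^ κ * D + (x ^ κ * descending-sum κ + partial (λ i → U (suc i) * x ^ i) κ)
          ≈⟨ +-congˡ (+-cong (*-congˡ (cancel-δ _ _ (descending κ))) (cancel-δ _ _ (ascending κ))) ⟩
        (1# + x) * (U (suc κ) - U κ) * x ^ κ * D + (x ^ κ * ((x ^ suc κ - U (suc κ) * x + U κ) * D) + (1# - U (suc κ) * x ^ κ + U κ * x ^ suc κ) * D)
          ≈⟨ solve 5 (λ x p u u′ d → (con (+ 1) :+ x) :* (u′ :- u) :* p :* d :+ (p :* ((x :* p :- u′ :* x :+ u) :* d) :+ (con (+ 1) :- u′ :* p :+ u :* (x :* p)) :* d) :=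
               (con (+ 1) :+ p :* (x :* p)) :* d) refl x (x ^ κ) (U κ) (U (suc κ)) D ⟩
        (1# + x ^ κ * x ^ suc κ) * D
          ≈⟨ *-congʳ (+-congˡ (^-homo-* x κ (suc κ))) ⟨
        (1# + x ^ (κ ℕ.+ suc κ)) * D ∎

      -- The case x = 1, where only half of Z occurs.
      ascending-closed : x ≈ 1# → ∀ κ → (U (suc κ) - U κ) * D + partial (λ i → U (suc i)) κ ≈ D
      ascending-closed x≈1 κ = begin
        (U (suc κ) - U κ) * D + partial (λ i → U (suc i)) κ
          ≈⟨ +-congˡ (partial-cong κ (λ i _ → trans (*-congˡ (power-1 i)) (*-identityʳ _))) ⟨
        (U (suc κ) - U κ) * D + partial (λ i → U (suc i) * x ^ i) κ
          ≈⟨ +-congˡ (cancel-δ _ _ (ascending κ)) ⟩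
        (U (suc κ) - U κ) * D + (1# - U (suc κ) * x ^ κ + U κ * x ^ suc κ) * D
          ≈⟨ +-congˡ (*-congʳ (+-cong (+-congˡ (-‿cong (*-congˡ (power-1 κ)))) (*-congˡ (power-1 (suc κ))))) ⟩
        (U (suc κ) - U κ) * D + (1# - U (suc κ) * 1# + U κ * 1#) * D
          ≈⟨ solve 3 (λ u u′ d → (u′ :- u) :* d :+ (con (+ 1) :- u′ :* con (+ 1) :+ u :* con (+ 1)) :* d := d) refl _ _ _ ⟩
        D ∎
        where
        power-1 : ∀ i → x ^ i ≈ 1#
        power-1 zero = refl
        power-1 (suc i) = trans (*-cong x≈1 (power-1 i)) (*-identityˡ _)

    σ : ℕ → Carrier
    σ n = (- 1#) ^ n

    sign-σ : ∀ n → sign (+ n) ≈ σ n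
    sign-σ zero = refl
    sign-σ (suc n) = trans (-‿cong (sign-σ n)) (solve 1 (λ x → :- x := :- con (+ 1) :* x) refl _)

    sign⁻ : ∀ n → sign -[1+ n ] ≈ - sign (+ n)
    sign⁻ zero = refl
    sign⁻ (suc n) = -‿cong (sign⁻ n)

    penta : ℕ → ℕ
    penta κ = 3 ℕ.* triangle κ ℕ.+ 2 ℕ.* κ

    depth : ℕ → ℕ → ℕ
    depth κ m = κ ℕ.* κ ℕ.+ κ ℕ.+ ℤ.∣ tri (+ suc m ℤ.+ ℤ.- + κ) ∣

    -- The exponent of q^{penta κ + m(m+1)/2} after splitting off (q^m)^κ is a sum of a square and a triangular number.
    depth-split : ∀ κ m → depth κ m ℕ.+ m ℕ.* κ ≡ triangle (suc m) ℕ.+ penta κ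
    depth-split κ m = ℤP.+-injective (modulo-tri (ℤ.- + 1) (+ κ) (begin′))
      where
      lemma : ∀ k m t s → k ℤ.* k ℤ.+ k ℤ.+ (s ℤ.+ (t ℤ.+ k) ℤ.+ (+ 1 ℤ.+ m) ℤ.* ℤ.- k) ℤ.+ m ℤ.* k ≡
        s ℤ.+ (+ 3 ℤ.* t ℤ.+ + 2 ℤ.* k) ℤ.+ ℤ.- + 1 ℤ.* (t ℤ.+ t ℤ.- (k ℤ.* k ℤ.- k))
      lemma = solve-∀
      begin′ : + (depth κ m ℕ.+ m ℕ.* κ) ≡ + (triangle (suc m) ℕ.+ penta κ) ℤ.+ ℤ.- + 1 ℤ.* (tri (+ κ) ℤ.+ tri (+ κ) ℤ.- (+ κ ℤ.* + κ ℤ.- + κ))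
      begin′ = ≡.trans
        (≡.cong₂ ℤ._+_ (≡.cong₂ ℤ._+_ (≡.cong (ℤ._+ + κ) (ℤP.pos-* κ κ))
          (≡.trans (tri-abs (+ suc m ℤ.+ ℤ.- + κ)) (≡.trans (tri-+ (+ suc m) (ℤ.- + κ)) (≡.cong (λ t → tri (+ suc m) ℤ.+ t ℤ.+ (+ suc m) ℤ.* ℤ.- + κ) (tri-neg (+ κ))))))
          (ℤP.pos-* m κ))
        (≡.trans (lemma (+ κ) (+ m) (tri (+ κ)) (tri (+ suc m)))
          (≡.cong (λ t → + triangle (suc m) ℤ.+ t ℤ.+ ℤ.- + 1 ℤ.* (tri (+ κ) ℤ.+ tri (+ κ) ℤ.- (+ κ ℤ.* + κ ℤ.- + κ)))
            (≡.sym (≡.cong₂ ℤ._+_ (ℤP.pos-* 3 (triangle κ)) (ℤP.pos-* 2 κ)))))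

    m≤κ+tri : ∀ κ m → m ≤ κ ℕ.+ ℤ.∣ tri (+ suc m ℤ.+ ℤ.- + κ) ∣
    m≤κ+tri κ m with κ ℕ.≤? m
    ... | no κ≰m = ℕP.≤-trans (ℕP.<⇒≤ (ℕP.≰⇒> κ≰m)) (ℕP.m≤m+n κ _)
    ... | yes κ≤m = ≡.subst (λ i → m ≤ κ ℕ.+ ℤ.∣ tri i ∣) (≡.sym index)
      (ℕP.≤-trans (ℕP.≤-reflexive (≡.sym (ℕP.m+[n∸m]≡n κ≤m))) (ℕP.+-monoʳ-≤ κ (k≤triangle[1+k] (m ∸ κ))))
      where
      lemma : ∀ k d → + 1 ℤ.+ (k ℤ.+ d) ℤ.+ ℤ.- k ≡ + 1 ℤ.+ d
      lemma = solve-∀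
      index : + suc m ℤ.+ ℤ.- + κ ≡ + suc (m ∸ κ)
      index = ≡.trans (≡.cong (λ n → + suc n ℤ.+ ℤ.- + κ) (≡.sym (ℕP.m+[n∸m]≡n κ≤m))) (lemma (+ κ) (+ (m ∸ κ)))

    depth≥κ : ∀ κ m → κ ≤ depth κ m
    depth≥κ κ m = ℕP.≤-trans (ℕP.m≤n+m κ (κ ℕ.* κ)) (ℕP.m≤m+n _ _)

    depth≥m : ∀ κ m → m ≤ depth κ m
    depth≥m κ m = ℕP.≤-trans (m≤κ+tri κ m) (ℕP.+-monoˡ-≤ _ (ℕP.m≤n+m κ (κ ℕ.* κ)))

    balanced : ℕ → ℕ → ℤ → Carrier
    balanced κ j n = sign n * q^ℤ (+ penta κ ℤ.+ tri n ℤ.+ n ℤ.* + j)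

    balanced-exponent⁺ : ∀ κ j′ m → + penta κ ℤ.+ tri (+ m) ℤ.+ + m ℤ.* + suc j′ ≡ + (depth κ m ℕ.+ m ℕ.* (κ ℕ.+ j′))
    balanced-exponent⁺ κ j′ m = ≡.trans (lemma (+ penta κ) (tri (+ m)) (+ m) (+ j′) (+ κ))
      (≡.trans (≡.cong (ℤ._+ + m ℤ.* + j′) (≡.trans (≡.cong +_ (ℕP.+-comm (penta κ) (triangle (suc m)))) (≡.cong +_ (≡.sym (depth-split κ m)))))
        (≡.trans (≡.cong (λ t → + (depth κ m ℕ.+ m ℕ.* κ) ℤ.+ t) (≡.sym (ℤP.pos-* m j′))) (≡.cong +_ (≡.trans (ℕP.+-assoc (depth κ m) _ _) (≡.cong (depth κ m ℕ.+_) (≡.sym (ℕP.*-distribˡ-+ m κ j′)))))))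
      where
      lemma : ∀ p t m j k → p ℤ.+ t ℤ.+ m ℤ.* (+ 1 ℤ.+ j) ≡ p ℤ.+ (t ℤ.+ m) ℤ.+ m ℤ.* j
      lemma = solve-∀

    balanced-exponent⁻ : ∀ κ j i m → i ℕ.+ j ≡ κ → + penta κ ℤ.+ tri -[1+ m ] ℤ.+ -[1+ m ] ℤ.* + j ≡ + (depth κ (suc m) ℕ.+ suc m ℕ.* i)
    balanced-exponent⁻ κ j i m ≡.refl = ≡.trans (≡.cong (λ t → t ℤ.+ -[1+ m ] ℤ.* + j) (≡.trans (≡.cong +_ (ℕP.+-comm (penta κ) (triangle (2 ℕ.+ m)))) (≡.cong +_ (≡.sym (depth-split κ (suc m))))))
      (≡.trans (≡.cong (λ t → + depth κ (suc m) ℤ.+ t ℤ.+ -[1+ m ] ℤ.* + j) (ℤP.pos-* (suc m) κ))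
        (≡.trans (lemma (+ depth κ (suc m)) (+ suc m) (+ i) (+ j)) (≡.cong (λ t → + depth κ (suc m) ℤ.+ t) (≡.sym (ℤP.pos-* (suc m) i)))))
      where
      lemma : ∀ d m i j → d ℤ.+ m ℤ.* (i ℤ.+ j) ℤ.+ ℤ.- m ℤ.* j ≡ d ℤ.+ m ℤ.* i
      lemma = solve-∀

    balanced-null : ∀ κ j′ i → i ℕ.+ suc j′ ≡ κ → Null (balanced κ (suc j′))
    balanced-null κ j′ i e N = let (B , h) = powers-null N in B , λ n p →
      ≈[]-trans (*-cong[] (≈⇒≈[] refl) (h n p)) (≈⇒≈[] (zeroʳ _))
      where
      powers-null : Null (λ n → q^ℤ (+ penta κ ℤ.+ tri n ℤ.+ n ℤ.* + suc j′))
      powers-null = q^ℤ-null (λ n → + penta κ ℤ.+ tri n ℤ.+ n ℤ.* + suc j′) λ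
        { (+ m) → ≡.subst (λ t → + m ℤ.≤ t ℤ.+ + 1) (≡.sym (balanced-exponent⁺ κ j′ m)) (ℤ.+≤+ (ℕP.≤-trans (ℕP.≤-trans (depth≥m κ m) (ℕP.m≤m+n _ _)) (ℕP.m≤m+n _ 1)))
        ; -[1+ m ] → ≡.subst (λ t → + m ℤ.≤ t ℤ.+ + 1) (≡.sym (balanced-exponent⁻ κ (suc j′) i m e))
            (ℤ.+≤+ (ℕP.≤-trans (ℕP.n≤1+n m) (ℕP.≤-trans (ℕP.≤-trans (depth≥m κ (suc m)) (ℕP.m≤m+n _ _)) (ℕP.m≤m+n _ 1)))) }

    -- The reflection n ↦ 1 - 2j - n preserves the exponent and reverses the sign.
    balanced-zero : ∀ κ j′ i → i ℕ.+ suc j′ ≡ κ → balanced κ (suc j′) ⇓ℤ 0#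
    balanced-zero κ j′ i e = ⇓ℤ-cong (λ _ → refl) (⇓ℤ-antisymmetric ½ half s reversed (proj₂ total)) (proj₂ total)
      where
      j = + suc j′
      s = + 1 ℤ.+ ℤ.- (j ℤ.+ j)
      total = completeℤ (balanced-null κ j′ i e)
      tri-s : tri s ≡ tri j ℤ.+ tri j ℤ.+ j ℤ.* j
      tri-s = ≡.trans (tri-suc (ℤ.- (j ℤ.+ j))) (≡.trans (≡.cong (ℤ._+ ℤ.- (j ℤ.+ j)) (≡.trans (tri-neg (j ℤ.+ j)) (≡.cong (ℤ._+ (j ℤ.+ j)) (tri-+ j j)))) (lemma (tri j ℤ.+ tri j ℤ.+ j ℤ.* j) (j ℤ.+ j)))
        where
        lemma : ∀ x y → x ℤ.+ y ℤ.+ ℤ.- y ≡ x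
        lemma = solve-∀
      exponents : ∀ n → + penta κ ℤ.+ tri (s ℤ.+ ℤ.- n) ℤ.+ (s ℤ.+ ℤ.- n) ℤ.* j ≡ + penta κ ℤ.+ tri n ℤ.+ n ℤ.* j
      exponents n = modulo-tri (+ 1) j (≡.trans
        (≡.cong (λ t → + penta κ ℤ.+ t ℤ.+ (s ℤ.+ ℤ.- n) ℤ.* j) (≡.trans (tri-+ s (ℤ.- n)) (≡.cong₂ (λ t t′ → t ℤ.+ t′ ℤ.+ s ℤ.* ℤ.- n) tri-s (tri-neg n))))
        (lemma (+ penta κ) (tri j) (tri n) j n))
        where
        lemma : ∀ p t u j n → p ℤ.+ ((t ℤ.+ t ℤ.+ j ℤ.* j) ℤ.+ (u ℤ.+ n) ℤ.+ (+ 1 ℤ.+ ℤ.- (j ℤ.+ j)) ℤ.* ℤ.- n) ℤ.+ (+ 1 ℤ.+ ℤ.- (j ℤ.+ j) ℤ.+ ℤ.- n) ℤ.* j ≡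
          p ℤ.+ u ℤ.+ n ℤ.* j ℤ.+ + 1 ℤ.* (t ℤ.+ t ℤ.- (j ℤ.* j ℤ.- j))
        lemma = solve-∀
      signs : ∀ n → sign (s ℤ.+ ℤ.- n) ≈ - sign n
      signs n = begin
        sign (s ℤ.+ ℤ.- n)                     ≈⟨ sign-+ s (ℤ.- n) ⟩
        sign s * sign (ℤ.- n)                  ≈⟨ *-cong (trans (sign-suc (ℤ.- (j ℤ.+ j))) (-‿cong (trans (sign-neg (j ℤ.+ j)) (trans (sign-+ j j) (sign-square j))))) (sign-neg n) ⟩
        - 1# * sign n                          ≈⟨ solve 1 (λ x → :- con (+ 1) :* x := :- x) refl _ ⟩
        - sign n                               ∎
      reversed : ∀ n → balanced κ (suc j′) (s ℤ.- n) ≈ - balanced κ (suc j′) n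
      reversed n = trans (*-cong (signs n) (reflexive (≡.cong q^ℤ (exponents n)))) (solve 2 (λ x y → :- x :* y := :- (x :* y)) refl _ _)

    v z : ℕ → Carrier
    v zero = 1#
    v (suc m) = σ (suc m) * (q ^ triangle (2 ℕ.+ m) * (1# + q ^ suc m))
    z κ = sign (+ κ) * (1# - q ^ suc (κ ℕ.+ κ))

    pentagonal : ℤ → Carrier
    pentagonal = theta-term 3 2

    pentagonal⁺ : ∀ κ → exponent (+ 3) (+ 2) (+ κ) ≡ + penta κ
    pentagonal⁺ κ = exponent⁺ 3 2 κ

    pentagonal⁻ : ∀ κ → exponent (+ 3) (+ 2) -[1+ κ ] ≡ + (penta κ ℕ.+ suc (κ ℕ.+ κ))
    pentagonal⁻ κ = ≡.trans (exponent⁻ 2 1 κ) (≡.cong +_ (lemma (triangle κ) κ))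
      where
      lemma : ∀ t k → 3 ℕ.* (t ℕ.+ k) ℕ.+ 1 ℕ.* suc k ≡ 3 ℕ.* t ℕ.+ 2 ℕ.* k ℕ.+ suc (k ℕ.+ k)
      lemma = ℕ-solve-∀

    pentagonal-pair : ∀ κ → pair pentagonal κ ≈ z κ * q ^ penta κ
    pentagonal-pair κ = begin
      sign (+ κ) * q^ℤ (exponent (+ 3) (+ 2) (+ κ)) + sign -[1+ κ ] * q^ℤ (exponent (+ 3) (+ 2) -[1+ κ ])
        ≈⟨ +-cong (*-congˡ (reflexive (≡.cong q^ℤ (pentagonal⁺ κ))))
             (*-cong (sign⁻ κ) (trans (reflexive (≡.cong q^ℤ (pentagonal⁻ κ))) (^-homo-* q (penta κ) (suc (κ ℕ.+ κ))))) ⟩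
      sign (+ κ) * q ^ penta κ + - sign (+ κ) * (q ^ penta κ * q ^ suc (κ ℕ.+ κ))
        ≈⟨ solve 3 (λ s p r → s :* p :+ :- s :* (p :* r) := s :* (con (+ 1) :- r) :* p) refl _ _ _ ⟩
      z κ * q ^ penta κ ∎

    g : ℕ → ℕ → Carrier
    g κ zero = 1#
    g κ (suc m) = σ (suc m) * (1# + (q ^ suc m) ^ (κ ℕ.+ suc κ))

    P T W : ℕ → ℕ → Carrier
    P κ m = q ^ depth κ m * (z κ * g κ m * D m)
    T κ m = (pair pentagonal κ * V κ) * (v m * D m)
    W κ m = z κ * partial (λ i → U (suc i) * fold (balanced κ (suc (κ ∸ suc i))) m) κ

    P-null : JointlyNull P
    P-null N = suc N , λ κ m → λ
      { (inj₁ p) → vanish κ m (ℕP.≤-trans p (depth≥κ κ m))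
      ; (inj₂ p) → vanish κ m (ℕP.≤-trans p (depth≥m κ m)) }
      where
      vanish : ∀ κ m → N < depth κ m → P κ m ≈[ N ] 0#
      vanish κ m p = ≈[]-trans (*-cong[] (q-null N _ p) (≈⇒≈[] refl)) (≈⇒≈[] (zeroˡ _))

    module _ (m : ℕ) where
      open Telescoping (q ^ m) (D m) (D-inverse m) public

    complement : ∀ {i κ} → i < κ → i ℕ.+ suc (κ ∸ suc i) ≡ κ
    complement {i} p = ≡.trans (ℕP.+-suc i _) (ℕP.m+[n∸m]≡n p)

    T+W≈P : ∀ κ m → T κ m + W κ m ≈ P κ m
    T+W≈P κ zero = begin
      pair pentagonal κ * V κ * (1# * D 0) + z κ * partial (λ i → U (suc i) * fold (balanced κ (suc (κ ∸ suc i))) 0) κ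
        ≈⟨ +-cong (*-congʳ (*-congʳ (pentagonal-pair κ))) (*-congˡ (trans (partial-cong κ (λ i _ →
             trans (*-congˡ (at-zero (κ ∸ suc i))) (*-comm _ _))) (partial-*ˡ _ _ κ))) ⟩
      z κ * Q * V κ * (1# * D 0) + z κ * (Q * partial (λ i → U (suc i)) κ)
        ≈⟨ solve 5 (λ z p e d u → z :* p :* e :* (con (+ 1) :* d) :+ z :* (p :* u) := p :* (z :* con (+ 1) :* (e :* d :+ u))) refl _ _ _ _ _ ⟩
      Q * (z κ * 1# * (V κ * D 0 + partial (λ i → U (suc i)) κ))
        ≈⟨ *-cong (reflexive (≡.cong (q ^_) (≡.trans (≡.sym (depth-split κ 0)) (ℕP.+-identityʳ _)))) (*-congˡ (ascending-closed 0 refl κ)) ⟩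
      P κ 0 ∎
      where
      Q = q ^ penta κ
      at-zero : ∀ j → balanced κ (suc j) (+ 0) ≈ Q
      at-zero j = trans (*-identityˡ _) (reflexive (≡.cong q^ℤ (lemma (+ penta κ) (+ suc j))))
        where
        lemma : ∀ p j → p ℤ.+ + 0 ℤ.+ + 0 ℤ.* j ≡ p
        lemma = solve-∀
    T+W≈P κ (suc m′) = begin
      pair pentagonal κ * V κ * (v m * D m) + z κ * partial (λ i → U (suc i) * fold (balanced κ (suc (κ ∸ suc i))) m) κ
        ≈⟨ +-cong (*-congʳ (*-congʳ (pentagonal-pair κ))) (*-congˡ (trans (partial-cong κ (λ i p →
             trans (*-congˡ (balanced-fold i p)) (solve 3 (λ u a b → u :* (a :* b) := a :* (u :* b)) refl _ _ _))) (partial-*ˡ _ _ κ))) ⟩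
      z κ * q ^ penta κ * V κ * (σ m * (q ^ triangle (suc m) * (1# + x)) * D m) + z κ * (σ m * d * Z m κ)
        ≈⟨ +-congʳ (solve 7 (λ z p e s t x d → z :* p :* e :* (s :* (t :* x) :* d) := z :* e :* s :* x :* d :* (t :* p)) refl _ _ _ _ _ _ _) ⟩
      z κ * V κ * σ m * (1# + x) * D m * (q ^ triangle (suc m) * q ^ penta κ) + z κ * (σ m * d * Z m κ)
        ≈⟨ +-congʳ (*-congˡ split) ⟩
      z κ * V κ * σ m * (1# + x) * D m * (d * x ^ κ) + z κ * (σ m * d * Z m κ)
        ≈⟨ solve 8 (λ z e s x d p y w → z :* e :* s :* x :* d :* (p :* y) :+ z :* (s :* p :* w) := p :* (z :* s :* (x :* e :* y :* d :+ w))) refl _ _ _ _ _ _ _ _ ⟩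
      d * (z κ * σ m * ((1# + x) * V κ * x ^ κ * D m + Z m κ))
        ≈⟨ *-congˡ (*-congˡ (Z-closed m κ)) ⟩
      d * (z κ * σ m * ((1# + x ^ (κ ℕ.+ suc κ)) * D m))
        ≈⟨ solve 5 (λ d z s a b → d :* (z :* s :* (a :* b)) := d :* (z :* (s :* a) :* b)) refl _ _ _ _ _ ⟩
      P κ m ∎
      where
      m = suc m′
      x = q ^ m
      d = q ^ depth κ m
      split : q ^ triangle (suc m) * q ^ penta κ ≈ d * x ^ κ
      split = begin
        q ^ triangle (suc m) * q ^ penta κ       ≈⟨ ^-homo-* q (triangle (suc m)) (penta κ) ⟨
        q ^ (triangle (suc m) ℕ.+ penta κ)       ≡⟨ ≡.cong (q ^_) (≡.sym (depth-split κ m)) ⟩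
        q ^ (depth κ m ℕ.+ m ℕ.* κ)              ≈⟨ ^-homo-* q (depth κ m) (m ℕ.* κ) ⟩
        d * q ^ (m ℕ.* κ)                        ≈⟨ *-congˡ (^-assocʳ q m κ) ⟨
        d * x ^ κ                                ∎
      power : ∀ k → q ^ (depth κ m ℕ.+ m ℕ.* k) ≈ d * x ^ k
      power k = trans (^-homo-* q (depth κ m) (m ℕ.* k)) (*-congˡ (sym (^-assocʳ q m k)))
      balanced-fold : ∀ i → i < κ → fold (balanced κ (suc (κ ∸ suc i))) m ≈ σ m * d * (x ^ (κ ℕ.+ (κ ∸ suc i)) + x ^ i)
      balanced-fold i p = begin
        sign (+ m) * q^ℤ (+ penta κ ℤ.+ tri (+ m) ℤ.+ + m ℤ.* + suc j) + sign -[1+ m′ ] * q^ℤ (+ penta κ ℤ.+ tri -[1+ m′ ] ℤ.+ -[1+ m′ ] ℤ.* + suc j)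
          ≈⟨ +-cong (*-cong (sign-σ m) (trans (reflexive (≡.cong q^ℤ (balanced-exponent⁺ κ j m))) (power (κ ℕ.+ j))))
               (*-cong (trans (sign⁻ m′) (sign-σ m)) (trans (reflexive (≡.cong q^ℤ (balanced-exponent⁻ κ (suc j) i m′ (complement p)))) (power i))) ⟩
        σ m * (d * x ^ (κ ℕ.+ j)) + σ m * (d * x ^ i)
          ≈⟨ solve 4 (λ s d a b → s :* (d :* a) :+ s :* (d :* b) := s :* d :* (a :+ b)) refl _ _ _ _ ⟩
        σ m * d * (x ^ (κ ℕ.+ j) + x ^ i) ∎
        where
        j = κ ∸ suc i

    W-row : ∀ κ → W κ ⇓ 0#
    W-row κ = ⇓-cong (λ _ → refl) (zeroʳ _) (⇓-*ˡ (z κ) (rows κ ℕP.≤-refl))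
      where
      rows : ∀ K → K ≤ κ → (λ m → partial (λ i → U (suc i) * fold (balanced κ (suc (κ ∸ suc i))) m) K) ⇓ 0#
      rows zero p = ⇓-0
      rows (suc K) p = ⇓-cong (λ _ → refl) (trans (+-congˡ (zeroʳ _)) (+-identityʳ _))
        (⇓-+ (rows K (ℕP.<⇒≤ p)) (⇓-*ˡ (U (suc K)) (⇓ℤ-fold (balanced-zero κ (κ ∸ suc K) K (complement p)))))

    cubic : ℕ → ℕ → ℕ → ℕ
    cubic a b p = 3 ℕ.* p ℕ.* p ℕ.+ a ℕ.* p ℕ.+ b

    cubic-pos : ∀ a b p → + cubic a b p ≡ + 3 ℤ.* + p ℤ.* + p ℤ.+ + a ℤ.* + p ℤ.+ + b
    cubic-pos a b p = ≡.cong (ℤ._+ + b) (≡.cong₂ ℤ._+_ (≡.trans (ℤP.pos-* (3 ℕ.* p) p) (≡.cong (ℤ._* + p) (ℤP.pos-* 3 p))) (ℤP.pos-* a p))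

    module Columns {E : Carrier} (E-sum : theta-term 3 2 ⇓ℤ E) where

      theta-3-1 : theta-term 3 1 ⇓ℤ E
      theta-3-1 = ⇓ℤ-substitute⁻ (+ 0) (λ n → *-cong (trans (reflexive (≡.cong sign (ℤP.+-identityˡ (ℤ.- n)))) (sign-neg n)) (reflexive (≡.cong q^ℤ (exponents n)))) E-sum
        where
        lemma : ∀ t n → + 3 ℤ.* (t ℤ.+ n) ℤ.+ + 1 ℤ.* (+ 0 ℤ.+ ℤ.- n) ≡ + 3 ℤ.* t ℤ.+ + 2 ℤ.* n
        lemma = solve-∀
        exponents : ∀ n → exponent (+ 3) (+ 1) (+ 0 ℤ.- n) ≡ exponent (+ 3) (+ 2) n
        exponents n = ≡.trans (≡.cong (λ t → + 3 ℤ.* t ℤ.+ + 1 ℤ.* (+ 0 ℤ.+ ℤ.- n)) (≡.trans (≡.cong tri (ℤP.+-identityˡ (ℤ.- n))) (tri-neg n))) (lemma (tri n) n)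

      theta-3-0 : theta-term 3 0 ⇓ℤ 0#
      theta-3-0 = ⇓ℤ-cong (λ _ → refl) (⇓ℤ-antisymmetric ½ half (+ 1) reversed (proj₂ total)) (proj₂ total)
        where
        theta-null : Null (theta-term 3 0)
        theta-null N = let (B , h) = plain-null 0 3 (s≤s z≤n) N in B , λ n p → ≈[]-trans (*-cong[] (≈⇒≈[] refl) (h n p)) (≈⇒≈[] (zeroʳ _))
        total = completeℤ theta-null
        reversed : ∀ n → theta-term 3 0 (+ 1 ℤ.- n) ≈ - theta-term 3 0 n
        reversed n = trans
          (*-cong (trans (sign-suc (ℤ.- n)) (-‿cong (sign-neg n)))
            (reflexive (≡.cong q^ℤ (≡.cong₂ ℤ._+_ (≡.cong (+ 3 ℤ.*_) (≡.trans (tri-suc (ℤ.- n)) (≡.trans (≡.cong (ℤ._+ ℤ.- n) (tri-neg n)) (lemma (tri n) n)))) ≡.refl))))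
          (solve 2 (λ x y → :- x :* y := :- (x :* y)) refl _ _)
          where
          lemma : ∀ t n → t ℤ.+ n ℤ.+ ℤ.- n ≡ t
          lemma = solve-∀

      shifted : ∀ {S} a a′ → a ℕ.+ a′ ≡ 3 → theta-term 3 a ⇓ℤ S → ∀ s K (f : ℤ → ℤ) →
        (∀ n → f (s ℤ.+ n) ≡ + K ℤ.+ exponent (+ 3) (+ a) n) → (λ n → sign n * q^ℤ (f n)) ⇓ℤ sign s * q ^ K * S
      shifted a a′ eq p s K f h = ⇓ℤ-substitute s (λ n → begin
          sign (s ℤ.+ n) * q^ℤ (f (s ℤ.+ n))                                  ≈⟨ *-cong (sign-+ s n) (reflexive (≡.cong q^ℤ (h n))) ⟩
          sign s * sign n * q^ℤ (+ K ℤ.+ exponent (+ 3) (+ a) n)              ≈⟨ *-congˡ (q^ℤ-+ (ℤ.+≤+ z≤n) (≡.subst (λ P → + 0 ℤ.≤ exponent (+ P) (+ a) n) eq (exponent≥0 a a′ n))) ⟩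
          sign s * sign n * (q ^ K * plain 3 a n)                             ≈⟨ solve 4 (λ s t k x → s :* t :* (k :* x) := s :* k :* (t :* x)) refl _ _ _ _ ⟩
          sign s * q ^ K * theta-term 3 a n                                   ∎) (⇓ℤ-*ˡ (sign s * q ^ K) p)

      lower upper : ℕ → ℤ → ℤ
      lower m n = exponent (+ 3) (+ 2) n ℤ.+ + triangle (suc m) ℤ.- + m ℤ.* n
      upper m n = exponent (+ 3) (+ 2) n ℤ.+ + triangle (suc m) ℤ.+ + m ℤ.* (+ 1 ℤ.+ n)

      column-pairs : ∀ m κ → P κ (suc m) ≈
        (pair (λ n → sign n * q^ℤ (lower (suc m) n)) κ + pair (λ n → sign n * q^ℤ (upper (suc m) n)) κ) * (σ (suc m) * D (suc m))
      column-pairs m′ κ = begin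
        d * (sign (+ κ) * (1# - r) * (σ m * (1# + x ^ (κ ℕ.+ suc κ))) * D m)
          ≈⟨ solve 6 (λ d s r σ w D → d :* (s :* (con (+ 1) :- r) :* (σ :* (con (+ 1) :+ w)) :* D) :=
               (s :* d :+ :- s :* (d :* w :* r) :+ (s :* (d :* w) :+ :- s :* (d :* r))) :* (σ :* D)) refl d (sign (+ κ)) r (σ m) (x ^ (κ ℕ.+ suc κ)) (D m) ⟩
        (sign (+ κ) * d + - sign (+ κ) * (d * x ^ (κ ℕ.+ suc κ) * r) + (sign (+ κ) * (d * x ^ (κ ℕ.+ suc κ)) + - sign (+ κ) * (d * r))) * (σ m * D m)
          ≈⟨ *-congʳ (+-cong
               (+-cong (*-congˡ (reflexive (≡.cong q^ℤ (≡.sym lower⁺))))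
                       (*-cong (sym (sign⁻ κ)) (trans (*-congʳ (power (κ ℕ.+ suc κ))) (trans (sym (^-homo-* q (depth κ m ℕ.+ m ℕ.* (κ ℕ.+ suc κ)) _)) (reflexive (≡.cong q^ℤ (≡.sym lower⁻)))))))
               (+-cong (*-congˡ (trans (power (κ ℕ.+ suc κ)) (reflexive (≡.cong q^ℤ (≡.sym upper⁺)))))
                       (*-cong (sym (sign⁻ κ)) (trans (sym (^-homo-* q (depth κ m) _)) (reflexive (≡.cong q^ℤ (≡.sym upper⁻))))))) ⟩
        (pair (λ n → sign n * q^ℤ (lower m n)) κ + pair (λ n → sign n * q^ℤ (upper m n)) κ) * (σ m * D m) ∎
        where
        m = suc m′
        x = q ^ m
        d = q ^ depth κ m
        r = q ^ suc (κ ℕ.+ κ)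
        power : ∀ k → d * x ^ k ≈ q ^ (depth κ m ℕ.+ m ℕ.* k)
        power k = trans (*-congˡ (^-assocʳ q m k)) (sym (^-homo-* q (depth κ m) (m ℕ.* k)))
        split : + penta κ ℤ.+ + triangle (suc m) ≡ + depth κ m ℤ.+ + m ℤ.* + κ
        split = ≡.trans (≡.cong +_ (≡.trans (ℕP.+-comm (penta κ) _) (≡.sym (depth-split κ m)))) (≡.cong (λ t → + depth κ m ℤ.+ t) (ℤP.pos-* m κ))
        lower⁺ : lower m (+ κ) ≡ + depth κ m
        lower⁺ = ≡.trans (≡.cong (λ t → t ℤ.+ + triangle (suc m) ℤ.- + m ℤ.* + κ) (pentagonal⁺ κ)) (≡.trans (≡.cong (ℤ._- + m ℤ.* + κ) split) (lemma (+ depth κ m) (+ m ℤ.* + κ)))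
          where
          lemma : ∀ d x → d ℤ.+ x ℤ.- x ≡ d
          lemma = solve-∀
        lower⁻ : lower m -[1+ κ ] ≡ + (depth κ m ℕ.+ m ℕ.* (κ ℕ.+ suc κ) ℕ.+ suc (κ ℕ.+ κ))
        lower⁻ = ≡.trans (≡.cong (λ t → t ℤ.+ + triangle (suc m) ℤ.- + m ℤ.* -[1+ κ ]) (pentagonal⁻ κ))
          (≡.trans (lemma (+ penta κ) (+ triangle (suc m)) (+ m) (+ κ)) (≡.trans (≡.cong (λ t → t ℤ.+ + m ℤ.* (+ 1 ℤ.+ + κ) ℤ.+ (+ 1 ℤ.+ (+ κ ℤ.+ + κ))) split)
            (≡.trans (lemma′ (+ depth κ m) (+ m) (+ κ)) (≡.cong (λ t → + depth κ m ℤ.+ t ℤ.+ (+ 1 ℤ.+ (+ κ ℤ.+ + κ))) (≡.sym (ℤP.pos-* m (κ ℕ.+ suc κ)))))))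
          where
          lemma : ∀ p t m k → p ℤ.+ (+ 1 ℤ.+ (k ℤ.+ k)) ℤ.+ t ℤ.- m ℤ.* (ℤ.- (+ 1 ℤ.+ k)) ≡ p ℤ.+ t ℤ.+ m ℤ.* (+ 1 ℤ.+ k) ℤ.+ (+ 1 ℤ.+ (k ℤ.+ k))
          lemma = solve-∀
          lemma′ : ∀ d m k → d ℤ.+ m ℤ.* k ℤ.+ m ℤ.* (+ 1 ℤ.+ k) ℤ.+ (+ 1 ℤ.+ (k ℤ.+ k)) ≡ d ℤ.+ m ℤ.* (k ℤ.+ (+ 1 ℤ.+ k)) ℤ.+ (+ 1 ℤ.+ (k ℤ.+ k))
          lemma′ = solve-∀
        upper⁺ : upper m (+ κ) ≡ + (depth κ m ℕ.+ m ℕ.* (κ ℕ.+ suc κ))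
        upper⁺ = ≡.trans (≡.cong (λ t → t ℤ.+ + triangle (suc m) ℤ.+ + m ℤ.* (+ 1 ℤ.+ + κ)) (pentagonal⁺ κ))
          (≡.trans (≡.cong (ℤ._+ + m ℤ.* (+ 1 ℤ.+ + κ)) split) (≡.trans (lemma (+ depth κ m) (+ m) (+ κ)) (≡.cong (λ t → + depth κ m ℤ.+ t) (≡.sym (ℤP.pos-* m (κ ℕ.+ suc κ))))))
          where
          lemma : ∀ d m k → d ℤ.+ m ℤ.* k ℤ.+ m ℤ.* (+ 1 ℤ.+ k) ≡ d ℤ.+ m ℤ.* (k ℤ.+ (+ 1 ℤ.+ k))
          lemma = solve-∀
        upper⁻ : upper m -[1+ κ ] ≡ + (depth κ m ℕ.+ suc (κ ℕ.+ κ))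
        upper⁻ = ≡.trans (≡.cong (λ t → t ℤ.+ + triangle (suc m) ℤ.+ + m ℤ.* (+ 1 ℤ.+ -[1+ κ ])) (pentagonal⁻ κ))
          (≡.trans (lemma (+ penta κ) (+ triangle (suc m)) (+ m) (+ κ)) (≡.trans (≡.cong (λ t → t ℤ.- + m ℤ.* + κ ℤ.+ (+ 1 ℤ.+ (+ κ ℤ.+ + κ))) split)
            (lemma′ (+ depth κ m) (+ m) (+ κ))))
          where
          lemma : ∀ p t m k → p ℤ.+ (+ 1 ℤ.+ (k ℤ.+ k)) ℤ.+ t ℤ.+ m ℤ.* (+ 1 ℤ.+ ℤ.- (+ 1 ℤ.+ k)) ≡ p ℤ.+ t ℤ.- m ℤ.* k ℤ.+ (+ 1 ℤ.+ (k ℤ.+ k))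
          lemma = solve-∀
          lemma′ : ∀ d m k → d ℤ.+ m ℤ.* k ℤ.- m ℤ.* k ℤ.+ (+ 1 ℤ.+ (k ℤ.+ k)) ≡ d ℤ.+ (+ 1 ℤ.+ (k ℤ.+ k))
          lemma′ = solve-∀

      column-0 : (λ κ → P κ 0) ⇓ E * D 0
      column-0 = ⇓-cong (λ κ → begin
          D 0 * pair pentagonal κ               ≈⟨ *-congˡ (pentagonal-pair κ) ⟩
          D 0 * (z κ * q ^ penta κ)             ≈⟨ solve 3 (λ d z p → d :* (z :* p) := p :* (z :* con (+ 1) :* d)) refl _ _ _ ⟩
          q ^ penta κ * (z κ * 1# * D 0)        ≈⟨ *-congʳ (reflexive (≡.cong (q ^_) (≡.trans (≡.sym (depth-split κ 0)) (ℕP.+-identityʳ _)))) ⟩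
          P κ 0                                 ∎)
        (*-comm _ _) (⇓-*ˡ (D 0) (pairs E-sum))

      column : ∀ m {X Y} → 0 < m → (λ n → sign n * q^ℤ (lower m n)) ⇓ℤ X → (λ n → sign n * q^ℤ (upper m n)) ⇓ℤ Y →
        (λ κ → P κ m) ⇓ (X + Y) * (σ m * D m)
      column (suc m) _ p p′ = ⇓-cong (λ κ → trans (*-comm _ _) (sym (column-pairs m κ))) (*-comm _ _)
        (⇓-*ˡ (σ (suc m) * D (suc m)) (⇓-+ (pairs p) (pairs p′)))

      index-pos : ∀ p r → + (p ℕ.* 3 ℕ.+ r) ≡ + p ℤ.* + 3 ℤ.+ + r
      index-pos p r = ≡.cong (ℤ._+ + r) (ℤP.pos-* p 3)

      triangle-pos : ∀ p r → + triangle (suc (p ℕ.* 3 ℕ.+ r)) ≡ + 3 ℤ.* tri (+ p) ℤ.+ + 3 ℤ.* (+ p ℤ.* + p) ℤ.+ + triangle (suc r) ℤ.+ + p ℤ.* + 3 ℤ.* + suc r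
      triangle-pos p r = ≡.trans (≡.cong tri (≡.trans (≡.cong +_ (≡.sym (ℕP.+-suc (p ℕ.* 3) r))) (index-pos p (suc r))))
        (≡.trans (tri-+ (+ p ℤ.* + 3) (+ suc r)) (≡.cong (λ t → t ℤ.+ + triangle (suc r) ℤ.+ + p ℤ.* + 3 ℤ.* + suc r) (tri-triple (+ p))))

      tri-back : ∀ P → tri (ℤ.- (+ 1 ℤ.+ P)) ≡ tri P ℤ.+ P ℤ.+ (+ 1 ℤ.+ P)
      tri-back P = ≡.trans (tri-neg (+ 1 ℤ.+ P)) (≡.cong (ℤ._+ (+ 1 ℤ.+ P)) (tri-suc P))

      lower-shift upper-shift : (p r : ℕ) (s t n : ℤ) → ℤ
      lower-shift p r s t n = let P = + p in
        + 3 ℤ.* (t ℤ.+ tri n ℤ.+ s ℤ.* n) ℤ.+ + 2 ℤ.* (s ℤ.+ n) ℤ.+ (+ 3 ℤ.* tri P ℤ.+ + 3 ℤ.* (P ℤ.* P) ℤ.+ + triangle (suc r) ℤ.+ P ℤ.* + 3 ℤ.* + suc r) ℤ.- (P ℤ.* + 3 ℤ.+ + r) ℤ.* (s ℤ.+ n)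
      upper-shift p r s t n = let P = + p in
        + 3 ℤ.* (t ℤ.+ tri n ℤ.+ s ℤ.* n) ℤ.+ + 2 ℤ.* (s ℤ.+ n) ℤ.+ (+ 3 ℤ.* tri P ℤ.+ + 3 ℤ.* (P ℤ.* P) ℤ.+ + triangle (suc r) ℤ.+ P ℤ.* + 3 ℤ.* + suc r) ℤ.+ (P ℤ.* + 3 ℤ.+ + r) ℤ.* (+ 1 ℤ.+ (s ℤ.+ n))

      lower-expand : ∀ p r s {t} → tri s ≡ t → ∀ n → lower (p ℕ.* 3 ℕ.+ r) (s ℤ.+ n) ≡ lower-shift p r s t n
      lower-expand p r s ≡.refl n = ≡.cong₂ (λ x y → x ℤ.- y ℤ.* (s ℤ.+ n))
        (≡.cong₂ (λ x y → + 3 ℤ.* x ℤ.+ + 2 ℤ.* (s ℤ.+ n) ℤ.+ y) (tri-+ s n) (triangle-pos p r)) (index-pos p r)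

      upper-expand : ∀ p r s {t} → tri s ≡ t → ∀ n → upper (p ℕ.* 3 ℕ.+ r) (s ℤ.+ n) ≡ upper-shift p r s t n
      upper-expand p r s ≡.refl n = ≡.cong₂ (λ x y → x ℤ.+ y ℤ.* (+ 1 ℤ.+ (s ℤ.+ n)))
        (≡.cong₂ (λ x y → + 3 ℤ.* x ℤ.+ + 2 ℤ.* (s ℤ.+ n) ℤ.+ y) (tri-+ s n) (triangle-pos p r)) (index-pos p r)

      module _ (p : ℕ) where
        private
          P′ = + p
          back = ℤ.- (+ 1 ℤ.+ P′)

        lower-sum : ∀ r a {S} → r ℕ.+ a ≡ 2 → theta-term 3 a ⇓ℤ S →
          (λ n → sign n * q^ℤ (lower (p ℕ.* 3 ℕ.+ r) n)) ⇓ℤ sign P′ * q ^ cubic (2 ℕ.+ (r ℕ.+ r)) (triangle (suc r)) p * S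
        lower-sum r a eq sum = shifted a (suc r) (≡.trans (ℕP.+-suc a r) (≡.cong suc (≡.trans (ℕP.+-comm a r) eq))) sum P′ (cubic (2 ℕ.+ (r ℕ.+ r)) (triangle (suc r)) p) (lower (p ℕ.* 3 ℕ.+ r)) λ n →
          ≡.trans (lower-expand p r P′ ≡.refl n) (modulo-tri (+ 3) P′ (≡.trans
            (lemma (tri P′) P′ (tri n) n (+ r) (+ a) (+ triangle (suc r)) (≡.cong +_ eq))
            (≡.cong (λ K → K ℤ.+ exponent (+ 3) (+ a) n ℤ.+ + 3 ℤ.* (tri P′ ℤ.+ tri P′ ℤ.- (P′ ℤ.* P′ ℤ.- P′))) (≡.sym (cubic-pos (2 ℕ.+ (r ℕ.+ r)) (triangle (suc r)) p)))))
          where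
          identity : ∀ t P u n r a τ → + 3 ℤ.* (t ℤ.+ u ℤ.+ P ℤ.* n) ℤ.+ (r ℤ.+ a) ℤ.* (P ℤ.+ n) ℤ.+ (+ 3 ℤ.* t ℤ.+ + 3 ℤ.* (P ℤ.* P) ℤ.+ τ ℤ.+ P ℤ.* + 3 ℤ.* (+ 1 ℤ.+ r)) ℤ.- (P ℤ.* + 3 ℤ.+ r) ℤ.* (P ℤ.+ n) ≡
            (+ 3 ℤ.* P ℤ.* P ℤ.+ ((r ℤ.+ a) ℤ.+ (r ℤ.+ r)) ℤ.* P ℤ.+ τ) ℤ.+ (+ 3 ℤ.* u ℤ.+ a ℤ.* n) ℤ.+ + 3 ℤ.* (t ℤ.+ t ℤ.- (P ℤ.* P ℤ.- P))
          identity = solve-∀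
          lemma : ∀ t P u n r a τ → r ℤ.+ a ≡ + 2 → + 3 ℤ.* (t ℤ.+ u ℤ.+ P ℤ.* n) ℤ.+ + 2 ℤ.* (P ℤ.+ n) ℤ.+ (+ 3 ℤ.* t ℤ.+ + 3 ℤ.* (P ℤ.* P) ℤ.+ τ ℤ.+ P ℤ.* + 3 ℤ.* (+ 1 ℤ.+ r)) ℤ.- (P ℤ.* + 3 ℤ.+ r) ℤ.* (P ℤ.+ n) ≡
            (+ 3 ℤ.* P ℤ.* P ℤ.+ (+ 2 ℤ.+ (r ℤ.+ r)) ℤ.* P ℤ.+ τ) ℤ.+ (+ 3 ℤ.* u ℤ.+ a ℤ.* n) ℤ.+ + 3 ℤ.* (t ℤ.+ t ℤ.- (P ℤ.* P ℤ.- P))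
          lemma t P u n r a τ e = ≡.subst (λ x → + 3 ℤ.* (t ℤ.+ u ℤ.+ P ℤ.* n) ℤ.+ x ℤ.* (P ℤ.+ n) ℤ.+ (+ 3 ℤ.* t ℤ.+ + 3 ℤ.* (P ℤ.* P) ℤ.+ τ ℤ.+ P ℤ.* + 3 ℤ.* (+ 1 ℤ.+ r)) ℤ.- (P ℤ.* + 3 ℤ.+ r) ℤ.* (P ℤ.+ n) ≡
            (+ 3 ℤ.* P ℤ.* P ℤ.+ (x ℤ.+ (r ℤ.+ r)) ℤ.* P ℤ.+ τ) ℤ.+ (+ 3 ℤ.* u ℤ.+ a ℤ.* n) ℤ.+ + 3 ℤ.* (t ℤ.+ t ℤ.- (P ℤ.* P ℤ.- P))) e (identity t P u n r a τ)

        upper-sum-0 : (λ n → sign n * q^ℤ (upper (p ℕ.* 3 ℕ.+ 0) n)) ⇓ℤ sign (ℤ.- P′) * q ^ cubic 4 0 p * E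
        upper-sum-0 = shifted 2 1 ≡.refl E-sum (ℤ.- P′) (cubic 4 0 p) (upper (p ℕ.* 3 ℕ.+ 0)) λ n →
          ≡.trans (upper-expand p 0 (ℤ.- P′) (tri-neg P′) n) (modulo-tri (+ 3) P′ (≡.trans (lemma (tri P′) P′ (tri n) n)
            (≡.cong (λ K → K ℤ.+ exponent (+ 3) (+ 2) n ℤ.+ + 3 ℤ.* (tri P′ ℤ.+ tri P′ ℤ.- (P′ ℤ.* P′ ℤ.- P′))) (≡.sym (cubic-pos 4 0 p)))))
          where
          lemma : ∀ t P u n → + 3 ℤ.* (t ℤ.+ P ℤ.+ u ℤ.+ ℤ.- P ℤ.* n) ℤ.+ + 2 ℤ.* (ℤ.- P ℤ.+ n) ℤ.+ (+ 3 ℤ.* t ℤ.+ + 3 ℤ.* (P ℤ.* P) ℤ.+ + 0 ℤ.+ P ℤ.* + 3 ℤ.* + 1) ℤ.+ (P ℤ.* + 3 ℤ.+ + 0) ℤ.* (+ 1 ℤ.+ (ℤ.- P ℤ.+ n)) ≡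
            (+ 3 ℤ.* P ℤ.* P ℤ.+ + 4 ℤ.* P ℤ.+ + 0) ℤ.+ (+ 3 ℤ.* u ℤ.+ + 2 ℤ.* n) ℤ.+ + 3 ℤ.* (t ℤ.+ t ℤ.- (P ℤ.* P ℤ.- P))
          lemma = solve-∀

        upper-sum : ∀ a a′ {S} → a ℕ.+ a′ ≡ 3 → theta-term 3 a ⇓ℤ S →
          (λ n → sign n * q^ℤ (upper (p ℕ.* 3 ℕ.+ suc a) n)) ⇓ℤ sign back * q ^ cubic (6 ℕ.+ (a ℕ.+ a)) (suc (triangle (2 ℕ.+ a))) p * S
        upper-sum a a′ eq sum = shifted a a′ eq sum back (cubic (6 ℕ.+ (a ℕ.+ a)) (suc (triangle (2 ℕ.+ a))) p) (upper (p ℕ.* 3 ℕ.+ suc a)) λ n →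
          ≡.trans (upper-expand p (suc a) back (tri-back P′) n) (modulo-tri (+ 3) P′ (≡.trans (lemma (tri P′) P′ (tri n) n (+ a) (+ triangle (2 ℕ.+ a)))
            (≡.cong (λ K → K ℤ.+ exponent (+ 3) (+ a) n ℤ.+ + 3 ℤ.* (tri P′ ℤ.+ tri P′ ℤ.- (P′ ℤ.* P′ ℤ.- P′))) (≡.sym (cubic-pos (6 ℕ.+ (a ℕ.+ a)) (suc (triangle (2 ℕ.+ a))) p)))))
          where
          lemma : ∀ t P u n a τ → + 3 ℤ.* (t ℤ.+ P ℤ.+ (+ 1 ℤ.+ P) ℤ.+ u ℤ.+ ℤ.- (+ 1 ℤ.+ P) ℤ.* n) ℤ.+ + 2 ℤ.* (ℤ.- (+ 1 ℤ.+ P) ℤ.+ n) ℤ.+ (+ 3 ℤ.* t ℤ.+ + 3 ℤ.* (P ℤ.* P) ℤ.+ τ ℤ.+ P ℤ.* + 3 ℤ.* (+ 2 ℤ.+ a)) ℤ.+ (P ℤ.* + 3 ℤ.+ (+ 1 ℤ.+ a)) ℤ.* (+ 1 ℤ.+ (ℤ.- (+ 1 ℤ.+ P) ℤ.+ n)) ≡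
            (+ 3 ℤ.* P ℤ.* P ℤ.+ (+ 6 ℤ.+ (a ℤ.+ a)) ℤ.* P ℤ.+ (+ 1 ℤ.+ τ)) ℤ.+ (+ 3 ℤ.* u ℤ.+ a ℤ.* n) ℤ.+ + 3 ℤ.* (t ℤ.+ t ℤ.- (P ℤ.* P ℤ.- P))
          lemma = solve-∀

        private
          s = sign P′
          σ-triple : ∀ p r → σ (p ℕ.* 3 ℕ.+ r) ≈ sign (+ p) * σ r
          σ-triple zero r = sym (*-identityˡ _)
          σ-triple (suc p) r = trans (*-congˡ (*-congˡ (*-congˡ (σ-triple p r))))
            (solve 2 (λ s t → :- con (+ 1) :* (:- con (+ 1) :* (:- con (+ 1) :* (s :* t))) := :- s :* t) refl _ _)
          sign-back : sign back ≈ - s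
          sign-back = sign-neg (+ suc p)
          collapse : ∀ x y → s * s * x + 0# * y ≈ x
          collapse x y = trans (+-cong (trans (*-congʳ (sign-square P′)) (*-identityˡ x)) (zeroˡ y)) (+-identityʳ x)

        column-3p : 0 < p → (λ κ → P κ (p ℕ.* 3 ℕ.+ 0)) ⇓ E * ((q ^ cubic 2 0 p + q ^ cubic 4 0 p) * D (p ℕ.* 3 ℕ.+ 0))
        column-3p 0<p = ⇓-cong (λ _ → refl) (begin
          (s * a * E + sign (ℤ.- P′) * b * E) * (σ (p ℕ.* 3 ℕ.+ 0) * d)     ≈⟨ *-cong (+-congˡ (*-congʳ (*-congʳ (sign-neg P′)))) (*-congʳ (σ-triple p 0)) ⟩
          (s * a * E + s * b * E) * (s * 1# * d)                             ≈⟨ solve 5 (λ s a b e d → (s :* a :* e :+ s :* b :* e) :* (s :* con (+ 1) :* d) := s :* s :* (e :* ((a :+ b) :* d)) :+ con (+ 0) :* s) refl s a b E d ⟩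
          s * s * (E * ((a + b) * d)) + 0# * s                               ≈⟨ collapse _ _ ⟩
          E * ((a + b) * d)                                                  ∎)
          (column (p ℕ.* 3 ℕ.+ 0) (ℕP.≤-trans 0<p (ℕP.≤-trans (ℕP.m≤m*n p 3) (ℕP.m≤m+n _ 0))) (lower-sum 0 2 ≡.refl E-sum) upper-sum-0)
          where
          a = q ^ cubic 2 0 p
          b = q ^ cubic 4 0 p
          d = D (p ℕ.* 3 ℕ.+ 0)

        column-3p+1 : (λ κ → P κ (p ℕ.* 3 ℕ.+ 1)) ⇓ E * - (q ^ cubic 4 1 p * D (p ℕ.* 3 ℕ.+ 1))
        column-3p+1 = ⇓-cong (λ _ → refl) (begin
          (s * a * E + sign back * b * 0#) * (σ (p ℕ.* 3 ℕ.+ 1) * d)        ≈⟨ *-congˡ (*-congʳ (σ-triple p 1)) ⟩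
          (s * a * E + sign back * b * 0#) * (s * (- 1# * 1#) * d)          ≈⟨ solve 6 (λ s a b r e d → (s :* a :* e :+ r :* b :* con (+ 0)) :* (s :* (:- con (+ 1) :* con (+ 1)) :* d) := s :* s :* (e :* :- (a :* d)) :+ con (+ 0) :* s) refl s a b (sign back) E d ⟩
          s * s * (E * - (a * d)) + 0# * s                                   ≈⟨ collapse _ _ ⟩
          E * - (a * d)                                                      ∎)
          (column (p ℕ.* 3 ℕ.+ 1) (ℕP.m≤n+m 1 (p ℕ.* 3)) (lower-sum 1 1 ≡.refl theta-3-1) (upper-sum 0 3 ≡.refl theta-3-0))
          where
          a = q ^ cubic 4 1 p
          b = q ^ cubic 6 2 p
          d = D (p ℕ.* 3 ℕ.+ 1)

        column-3p+2 : (λ κ → P κ (p ℕ.* 3 ℕ.+ 2)) ⇓ E * - (q ^ cubic 8 4 p * D (p ℕ.* 3 ℕ.+ 2))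
        column-3p+2 = ⇓-cong (λ _ → refl) (begin
          (s * a * 0# + sign back * b * E) * (σ (p ℕ.* 3 ℕ.+ 2) * d)        ≈⟨ *-cong (+-congˡ (*-congʳ (*-congʳ sign-back))) (*-congʳ (σ-triple p 2)) ⟩
          (s * a * 0# + - s * b * E) * (s * (- 1# * (- 1# * 1#)) * d)        ≈⟨ solve 5 (λ s a b e d → (s :* a :* con (+ 0) :+ :- s :* b :* e) :* (s :* (:- con (+ 1) :* (:- con (+ 1) :* con (+ 1))) :* d) := s :* s :* (e :* :- (b :* d)) :+ con (+ 0) :* s) refl s a b E d ⟩
          s * s * (E * - (b * d)) + 0# * s                                   ≈⟨ collapse _ _ ⟩
          E * - (b * d)                                                      ∎)
          (column (p ℕ.* 3 ℕ.+ 2) (ℕP.≤-trans (s≤s z≤n) (ℕP.m≤n+m 2 (p ℕ.* 3))) (lower-sum 2 0 ≡.refl theta-3-0) (upper-sum 1 2 ≡.refl theta-3-1))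
          where
          a = q ^ cubic 6 3 p
          b = q ^ cubic 8 4 p
          d = D (p ℕ.* 3 ℕ.+ 2)

      -- The sum over m is organised by m mod 3: the theta series in κ attached to m is E up to a monomial, or vanishes.
      lambert-product : ∀ {Y C T₁ T₂ S₁ S₂} → (λ κ → pair pentagonal κ * V κ) ⇓ Y → (λ m → v m * D m) ⇓ C →
        T₁ ⇓ℤ S₁ → T₂ ⇓ℤ S₂ → T₁ (+ 0) ≈ D 0 →
        (∀ p → 0 < p → fold T₁ p ≈ (q ^ cubic 2 0 p + q ^ cubic 4 0 p) * D (p ℕ.* 3 ℕ.+ 0)) →
        (∀ p → pair T₂ p ≈ q ^ cubic 4 1 p * D (p ℕ.* 3 ℕ.+ 1) + q ^ cubic 8 4 p * D (p ℕ.* 3 ℕ.+ 2)) →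
        Y * C ≈ E * (S₁ - S₂)
      lambert-product {Y} {C} {T₁} {T₂} {S₁} {S₂} Y-sum C-sum sum₁ sum₂ T₁0 fold₁ pair₂ =
        ⇓-unique (⇓-blocks 2 columns-sum) (⇓-cong block refl (⇓-*ˡ E (⇓-+ (⇓ℤ-fold sum₁) (⇓-neg (pairs sum₂)))))
        where
        limit : ∀ m → ∃ λ S → (λ κ → P κ m) ⇓ S
        limit m = complete _ λ N → let (B , h) = P-null N in B , λ κ p → h κ m (inj₁ p)
        rows : ∀ κ → P κ ⇓ pair pentagonal κ * V κ * C
        rows κ = ⇓-cong (T+W≈P κ) (+-identityʳ _) (⇓-+ (⇓-*ˡ (pair pentagonal κ * V κ) C-sum) (W-row κ))
        columns-sum : (λ m → proj₁ (limit m)) ⇓ Y * C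
        columns-sum = fubini P-null rows (λ m → proj₂ (limit m)) (⇓-cong (λ _ → *-comm _ _) (*-comm _ _) (⇓-*ˡ C Y-sum))
        first : ∀ p → E * fold T₁ p ≈ proj₁ (limit (p ℕ.* 3 ℕ.+ 0))
        first zero = trans (*-congˡ T₁0) (⇓-unique column-0 (proj₂ (limit 0)))
        first (suc p) = trans (*-congˡ (fold₁ (suc p) (s≤s z≤n))) (⇓-unique (column-3p (suc p) (s≤s z≤n)) (proj₂ (limit (suc p ℕ.* 3 ℕ.+ 0))))
        block : ∀ p → E * (fold T₁ p + - pair T₂ p) ≈ partial (λ i → proj₁ (limit (p ℕ.* 3 ℕ.+ i))) 3
        block p = begin
          E * (fold T₁ p + - pair T₂ p)
            ≈⟨ *-congˡ (+-congˡ (-‿cong (pair₂ p))) ⟩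
          E * (fold T₁ p + - (q ^ cubic 4 1 p * D (p ℕ.* 3 ℕ.+ 1) + q ^ cubic 8 4 p * D (p ℕ.* 3 ℕ.+ 2)))
            ≈⟨ solve 4 (λ e f x y → e :* (f :+ :- (x :+ y)) := con (+ 0) :+ e :* f :+ e :* :- x :+ e :* :- y) refl _ _ _ _ ⟩
          0# + E * fold T₁ p + E * - (q ^ cubic 4 1 p * D (p ℕ.* 3 ℕ.+ 1)) + E * - (q ^ cubic 8 4 p * D (p ℕ.* 3 ℕ.+ 2))
            ≈⟨ +-cong (+-cong (+-congˡ (first p)) (⇓-unique (column-3p+1 p) (proj₂ (limit (p ℕ.* 3 ℕ.+ 1))))) (⇓-unique (column-3p+2 p) (proj₂ (limit (p ℕ.* 3 ℕ.+ 2)))) ⟩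
          partial (λ i → proj₁ (limit (p ℕ.* 3 ℕ.+ i))) 3 ∎

module ClassIdentities {c ℓ} (R : CommutativeRing c ℓ) (β γ y j₁ j₅ j₇ c₁ : CommutativeRing.Carrier R) where

  open CommutativeRing R
  open RingTools R
  open Relation.Binary.Reasoning.Setoid setoid

  two three : Carrier
  two = 1# + 1#
  three = 1# + two

  w c₂ c₃ α j₄ θ₁ θ₃ : Carrier
  w = two - c₁
  c₂ = c₁ * c₁ - two
  c₃ = 1# - c₁ - c₁ * c₁
  α = β * β + y * (β * (γ * γ))
  j₄ = y * (β * j₁) + β * (γ * j₅)
  θ₁ = - ((1# + c₁) * (α * γ))
  θ₃ = - (c₃ * γ)

  K₁ K₂ K₃ K₄ K₆ : Carrier
  K₁ = c₁ - 1#
  K₂ = c₁ * c₁ - c₁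
  K₃ = two + c₁ - two * (c₁ * c₁)
  K₄ = - c₁ - c₃ * w
  K₆ = - (c₂ + 1#)

  ρ₀ ρ₁ ρ₂ ρ₃ ρ₄ ρ₅ ρ₆ : Carrier
  ρ₀ = j₇ * (α * (β * β)) - w * ((1# + c₁) * (y * y * (j₁ * (α * β))))
  ρ₁ = K₁ * (j₇ * (α * β))
  ρ₂ = K₂ * (j₇ * α) - w * ((1# + c₂) * (y * j₄))
  ρ₃ = K₃ * (j₇ * β)
  ρ₄ = K₄ * j₇
  ρ₅ = w * (c₁ * (α * j₅ - y * (γ * j₄)))
  ρ₆ = K₆ * (j₇ * (β * γ)) + w * ((two + c₂) * (j₅ * β))

  Y₀ Y₁ Y₂ Y₅ : Carrier
  Y₀ = j₇ * α + (c₂ - c₁) * (y * j₄)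
  Y₁ = - (j₇ * β) + (three + two * c₂) * (y * y * j₁)
  Y₂ = - j₇ + w * j₇
  Y₅ = j₇ * γ + ((c₁ - two) * j₅ - (c₂ - c₁) * (j₅ - j₇ * γ))

  -- Both relations are multiplied by polynomial cofactors found by division with remainder, the leading monomials being c₁³ and β³γ.
  module _ (c₁-relation : c₁ * c₁ * c₁ + c₁ * c₁ - two * c₁ - 1# ≈ 0#) (curve : β * β * β * γ + y * (β * β * (γ * γ * γ)) - 1# ≈ 0#) where
    private
      modulo : ∀ a b {x} → x + a * (c₁ * c₁ * c₁ + c₁ * c₁ - two * c₁ - 1#) + b * (β * β * β * γ + y * (β * β * (γ * γ * γ)) - 1#) ≈ x
      modulo a b {x} = begin
        x + a * (c₁ * c₁ * c₁ + c₁ * c₁ - two * c₁ - 1#) + b * (β * β * β * γ + y * (β * β * (γ * γ * γ)) - 1#)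
          ≈⟨ +-cong (+-congˡ (trans (*-congˡ c₁-relation) (zeroʳ a))) (trans (*-congˡ curve) (zeroʳ b)) ⟩
        x + 0# + 0#
          ≈⟨ trans (+-identityʳ _) (+-identityʳ _) ⟩
        x ∎

    private
      module Poly (b g y j₁ j₅ j₇ c : Polynomial 7) where
        rc rβ : Polynomial 7
        rc = c :* c :* c :+ c :* c :- con (+ 2) :* c :- con (+ 1)
        rβ = b :* b :* b :* g :+ y :* (b :* b :* (g :* g :* g)) :- con (+ 1)
        twoᵖ threeᵖ wᵖ c₂ᵖ c₃ᵖ αᵖ j₄ᵖ θ₁ᵖ θ₃ᵖ K₁ᵖ K₂ᵖ K₃ᵖ K₄ᵖ K₆ᵖ ρ₀ᵖ ρ₁ᵖ ρ₂ᵖ ρ₃ᵖ ρ₄ᵖ ρ₅ᵖ ρ₆ᵖ Y₀ᵖ Y₁ᵖ Y₂ᵖ Y₅ᵖ : Polynomial 7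
        twoᵖ = con (+ 1) :+ con (+ 1)
        threeᵖ = con (+ 1) :+ twoᵖ
        wᵖ = twoᵖ :- c
        c₂ᵖ = c :* c :- twoᵖ
        c₃ᵖ = con (+ 1) :- c :- c :* c
        αᵖ = b :* b :+ y :* (b :* (g :* g))
        j₄ᵖ = y :* (b :* j₁) :+ b :* (g :* j₅)
        θ₁ᵖ = :- ((con (+ 1) :+ c) :* (αᵖ :* g))
        θ₃ᵖ = :- (c₃ᵖ :* g)
        K₁ᵖ = c :- con (+ 1)
        K₂ᵖ = c :* c :- c
        K₃ᵖ = twoᵖ :+ c :- twoᵖ :* (c :* c)
        K₄ᵖ = :- c :- c₃ᵖ :* wᵖ
        K₆ᵖ = :- (c₂ᵖ :+ con (+ 1))
        ρ₀ᵖ = j₇ :* (αᵖ :* (b :* b)) :- wᵖ :* ((con (+ 1) :+ c) :* (y :* y :* (j₁ :* (αᵖ :* b))))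
        ρ₁ᵖ = K₁ᵖ :* (j₇ :* (αᵖ :* b))
        ρ₂ᵖ = K₂ᵖ :* (j₇ :* αᵖ) :- wᵖ :* ((con (+ 1) :+ c₂ᵖ) :* (y :* j₄ᵖ))
        ρ₃ᵖ = K₃ᵖ :* (j₇ :* b)
        ρ₄ᵖ = K₄ᵖ :* j₇
        ρ₅ᵖ = wᵖ :* (c :* (αᵖ :* j₅ :- y :* (g :* j₄ᵖ)))
        ρ₆ᵖ = K₆ᵖ :* (j₇ :* (b :* g)) :+ wᵖ :* ((twoᵖ :+ c₂ᵖ) :* (j₅ :* b))
        Y₀ᵖ = j₇ :* αᵖ :+ (c₂ᵖ :- c) :* (y :* j₄ᵖ)
        Y₁ᵖ = :- (j₇ :* b) :+ (threeᵖ :+ twoᵖ :* c₂ᵖ) :* (y :* y :* j₁)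
        Y₂ᵖ = :- j₇ :+ wᵖ :* j₇
        Y₅ᵖ = j₇ :* g :+ ((c :- twoᵖ) :* j₅ :- (c₂ᵖ :- c) :* (j₅ :- j₇ :* g))

    class-0 : ρ₀ + y * (θ₁ * ρ₆) + y * (θ₃ * ρ₄) ≈ α * Y₀ + y * (- 1# * Y₅ + γ * Y₂)
    class-0 = trans (solve 7 (λ b g y j₁ j₅ j₇ c → let open Poly b g y j₁ j₅ j₇ c in
      ρ₀ᵖ :+ y :* (θ₁ᵖ :* ρ₆ᵖ) :+ y :* (θ₃ᵖ :* ρ₄ᵖ) :=
      αᵖ :* Y₀ᵖ :+ y :* (:- con (+ 1) :* Y₅ᵖ :+ g :* Y₂ᵖ) :+ (g :* y :* j₇ :+ g :* y :* j₇ :* c :+ con -[1+ 0 ] :* g :* y :* j₇ :* c :* c :+ con -[1+ 1 ] :* b :* b :* g :* g :* g :* y :* y :* j₅ :+ b :* b :* g :* g :* g :* y :* y :* j₅ :* c :+ b :* b :* g :* g :* g :* g :* y :* y :* j₇ :+ con -[1+ 1 ] :* b :* b :* b :* g :* y :* j₅ :+ b :* b :* b :* g :* y :* j₅ :* c :+ b :* b :* b :* g :* g :* y :* j₇) :* rc :+ (con -[1+ 1 ] :* y :* j₅ :* c :+ y :* j₅ :* c :* c :+ con -[1+ 0 ] :* g :* y :* j₇ :+ g :* y :* j₇ :* c) :* rβ) refl β γ y j₁ j₅ j₇ c₁)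
      (modulo _ _)

    class-1 : ρ₁ + θ₁ * ρ₀ + y * (θ₃ * ρ₅) ≈ α * Y₁ + - β * Y₀
    class-1 = trans (solve 7 (λ b g y j₁ j₅ j₇ c → let open Poly b g y j₁ j₅ j₇ c in
      ρ₁ᵖ :+ θ₁ᵖ :* ρ₀ᵖ :+ y :* (θ₃ᵖ :* ρ₅ᵖ) :=
      αᵖ :* Y₁ᵖ :+ :- b :* Y₀ᵖ :+ (con -[1+ 1 ] :* b :* g :* g :* y :* y :* y :* j₁ :+ b :* g :* g :* y :* y :* y :* j₁ :* c :+ con (+ 2) :* b :* b :* g :* y :* j₅ :+ con -[1+ 0 ] :* b :* b :* g :* y :* j₅ :* c :+ con -[1+ 0 ] :* b :* b :* b :* g :* g :* g :* g :* g :* y :* y :* y :* y :* j₁ :+ con -[1+ 1 ] :* b :* b :* b :* b :* g :* g :* g :* y :* y :* y :* j₁ :+ con -[1+ 0 ] :* b :* b :* b :* b :* b :* g :* y :* y :* j₁) :* rc :+ (b :* g :* g :* y :* y :* y :* j₁ :+ b :* g :* g :* y :* y :* y :* j₁ :* c :+ b :* g :* g :* y :* y :* y :* j₁ :* c :* c :+ b :* b :* y :* y :* j₁ :+ b :* b :* y :* y :* j₁ :* c :+ b :* b :* y :* y :* j₁ :* c :* c :+ con -[1+ 0 ] :* b :* b :* g :* g :* y :* j₇ :+ con -[1+ 0 ] :* b :* b :* g :* g :* y :* j₇ :* c :+ con -[1+ 0 ] :* b :* b :* b :* j₇ :+ con -[1+ 0 ] :* b :* b :* b :* j₇ :* c)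 :* rβ) refl β γ y j₁ j₅ j₇ c₁)
      (modulo _ _)

    class-2 : ρ₂ + θ₁ * ρ₁ + y * (θ₃ * ρ₆) ≈ α * Y₂ + - β * Y₁ + - 1# * Y₀
    class-2 = trans (solve 7 (λ b g y j₁ j₅ j₇ c → let open Poly b g y j₁ j₅ j₇ c in
      ρ₂ᵖ :+ θ₁ᵖ :* ρ₁ᵖ :+ y :* (θ₃ᵖ :* ρ₆ᵖ) :=
      αᵖ :* Y₂ᵖ :+ :- b :* Y₁ᵖ :+ :- con (+ 1) :* Y₀ᵖ :+ (b :* y :* y :* j₁ :+ con (+ 2) :* b :* g :* y :* j₅ :* c :+ con -[1+ 0 ] :* b :* g :* y :* j₅ :* c :* c :+ con -[1+ 0 ] :* b :* g :* g :* y :* j₇ :* c) :* rc :+ (b :* g :* g :* y :* j₇ :+ con -[1+ 0 ] :* b :* g :* g :* y :* j₇ :* c :* c :+ b :* b :* j₇ :+ con -[1+ 0 ] :* b :* b :* j₇ :* c :* c) :* rβ) refl β γ y j₁ j₅ j₇ c₁)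
      (modulo _ _)

    class-3 : ρ₃ + θ₁ * ρ₂ + θ₃ * ρ₀ ≈ - β * Y₂ + - 1# * Y₁ + y * (γ * Y₅)
    class-3 = trans (solve 7 (λ b g y j₁ j₅ j₇ c → let open Poly b g y j₁ j₅ j₇ c in
      ρ₃ᵖ :+ θ₁ᵖ :* ρ₂ᵖ :+ θ₃ᵖ :* ρ₀ᵖ :=
      :- b :* Y₂ᵖ :+ :- con (+ 1) :* Y₁ᵖ :+ y :* (g :* Y₅ᵖ) :+ (b :* b :* g :* g :* g :* y :* y :* y :* j₁ :+ con (+ 2) :* b :* b :* g :* g :* g :* g :* y :* y :* j₅ :+ con -[1+ 0 ] :* b :* b :* g :* g :* g :* g :* y :* y :* j₅ :* c :+ con -[1+ 0 ] :* b :* b :* g :* g :* g :* g :* g :* y :* y :* j₇ :+ b :* b :* b :* g :* y :* y :* j₁ :+ con (+ 2) :* b :* b :* b :* g :* g :* y :* j₅ :+ con -[1+ 0 ] :* b :* b :* b :* g :* g :* y :* j₅ :* c :+ con -[1+ 1 ] :* b :* b :* b :* g :* g :* g :* y :* j₇ :+ con -[1+ 0 ] :* b :* b :* b :* b :* g :* j₇) :* rc :+ (y :* y :* j₁ :+ con -[1+ 1 ] :* y :* y :* j₁ :* c :* c :+ con (+ 2) :* g :* y :* j₅ :* c :+ con -[1+ 0 ] :* g :* y :* j₅ :* c :* c :+ con -[1+ 0 ] :* g :* g :* y :* j₇ :+ con -[1+ 0 ] :* g :* g :* y :* j₇ :* c :+ g :* g :* y :* j₇ :* c :* c :+ con -[1+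 1 ] :* b :* j₇ :+ con (+ 2) :* b :* j₇ :* c :* c) :* rβ) refl β γ y j₁ j₅ j₇ c₁)
      (modulo _ _)

    class-4 : ρ₄ + θ₁ * ρ₃ + θ₃ * ρ₁ ≈ - 1# * Y₂
    class-4 = trans (solve 7 (λ b g y j₁ j₅ j₇ c → let open Poly b g y j₁ j₅ j₇ c in
      ρ₄ᵖ :+ θ₁ᵖ :* ρ₃ᵖ :+ θ₃ᵖ :* ρ₁ᵖ :=
      :- con (+ 1) :* Y₂ᵖ :+ (con -[1+ 0 ] :* j₇ :+ con (+ 3) :* b :* b :* g :* g :* g :* y :* j₇ :+ con (+ 3) :* b :* b :* b :* g :* j₇) :* rc :+ (con (+ 2) :* j₇ :+ j₇ :* c :+ con -[1+ 1 ] :* j₇ :* c :* c) :* rβ) refl β γ y j₁ j₅ j₇ c₁)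
      (modulo _ _)

    class-5 : ρ₅ + θ₁ * ρ₄ + θ₃ * ρ₂ ≈ α * Y₅ + γ * Y₀
    class-5 = trans (solve 7 (λ b g y j₁ j₅ j₇ c → let open Poly b g y j₁ j₅ j₇ c in
      ρ₅ᵖ :+ θ₁ᵖ :* ρ₄ᵖ :+ θ₃ᵖ :* ρ₂ᵖ :=
      αᵖ :* Y₅ᵖ :+ g :* Y₀ᵖ :+ (con -[1+ 1 ] :* b :* g :* y :* y :* j₁ :* c :+ b :* g :* y :* y :* j₁ :* c :* c :+ con -[1+ 1 ] :* b :* g :* g :* y :* j₅ :* c :+ b :* g :* g :* y :* j₅ :* c :* c :+ con -[1+ 1 ] :* b :* g :* g :* g :* y :* j₇ :+ con (+ 2) :* b :* g :* g :* g :* y :* j₇ :* c :+ con -[1+ 1 ] :* b :* b :* g :* j₇ :+ con (+ 2) :* b :* b :* g :* j₇ :* c) :* rc :+ (con (+ 0)) :* rβ) refl β γ y j₁ j₅ j₇ c₁)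
      (modulo _ _)

    class-6 : ρ₆ + θ₁ * ρ₅ + θ₃ * ρ₃ ≈ - β * Y₅ + γ * Y₁
    class-6 = trans (solve 7 (λ b g y j₁ j₅ j₇ c → let open Poly b g y j₁ j₅ j₇ c in
      ρ₆ᵖ :+ θ₁ᵖ :* ρ₅ᵖ :+ θ₃ᵖ :* ρ₃ᵖ :=
      :- b :* Y₅ᵖ :+ g :* Y₁ᵖ :+ (con -[1+ 0 ] :* b :* j₅ :+ b :* g :* j₇ :+ con -[1+ 1 ] :* b :* g :* j₇ :* c :+ con -[1+ 0 ] :* b :* b :* g :* g :* g :* g :* y :* y :* y :* j₁ :+ con -[1+ 0 ] :* b :* b :* b :* g :* g :* y :* y :* j₁ :+ b :* b :* b :* g :* g :* g :* y :* j₅ :+ b :* b :* b :* b :* g :* j₅) :* rc :+ (con -[1+ 0 ] :* g :* y :* y :* j₁ :+ con (+ 2) :* g :* y :* y :* j₁ :* c :* c :+ b :* j₅ :+ con -[1+ 1 ] :* b :* j₅ :* c :* c) :* rβ) refl β γ y j₁ j₅ j₇ c₁)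
      (modulo _ _)

module ThetaFunctions {ℓ₁ ℓ₂} (A : SeriesAlgebra ℓ₁ ℓ₂) where

  open SeriesAlgebra A
  open RingTools commutativeRing
  open ZSums filteredRing
  open Monomials A
  open Relation.Binary.Reasoning.Setoid setoid

  module Base (d : ℕ) (1≤d : 1 ≤ d) where
    Q : Carrier
    Q = q ^ d

    uᵈ : ℕ → Carrier
    uᵈ i = u (ℕ.pred (d ℕ.* suc i))

    Q^ : ∀ k → Q ^ k ≈ q ^ (d ℕ.* k)
    Q^ k = ^-assocʳ q d k

    uᵈ-inverse : ∀ i → (1# - Q ^ suc i) * uᵈ i ≈ 1#
    uᵈ-inverse i = trans (*-congʳ (+-congˡ (-‿cong (trans (Q^ (suc i)) (reflexive (≡.cong (q ^_) (≡.sym (ℕP.suc-pred (d ℕ.* suc i) ⦃ nonZero ⦄))))))))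
      (u-inverse (ℕ.pred (d ℕ.* suc i)))
      where
      nonZero : ℕ.NonZero (d ℕ.* suc i)
      nonZero = ℕP.m*n≢0 d (suc i) ⦃ ℕ.>-nonZero 1≤d ⦄

    open FiniteIdentities.QFactorial commutativeRing Q uᵈ uᵈ-inverse using (factorial)

    E E⁻ : Carrier
    E = poch d d
    E⁻ = proj₁ (poch-invertible d d 1≤d 1≤d)

    factorial⟶E : factorial ⟶ E
    factorial⟶E = ⟶-cong (λ M → product-cong M (λ i → +-congˡ (-‿cong (trans (reflexive (≡.cong (q ^_) (≡.sym (ℕP.*-suc d i)))) (sym (Q^ (suc i))))))) refl
      (poch-limit d d 1≤d 1≤d)

    open Products.InfiniteProducts filteredRing complete Q uᵈ uᵈ-inverse E E⁻ factorial⟶E (proj₂ (poch-invertible d d 1≤d 1≤d)) public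

  private
    triangle-monomial : ∀ p a n → (q ^ p) ^ triangle n * (- (q ^ a)) ^ n ≈ sign (+ n) * q ^ (p ℕ.* triangle n ℕ.+ a ℕ.* n)
    triangle-monomial p a n = begin
      (q ^ p) ^ triangle n * (- (q ^ a)) ^ n                 ≈⟨ *-cong (^-assocʳ q p _) (trans (alternate (q ^ a) n) (*-congˡ (^-assocʳ q a n))) ⟩
      q ^ (p ℕ.* triangle n) * (sign (+ n) * q ^ (a ℕ.* n))  ≈⟨ solve 3 (λ x s y → x :* (s :* y) := s :* (x :* y)) refl _ _ _ ⟩
      sign (+ n) * (q ^ (p ℕ.* triangle n) * q ^ (a ℕ.* n))  ≈⟨ *-congˡ (^-homo-* q (p ℕ.* triangle n) (a ℕ.* n)) ⟨
      sign (+ n) * q ^ (p ℕ.* triangle n ℕ.+ a ℕ.* n)        ∎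
      where
      alternate : ∀ x n → (- x) ^ n ≈ sign (+ n) * x ^ n
      alternate x zero = sym (*-identityˡ 1#)
      alternate x (suc n) = trans (*-congˡ (alternate x n)) (solve 3 (λ x s y → :- x :* (s :* y) := :- s :* (x :* y)) refl _ _ _)

    sign⁺⁻ : ∀ n → sign -[1+ n ] ≈ sign (+ suc n)
    sign⁺⁻ zero = refl
    sign⁺⁻ (suc n) = -‿cong (sign⁺⁻ n)

  theta-null : ∀ a a′ → 1 ≤ a ℕ.+ a′ → Null (theta-term (a ℕ.+ a′) a)
  theta-null a a′ pos N = let (B , h) = plain-null a a′ pos N in B , λ n p → ≈[]-trans (*-cong[] (≈⇒≈[] refl) (h n p)) (≈⇒≈[] (zeroʳ _))

  theta-sum : ∀ a a′ → 1 ≤ a → 1 ≤ a′ → let p = a ℕ.+ a′ in theta-term p a ⇓ℤ poch a p * poch a′ p * poch p p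
  theta-sum a a′ 1≤a 1≤a′ = triple-product {x = - (q ^ a)} {y = - (q ^ a′)}
    (trans (solve 2 (λ x y → :- x :* :- y := x :* y) refl _ _) (sym (^-homo-* q a a′)))
    (⟶-cong (λ M → trans (sym (product-* _ _ M)) (product-cong M (λ i → *-cong (factor a i) (factor a′ i)))) refl
      (⟶-* (poch-limit a p 1≤a 1≤p) (poch-limit a′ p 1≤a′ 1≤p)))
    (theta-null a a′ 1≤p)
    (λ n → trans (*-congˡ (reflexive (≡.cong q^ℤ (exponent⁺ p a n)))) (sym (triangle-monomial p a n)))
    (λ n → trans (*-cong (sign⁺⁻ n) (reflexive (≡.cong q^ℤ (exponent⁻ a a′ n)))) (sym (triangle-monomial p a′ (suc n))))
    where
    p = a ℕ.+ a′
    1≤p : 1 ≤ p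
    1≤p = ℕP.≤-trans 1≤a (ℕP.m≤m+n a a′)
    open Base p 1≤p
    factor : ∀ b i → 1# - q ^ (b ℕ.+ p ℕ.* i) ≈ 1# + - (q ^ b) * (q ^ p) ^ i
    factor b i = +-congˡ (trans (-‿cong (trans (^-homo-* q b _) (*-congˡ (sym (Q^ i))))) (solve 2 (λ x y → :- (x :* y) := :- x :* y) refl _ _))

  poch-triple : ∀ a d → 1 ≤ a → 1 ≤ d → poch a d ≈ poch a (3 ℕ.* d) * poch (a ℕ.+ d) (3 ℕ.* d) * poch (a ℕ.+ 2 ℕ.* d) (3 ℕ.* d)
  poch-triple a d 1≤a 1≤d = ⟶-unique
    (⟶-subseq (ℕ._* 3) (λ M → ℕP.m≤m*n M 3) (poch-limit a d 1≤a 1≤d))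
    (⟶-cong (λ M → trans (*-congʳ (sym (product-* _ _ M))) (trans (sym (product-* _ _ M)) (sym (regroup M)))) refl
      (⟶-* (⟶-* (poch-limit a D 1≤a 1≤D) (poch-limit (a ℕ.+ d) D (ℕP.≤-trans 1≤a (ℕP.m≤m+n a d)) 1≤D)) (poch-limit (a ℕ.+ 2 ℕ.* d) D (ℕP.≤-trans 1≤a (ℕP.m≤m+n a _)) 1≤D)))
    where
    D = 3 ℕ.* d
    1≤D : 1 ≤ D
    1≤D = ℕP.≤-trans 1≤d (ℕP.m≤m+n d _)
    f : ℕ → ℕ → Carrier
    f b i = 1# - q ^ (b ℕ.+ D ℕ.* i)
    g : ℕ → Carrier
    g i = 1# - q ^ (a ℕ.+ d ℕ.* i)
    same : ∀ {i j} → i ≡ j → 1# - q ^ i ≈ 1# - q ^ j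
    same ≡.refl = refl
    i₀ : ∀ a d k → a ℕ.+ d ℕ.* (k ℕ.* 3) ≡ a ℕ.+ 3 ℕ.* d ℕ.* k
    i₀ = ℕ-solve-∀
    i₁ : ∀ a d k → a ℕ.+ d ℕ.* suc (k ℕ.* 3) ≡ a ℕ.+ d ℕ.+ 3 ℕ.* d ℕ.* k
    i₁ = ℕ-solve-∀
    i₂ : ∀ a d k → a ℕ.+ d ℕ.* suc (suc (k ℕ.* 3)) ≡ a ℕ.+ 2 ℕ.* d ℕ.+ 3 ℕ.* d ℕ.* k
    i₂ = ℕ-solve-∀
    regroup : ∀ M → product g (M ℕ.* 3) ≈ product (λ i → f a i * f (a ℕ.+ d) i * f (a ℕ.+ 2 ℕ.* d) i) M
    regroup zero = refl
    regroup (suc M) = begin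
      product g (M ℕ.* 3) * g (M ℕ.* 3) * g (suc (M ℕ.* 3)) * g (suc (suc (M ℕ.* 3)))
        ≈⟨ *-cong (*-cong (*-cong (regroup M) (same (i₀ a d M))) (same (i₁ a d M))) (same (i₂ a d M)) ⟩
      product (λ i → f a i * f (a ℕ.+ d) i * f (a ℕ.+ 2 ℕ.* d) i) M * f a M * f (a ℕ.+ d) M * f (a ℕ.+ 2 ℕ.* d) M
        ≈⟨ solve 4 (λ p x y z → p :* x :* y :* z := p :* (x :* y :* z)) refl _ _ _ _ ⟩
      product (λ i → f a i * f (a ℕ.+ d) i * f (a ℕ.+ 2 ℕ.* d) i) (suc M) ∎

  plain-sum : ∀ {p} a a′ → p ≡ a ℕ.+ a′ → 1 ≤ p → ∃ λ S → plain p a ⇓ℤ S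
  plain-sum a a′ ≡.refl pos = completeℤ (plain-null a a′ pos)

  theta-minor : ∀ {p m n e g X Y χn φm φn χm} → n ≡ m ℕ.+ e → p ≡ n ℕ.+ n ℕ.+ g → 1 ≤ e →
    theta-term p (n ℕ.+ m) ⇓ℤ X → theta-term p e ⇓ℤ Y →
    plain (p ℕ.+ p) (n ℕ.+ n) ⇓ℤ χn → plain (p ℕ.+ p) (p ℕ.+ (m ℕ.+ m)) ⇓ℤ φm →
    plain (p ℕ.+ p) (p ℕ.+ (n ℕ.+ n)) ⇓ℤ φn → plain (p ℕ.+ p) (m ℕ.+ m) ⇓ℤ χm →
    X * Y ≈ χn * φm - q ^ e * (φn * χm)
  theta-minor {m = m} {e = e} {g = g} ≡.refl ≡.refl 1≤e = theta-product m e g (ℕP.≤-trans 1≤e (ℕP.m≤n+m e m))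

  -- Each product θ(x+y) θ(x-y) is a 2 × 2 minor of the matrix with rows χ and φ, so the identity is the Plücker relation.
  weierstrass : ∀ d z y x g → 1 ≤ z → 1 ≤ y → 1 ≤ x →
    let b = d ℕ.+ z ; c = b ℕ.+ y ; a = c ℕ.+ x ; p = (a ℕ.+ a) ℕ.+ g in
    (J : ℕ → Carrier) → (∀ n n′ → 1 ≤ n → 1 ≤ n′ → n ℕ.+ n′ ≡ p → theta-term p n ⇓ℤ J n) →
    J (a ℕ.+ b) * J (y ℕ.+ x) * (J (c ℕ.+ d) * J (z ℕ.+ y)) ≈
    J (a ℕ.+ d) * J (z ℕ.+ (y ℕ.+ x)) * (J (c ℕ.+ b) * J y) + q ^ y * (J (a ℕ.+ c) * J x * (J (b ℕ.+ d) * J z))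
  weierstrass d z y x g 1≤z 1≤y 1≤x J θ = begin
    J (a ℕ.+ b) * J (y ℕ.+ x) * (J (c ℕ.+ d) * J (z ℕ.+ y))
      ≈⟨ *-cong (trans (minor b (y ℕ.+ x) (ℕP.+-assoc b y x) (ℕP.≤-trans 1≤y (ℕP.m≤m+n y x)) g ≡.refl a≤a b≤a) (minus (q^+ y x)))
                (trans (minor d (z ℕ.+ y) (ℕP.+-assoc d z y) (ℕP.≤-trans 1≤z (ℕP.m≤m+n z y)) (x ℕ.+ x ℕ.+ g) p≡c c≤a d≤a) (minus (q^+ z y))) ⟩
    (χ a a≤a * φ b b≤a - Y * X * (φ a a≤a * χ b b≤a)) * (χ c c≤a * φ d d≤a - Z * Y * (φ c c≤a * χ d d≤a))
      ≈⟨ solve 11 (λ a A b B c C d D X Y Z → (a :* B :- Y :* X :* (A :* b)) :* (c :* D :- Z :* Y :* (C :* d)) :=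
           (a :* D :- Z :* (Y :* X) :* (A :* d)) :* (c :* B :- Y :* (C :* b)) :+ Y :* ((a :* C :- X :* (A :* c)) :* (b :* D :- Z :* (B :* d)))) refl
         (χ a a≤a) (φ a a≤a) (χ b b≤a) (φ b b≤a) (χ c c≤a) (φ c c≤a) (χ d d≤a) (φ d d≤a) X Y Z ⟩
    (χ a a≤a * φ d d≤a - Z * (Y * X) * (φ a a≤a * χ d d≤a)) * (χ c c≤a * φ b b≤a - Y * (φ c c≤a * χ b b≤a)) +
      Y * ((χ a a≤a * φ c c≤a - X * (φ a a≤a * χ c c≤a)) * (χ b b≤a * φ d d≤a - Z * (φ b b≤a * χ d d≤a)))
      ≈⟨ +-cong
          (*-cong (trans (minor d (z ℕ.+ (y ℕ.+ x)) a≡d+ (ℕP.≤-trans 1≤z (ℕP.m≤m+n z _)) g ≡.refl a≤a d≤a) (minus (trans (q^+ z (y ℕ.+ x)) (*-congˡ (q^+ y x)))))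
                  (minor b y ≡.refl 1≤y (x ℕ.+ x ℕ.+ g) p≡c c≤a b≤a))
          (*-congˡ (*-cong (minor c x ≡.refl 1≤x g ≡.refl a≤a c≤a)
                           (minor d z ≡.refl 1≤z (y ℕ.+ y ℕ.+ (x ℕ.+ x) ℕ.+ g) p≡b b≤a d≤a))) ⟨
    J (a ℕ.+ d) * J (z ℕ.+ (y ℕ.+ x)) * (J (c ℕ.+ b) * J y) + q ^ y * (J (a ℕ.+ c) * J x * (J (b ℕ.+ d) * J z)) ∎
    where
    b = d ℕ.+ z
    c = b ℕ.+ y
    a = c ℕ.+ x
    p = (a ℕ.+ a) ℕ.+ g
    X = q ^ x
    Y = q ^ y
    Z = q ^ z
    q^+ : ∀ m n → q ^ (m ℕ.+ n) ≈ q ^ m * q ^ n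
    q^+ = ^-homo-* q
    minus : ∀ {u u′ v w} → u ≈ u′ → v - u * w ≈ v - u′ * w
    minus e = +-congˡ (-‿cong (*-congʳ e))
    a≡d+ : a ≡ d ℕ.+ (z ℕ.+ (y ℕ.+ x))
    a≡d+ = lemma d z y x
      where
      lemma : ∀ d z y x → d ℕ.+ z ℕ.+ y ℕ.+ x ≡ d ℕ.+ (z ℕ.+ (y ℕ.+ x))
      lemma = ℕ-solve-∀
    p≡c : p ≡ c ℕ.+ c ℕ.+ (x ℕ.+ x ℕ.+ g)
    p≡c = lemma c x g
      where
      lemma : ∀ c x g → c ℕ.+ x ℕ.+ (c ℕ.+ x) ℕ.+ g ≡ c ℕ.+ c ℕ.+ (x ℕ.+ x ℕ.+ g)
      lemma = ℕ-solve-∀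
    p≡b : p ≡ b ℕ.+ b ℕ.+ (y ℕ.+ y ℕ.+ (x ℕ.+ x) ℕ.+ g)
    p≡b = lemma b y x g
      where
      lemma : ∀ b y x g → b ℕ.+ y ℕ.+ x ℕ.+ (b ℕ.+ y ℕ.+ x) ℕ.+ g ≡ b ℕ.+ b ℕ.+ (y ℕ.+ y ℕ.+ (x ℕ.+ x) ℕ.+ g)
      lemma = ℕ-solve-∀
    1≤a : 1 ≤ a
    1≤a = ℕP.≤-trans 1≤x (ℕP.m≤n+m x c)
    a≤a : a ≤ a
    a≤a = ℕP.≤-refl
    c≤a : c ≤ a
    c≤a = ℕP.m≤m+n c x
    b≤a : b ≤ a
    b≤a = ℕP.≤-trans (ℕP.m≤m+n b y) c≤a
    d≤a : d ≤ a
    d≤a = ℕP.≤-trans (ℕP.m≤m+n d z) b≤a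
    2p : 1 ≤ p ℕ.+ p
    2p = ℕP.≤-trans 1≤a (ℕP.≤-trans (ℕP.≤-trans (ℕP.m≤m+n a a) (ℕP.m≤m+n _ g)) (ℕP.m≤m+n p p))
    χ-sum : ∀ m → m ≤ a → ∃ λ S → plain (p ℕ.+ p) (m ℕ.+ m) ⇓ℤ S
    χ-sum m h = plain-sum (m ℕ.+ m) (p ℕ.+ (a ∸ m ℕ.+ (a ∸ m)) ℕ.+ g) (≡.trans (≡.cong (λ t → p ℕ.+ (t ℕ.+ t ℕ.+ g)) (≡.sym (ℕP.m+[n∸m]≡n h))) (lemma p m (a ∸ m) g)) 2p
      where
      lemma : ∀ p m n g → p ℕ.+ (m ℕ.+ n ℕ.+ (m ℕ.+ n) ℕ.+ g) ≡ m ℕ.+ m ℕ.+ (p ℕ.+ (n ℕ.+ n) ℕ.+ g)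
      lemma = ℕ-solve-∀
    φ-sum : ∀ m → m ≤ a → ∃ λ S → plain (p ℕ.+ p) (p ℕ.+ (m ℕ.+ m)) ⇓ℤ S
    φ-sum m h = plain-sum (p ℕ.+ (m ℕ.+ m)) (a ∸ m ℕ.+ (a ∸ m) ℕ.+ g) (≡.trans (≡.cong (λ t → p ℕ.+ (t ℕ.+ t ℕ.+ g)) (≡.sym (ℕP.m+[n∸m]≡n h))) (lemma p m (a ∸ m) g)) 2p
      where
      lemma : ∀ p m n g → p ℕ.+ (m ℕ.+ n ℕ.+ (m ℕ.+ n) ℕ.+ g) ≡ p ℕ.+ (m ℕ.+ m) ℕ.+ (n ℕ.+ n ℕ.+ g)
      lemma = ℕ-solve-∀
    χ φ : ∀ m → m ≤ a → Carrier
    χ m h = proj₁ (χ-sum m h)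
    φ m h = proj₁ (φ-sum m h)
    minor : ∀ m e {n} → n ≡ m ℕ.+ e → 1 ≤ e → ∀ g′ → p ≡ n ℕ.+ n ℕ.+ g′ → (hn : n ≤ a) (hm : m ≤ a) →
      J (n ℕ.+ m) * J e ≈ χ n hn * φ m hm - q ^ e * (φ n hn * χ m hm)
    minor m e {n} eq 1≤e g′ eq′ hn hm = theta-minor eq eq′ 1≤e
      (θ (n ℕ.+ m) (e ℕ.+ g′) (ℕP.≤-trans 1≤n (ℕP.m≤m+n n m)) (ℕP.≤-trans 1≤e (ℕP.m≤m+n e g′))
        (≡.sym (≡.trans eq′ (≡.trans (≡.cong (λ t → n ℕ.+ t ℕ.+ g′) eq) (lemma₁ n m e g′)))))
      (θ e (n ℕ.+ m ℕ.+ g′) 1≤e (ℕP.≤-trans 1≤n (ℕP.≤-trans (ℕP.m≤m+n n m) (ℕP.m≤m+n _ g′)))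
        (≡.sym (≡.trans eq′ (≡.trans (≡.cong (λ t → n ℕ.+ t ℕ.+ g′) eq) (lemma₂ n m e g′)))))
      (proj₂ (χ-sum n hn)) (proj₂ (φ-sum m hm)) (proj₂ (φ-sum n hn)) (proj₂ (χ-sum m hm))
      where
      1≤n : 1 ≤ n
      1≤n = ≡.subst (1 ≤_) (≡.sym eq) (ℕP.≤-trans 1≤e (ℕP.m≤n+m e m))
      lemma₁ : ∀ n m e g → n ℕ.+ (m ℕ.+ e) ℕ.+ g ≡ n ℕ.+ m ℕ.+ (e ℕ.+ g)
      lemma₁ = ℕ-solve-∀
      lemma₂ : ∀ n m e g → n ℕ.+ (m ℕ.+ e) ℕ.+ g ≡ e ℕ.+ (n ℕ.+ m ℕ.+ g)
      lemma₂ = ℕ-solve-∀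

  J : ℕ → ℕ → Carrier
  J p a = poch a p * poch (p ∸ a) p * poch p p

  J-sum : ∀ {p} a a′ → 1 ≤ a → 1 ≤ a′ → a ℕ.+ a′ ≡ p → theta-term p a ⇓ℤ J p a
  J-sum a a′ 1≤a 1≤a′ ≡.refl = ⇓ℤ-cong (λ _ → refl)
    (*-congʳ (*-congˡ (reflexive (≡.cong (λ k → poch k (a ℕ.+ a′)) (≡.sym (ℕP.m+n∸m≡n a a′)))))) (theta-sum a a′ 1≤a 1≤a′)

  private
    1≤ : ∀ {n} → 1 ≤ suc n
    1≤ = s≤s z≤n

  *-cancel-unit : ∀ {x y e e⁻} → e * e⁻ ≈ 1# → x * e ≈ y * e → x ≈ y
  *-cancel-unit {x} {y} {e} {e⁻} unit eq = begin
    x             ≈⟨ trans (sym (*-identityʳ x)) (*-congˡ (sym unit)) ⟩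
    x * (e * e⁻)  ≈⟨ trans (sym (*-assoc _ _ _)) (*-congʳ eq) ⟩
    y * e * e⁻    ≈⟨ trans (*-assoc _ _ _) (*-congˡ unit) ⟩
    y * 1#        ≈⟨ *-identityʳ y ⟩
    y             ∎

  module ThetaQuotients (p : ℕ) (1≤p : 1 ≤ p) where
    j : ℕ → Carrier
    j a = poch a p * poch (p ∸ a) p

    private
      e e⁻ : Carrier
      e = poch p p
      e⁻ = proj₁ (poch-invertible p p 1≤p 1≤p)
      e-unit : e * e⁻ ≈ 1#
      e-unit = proj₂ (poch-invertible p p 1≤p 1≤p)
      cancel : ∀ {x₁ x₂ x₃ x₄ y₁ y₂ y₃ y₄ z₁ z₂ z₃ z₄ Y} →
        x₁ * e * (x₂ * e) * (x₃ * e * (x₄ * e)) ≈ y₁ * e * (y₂ * e) * (y₃ * e * (y₄ * e)) + Y * (z₁ * e * (z₂ * e) * (z₃ * e * (z₄ * e))) →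
        x₁ * x₂ * (x₃ * x₄) ≈ y₁ * y₂ * (y₃ * y₄) + Y * (z₁ * z₂ * (z₃ * z₄))
      cancel {x₁} {x₂} {x₃} {x₄} {y₁} {y₂} {y₃} {y₄} {z₁} {z₂} {z₃} {z₄} {Y} h =
        *-cancel-unit {e = e * e * (e * e)} {e⁻ = e⁻ * e⁻ * (e⁻ * e⁻)}
          (trans (solve 2 (λ e i → e :* e :* (e :* e) :* (i :* i :* (i :* i)) := (e :* i) :* (e :* i) :* ((e :* i) :* (e :* i))) refl e e⁻)
            (trans (*-cong (*-cong e-unit e-unit) (*-cong e-unit e-unit)) (solve 0 (con (+ 1) :* con (+ 1) :* (con (+ 1) :* con (+ 1)) := con (+ 1)) refl)))
          (trans (quartic x₁ x₂ x₃ x₄) (trans h (trans (+-cong (sym (quartic y₁ y₂ y₃ y₄)) (trans (*-congˡ (sym (quartic z₁ z₂ z₃ z₄))) (sym (*-assoc _ _ _)))) (sym (distribʳ _ _ _)))))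
        where
        quartic : ∀ a b c d → a * b * (c * d) * (e * e * (e * e)) ≈ a * e * (b * e) * (c * e * (d * e))
        quartic a b c d = solve 5 (λ a b c d e → a :* b :* (c :* d) :* (e :* e :* (e :* e)) := a :* e :* (b :* e) :* (c :* e :* (d :* e))) refl a b c d e

    theta-relation : ∀ d z y x g → 1 ≤ z → 1 ≤ y → 1 ≤ x →
      let b = d ℕ.+ z ; c = b ℕ.+ y ; a = c ℕ.+ x in (a ℕ.+ a) ℕ.+ g ≡ p →
      j (a ℕ.+ b) * j (y ℕ.+ x) * (j (c ℕ.+ d) * j (z ℕ.+ y)) ≈
      j (a ℕ.+ d) * j (z ℕ.+ (y ℕ.+ x)) * (j (c ℕ.+ b) * j y) + q ^ y * (j (a ℕ.+ c) * j x * (j (b ℕ.+ d) * j z))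
    theta-relation d z y x g 1≤z 1≤y 1≤x ≡.refl = cancel (weierstrass d z y x g 1≤z 1≤y 1≤x (J p) (λ n n′ 1≤n 1≤n′ eq → J-sum n n′ 1≤n 1≤n′ eq))

  open ThetaQuotients 21 1≤ using (j ; theta-relation) public
  open ThetaQuotients 7 1≤ using () renaming (j to t ; theta-relation to t-relation) public

  e₂₁ e₇ : Carrier
  e₂₁ = poch 21 21
  e₇ = poch 7 7

  j-reflect : ∀ a → a ≤ 21 → j (21 ∸ a) ≈ j a
  j-reflect a p = trans (*-congˡ (reflexive (≡.cong (λ k → poch k 21) (ℕP.m∸[m∸n]≡n p)))) (*-comm _ _)
  t-reflect : ∀ a → a ≤ 7 → t (7 ∸ a) ≈ t a
  t-reflect a p = trans (*-congˡ (reflexive (≡.cong (λ k → poch k 7) (ℕP.m∸[m∸n]≡n p)))) (*-comm _ _)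
  regroup : ∀ a b c x y z → (a * b * c) * (x * y * z) ≈ (a * z) * ((x * c) * (b * y))
  regroup = solve 6 (λ a b c x y z → (a :* b :* c) :* (x :* y :* z) := (a :* z) :* ((x :* c) :* (b :* y))) refl

  t₁≈ : t 1 ≈ j 1 * (j 6 * j 8)
  t₁≈ = trans (*-cong (poch-triple 1 7 1≤ 1≤) (poch-triple 6 7 1≤ 1≤)) (regroup _ _ _ _ _ _)

  t₂≈ : t 2 ≈ j 2 * (j 5 * j 9)
  t₂≈ = trans (*-cong (poch-triple 2 7 1≤ 1≤) (poch-triple 5 7 1≤ 1≤)) (regroup _ _ _ _ _ _)

  t₃≈ : t 3 ≈ j 3 * (j 4 * j 10)
  t₃≈ = trans (*-cong (poch-triple 3 7 1≤ 1≤) (poch-triple 4 7 1≤ 1≤)) (regroup _ _ _ _ _ _)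

  e₇≈ : e₇ ≈ e₂₁ * j 7
  e₇≈ = trans (poch-triple 7 7 1≤ 1≤) (*-comm _ _)

  poch-1-1 : poch 1 1 ≈ J 3 2
  poch-1-1 = trans (poch-triple 1 1 1≤ 1≤) (*-congʳ (*-comm _ _))

  theta-inverse : ∀ p a → 1 ≤ a → 1 ≤ p ∸ a → 1 ≤ p → ∃ λ i → poch a p * poch (p ∸ a) p * i ≈ 1#
  theta-inverse p a 1≤a 1≤p∸a 1≤p = let (i , h) = poch-invertible a p 1≤a 1≤p ; (i′ , h′) = poch-invertible (p ∸ a) p 1≤p∸a 1≤p in
    i * i′ , trans (solve 4 (λ a b i i′ → a :* b :* (i :* i′) := (a :* i) :* (b :* i′)) refl _ _ _ _) (trans (*-cong h h′) (*-identityˡ _))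

  τ₁ τ₂ τ₃ α β γ : Carrier
  τ₁ = proj₁ (theta-inverse 7 1 1≤ 1≤ 1≤)
  τ₂ = proj₁ (theta-inverse 7 2 1≤ 1≤ 1≤)
  τ₃ = proj₁ (theta-inverse 7 3 1≤ 1≤ 1≤)
  α = t 2 * τ₁
  β = t 3 * τ₂
  γ = t 1 * τ₃

  t₁-unit : t 1 * τ₁ ≈ 1#
  t₁-unit = proj₂ (theta-inverse 7 1 1≤ 1≤ 1≤)
  t₂-unit : t 2 * τ₂ ≈ 1#
  t₂-unit = proj₂ (theta-inverse 7 2 1≤ 1≤ 1≤)
  t₃-unit : t 3 * τ₃ ≈ 1#
  t₃-unit = proj₂ (theta-inverse 7 3 1≤ 1≤ 1≤)

  αβγ≈1 : α * β * γ ≈ 1#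
  αβγ≈1 = trans (solve 6 (λ a b c x y z → (b :* x) :* (c :* y) :* (a :* z) := (a :* x) :* ((b :* y) :* (c :* z))) refl (t 1) (t 2) (t 3) τ₁ τ₂ τ₃)
    (trans (*-cong t₁-unit (*-cong t₂-unit t₃-unit)) (solve 0 (con (+ 1) :* (con (+ 1) :* con (+ 1)) := con (+ 1)) refl))

  private
    divide : ∀ {x y t τ} → t * τ ≈ 1# → x * t ≈ y → x ≈ y * τ
    divide {x} {y} {t} {τ} unit h = trans (trans (sym (*-identityʳ x)) (*-congˡ (sym unit))) (trans (sym (*-assoc _ _ _)) (*-congʳ h))
    power₁ : q ^ 1 ≈ q
    power₁ = *-identityʳ q
    power₂ : q ^ 2 ≈ q * q
    power₂ = *-congˡ (*-identityʳ q)

  -- The Klein quartic t₂³t₃ = t₁t₃³ + q t₁³t₂ in the coordinates β, γ.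
  α≈ : α ≈ β * β + q * (β * (γ * γ))
  α≈ = begin
    t 2 * τ₁
      ≈⟨ divide {τ = τ₂ * τ₂ * τ₃} unit (solve 4 (λ a b c x → b :* x :* (b :* b :* c) := b :* b :* (b :* c) :* x) refl (t 1) (t 2) (t 3) τ₁) ⟩
    t 2 * t 2 * (t 2 * t 3) * τ₁ * (τ₂ * τ₂ * τ₃)
      ≈⟨ *-congʳ (*-congʳ klein) ⟩
    (t 3 * t 3 * (t 3 * t 1) + q * (t 2 * t 1 * (t 1 * t 1))) * τ₁ * (τ₂ * τ₂ * τ₃)
      ≈⟨ solve 7 (λ a b c x y z q → (c :* c :* (c :* a) :+ q :* (b :* a :* (a :* a))) :* x :* (y :* y :* z) :=
           (c :* y) :* (c :* y) :* ((a :* x) :* (c :* z)) :+ q :* (a :* y :* (a :* z) :* ((a :* x) :* (b :* y)))) refl (t 1) (t 2) (t 3) τ₁ τ₂ τ₃ q ⟩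
    β * β * ((t 1 * τ₁) * (t 3 * τ₃)) + q * (t 1 * τ₂ * (t 1 * τ₃) * ((t 1 * τ₁) * (t 2 * τ₂)))
      ≈⟨ +-cong (*-congˡ (*-cong t₁-unit t₃-unit)) (*-congˡ (*-cong (*-congʳ (sym βγ)) (*-cong t₁-unit t₂-unit))) ⟩
    β * β * (1# * 1#) + q * (β * γ * γ * (1# * 1#))
      ≈⟨ solve 3 (λ b g q → b :* b :* (con (+ 1) :* con (+ 1)) :+ q :* (b :* g :* g :* (con (+ 1) :* con (+ 1))) := b :* b :+ q :* (b :* (g :* g))) refl β γ q ⟩
    β * β + q * (β * (γ * γ)) ∎
    where
    unit : t 2 * t 2 * t 3 * (τ₂ * τ₂ * τ₃) ≈ 1#
    unit = trans (solve 4 (λ b c y z → b :* b :* c :* (y :* y :* z) := (b :* y) :* ((b :* y) :* (c :* z))) refl (t 2) (t 3) τ₂ τ₃)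
      (trans (*-cong t₂-unit (*-cong t₂-unit t₃-unit)) (solve 0 (con (+ 1) :* (con (+ 1) :* con (+ 1)) := con (+ 1)) refl))
    βγ : β * γ ≈ t 1 * τ₂
    βγ = trans (solve 4 (λ a c y z → (c :* y) :* (a :* z) := a :* y :* (c :* z)) refl (t 1) (t 3) τ₂ τ₃) (trans (*-congˡ t₃-unit) (*-identityʳ _))
    klein : t 2 * t 2 * (t 2 * t 3) ≈ t 3 * t 3 * (t 3 * t 1) + q * (t 2 * t 1 * (t 1 * t 1))
    klein = begin
      t 2 * t 2 * (t 2 * t 3)       ≈⟨ *-congˡ (*-congˡ (sym (t-reflect 3 (ℕ.s≤s (ℕ.s≤s (ℕ.s≤s z≤n)))))) ⟩
      t 2 * t 2 * (t 2 * t 4)       ≈⟨ solve 2 (λ b d → b :* b :* (b :* d) := d :* b :* (b :* b)) refl (t 2) (t 4) ⟩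
      t 4 * t 2 * (t 2 * t 2)       ≈⟨ t-relation 0 1 1 1 1 1≤ 1≤ 1≤ ≡.refl ⟩
      t 3 * t 3 * (t 3 * t 1) + q ^ 1 * (t 5 * t 1 * (t 1 * t 1))
        ≈⟨ +-congˡ (*-cong power₁ (*-congʳ (*-congʳ (t-reflect 2 (ℕ.s≤s (ℕ.s≤s z≤n)))))) ⟩
      t 3 * t 3 * (t 3 * t 1) + q * (t 2 * t 1 * (t 1 * t 1)) ∎

  ≤21 : ∀ a {b} → a ℕ.+ b ≡ 21 → a ≤ 21
  ≤21 a {b} h = ≡.subst (a ≤_) h (ℕP.m≤m+n a b)

  j₄≈ : j 4 ≈ q * (β * j 1) + β * (γ * j 5)
  j₄≈ = trans (divide t₂-unit relation) (trans
    (solve 6 (λ a c y j₁ j₅ q → (q :* j₁ :* c :+ j₅ :* a) :* y := q :* (c :* y :* j₁) :+ a :* y :* j₅) refl (t 1) (t 3) τ₂ (j 1) (j 5) q)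
    (+-congˡ (begin
      t 1 * τ₂ * j 5                     ≈⟨ trans (sym (*-identityʳ _)) (*-congˡ (sym t₃-unit)) ⟩
      t 1 * τ₂ * j 5 * (t 3 * τ₃)        ≈⟨ solve 5 (λ a c y j₅ z → a :* y :* j₅ :* (c :* z) := c :* y :* (a :* z :* j₅)) refl (t 1) (t 3) τ₂ (j 5) τ₃ ⟩
      β * (γ * j 5)                      ∎)))
    where
    relation : j 4 * t 2 ≈ q * j 1 * t 3 + j 5 * t 1
    relation = begin
      j 4 * t 2                             ≈⟨ *-congˡ t₂≈ ⟩
      j 4 * (j 2 * (j 5 * j 9))             ≈⟨ solve 4 (λ a b c d → a :* (b :* (c :* d)) := d :* c :* (a :* b)) refl (j 4) (j 2) (j 5) (j 9) ⟩
      j 9 * j 5 * (j 4 * j 2)               ≈⟨ theta-relation 1 1 1 4 7 1≤ 1≤ 1≤ ≡.refl ⟩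
      j 8 * j 6 * (j 5 * j 1) + q ^ 1 * (j 10 * j 4 * (j 3 * j 1))
        ≈⟨ +-congˡ (*-congʳ power₁) ⟩
      j 8 * j 6 * (j 5 * j 1) + q * (j 10 * j 4 * (j 3 * j 1))
        ≈⟨ solve 8 (λ a b c d e f g q → a :* b :* (c :* d) :+ q :* (e :* f :* (g :* d)) := q :* d :* (g :* (f :* e)) :+ c :* (d :* (b :* a))) refl (j 8) (j 6) (j 5) (j 1) (j 10) (j 4) (j 3) q ⟩
      q * j 1 * (j 3 * (j 4 * j 10)) + j 5 * (j 1 * (j 6 * j 8))
        ≈⟨ +-cong (*-congˡ (sym t₃≈)) (*-congˡ (sym t₁≈)) ⟩
      q * j 1 * t 3 + j 5 * t 1             ∎

  quintuple-α : j 10 + q * j 4 ≈ j 7 * α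
  quintuple-α = trans (divide t₁-unit relation) (*-assoc _ _ _)
    where
    relation : (j 10 + q * j 4) * t 1 ≈ j 7 * t 2
    relation = sym (begin
      j 7 * t 2                             ≈⟨ *-congˡ t₂≈ ⟩
      j 7 * (j 2 * (j 5 * j 9))             ≈⟨ *-congˡ (*-congˡ (*-congˡ (sym (j-reflect 9 (≤21 9 ≡.refl))))) ⟩
      j 7 * (j 2 * (j 5 * j 12))            ≈⟨ solve 4 (λ a b c d → a :* (b :* (c :* d)) := d :* b :* (a :* c)) refl (j 7) (j 2) (j 5) (j 12) ⟩
      j 12 * j 2 * (j 7 * j 5)              ≈⟨ theta-relation 1 4 1 1 7 1≤ 1≤ 1≤ ≡.refl ⟩
      j 8 * j 6 * (j 11 * j 1) + q ^ 1 * (j 13 * j 1 * (j 6 * j 4))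
        ≈⟨ +-cong (*-congˡ (*-congʳ (j-reflect 10 (≤21 10 ≡.refl)))) (*-cong power₁ (*-congʳ (*-congʳ (j-reflect 8 (≤21 8 ≡.refl))))) ⟩
      j 8 * j 6 * (j 10 * j 1) + q * (j 8 * j 1 * (j 6 * j 4))
        ≈⟨ solve 6 (λ a b c d e q → a :* b :* (c :* d) :+ q :* (a :* d :* (b :* e)) := (c :+ q :* e) :* (d :* (b :* a))) refl (j 8) (j 6) (j 10) (j 1) (j 4) q ⟩
      (j 10 + q * j 4) * (j 1 * (j 6 * j 8)) ≈⟨ *-congˡ t₁≈ ⟨
      (j 10 + q * j 4) * t 1                ∎)

  quintuple-β : j 8 + q * q * j 1 ≈ j 7 * β
  quintuple-β = trans (divide t₂-unit relation) (*-assoc _ _ _)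
    where
    relation : (j 8 + q * q * j 1) * t 2 ≈ j 7 * t 3
    relation = sym (begin
      j 7 * t 3                             ≈⟨ *-congˡ t₃≈ ⟩
      j 7 * (j 3 * (j 4 * j 10))            ≈⟨ solve 4 (λ a b c d → a :* (b :* (c :* d)) := d :* c :* (a :* b)) refl (j 7) (j 3) (j 4) (j 10) ⟩
      j 10 * j 4 * (j 7 * j 3)              ≈⟨ theta-relation 2 1 2 2 7 1≤ 1≤ 1≤ ≡.refl ⟩
      j 9 * j 5 * (j 8 * j 2) + q ^ 2 * (j 12 * j 2 * (j 5 * j 1))
        ≈⟨ +-congˡ (*-cong power₂ (*-congʳ (*-congʳ (j-reflect 9 (≤21 9 ≡.refl))))) ⟩
      j 9 * j 5 * (j 8 * j 2) + q * q * (j 9 * j 2 * (j 5 * j 1))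
        ≈⟨ solve 6 (λ a b c d e q → a :* b :* (c :* d) :+ q :* q :* (a :* d :* (b :* e)) := (c :+ q :* q :* e) :* (d :* (b :* a))) refl (j 9) (j 5) (j 8) (j 2) (j 1) q ⟩
      (j 8 + q * q * j 1) * (j 2 * (j 5 * j 9)) ≈⟨ *-congˡ t₂≈ ⟨
      (j 8 + q * q * j 1) * t 2             ∎)

  quintuple-γ : j 5 - q * j 2 ≈ j 7 * γ
  quintuple-γ = trans (divide t₃-unit relation) (*-assoc _ _ _)
    where
    product-relation : j 5 * t 3 ≈ j 7 * t 1 + q * (j 2 * t 3)
    product-relation = begin
      j 5 * t 3                             ≈⟨ *-congˡ t₃≈ ⟩
      j 5 * (j 3 * (j 4 * j 10))            ≈⟨ solve 4 (λ a b c d → a :* (b :* (c :* d)) := d :* c :* (a :* b)) refl (j 5) (j 3) (j 4) (j 10) ⟩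
      j 10 * j 4 * (j 5 * j 3)              ≈⟨ theta-relation 1 2 1 3 7 1≤ 1≤ 1≤ ≡.refl ⟩
      j 8 * j 6 * (j 7 * j 1) + q ^ 1 * (j 11 * j 3 * (j 4 * j 2))
        ≈⟨ +-congˡ (*-cong power₁ (*-congʳ (*-congʳ (j-reflect 10 (≤21 10 ≡.refl))))) ⟩
      j 8 * j 6 * (j 7 * j 1) + q * (j 10 * j 3 * (j 4 * j 2))
        ≈⟨ solve 9 (λ a b c d e f g h q → a :* b :* (c :* d) :+ q :* (e :* f :* (g :* h)) := c :* (d :* (b :* a)) :+ q :* (h :* (f :* (g :* e)))) refl
             (j 8) (j 6) (j 7) (j 1) (j 10) (j 3) (j 4) (j 2) q ⟩
      j 7 * (j 1 * (j 6 * j 8)) + q * (j 2 * (j 3 * (j 4 * j 10)))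
        ≈⟨ +-cong (*-congˡ t₁≈) (*-congˡ (*-congˡ t₃≈)) ⟨
      j 7 * t 1 + q * (j 2 * t 3)           ∎
    relation : (j 5 - q * j 2) * t 3 ≈ j 7 * t 1
    relation = begin
      (j 5 - q * j 2) * t 3                        ≈⟨ solve 4 (λ a b c q → (a :- q :* b) :* c := a :* c :- q :* (b :* c)) refl (j 5) (j 2) (t 3) q ⟩
      j 5 * t 3 - q * (j 2 * t 3)                  ≈⟨ +-congʳ product-relation ⟩
      j 7 * t 1 + q * (j 2 * t 3) - q * (j 2 * t 3) ≈⟨ solve 2 (λ a b → a :+ b :- b := a) refl _ _ ⟩
      j 7 * t 1                                    ∎

module Dissection {c ℓ} (A : SeriesAlgebra c ℓ) where

  open SeriesAlgebra A
  open RingTools commutativeRing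
  open ZSums filteredRing
  open Monomials A
  open ThetaFunctions A
  open Relation.Binary.Reasoning.Setoid setoid

  dil-^ : ∀ k → dil (q ^ k) ≈ q ^ (7 ℕ.* k)
  dil-^ k = trans (go k) (^-assocʳ q 7 k)
    where
    go : ∀ k → dil (q ^ k) ≈ (q ^ 7) ^ k
    go zero = dil-1
    go (suc k) = trans (dil-* q (q ^ k)) (*-cong dil-q (go k))

  dil-sign : ∀ n → dil (sign n) ≈ sign n
  dil-sign (+ zero) = dil-1
  dil-sign (+ suc k) = trans (dil-neg _) (-‿cong (dil-sign (+ k)))
  dil-sign -[1+ zero ] = trans (dil-neg 1#) (-‿cong dil-1)
  dil-sign -[1+ suc k ] = trans (dil-neg _) (-‿cong (dil-sign -[1+ k ]))

  dil-q^ℤ : ∀ {i} → + 0 ℤ.≤ i → dil (q^ℤ i) ≈ q^ℤ (+ 7 ℤ.* i)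
  dil-q^ℤ {+ k} _ = trans (dil-^ k) (reflexive (≡.cong q^ℤ (ℤP.pos-* 7 k)))

  dil-⇓ : ∀ {T S} → T ⇓ S → (λ k → dil (T k)) ⇓ dil S
  dil-⇓ {T} p N = let (B , h) = p N in B , λ M q → ≈[]-trans (≈⇒≈[] (partials M)) (dil-cong[] (h M q))
    where
    partials : ∀ M → partial (λ k → dil (T k)) M ≈ dil (partial T M)
    partials zero = sym dil-0
    partials (suc M) = trans (+-congʳ (partials M)) (sym (dil-+ _ _))

  dil-⇓ℤ : ∀ {T S} → T ⇓ℤ S → (λ n → dil (T n)) ⇓ℤ dil S
  dil-⇓ℤ p .null N = let (B , h) = null p N in B , λ n q → ≈[]-trans (dil-cong[] (h n q)) (≈⇒≈[] dil-0)
  dil-⇓ℤ p .pairs = ⇓-cong (λ k → dil-+ _ _) refl (dil-⇓ (pairs p))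

  residue : ℕ → ℤ
  residue r = + r ℤ.+ -[1+ 2 ]

  dissection : ∀ (s : ℤ → Carrier) (E : ℤ → ℤ) p (a a′ ε : ℕ → ℕ) (Θ : ℕ → Carrier) {S} →
    (∀ n → s (+ 7 ℤ.+ n) ≈ - s n) →
    (∀ r → r < 7 → a r ℕ.+ a′ r ≡ p) →
    (∀ r → r < 7 → ∀ k → E (k ℤ.* + 7 ℤ.+ residue r) ≡ + ε r ℤ.+ + 7 ℤ.* exponent (+ p) (+ a r) k) →
    (∀ r → r < 7 → theta-term p (a r) ⇓ℤ Θ r) →
    (λ n → s n * q^ℤ (E n)) ⇓ℤ S →
    S ≈ partial (λ r → s (residue r) * (q ^ ε r * dil (Θ r))) 7
  dissection s E p a a′ ε Θ anti complementary exponents sums total =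
    ⇓ℤ-split 6 _ (⇓ℤ-shift -[1+ 2 ] total) λ r r<7 → ⇓ℤ-cong (λ k → sym (term r r<7 k)) (*-assoc _ _ _) (⇓ℤ-*ˡ (s (residue r) * q ^ ε r) (dil-⇓ℤ (sums r r<7)))
    where
    term : ∀ r → r < 7 → ∀ k → s (-[1+ 2 ] ℤ.+ (k ℤ.* + 7 ℤ.+ + r)) * q^ℤ (E (-[1+ 2 ] ℤ.+ (k ℤ.* + 7 ℤ.+ + r))) ≈ (s (residue r) * q ^ ε r) * dil (theta-term p (a r) k)
    term r r<7 k = begin
      s (-[1+ 2 ] ℤ.+ (k ℤ.* + 7 ℤ.+ + r)) * q^ℤ (E (-[1+ 2 ] ℤ.+ (k ℤ.* + 7 ℤ.+ + r)))
        ≡⟨ ≡.cong (λ n → s n * q^ℤ (E n)) (index k (+ r)) ⟩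
      s (k ℤ.* + 7 ℤ.+ residue r) * q^ℤ (E (k ℤ.* + 7 ℤ.+ residue r))
        ≈⟨ *-cong (antiperiodic s (+ 7) anti k (residue r)) (reflexive (≡.cong q^ℤ (exponents r r<7 k))) ⟩
      sign k * s (residue r) * q^ℤ (+ ε r ℤ.+ + 7 ℤ.* x)
        ≈⟨ *-congˡ (trans (q^ℤ-+ (ℤ.+≤+ z≤n) (7x≥0 x≥0)) (*-congˡ (sym (dil-q^ℤ x≥0)))) ⟩
      sign k * s (residue r) * (q ^ ε r * dil (q^ℤ x))
        ≈⟨ solve 4 (λ a b c d → a :* b :* (c :* d) := b :* c :* (a :* d)) refl _ _ _ _ ⟩
      s (residue r) * q ^ ε r * (sign k * dil (q^ℤ x))
        ≈⟨ *-congˡ (trans (dil-* _ _) (*-congʳ (dil-sign k))) ⟨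
      s (residue r) * q ^ ε r * dil (theta-term p (a r) k) ∎
      where
      x = exponent (+ p) (+ a r) k
      x≥0 : + 0 ℤ.≤ x
      x≥0 = ≡.subst (λ p → + 0 ℤ.≤ exponent (+ p) (+ a r) k) (complementary r r<7) (exponent≥0 (a r) (a′ r) k)
      7x≥0 : ∀ {x} → + 0 ℤ.≤ x → + 0 ℤ.≤ + 7 ℤ.* x
      7x≥0 {+ n} _ = ≡.subst (+ 0 ℤ.≤_) (ℤP.pos-* 7 n) (ℤ.+≤+ z≤n)
      index : ∀ k r → -[1+ 2 ] ℤ.+ (k ℤ.* + 7 ℤ.+ r) ≡ k ℤ.* + 7 ℤ.+ (r ℤ.+ -[1+ 2 ])
      index = solve-∀

  tri-sevenfold : ∀ k x → tri (k ℤ.* + 7 ℤ.+ x) ≡ + 49 ℤ.* tri k ℤ.+ + 21 ℤ.* k ℤ.+ tri x ℤ.+ k ℤ.* + 7 ℤ.* x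
  tri-sevenfold k x = ≡.trans (tri-+ (k ℤ.* + 7) x) (≡.cong (λ t → t ℤ.+ tri x ℤ.+ k ℤ.* + 7 ℤ.* x) multiple)
    where
    split : ∀ k → k ℤ.* + 7 ≡ k ℤ.* + 3 ℤ.+ k ℤ.* + 3 ℤ.+ k
    split = solve-∀
    collect : ∀ t k → (+ 3 ℤ.* t ℤ.+ + 3 ℤ.* (k ℤ.* k)) ℤ.+ (+ 3 ℤ.* t ℤ.+ + 3 ℤ.* (k ℤ.* k)) ℤ.+ k ℤ.* + 3 ℤ.* (k ℤ.* + 3) ℤ.+ t ℤ.+ (k ℤ.* + 3 ℤ.+ k ℤ.* + 3) ℤ.* k ≡
      + 49 ℤ.* t ℤ.+ + 21 ℤ.* k ℤ.+ ℤ.- + 21 ℤ.* (t ℤ.+ t ℤ.- (k ℤ.* k ℤ.- k))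
    collect = solve-∀
    multiple : tri (k ℤ.* + 7) ≡ + 49 ℤ.* tri k ℤ.+ + 21 ℤ.* k
    multiple = modulo-tri (ℤ.- + 21) k (≡.trans (≡.cong tri (split k)) (≡.trans (tri-+ (k ℤ.* + 3 ℤ.+ k ℤ.* + 3) k)
      (≡.trans (≡.cong (λ t → t ℤ.+ tri k ℤ.+ (k ℤ.* + 3 ℤ.+ k ℤ.* + 3) ℤ.* k)
        (≡.trans (tri-+ (k ℤ.* + 3) (k ℤ.* + 3)) (≡.cong (λ t → t ℤ.+ t ℤ.+ k ℤ.* + 3 ℤ.* (k ℤ.* + 3)) (tri-triple k)))) (collect (tri k) k))))

  theta-offset pentagonal-offset : ℕ → ℕ
  theta-offset r = ℤ.∣ tri (residue r) ∣
  pentagonal-offset r = ℤ.∣ exponent (+ 3) (+ 2) (residue r) ∣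

  theta-dissection : ∀ (s : ℤ → Carrier) {S} → (∀ n → s (+ 7 ℤ.+ n) ≈ - s n) → (λ n → s n * q^ℤ (tri n)) ⇓ℤ S →
    S ≈ partial (λ r → s (residue (suc r)) * (q ^ theta-offset (suc r) * dil (J 7 (suc r)))) 6
  theta-dissection s {S} anti total = begin
    S ≈⟨ dissection s tri 7 (λ r → r) (7 ∸_) theta-offset Θ anti (λ r r<7 → ℕP.m+[n∸m]≡n (ℕP.<⇒≤ r<7)) exponents sums total ⟩
    partial (λ r → s (residue r) * (q ^ theta-offset r * dil (Θ r))) 7
      ≈⟨ partial-head (λ r → s (residue r) * (q ^ theta-offset r * dil (Θ r))) 6 ⟩
    s (residue 0) * (q ^ theta-offset 0 * dil 0#) + partial (λ r → s (residue (suc r)) * (q ^ theta-offset (suc r) * dil (J 7 (suc r)))) 6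
      ≈⟨ trans (+-congʳ (trans (*-congˡ (trans (*-congˡ dil-0) (zeroʳ _))) (zeroʳ _))) (+-identityˡ _) ⟩
    partial (λ r → s (residue (suc r)) * (q ^ theta-offset (suc r) * dil (J 7 (suc r)))) 6 ∎
    where
    Θ : ℕ → Carrier
    Θ zero = 0#
    Θ (suc r) = J 7 (suc r)
    vanishing : theta-term 7 0 ⇓ℤ 0#
    vanishing = ⇓ℤ-cong (λ _ → refl) (⇓ℤ-antisymmetric ½ half (+ 1) reversed (proj₂ sum)) (proj₂ sum)
      where
      sum = completeℤ (theta-null 0 7 (s≤s z≤n))
      cancel : ∀ t n → t ℤ.+ n ℤ.+ ℤ.- n ≡ t
      cancel = solve-∀
      reversed : ∀ n → theta-term 7 0 (+ 1 ℤ.- n) ≈ - theta-term 7 0 n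
      reversed n = trans
        (*-cong (trans (sign-suc (ℤ.- n)) (-‿cong (sign-neg n)))
          (reflexive (≡.cong q^ℤ (≡.cong₂ ℤ._+_ (≡.cong (+ 7 ℤ.*_) (≡.trans (tri-suc (ℤ.- n)) (≡.trans (≡.cong (ℤ._+ ℤ.- n) (tri-neg n)) (cancel (tri n) n)))) ≡.refl))))
        (solve 2 (λ x y → :- x :* y := :- (x :* y)) refl _ _)
    sums : ∀ r → r < 7 → theta-term 7 r ⇓ℤ Θ r
    sums zero _ = vanishing
    sums (suc r) r<7 = J-sum (suc r) (7 ∸ suc r) (s≤s z≤n) (ℕP.m<n⇒0<n∸m r<7) (ℕP.m+[n∸m]≡n (ℕP.<⇒≤ r<7))
    exponents : ∀ r → r < 7 → ∀ k → tri (k ℤ.* + 7 ℤ.+ residue r) ≡ + theta-offset r ℤ.+ + 7 ℤ.* exponent (+ 7) (+ r) k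
    exponents r _ k = ≡.trans (tri-sevenfold k (residue r)) (≡.trans (lemma (tri k) (tri (residue r)) k (+ r)) (≡.cong (λ t → t ℤ.+ + 7 ℤ.* exponent (+ 7) (+ r) k) (≡.sym (tri-abs (residue r)))))
      where
      lemma : ∀ t u k r → + 49 ℤ.* t ℤ.+ + 21 ℤ.* k ℤ.+ u ℤ.+ k ℤ.* + 7 ℤ.* (r ℤ.+ -[1+ 2 ]) ≡ u ℤ.+ + 7 ℤ.* (+ 7 ℤ.* t ℤ.+ r ℤ.* k)
      lemma = solve-∀

  pentagonal-dissection : ∀ (s : ℤ → Carrier) {S} → (∀ n → s (+ 7 ℤ.+ n) ≈ - s n) → (λ n → s n * q^ℤ (exponent (+ 3) (+ 2) n)) ⇓ℤ S →
    S ≈ partial (λ r → s (residue r) * (q ^ pentagonal-offset r * dil (J 21 (2 ℕ.+ 3 ℕ.* r)))) 7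
  pentagonal-dissection s {S} anti total =
    dissection s (exponent (+ 3) (+ 2)) 21 a (λ r → 21 ∸ a r) pentagonal-offset (λ r → J 21 (a r)) anti (λ r r<7 → ℕP.m+[n∸m]≡n (ℕP.<⇒≤ (bound r r<7))) exponents
      (λ r r<7 → J-sum (a r) (21 ∸ a r) (s≤s z≤n) (ℕP.m<n⇒0<n∸m (bound r r<7)) (ℕP.m+[n∸m]≡n (ℕP.<⇒≤ (bound r r<7)))) total
    where
    a : ℕ → ℕ
    a r = 2 ℕ.+ 3 ℕ.* r
    bound : ∀ r → r < 7 → a r < 21
    bound r (s≤s r≤6) = s≤s (ℕP.+-monoʳ-≤ 2 (ℕP.*-monoʳ-≤ 3 r≤6))
    abs : ∀ n → + ℤ.∣ exponent (+ 3) (+ 2) n ∣ ≡ exponent (+ 3) (+ 2) n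
    abs n = ℤP.0≤i⇒+∣i∣≡i (exponent≥0 2 1 n)
    exponents : ∀ r → r < 7 → ∀ k → exponent (+ 3) (+ 2) (k ℤ.* + 7 ℤ.+ residue r) ≡ + pentagonal-offset r ℤ.+ + 7 ℤ.* exponent (+ 21) (+ a r) k
    exponents r _ k = ≡.trans (≡.cong (λ t → + 3 ℤ.* t ℤ.+ + 2 ℤ.* (k ℤ.* + 7 ℤ.+ residue r)) (tri-sevenfold k (residue r)))
      (≡.trans (lemma (tri k) (tri (residue r)) k (+ r)) (≡.cong₂ (λ t u → t ℤ.+ + 7 ℤ.* (+ 21 ℤ.* tri k ℤ.+ u ℤ.* k)) (≡.sym (abs (residue r))) (≡.cong (λ t → + 2 ℤ.+ t) (≡.sym (ℤP.pos-* 3 r)))))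
      where
      lemma : ∀ t u k r → + 3 ℤ.* (+ 49 ℤ.* t ℤ.+ + 21 ℤ.* k ℤ.+ u ℤ.+ k ℤ.* + 7 ℤ.* (r ℤ.+ -[1+ 2 ])) ℤ.+ + 2 ℤ.* (k ℤ.* + 7 ℤ.+ (r ℤ.+ -[1+ 2 ])) ≡
        (+ 3 ℤ.* u ℤ.+ + 2 ℤ.* (r ℤ.+ -[1+ 2 ])) ℤ.+ + 7 ℤ.* (+ 21 ℤ.* t ℤ.+ (+ 2 ℤ.+ + 3 ℤ.* r) ℤ.* k)
      lemma = solve-∀

module SeventhRoot {ℓ₁ ℓ₂} (A : SeriesAlgebra ℓ₁ ℓ₂) where

  open SeriesAlgebra A
  open RingTools commutativeRing
  open ZSums filteredRing
  open Monomials A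
  open Lambert A using (module LambertProduct)
  open ThetaFunctions A
  open Dissection A
  open Relation.Binary.Reasoning.Setoid setoid

  module Period (ζ ζ⁻ : Carrier) (ζζ⁻≈1 : ζ * ζ⁻ ≈ 1#) (ζ⁷≈1 : ζ ^ 7 ≈ 1#) where

    c : Carrier
    c = ζ + ζ⁻

    open ChebyshevPolynomials commutativeRing c

    module Real (root : c * c * c + c * c - (1# + 1#) * c - 1# ≈ 0#) (dil-c : dil c ≈ c) where

      open Period7 root

      module CI = ClassIdentities commutativeRing β γ q (j 1) (j 5) (j 7) c

      infixl 6 _⟨+⟩_ _⟨-⟩_
      infixl 7 _⟨*⟩_
      _⟨+⟩_ : ∀ {x y x′ y′} → dil x ≈ x′ → dil y ≈ y′ → dil (x + y) ≈ x′ + y′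
      p ⟨+⟩ p′ = trans (dil-+ _ _) (+-cong p p′)
      _⟨*⟩_ : ∀ {x y x′ y′} → dil x ≈ x′ → dil y ≈ y′ → dil (x * y) ≈ x′ * y′
      p ⟨*⟩ p′ = trans (dil-* _ _) (*-cong p p′)
      ⟨neg⟩ : ∀ {x x′} → dil x ≈ x′ → dil (- x) ≈ - x′
      ⟨neg⟩ p = trans (dil-neg _) (-‿cong p)
      _⟨-⟩_ : ∀ {x y x′ y′} → dil x ≈ x′ → dil y ≈ y′ → dil (x - y) ≈ x′ - y′
      p ⟨-⟩ p′ = p ⟨+⟩ ⟨neg⟩ p′

      y : Carrier
      y = q ^ 7

      curve : β * β * β * γ + q * (β * β * (γ * γ * γ)) - 1# ≈ 0#
      curve = trans (+-congʳ (trans (solve 3 (λ b g q → b :* b :* b :* g :+ q :* (b :* b :* (g :* g :* g)) := (b :* b :+ q :* (b :* (g :* g))) :* b :* g) refl β γ q)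
        (trans (*-congʳ (*-congʳ (sym α≈))) αβγ≈1))) (-‿inverseʳ 1#)

      ρ̂ : ℕ → Carrier
      ρ̂ 0 = CI.ρ₀
      ρ̂ 1 = CI.ρ₁
      ρ̂ 2 = CI.ρ₂
      ρ̂ 3 = CI.ρ₃
      ρ̂ 4 = CI.ρ₄
      ρ̂ 5 = CI.ρ₅
      ρ̂ _ = CI.ρ₆

      combine : ∀ {x₀ x₁ x₂ x₃ x₄ x₅ x₆ θ θ′ a b g z₀ z₁ z₂ z₅ : Carrier} →
        x₀ + y * (θ * x₆) + y * (θ′ * x₄) ≈ a * z₀ + y * (- 1# * z₅ + g * z₂) →
        x₁ + θ * x₀ + y * (θ′ * x₅) ≈ a * z₁ + - b * z₀ →
        x₂ + θ * x₁ + y * (θ′ * x₆) ≈ a * z₂ + - b * z₁ + - 1# * z₀ →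
        x₃ + θ * x₂ + θ′ * x₀ ≈ - b * z₂ + - 1# * z₁ + y * (g * z₅) →
        x₄ + θ * x₃ + θ′ * x₁ ≈ - 1# * z₂ →
        x₅ + θ * x₄ + θ′ * x₂ ≈ a * z₅ + g * z₀ →
        x₆ + θ * x₅ + θ′ * x₃ ≈ - b * z₅ + g * z₁ →
        (0# + q ^ 0 * x₀ + q ^ 1 * x₁ + q ^ 2 * x₂ + q ^ 3 * x₃ + q ^ 4 * x₄ + q ^ 5 * x₅ + q ^ 6 * x₆) * (1# + q * θ + q ^ 3 * θ′) ≈
        (a - q * b - q ^ 2 + q ^ 5 * g) * (z₀ + q * z₁ + q ^ 2 * z₂ + q ^ 5 * z₅)
      combine {x₀} {x₁} {x₂} {x₃} {x₄} {x₅} {x₆} {θ} {θ′} {a} {b} {g} {z₀} {z₁} {z₂} {z₅} h₀ h₁ h₂ h₃ h₄ h₅ h₆ = begin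
        (0# + q ^ 0 * x₀ + q ^ 1 * x₁ + q ^ 2 * x₂ + q ^ 3 * x₃ + q ^ 4 * x₄ + q ^ 5 * x₅ + q ^ 6 * x₆) * (1# + q * θ + q ^ 3 * θ′)
          ≈⟨ solve 10 (λ q θ θ′ x₀ x₁ x₂ x₃ x₄ x₅ x₆ →
               (con (+ 0) :+ q :^ 0 :* x₀ :+ q :^ 1 :* x₁ :+ q :^ 2 :* x₂ :+ q :^ 3 :* x₃ :+ q :^ 4 :* x₄ :+ q :^ 5 :* x₅ :+ q :^ 6 :* x₆) :* (con (+ 1) :+ q :* θ :+ q :^ 3 :* θ′) :=
               (x₀ :+ q :^ 7 :* (θ :* x₆) :+ q :^ 7 :* (θ′ :* x₄)) :+ q :* (x₁ :+ θ :* x₀ :+ q :^ 7 :* (θ′ :* x₅)) :+ q :^ 2 :* (x₂ :+ θ :* x₁ :+ q :^ 7 :* (θ′ :* x₆))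
               :+ q :^ 3 :* (x₃ :+ θ :* x₂ :+ θ′ :* x₀) :+ q :^ 4 :* (x₄ :+ θ :* x₃ :+ θ′ :* x₁) :+ q :^ 5 :* (x₅ :+ θ :* x₄ :+ θ′ :* x₂) :+ q :^ 6 :* (x₆ :+ θ :* x₅ :+ θ′ :* x₃))
             refl q θ θ′ x₀ x₁ x₂ x₃ x₄ x₅ x₆ ⟩
        (x₀ + y * (θ * x₆) + y * (θ′ * x₄)) + q * (x₁ + θ * x₀ + y * (θ′ * x₅)) + q ^ 2 * (x₂ + θ * x₁ + y * (θ′ * x₆))
          + q ^ 3 * (x₃ + θ * x₂ + θ′ * x₀) + q ^ 4 * (x₄ + θ * x₃ + θ′ * x₁) + q ^ 5 * (x₅ + θ * x₄ + θ′ * x₂) + q ^ 6 * (x₆ + θ * x₅ + θ′ * x₃)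
          ≈⟨ +-cong (+-cong (+-cong (+-cong (+-cong (+-cong h₀ (*-congˡ h₁)) (*-congˡ h₂)) (*-congˡ h₃)) (*-congˡ h₄)) (*-congˡ h₅)) (*-congˡ h₆) ⟩
        (a * z₀ + y * (- 1# * z₅ + g * z₂)) + q * (a * z₁ + - b * z₀) + q ^ 2 * (a * z₂ + - b * z₁ + - 1# * z₀)
          + q ^ 3 * (- b * z₂ + - 1# * z₁ + y * (g * z₅)) + q ^ 4 * (- 1# * z₂) + q ^ 5 * (a * z₅ + g * z₀) + q ^ 6 * (- b * z₅ + g * z₁)
          ≈⟨ solve 8 (λ q a b g z₀ z₁ z₂ z₅ →
               (a :* z₀ :+ q :^ 7 :* (:- con (+ 1) :* z₅ :+ g :* z₂)) :+ q :* (a :* z₁ :+ :- b :* z₀) :+ q :^ 2 :* (a :* z₂ :+ :- b :* z₁ :+ :- con (+ 1) :* z₀)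
               :+ q :^ 3 :* (:- b :* z₂ :+ :- con (+ 1) :* z₁ :+ q :^ 7 :* (g :* z₅)) :+ q :^ 4 :* (:- con (+ 1) :* z₂) :+ q :^ 5 :* (a :* z₅ :+ g :* z₀) :+ q :^ 6 :* (:- b :* z₅ :+ g :* z₁) :=
               (a :- q :* b :- q :^ 2 :+ q :^ 5 :* g) :* (z₀ :+ q :* z₁ :+ q :^ 2 :* z₂ :+ q :^ 5 :* z₅)) refl q a b g z₀ z₁ z₂ z₅ ⟩
        (a - q * b - q ^ 2 + q ^ 5 * g) * (z₀ + q * z₁ + q ^ 2 * z₂ + q ^ 5 * z₅) ∎

      dilated-classes :
        partial (λ i → q ^ i * dil (ρ̂ i)) 7 * (1# + q * dil CI.θ₁ + q ^ 3 * dil CI.θ₃) ≈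
        (dil CI.α - q * dil β - q ^ 2 + q ^ 5 * dil γ) * (dil CI.Y₀ + q * dil CI.Y₁ + q ^ 2 * dil CI.Y₂ + q ^ 5 * dil CI.Y₅)
      dilated-classes = combine
        (transport (refl ⟨+⟩ (dil-q ⟨*⟩ (refl ⟨*⟩ refl)) ⟨+⟩ (dil-q ⟨*⟩ (refl ⟨*⟩ refl))) (CI.class-0 root curve) ((refl ⟨*⟩ refl) ⟨+⟩ (dil-q ⟨*⟩ ((minus-one ⟨*⟩ refl) ⟨+⟩ (refl ⟨*⟩ refl)))))
        (transport (refl ⟨+⟩ (refl ⟨*⟩ refl) ⟨+⟩ (dil-q ⟨*⟩ (refl ⟨*⟩ refl))) (CI.class-1 root curve) ((refl ⟨*⟩ refl) ⟨+⟩ (⟨neg⟩ refl ⟨*⟩ refl)))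
        (transport (refl ⟨+⟩ (refl ⟨*⟩ refl) ⟨+⟩ (dil-q ⟨*⟩ (refl ⟨*⟩ refl))) (CI.class-2 root curve) ((refl ⟨*⟩ refl) ⟨+⟩ (⟨neg⟩ refl ⟨*⟩ refl) ⟨+⟩ (minus-one ⟨*⟩ refl)))
        (transport (refl ⟨+⟩ (refl ⟨*⟩ refl) ⟨+⟩ (refl ⟨*⟩ refl)) (CI.class-3 root curve) ((⟨neg⟩ refl ⟨*⟩ refl) ⟨+⟩ (minus-one ⟨*⟩ refl) ⟨+⟩ (dil-q ⟨*⟩ (refl ⟨*⟩ refl))))
        (transport (refl ⟨+⟩ (refl ⟨*⟩ refl) ⟨+⟩ (refl ⟨*⟩ refl)) (CI.class-4 root curve) (minus-one ⟨*⟩ refl))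
        (transport (refl ⟨+⟩ (refl ⟨*⟩ refl) ⟨+⟩ (refl ⟨*⟩ refl)) (CI.class-5 root curve) ((refl ⟨*⟩ refl) ⟨+⟩ (refl ⟨*⟩ refl)))
        (transport (refl ⟨+⟩ (refl ⟨*⟩ refl) ⟨+⟩ (refl ⟨*⟩ refl)) (CI.class-6 root curve) ((⟨neg⟩ refl ⟨*⟩ refl) ⟨+⟩ (refl ⟨*⟩ refl)))
        where
        minus-one : dil (- 1#) ≈ - 1#
        minus-one = ⟨neg⟩ dil-1
        transport : ∀ {x x′ y y′} → dil x ≈ x′ → x ≈ y → dil y ≈ y′ → x′ ≈ y′
        transport p e p′ = trans (sym p) (trans (dil-cong e) p′)

      private
        he : Carrier
        he = dil e₂₁
        hj : ℕ → Carrier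
        hj a = dil (j a)

        dil-J21 : ∀ a → dil (J 21 a) ≈ hj a * he
        dil-J21 a = dil-* (j a) e₂₁

      pentagonal-form : ∀ (s : ℤ → Carrier) {S} → (∀ n → s (+ 7 ℤ.+ n) ≈ - s n) → (λ n → s n * q^ℤ (exponent (+ 3) (+ 2) n)) ⇓ℤ S →
        S ≈ he * ((s (+ 0) * hj 10 + s (+ 2) * (y * hj 4)) + q * (s -[1+ 0 ] * hj 8 + s (+ 3) * (y * y * hj 1))
          + q ^ 2 * (s (+ 1) * hj 7) + q ^ 5 * (s -[1+ 1 ] * hj 5 + s -[1+ 2 ] * (y * hj 2)))
      pentagonal-form s {S} anti sum = begin
        S ≈⟨ pentagonal-dissection s anti sum ⟩
        partial (λ r → s (residue r) * (q ^ pentagonal-offset r * dil (J 21 (2 ℕ.+ 3 ℕ.* r)))) 7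
          ≈⟨ +-cong (+-cong (+-cong (+-cong (+-cong (+-cong (+-congˡ (inner (dil-J21 2))) (inner (dil-J21 5))) (inner (dil-J21 8))) (inner (reflected 10 (≤21 10 ≡.refl))))
               (inner (reflected 7 (≤21 7 ≡.refl)))) (inner (reflected 4 (≤21 4 ≡.refl)))) (inner (reflected 1 (≤21 1 ≡.refl))) ⟩
        0# + s -[1+ 2 ] * (q ^ 12 * (hj 2 * he)) + s -[1+ 1 ] * (q ^ 5 * (hj 5 * he)) + s -[1+ 0 ] * (q ^ 1 * (hj 8 * he)) + s (+ 0) * (q ^ 0 * (hj 10 * he))
          + s (+ 1) * (q ^ 2 * (hj 7 * he)) + s (+ 2) * (q ^ 7 * (hj 4 * he)) + s (+ 3) * (q ^ 15 * (hj 1 * he))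
          ≈⟨ solve 16 (λ q e s₀ s₁ s₂ s₃ r₁ r₂ r₃ j₁ j₂ j₄ j₅ j₇ j₈ j₁₀ →
              con (+ 0) :+ r₃ :* (q :^ 12 :* (j₂ :* e)) :+ r₂ :* (q :^ 5 :* (j₅ :* e)) :+ r₁ :* (q :^ 1 :* (j₈ :* e)) :+ s₀ :* (q :^ 0 :* (j₁₀ :* e))
                :+ s₁ :* (q :^ 2 :* (j₇ :* e)) :+ s₂ :* (q :^ 7 :* (j₄ :* e)) :+ s₃ :* (q :^ 15 :* (j₁ :* e)) :=
              e :* ((s₀ :* j₁₀ :+ s₂ :* (q :^ 7 :* j₄)) :+ q :* (r₁ :* j₈ :+ s₃ :* (q :^ 7 :* q :^ 7 :* j₁)) :+ q :^ 2 :* (s₁ :* j₇) :+ q :^ 5 :* (r₂ :* j₅ :+ r₃ :* (q :^ 7 :* j₂))))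
             refl q he (s (+ 0)) (s (+ 1)) (s (+ 2)) (s (+ 3)) (s -[1+ 0 ]) (s -[1+ 1 ]) (s -[1+ 2 ]) (hj 1) (hj 2) (hj 4) (hj 5) (hj 7) (hj 8) (hj 10) ⟩
        he * ((s (+ 0) * hj 10 + s (+ 2) * (y * hj 4)) + q * (s -[1+ 0 ] * hj 8 + s (+ 3) * (y * y * hj 1))
          + q ^ 2 * (s (+ 1) * hj 7) + q ^ 5 * (s -[1+ 1 ] * hj 5 + s -[1+ 2 ] * (y * hj 2))) ∎
        where
        inner : ∀ {x y z w} → x ≈ y → w * (z * x) ≈ w * (z * y)
        inner e = *-congˡ (*-congˡ e)
        reflected : ∀ a → a ≤ 21 → dil (J 21 (21 ∸ a)) ≈ hj a * he
        reflected a p = trans (dil-J21 (21 ∸ a)) (*-congʳ (dil-cong (j-reflect a p)))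

      he₇ : Carrier
      he₇ = dil e₇

      he₇≈ : he₇ ≈ he * hj 7
      he₇≈ = trans (dil-cong e₇≈) (dil-* _ _)

      private
        hα hβ hγ : Carrier
        hα = dil CI.α
        hβ = dil β
        hγ = dil γ

        dil-α : hj 10 + y * hj 4 ≈ hj 7 * hα
        dil-α = trans (sym (refl ⟨+⟩ (dil-q ⟨*⟩ refl))) (trans (dil-cong quintuple-α) (refl ⟨*⟩ dil-cong α≈))
        dil-β : hj 8 + y * y * hj 1 ≈ hj 7 * hβ
        dil-β = trans (sym (refl ⟨+⟩ ((dil-q ⟨*⟩ dil-q) ⟨*⟩ refl))) (trans (dil-cong quintuple-β) (refl ⟨*⟩ refl))
        dil-γ : hj 5 - y * hj 2 ≈ hj 7 * hγ
        dil-γ = trans (sym (refl ⟨-⟩ (dil-q ⟨*⟩ refl))) (trans (dil-cong quintuple-γ) (refl ⟨*⟩ refl))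

      E : Carrier
      E = poch 1 1

      E-sum : theta-term 3 2 ⇓ℤ E
      E-sum = ⇓ℤ-cong (λ _ → refl) (sym poch-1-1) (J-sum 2 1 (s≤s z≤n) (s≤s z≤n) ≡.refl)

      sign-antiperiodic : ∀ n → sign (+ 7 ℤ.+ n) ≈ - sign n
      sign-antiperiodic n = trans (sign-+ (+ 7) n) (solve 1 (λ s → :- :- :- :- :- :- :- con (+ 1) :* s := :- s) refl (sign n))

      E-form : E ≈ he₇ * (hα - q * hβ - q ^ 2 + q ^ 5 * hγ)
      E-form = begin
        E ≈⟨ pentagonal-form sign sign-antiperiodic E-sum ⟩
        he * ((1# * hj 10 + - - 1# * (y * hj 4)) + q * (- 1# * hj 8 + - - - 1# * (y * y * hj 1)) + q ^ 2 * (- 1# * hj 7) + q ^ 5 * (- - 1# * hj 5 + - - - 1# * (y * hj 2)))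
          ≈⟨ solve 9 (λ q e j₁₀ y₄ j₈ y₁ j₇ j₅ y₂ →
               e :* ((con (+ 1) :* j₁₀ :+ :- :- con (+ 1) :* y₄) :+ q :* (:- con (+ 1) :* j₈ :+ :- :- :- con (+ 1) :* y₁) :+ q :^ 2 :* (:- con (+ 1) :* j₇) :+ q :^ 5 :* (:- :- con (+ 1) :* j₅ :+ :- :- :- con (+ 1) :* y₂)) :=
               e :* ((j₁₀ :+ y₄) :- q :* (j₈ :+ y₁) :- q :^ 2 :* j₇ :+ q :^ 5 :* (j₅ :- y₂))) refl q he (hj 10) (y * hj 4) (hj 8) (y * y * hj 1) (hj 7) (hj 5) (y * hj 2) ⟩
        he * ((hj 10 + y * hj 4) - q * (hj 8 + y * y * hj 1) - q ^ 2 * hj 7 + q ^ 5 * (hj 5 - y * hj 2))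
          ≈⟨ *-congˡ (+-cong (+-congʳ (+-cong dil-α (-‿cong (*-congˡ dil-β)))) (*-congˡ dil-γ)) ⟩
        he * (hj 7 * hα - q * (hj 7 * hβ) - q ^ 2 * hj 7 + q ^ 5 * (hj 7 * hγ))
          ≈⟨ solve 6 (λ q e j a b g → e :* (j :* a :- q :* (j :* b) :- q :^ 2 :* j :+ q :^ 5 :* (j :* g)) := e :* j :* (a :- q :* b :- q :^ 2 :+ q :^ 5 :* g)) refl q he (hj 7) hα hβ hγ ⟩
        he * hj 7 * (hα - q * hβ - q ^ 2 + q ^ 5 * hγ)
          ≈⟨ *-congʳ he₇≈ ⟨
        he₇ * (hα - q * hβ - q ^ 2 + q ^ 5 * hγ) ∎

      twisted : ℤ → Carrier
      twisted n = sign n * Vℤ n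

      twisted-antiperiodic : ∀ n → twisted (+ 7 ℤ.+ n) ≈ - twisted n
      twisted-antiperiodic n = trans (*-cong (sign-antiperiodic n) (Vℤ-period n)) (solve 2 (λ x y → :- x :* y := :- (x :* y)) refl _ _)

      twisted-sum : ∃ λ Y → (λ n → twisted n * q^ℤ (exponent (+ 3) (+ 2) n)) ⇓ℤ Y
      twisted-sum = completeℤ λ N → let (B , h) = plain-null 2 1 (s≤s z≤n) N in B , λ n p → ≈[]-trans (*-cong[] (≈⇒≈[] refl) (h n p)) (≈⇒≈[] (zeroʳ _))

      Y : Carrier
      Y = proj₁ twisted-sum

      Y-pairs : (λ κ → pair (theta-term 3 2) κ * V κ) ⇓ Y
      Y-pairs = ⇓-cong (λ κ → solve 5 (λ s v x t z → s :* v :* x :+ t :* v :* z := (s :* x :+ t :* z) :* v) refl _ (V κ) _ _ _) refl (pairs (proj₂ twisted-sum))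

      dil-w : dil CI.w ≈ CI.w
      dil-w = (dil-1 ⟨+⟩ dil-1) ⟨-⟩ dil-c
      dil-c₂ : dil CI.c₂ ≈ CI.c₂
      dil-c₂ = (dil-c ⟨*⟩ dil-c) ⟨-⟩ (dil-1 ⟨+⟩ dil-1)
      dil-c₃ : dil CI.c₃ ≈ CI.c₃
      dil-c₃ = dil-1 ⟨-⟩ dil-c ⟨-⟩ (dil-c ⟨*⟩ dil-c)

      private
        dil-two : dil CI.two ≈ CI.two
        dil-two = dil-1 ⟨+⟩ dil-1

        dil-Y₀ : dil CI.Y₀ ≈ V 0 * hj 10 + V 2 * (y * hj 4)
        dil-Y₀ = begin
          dil CI.Y₀                                              ≈⟨ (refl ⟨*⟩ refl) ⟨+⟩ ((dil-c₂ ⟨-⟩ dil-c) ⟨*⟩ (dil-q ⟨*⟩ dil-cong (sym j₄≈))) ⟩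
          hj 7 * hα + (CI.c₂ - c) * (y * hj 4)                   ≈⟨ +-congʳ dil-α ⟨
          hj 10 + y * hj 4 + (CI.c₂ - c) * (y * hj 4)
            ≈⟨ solve 3 (λ c j x → j :+ x :+ (c :* c :- con (+ 2) :- c) :* x := (con (+ 1) :- con (+ 0)) :* j :+ (c :* (c :* con (+ 1) :- con (+ 0)) :- con (+ 1) :- (c :* con (+ 1) :- con (+ 0))) :* x) refl c _ _ ⟩
          V 0 * hj 10 + V 2 * (y * hj 4)                         ∎

        dil-Y₁ : dil CI.Y₁ ≈ - V 0 * hj 8 + - V 3 * (y * y * hj 1)
        dil-Y₁ = begin
          dil CI.Y₁
            ≈⟨ ⟨neg⟩ (refl ⟨*⟩ refl) ⟨+⟩ (((dil-1 ⟨+⟩ dil-two) ⟨+⟩ (dil-two ⟨*⟩ dil-c₂)) ⟨*⟩ ((dil-q ⟨*⟩ dil-q) ⟨*⟩ refl)) ⟩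
          - (hj 7 * hβ) + (CI.three + CI.two * CI.c₂) * (y * y * hj 1)
            ≈⟨ +-congʳ (-‿cong dil-β) ⟨
          - (hj 8 + y * y * hj 1) + (CI.three + CI.two * CI.c₂) * (y * y * hj 1)
            ≈⟨ solve 3 (λ c j x → :- (j :+ x) :+ (con (+ 3) :+ con (+ 2) :* (c :* c :- con (+ 2))) :* x :=
                 :- (con (+ 1) :- con (+ 0)) :* j :+ :- (c :* (c :* (c :* con (+ 1) :- con (+ 0)) :- con (+ 1)) :- (c :* con (+ 1) :- con (+ 0)) :- (c :* (c :* con (+ 1) :- con (+ 0)) :- con (+ 1))) :* x
                 :+ x :* (c :* c :* c :+ c :* c :- con (+ 2) :* c :- con (+ 1))) refl c (hj 8) (y * y * hj 1) ⟩
          - V 0 * hj 8 + - V 3 * (y * y * hj 1) + y * y * hj 1 * (c * c * c + c * c - CI.two * c - 1#)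
            ≈⟨ trans (+-congˡ (trans (*-congˡ root) (zeroʳ _))) (+-identityʳ _) ⟩
          - V 0 * hj 8 + - V 3 * (y * y * hj 1) ∎

        dil-Y₂ : dil CI.Y₂ ≈ - V 1 * hj 7
        dil-Y₂ = trans (⟨neg⟩ refl ⟨+⟩ (dil-w ⟨*⟩ refl)) (solve 2 (λ c j → :- j :+ (con (+ 2) :- c) :* j := :- (c :* con (+ 1) :- con (+ 0) :- con (+ 1)) :* j) refl c (hj 7))

        dil-Y₅ : dil CI.Y₅ ≈ V 1 * hj 5 + - V 2 * (y * hj 2)
        dil-Y₅ = begin
          dil CI.Y₅
            ≈⟨ (refl ⟨*⟩ refl) ⟨+⟩ (((dil-c ⟨-⟩ dil-two) ⟨*⟩ refl) ⟨-⟩ ((dil-c₂ ⟨-⟩ dil-c) ⟨*⟩ (refl ⟨-⟩ (refl ⟨*⟩ refl)))) ⟩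
          hj 7 * hγ + ((c - CI.two) * hj 5 - (CI.c₂ - c) * (hj 5 - hj 7 * hγ))
            ≈⟨ +-cong dil-γ (+-congˡ (-‿cong (*-congˡ (+-congˡ (-‿cong dil-γ))))) ⟨
          hj 5 - y * hj 2 + ((c - CI.two) * hj 5 - (CI.c₂ - c) * (hj 5 - (hj 5 - y * hj 2)))
            ≈⟨ solve 3 (λ c j x → j :- x :+ ((c :- con (+ 2)) :* j :- (c :* c :- con (+ 2) :- c) :* (j :- (j :- x))) :=
                 (c :* con (+ 1) :- con (+ 0) :- con (+ 1)) :* j :+ :- (c :* (c :* con (+ 1) :- con (+ 0)) :- con (+ 1) :- (c :* con (+ 1) :- con (+ 0))) :* x) refl c (hj 5) (y * hj 2) ⟩
          V 1 * hj 5 + - V 2 * (y * hj 2) ∎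

      Y-form : Y ≈ he * (dil CI.Y₀ + q * dil CI.Y₁ + q ^ 2 * dil CI.Y₂ + q ^ 5 * dil CI.Y₅)
      Y-form = begin
        Y ≈⟨ pentagonal-form twisted twisted-antiperiodic (proj₂ twisted-sum) ⟩
        he * ((1# * V 0 * hj 10 + - - 1# * V 2 * (y * hj 4)) + q * (- 1# * V 0 * hj 8 + - - - 1# * V 3 * (y * y * hj 1)) + q ^ 2 * (- 1# * V 1 * hj 7)
          + q ^ 5 * (- - 1# * V 1 * hj 5 + - - - 1# * V 2 * (y * hj 2)))
          ≈⟨ *-congˡ (+-cong (+-cong (+-cong
               (+-cong (*-congʳ (plus 0)) (*-congʳ (double 2)))
               (*-congˡ (+-cong (*-congʳ (minus 0)) (*-congʳ (triple 3)))))
               (*-congˡ (*-congʳ (minus 1))))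
               (*-congˡ (+-cong (*-congʳ (double 1)) (*-congʳ (triple 2))))) ⟩
        he * ((V 0 * hj 10 + V 2 * (y * hj 4)) + q * (- V 0 * hj 8 + - V 3 * (y * y * hj 1)) + q ^ 2 * (- V 1 * hj 7) + q ^ 5 * (V 1 * hj 5 + - V 2 * (y * hj 2)))
          ≈⟨ *-congˡ (+-cong (+-cong (+-cong dil-Y₀ (*-congˡ dil-Y₁)) (*-congˡ dil-Y₂)) (*-congˡ dil-Y₅)) ⟨
        he * (dil CI.Y₀ + q * dil CI.Y₁ + q ^ 2 * dil CI.Y₂ + q ^ 5 * dil CI.Y₅) ∎
        where
        plus : ∀ n → 1# * V n ≈ V n
        plus n = *-identityˡ _
        minus : ∀ n → - 1# * V n ≈ - V n
        minus n = solve 1 (λ v → :- con (+ 1) :* v := :- v) refl (V n)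
        double : ∀ n → - - 1# * V n ≈ V n
        double n = solve 1 (λ v → :- :- con (+ 1) :* v := v) refl (V n)
        triple : ∀ n → - - - 1# * V n ≈ - V n
        triple n = solve 1 (λ v → :- :- :- con (+ 1) :* v := :- v) refl (V n)

      private
        ι₇ : Carrier
        ι₇ = proj₁ (theta-inverse 21 7 (s≤s z≤n) (s≤s z≤n) (s≤s z≤n))
        j₇-unit : j 7 * ι₇ ≈ 1#
        j₇-unit = proj₂ (theta-inverse 21 7 (s≤s z≤n) (s≤s z≤n) (s≤s z≤n))

        inverse-unique : ∀ {x i i′} → x * i ≈ 1# → x * i′ ≈ 1# → i ≈ i′
        inverse-unique {x} {i} {i′} p p′ = begin
          i               ≈⟨ trans (sym (*-identityʳ i)) (*-congˡ (sym p′)) ⟩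
          i * (x * i′)    ≈⟨ solve 3 (λ x i i′ → i :* (x :* i′) := x :* i :* i′) refl x i i′ ⟩
          x * i * i′      ≈⟨ trans (*-congʳ p) (*-identityˡ i′) ⟩
          i′              ∎

        unit² : ∀ {a b} → a ≈ 1# → b ≈ 1# → a * b ≈ 1#
        unit² p p′ = trans (*-cong p p′) (*-identityˡ 1#)

        drop : ∀ {x u} → u ≈ 1# → x * u ≈ x
        drop p = trans (*-congˡ p) (*-identityʳ _)

        inverse₁₂ : ∀ {i} → t 1 * t 2 * i ≈ 1# → i ≈ τ₁ * τ₂
        inverse₁₂ p = inverse-unique p (trans (solve 4 (λ a b x y → a :* b :* (x :* y) := a :* x :* (b :* y)) refl _ _ _ _) (unit² t₁-unit t₂-unit))
        inverse₁₃ : ∀ {i} → t 1 * t 3 * i ≈ 1# → i ≈ τ₁ * τ₃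
        inverse₁₃ p = inverse-unique p (trans (solve 4 (λ a b x y → a :* b :* (x :* y) := a :* x :* (b :* y)) refl _ _ _ _) (unit² t₁-unit t₃-unit))
        inverse₂₃ : ∀ {i} → t 2 * t 3 * i ≈ 1# → i ≈ τ₂ * τ₃
        inverse₂₃ p = inverse-unique p (trans (solve 4 (λ a b x y → a :* b :* (x :* y) := a :* x :* (b :* y)) refl _ _ _ _) (unit² t₂-unit t₃-unit))

        inverse₆₇₈ : ∀ {i} → j 6 * j 7 * j 8 * i ≈ 1# → i ≈ ι₇ * (j 1 * τ₁)
        inverse₆₇₈ p = inverse-unique p (trans (solve 6 (λ a b c i x z → a :* b :* c :* (i :* (x :* z)) := b :* i :* (x :* (a :* c) :* z)) refl (j 6) (j 7) (j 8) ι₇ (j 1) τ₁)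
          (unit² j₇-unit (trans (*-congʳ (sym t₁≈)) t₁-unit)))
        inverse₃₇₁₀ : ∀ {i} → j 3 * j 7 * j 10 * i ≈ 1# → i ≈ ι₇ * (j 4 * τ₃)
        inverse₃₇₁₀ p = inverse-unique p (trans (solve 6 (λ a b c i x z → a :* b :* c :* (i :* (x :* z)) := b :* i :* (a :* (x :* c) :* z)) refl (j 3) (j 7) (j 10) ι₇ (j 4) τ₃)
          (unit² j₇-unit (trans (*-congʳ (sym t₃≈)) t₃-unit)))
        inverse₂₇₉ : ∀ {i} → j 2 * j 7 * j 9 * i ≈ 1# → i ≈ ι₇ * (j 5 * τ₂)
        inverse₂₇₉ p = inverse-unique p (trans (solve 6 (λ a b c i x z → a :* b :* c :* (i :* (x :* z)) := b :* i :* (a :* (x :* c) :* z)) refl (j 2) (j 7) (j 9) ι₇ (j 5) τ₂)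
          (unit² j₇-unit (trans (*-congʳ (sym t₂≈)) t₂-unit)))
        inverse₃₄₇₇ : ∀ {i} → j 3 * j 4 * j 7 * j 7 * i ≈ 1# → i ≈ ι₇ * (ι₇ * (j 10 * τ₃))
        inverse₃₄₇₇ p = inverse-unique p (trans (solve 6 (λ a b c i x z → a :* b :* c :* c :* (i :* (i :* (x :* z))) := c :* i :* (c :* i :* (a :* (b :* x) :* z))) refl (j 3) (j 4) (j 7) ι₇ (j 10) τ₃)
          (unit² j₇-unit (unit² j₇-unit (trans (*-congʳ (sym t₃≈)) t₃-unit))))
        inverse₃₇₇₁₀ : ∀ {i} → j 3 * j 7 * j 7 * j 10 * i ≈ 1# → i ≈ ι₇ * (ι₇ * (j 4 * τ₃))
        inverse₃₇₇₁₀ p = inverse-unique p (trans (solve 6 (λ a b c i x z → a :* b :* b :* c :* (i :* (i :* (x :* z))) := b :* i :* (b :* i :* (a :* (x :* c) :* z))) refl (j 3) (j 7) (j 10) ι₇ (j 4) τ₃)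
          (unit² j₇-unit (unit² j₇-unit (trans (*-congʳ (sym t₃≈)) t₃-unit))))

        CIα : CI.α ≈ t 2 * τ₁
        CIα = sym α≈
        U₂₃ : (t 2 * τ₂) * (t 3 * τ₃) ≈ 1#
        U₂₃ = unit² t₂-unit t₃-unit

      form-0 : ∀ {k i i′} → CI.w * k ≈ 1# → t 1 * t 2 * i ≈ 1# → j 6 * j 7 * j 8 * i′ ≈ 1# →
        CI.w * (e₇ * (k * (t 3 * i) - (1# + c) * (q ^ 2 * i′))) ≈ e₂₁ * (τ₃ * CI.ρ₀)
      form-0 {k} {i} {i′} wk p p′ = begin
        CI.w * (e₇ * (k * (t 3 * i) - (1# + c) * (q ^ 2 * i′)))
          ≈⟨ *-congˡ (*-cong e₇≈ (+-cong (*-congˡ (*-congˡ (inverse₁₂ p))) (-‿cong (*-congˡ (*-congˡ (inverse₆₇₈ p′)))))) ⟩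
        CI.w * (e₂₁ * j 7 * (k * (t 3 * (τ₁ * τ₂)) - (1# + c) * (q ^ 2 * (ι₇ * (j 1 * τ₁)))))
          ≈⟨ solve 11 (λ w e s k t x y c q i r → w :* (e :* s :* (k :* (t :* (x :* y)) :- (con (+ 1) :+ c) :* (q :^ 2 :* (i :* (r :* x))))) :=
               e :* (s :* (t :* (x :* y)) :* (w :* k) :- w :* (con (+ 1) :+ c) :* (q :* q :* (r :* x)) :* (s :* i))) refl CI.w e₂₁ (j 7) k (t 3) τ₁ τ₂ c q ι₇ (j 1) ⟩
        e₂₁ * (j 7 * (t 3 * (τ₁ * τ₂)) * (CI.w * k) - CI.w * (1# + c) * (q * q * (j 1 * τ₁)) * (j 7 * ι₇))
          ≈⟨ *-congˡ (+-cong (drop wk) (-‿cong (drop j₇-unit))) ⟩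
        e₂₁ * (j 7 * (t 3 * (τ₁ * τ₂)) - CI.w * (1# + c) * (q * q * (j 1 * τ₁)))
          ≈⟨ *-congˡ (+-cong (drop U₂₃) (-‿cong (drop U₂₃))) ⟨
        e₂₁ * (j 7 * (t 3 * (τ₁ * τ₂)) * ((t 2 * τ₂) * (t 3 * τ₃)) - CI.w * (1# + c) * (q * q * (j 1 * τ₁)) * ((t 2 * τ₂) * (t 3 * τ₃)))
          ≈⟨ solve 11 (λ w e s t x y c q r b z →
               e :* (s :* (t :* (x :* y)) :* ((b :* y) :* (t :* z)) :- w :* (con (+ 1) :+ c) :* (q :* q :* (r :* x)) :* ((b :* y) :* (t :* z))) :=
               e :* (z :* (s :* ((b :* x) :* ((t :* y) :* (t :* y))) :- w :* ((con (+ 1) :+ c) :* (q :* q :* (r :* ((b :* x) :* (t :* y)))))))) refl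
             CI.w e₂₁ (j 7) (t 3) τ₁ τ₂ c q (j 1) (t 2) τ₃ ⟩
        e₂₁ * (τ₃ * (j 7 * (t 2 * τ₁ * (β * β)) - CI.w * ((1# + c) * (q * q * (j 1 * (t 2 * τ₁ * β))))))
          ≈⟨ *-congˡ (*-congˡ (+-cong (*-congˡ (*-congʳ CIα)) (-‿cong (*-congˡ (*-congˡ (*-congˡ (*-congˡ (*-congʳ CIα)))))))) ⟨
        e₂₁ * (τ₃ * CI.ρ₀) ∎

      form-1 : ∀ {k i} → CI.w * k ≈ CI.K₁ → t 1 * i ≈ 1# → CI.w * (e₇ * (k * i)) ≈ e₂₁ * (τ₃ * CI.ρ₁)
      form-1 {k} {i} wk p = begin
        CI.w * (e₇ * (k * i))                                          ≈⟨ *-congˡ (*-cong e₇≈ (*-congˡ (inverse-unique p t₁-unit))) ⟩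
        CI.w * (e₂₁ * j 7 * (k * τ₁))                                  ≈⟨ solve 5 (λ w e s k x → w :* (e :* s :* (k :* x)) := e :* ((w :* k) :* (s :* x))) refl _ _ _ _ _ ⟩
        e₂₁ * (CI.w * k * (j 7 * τ₁))                                  ≈⟨ *-congˡ (*-cong wk (sym (drop U₂₃))) ⟩
        e₂₁ * (CI.K₁ * (j 7 * τ₁ * ((t 2 * τ₂) * (t 3 * τ₃))))
          ≈⟨ solve 8 (λ e k s x b y t z → e :* (k :* (s :* x :* ((b :* y) :* (t :* z)))) := e :* (z :* (k :* (s :* ((b :* x) :* (t :* y)))))) refl e₂₁ CI.K₁ (j 7) τ₁ (t 2) τ₂ (t 3) τ₃ ⟩
        e₂₁ * (τ₃ * (CI.K₁ * (j 7 * (t 2 * τ₁ * β))))                  ≈⟨ *-congˡ (*-congˡ (*-congˡ (*-congˡ (*-congʳ CIα)))) ⟨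
        e₂₁ * (τ₃ * CI.ρ₁)                                             ∎

      form-2 : ∀ {k i i′} → CI.w * k ≈ CI.K₂ → t 1 * t 3 * i ≈ 1# → j 3 * j 7 * j 10 * i′ ≈ 1# →
        CI.w * (e₇ * (k * (t 2 * i) - (1# + CI.c₂) * (q * i′))) ≈ e₂₁ * (τ₃ * CI.ρ₂)
      form-2 {k} {i} {i′} wk p p′ = begin
        CI.w * (e₇ * (k * (t 2 * i) - (1# + CI.c₂) * (q * i′)))
          ≈⟨ *-congˡ (*-cong e₇≈ (+-cong (*-congˡ (*-congˡ (inverse₁₃ p))) (-‿cong (*-congˡ (*-congˡ (inverse₃₇₁₀ p′)))))) ⟩
        CI.w * (e₂₁ * j 7 * (k * (t 2 * (τ₁ * τ₃)) - (1# + CI.c₂) * (q * (ι₇ * (j 4 * τ₃)))))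
          ≈⟨ solve 11 (λ w e s k t x z c q i r → w :* (e :* s :* (k :* (t :* (x :* z)) :- (con (+ 1) :+ c) :* (q :* (i :* (r :* z))))) :=
               e :* ((w :* k) :* (s :* (t :* x)) :* z :- w :* (con (+ 1) :+ c) :* (q :* r :* z) :* (s :* i))) refl CI.w e₂₁ (j 7) k (t 2) τ₁ τ₃ CI.c₂ q ι₇ (j 4) ⟩
        e₂₁ * (CI.w * k * (j 7 * (t 2 * τ₁)) * τ₃ - CI.w * (1# + CI.c₂) * (q * j 4 * τ₃) * (j 7 * ι₇))
          ≈⟨ *-congˡ (+-cong (*-congʳ (*-cong wk (*-congˡ (sym CIα)))) (-‿cong (trans (drop j₇-unit) (*-congˡ (*-congʳ (*-congˡ j₄≈)))))) ⟩
        e₂₁ * (CI.K₂ * (j 7 * CI.α) * τ₃ - CI.w * (1# + CI.c₂) * (q * CI.j₄ * τ₃))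
          ≈⟨ solve 8 (λ e k a z w c q r → e :* (k :* a :* z :- w :* (con (+ 1) :+ c) :* (q :* r :* z)) := e :* (z :* (k :* a :- w :* ((con (+ 1) :+ c) :* (q :* r))))) refl
             e₂₁ CI.K₂ (j 7 * CI.α) τ₃ CI.w CI.c₂ q CI.j₄ ⟩
        e₂₁ * (τ₃ * CI.ρ₂) ∎

      form-3 : ∀ {k i} → CI.w * k ≈ CI.K₃ → t 2 * i ≈ 1# → CI.w * (e₇ * (k * i)) ≈ e₂₁ * (τ₃ * CI.ρ₃)
      form-3 {k} {i} wk p = begin
        CI.w * (e₇ * (k * i))                              ≈⟨ *-congˡ (*-cong e₇≈ (*-congˡ (inverse-unique p t₂-unit))) ⟩
        CI.w * (e₂₁ * j 7 * (k * τ₂))                      ≈⟨ solve 5 (λ w e s k x → w :* (e :* s :* (k :* x)) := e :* ((w :* k) :* (s :* x))) refl _ _ _ _ _ ⟩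
        e₂₁ * (CI.w * k * (j 7 * τ₂))                      ≈⟨ *-congˡ (*-cong wk (sym (drop t₃-unit))) ⟩
        e₂₁ * (CI.K₃ * (j 7 * τ₂ * (t 3 * τ₃)))            ≈⟨ solve 6 (λ e k s y t z → e :* (k :* (s :* y :* (t :* z))) := e :* (z :* (k :* (s :* (t :* y))))) refl e₂₁ CI.K₃ (j 7) τ₂ (t 3) τ₃ ⟩
        e₂₁ * (τ₃ * CI.ρ₃)                                 ∎

      form-4 : ∀ {k i} → CI.w * k ≈ CI.K₄ → t 3 * i ≈ 1# → CI.w * (e₇ * (k * i)) ≈ e₂₁ * (τ₃ * CI.ρ₄)
      form-4 {k} {i} wk p = begin
        CI.w * (e₇ * (k * i))                              ≈⟨ *-congˡ (*-cong e₇≈ (*-congˡ (inverse-unique p t₃-unit))) ⟩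
        CI.w * (e₂₁ * j 7 * (k * τ₃))                      ≈⟨ solve 5 (λ w e s k x → w :* (e :* s :* (k :* x)) := e :* (x :* ((w :* k) :* s))) refl _ _ _ _ _ ⟩
        e₂₁ * (τ₃ * (CI.w * k * j 7))                      ≈⟨ *-congˡ (*-congˡ (*-congʳ wk)) ⟩
        e₂₁ * (τ₃ * CI.ρ₄)                                 ∎

      form-5 : ∀ {i i′} → j 3 * j 4 * j 7 * j 7 * i ≈ 1# → j 3 * j 7 * j 7 * j 10 * i′ ≈ 1# →
        CI.w * (e₇ * (c * (j 5 * i) + c * (q ^ 2 * (j 2 * i′)))) ≈ e₂₁ * (τ₃ * CI.ρ₅)
      form-5 {i} {i′} p p′ = begin
        CI.w * (e₇ * (c * (j 5 * i) + c * (q ^ 2 * (j 2 * i′))))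
          ≈⟨ *-congˡ (*-cong e₇≈ (+-cong (*-congˡ (*-congˡ (inverse₃₄₇₇ p))) (*-congˡ (*-congˡ (*-congˡ (inverse₃₇₇₁₀ p′)))))) ⟩
        CI.w * (e₂₁ * j 7 * (c * (j 5 * (ι₇ * (ι₇ * (j 10 * τ₃)))) + c * (q ^ 2 * (j 2 * (ι₇ * (ι₇ * (j 4 * τ₃)))))))
          ≈⟨ solve 11 (λ w e s c f i x z q g h → w :* (e :* s :* (c :* (f :* (i :* (i :* (x :* z)))) :+ c :* (q :^ 2 :* (g :* (i :* (i :* (h :* z))))))) :=
               e :* (z :* (w :* (c :* (((x :+ q :* h) :* f :- q :* ((f :- q :* g) :* h)) :* i)))) :* (s :* i)) refl CI.w e₂₁ (j 7) c (j 5) ι₇ (j 10) τ₃ q (j 2) (j 4) ⟩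
        e₂₁ * (τ₃ * (CI.w * (c * (((j 10 + q * j 4) * j 5 - q * ((j 5 - q * j 2) * j 4)) * ι₇)))) * (j 7 * ι₇)
          ≈⟨ drop j₇-unit ⟩
        e₂₁ * (τ₃ * (CI.w * (c * (((j 10 + q * j 4) * j 5 - q * ((j 5 - q * j 2) * j 4)) * ι₇))))
          ≈⟨ *-congˡ (*-congˡ (*-congˡ (*-congˡ (trans (*-congʳ (+-cong (*-congʳ quintuple-α) (-‿cong (*-congˡ (*-congʳ quintuple-γ)))))
              (trans (solve 7 (λ s a f q g h i → (s :* a :* f :- q :* (s :* g :* h)) :* i := (a :* f :- q :* (g :* h)) :* (s :* i)) refl (j 7) α (j 5) q γ (j 4) ι₇) (drop j₇-unit)))))) ⟩
        e₂₁ * (τ₃ * (CI.w * (c * (α * j 5 - q * (γ * j 4)))))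
          ≈⟨ *-congˡ (*-congˡ (*-congˡ (*-congˡ (+-cong (*-congʳ α≈) (-‿cong (*-congˡ (*-congˡ j₄≈))))))) ⟩
        e₂₁ * (τ₃ * CI.ρ₅) ∎

      form-6 : ∀ {k i i′} → CI.w * k ≈ CI.K₆ → t 2 * t 3 * i ≈ 1# → j 2 * j 7 * j 9 * i′ ≈ 1# →
        CI.w * (e₇ * (k * (t 1 * i) + (1# + (1# + CI.c₂)) * i′)) ≈ e₂₁ * (τ₃ * CI.ρ₆)
      form-6 {k} {i} {i′} wk p p′ = begin
        CI.w * (e₇ * (k * (t 1 * i) + (1# + (1# + CI.c₂)) * i′))
          ≈⟨ *-congˡ (*-cong e₇≈ (+-cong (*-congˡ (*-congˡ (inverse₂₃ p))) (*-congˡ (inverse₂₇₉ p′)))) ⟩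
        CI.w * (e₂₁ * j 7 * (k * (t 1 * (τ₂ * τ₃)) + (1# + (1# + CI.c₂)) * (ι₇ * (j 5 * τ₂))))
          ≈⟨ solve 10 (λ w e s k a y z c i f → w :* (e :* s :* (k :* (a :* (y :* z)) :+ (con (+ 1) :+ (con (+ 1) :+ c)) :* (i :* (f :* y)))) :=
               e :* ((w :* k) :* (s :* (a :* (y :* z))) :+ w :* (con (+ 2) :+ c) :* (f :* y) :* (s :* i))) refl CI.w e₂₁ (j 7) k (t 1) τ₂ τ₃ CI.c₂ ι₇ (j 5) ⟩
        e₂₁ * (CI.w * k * (j 7 * (t 1 * (τ₂ * τ₃))) + CI.w * (CI.two + CI.c₂) * (j 5 * τ₂) * (j 7 * ι₇))
          ≈⟨ *-congˡ (+-cong (*-cong wk (sym (drop t₃-unit))) (trans (drop j₇-unit) (sym (drop t₃-unit)))) ⟩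
        e₂₁ * (CI.K₆ * (j 7 * (t 1 * (τ₂ * τ₃)) * (t 3 * τ₃)) + CI.w * (CI.two + CI.c₂) * (j 5 * τ₂) * (t 3 * τ₃))
          ≈⟨ solve 10 (λ e k s a y z t w d f → e :* (k :* (s :* (a :* (y :* z)) :* (t :* z)) :+ w :* d :* (f :* y) :* (t :* z)) :=
               e :* (z :* (k :* (s :* ((t :* y) :* (a :* z))) :+ w :* (d :* (f :* (t :* y)))))) refl e₂₁ CI.K₆ (j 7) (t 1) τ₂ τ₃ (t 3) CI.w (CI.two + CI.c₂) (j 5) ⟩
        e₂₁ * (τ₃ * CI.ρ₆) ∎

      module LambertSeries (D : ℕ → Carrier) (D-inverse : ∀ m → D m * (1# - c * q ^ m + q ^ m * q ^ m) ≈ 1#) where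

        open LambertProduct c D D-inverse using (v; cubic; module Columns)

        private
          1≤1 : 1 ≤ 1
          1≤1 = s≤s z≤n

        E⁻ : Carrier
        E⁻ = proj₁ (poch-invertible 1 1 1≤1 1≤1)

        E-unit : E * E⁻ ≈ 1#
        E-unit = proj₂ (poch-invertible 1 1 1≤1 1≤1)

        open FiniteIdentities.QFactorial commutativeRing q u u-inverse using (factorial)

        factorial⟶E : factorial ⟶ E
        factorial⟶E = ⟶-cong (λ M → product-cong M (λ i → +-congˡ (-‿cong (reflexive (≡.cong (λ k → q ^ suc k) (ℕP.+-identityʳ i)))))) refl (poch-limit 1 1 1≤1 1≤1)

        open Products.InfiniteProducts filteredRing complete q u u-inverse E E⁻ factorial⟶E E-unit using (triple-product-limit; partial-fractions)
        module PF = FiniteIdentities.QFactorial.PartialFractions commutativeRing q u u-inverse c D D-inverse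

        ζ-sign : ℤ → Carrier
        ζ-sign (+ k) = (- ζ) ^ k
        ζ-sign -[1+ k ] = (- ζ⁻) ^ suc k

        private
          modulo-ζ : ∀ a {x} → x + a * (ζ * ζ⁻ - 1#) ≈ x
          modulo-ζ a = trans (+-congˡ (trans (*-congˡ (trans (+-congʳ ζζ⁻≈1) (-‿inverseʳ 1#))) (zeroʳ a))) (+-identityʳ _)

        ζ-sign-suc : ∀ n → ζ-sign (ℤ.suc n) ≈ - ζ * ζ-sign n
        ζ-sign-suc (+ k) = refl
        ζ-sign-suc -[1+ zero ] = sym (trans (solve 2 (λ z w → :- z :* (:- w :* con (+ 1)) := con (+ 1) :+ con (+ 1) :* (z :* w :- con (+ 1))) refl ζ ζ⁻) (modulo-ζ 1#))
        ζ-sign-suc -[1+ suc k ] = sym (trans (solve 3 (λ z w x → :- z :* (:- w :* x) := x :+ x :* (z :* w :- con (+ 1))) refl ζ ζ⁻ _) (modulo-ζ _))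

        ζ-sign-+ : ∀ k n → ζ-sign (+ k ℤ.+ n) ≈ (- ζ) ^ k * ζ-sign n
        ζ-sign-+ zero n = trans (reflexive (≡.cong ζ-sign (ℤP.+-identityˡ n))) (sym (*-identityˡ _))
        ζ-sign-+ (suc k) n = trans (reflexive (≡.cong ζ-sign (ℤP.+-assoc (+ 1) (+ k) n)))
          (trans (ζ-sign-suc (+ k ℤ.+ n)) (trans (*-congˡ (ζ-sign-+ k n)) (sym (*-assoc _ _ _))))

        ζ-sign-antiperiodic : ∀ n → ζ-sign (+ 7 ℤ.+ n) ≈ - ζ-sign n
        ζ-sign-antiperiodic n = begin
          ζ-sign (+ 7 ℤ.+ n)          ≈⟨ ζ-sign-+ 7 n ⟩
          (- ζ) ^ 7 * ζ-sign n        ≈⟨ solve 2 (λ z s → (:- z) :^ 7 :* s := :- (z :^ 7) :* s) refl ζ _ ⟩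
          - (ζ ^ 7) * ζ-sign n        ≈⟨ *-congʳ (-‿cong ζ⁷≈1) ⟩
          - 1# * ζ-sign n             ≈⟨ solve 1 (λ s → :- con (+ 1) :* s := :- s) refl _ ⟩
          - ζ-sign n                  ∎

        ζ-theta : ∃ λ S → (λ n → ζ-sign n * q^ℤ (tri n)) ⇓ℤ S
        ζ-theta = completeℤ λ N → let (B , h) = plain-null 0 1 1≤1 N in B , λ n p →
          ≈[]-trans (*-cong[] (≈⇒≈[] refl) (≈[]-trans (≈⇒≈[] (reflexive (≡.cong q^ℤ (lemma (tri n) n)))) (h n p))) (≈⇒≈[] (zeroʳ _))
          where
          lemma : ∀ t n → t ≡ + 1 ℤ.* t ℤ.+ + 0 ℤ.* n
          lemma = solve-∀

        S₀ P : Carrier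
        S₀ = proj₁ ζ-theta
        P = (1# - ζ⁻) * (S₀ * E⁻)

        -- ∏(1 - ζqⁱ)(1 - ζ⁻¹qⁱ) differs from the triple product ∏(1 - ζqⁱ)(1 - ζ⁻¹qⁱ⁺¹) by the first and the last factor.
        P-limit : product PF.δ ⟶ P
        P-limit N = let (B , h) = shifted-limit N in suc (B ℕ.+ N) , λ M p →
          ≈[]-trans (negligible-factor M (ℕP.≤-trans (s≤s (ℕP.m≤n+m N B)) p)) (h M (ℕP.≤-trans (ℕP.≤-trans (ℕP.m≤m+n B N) (ℕP.n≤1+n _)) p))
          where
          x y′ : Carrier
          x = - ζ
          y′ = - ζ⁻ * q
          power : ∀ n → (- ζ⁻ * q) ^ n ≈ (- ζ⁻) ^ n * q ^ n
          power zero = sym (*-identityˡ 1#)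
          power (suc n) = trans (*-congˡ (power n)) (solve 4 (λ a b c d → a :* b :* (c :* d) := a :* c :* (b :* d)) refl _ _ _ _)
          triple-limit : product (λ i → (1# + x * q ^ i) * (1# + y′ * q ^ i)) ⟶ S₀ * E⁻
          triple-limit = triple-product-limit
            (trans (solve 3 (λ z w q → :- z :* (:- w :* q) := q :+ q :* (z :* w :- con (+ 1))) refl ζ ζ⁻ q) (modulo-ζ q))
            (λ n → *-comm _ _)
            (λ n → begin
              (- ζ⁻) ^ suc n * q ^ (triangle (suc n) ℕ.+ suc n)            ≈⟨ *-congˡ (^-homo-* q (triangle (suc n)) (suc n)) ⟩
              (- ζ⁻) ^ suc n * (q ^ triangle (suc n) * q ^ suc n)          ≈⟨ solve 3 (λ a b c → a :* (b :* c) := b :* (a :* c)) refl _ _ _ ⟩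
              q ^ triangle (suc n) * ((- ζ⁻) ^ suc n * q ^ suc n)          ≈⟨ *-congˡ (power (suc n)) ⟨
              q ^ triangle (suc n) * y′ ^ suc n                            ∎)
            (proj₂ ζ-theta)
          rotate : ∀ M → (1# - ζ⁻) * product (λ i → (1# + x * q ^ i) * (1# + y′ * q ^ i)) M ≈ product PF.δ M * (1# - ζ⁻ * q ^ M)
          rotate zero = solve 1 (λ w → (con (+ 1) :- w) :* con (+ 1) := con (+ 1) :* (con (+ 1) :- w :* con (+ 1))) refl ζ⁻
          rotate (suc M) = begin
            (1# - ζ⁻) * (product (λ i → (1# + x * q ^ i) * (1# + y′ * q ^ i)) M * ((1# + x * q ^ M) * (1# + y′ * q ^ M)))
              ≈⟨ trans (sym (*-assoc _ _ _)) (*-congʳ (rotate M)) ⟩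
            product PF.δ M * (1# - ζ⁻ * q ^ M) * ((1# + x * q ^ M) * (1# + y′ * q ^ M))
              ≈⟨ solve 5 (λ d z w q p → d :* (con (+ 1) :- w :* p) :* ((con (+ 1) :+ :- z :* p) :* (con (+ 1) :+ :- w :* q :* p)) :=
                   d :* (con (+ 1) :- (z :+ w) :* p :+ p :* p) :* (con (+ 1) :- w :* (q :* p)) :+ d :* (p :* p) :* (con (+ 1) :- w :* (q :* p)) :* (z :* w :- con (+ 1))) refl (product PF.δ M) ζ ζ⁻ q (q ^ M) ⟩
            product PF.δ M * PF.δ M * (1# - ζ⁻ * q ^ suc M) + product PF.δ M * (q ^ M * q ^ M) * (1# - ζ⁻ * q ^ suc M) * (ζ * ζ⁻ - 1#)
              ≈⟨ modulo-ζ _ ⟩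
            product PF.δ (suc M) * (1# - ζ⁻ * q ^ suc M) ∎
          shifted-limit : (λ M → product PF.δ M * (1# - ζ⁻ * q ^ M)) ⟶ P
          shifted-limit = ⟶-cong rotate refl (⟶-* ⟶-const triple-limit)
          negligible-factor : ∀ {N} M → N < M → product PF.δ M ≈[ N ] product PF.δ M * (1# - ζ⁻ * q ^ M)
          negligible-factor {N} M p = ≈[]-trans (≈⇒≈[] (solve 2 (λ d w → d := d :* (con (+ 1) :- w :* con (+ 0))) refl (product PF.δ M) ζ⁻))
            (*-cong[] (≈⇒≈[] refl) (+-cong[] (≈⇒≈[] refl) (-‿cong[] (*-cong[] (≈⇒≈[] refl) (≈[]-sym (q-null N M p))))))

        private
          he₃ hθ₁ hθ₃ : Carrier
          he₃ = dil (J 7 3)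
          hθ₁ = dil CI.θ₁
          hθ₃ = dil CI.θ₃

          J-reflect : ∀ a → a ≤ 7 → J 7 (7 ∸ a) ≈ J 7 a
          J-reflect a p = *-congʳ (trans (*-congˡ (reflexive (≡.cong (λ k → poch k 7) (ℕP.m∸[m∸n]≡n p)))) (*-comm _ _))

          scale-θ₁ : he₃ * hθ₁ ≈ - ((1# + c) * dil (J 7 2))
          scale-θ₁ = trans (sym (dil-* _ _)) (trans (dil-cong (begin
              t 3 * e₇ * - ((1# + c) * (CI.α * γ))          ≈⟨ *-congˡ (-‿cong (*-congˡ (*-congʳ (sym α≈)))) ⟩
              t 3 * e₇ * - ((1# + c) * (t 2 * τ₁ * (t 1 * τ₃)))
                ≈⟨ solve 7 (λ a b d x z e c → d :* e :* :- ((con (+ 1) :+ c) :* (b :* x :* (a :* z))) := :- ((con (+ 1) :+ c) :* (b :* e :* ((a :* x) :* (d :* z))))) refl (t 1) (t 2) (t 3) τ₁ τ₃ e₇ c ⟩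
              - ((1# + c) * (t 2 * e₇ * ((t 1 * τ₁) * (t 3 * τ₃))))
                ≈⟨ -‿cong (*-congˡ (trans (*-congˡ (trans (*-cong t₁-unit t₃-unit) (*-identityˡ 1#))) (*-identityʳ _))) ⟩
              - ((1# + c) * J 7 2)                          ∎))
            (⟨neg⟩ ((dil-1 ⟨+⟩ dil-c) ⟨*⟩ refl)))

          scale-θ₃ : he₃ * hθ₃ ≈ - (CI.c₃ * dil (J 7 1))
          scale-θ₃ = trans (sym (dil-* _ _)) (trans (dil-cong (begin
              t 3 * e₇ * - (CI.c₃ * (t 1 * τ₃))
                ≈⟨ solve 5 (λ a d z e c → d :* e :* :- (c :* (a :* z)) := :- (c :* (a :* e :* (d :* z)))) refl (t 1) (t 3) τ₃ e₇ CI.c₃ ⟩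
              - (CI.c₃ * (t 1 * e₇ * (t 3 * τ₃)))           ≈⟨ -‿cong (*-congˡ (trans (*-congˡ t₃-unit) (*-identityʳ _))) ⟩
              - (CI.c₃ * J 7 1)                             ∎))
            (⟨neg⟩ (dil-c₃ ⟨*⟩ refl)))

        P-form : P * E ≈ CI.w * (he₃ * (1# + q * hθ₁ + q ^ 3 * hθ₃))
        P-form = begin
          (1# - ζ⁻) * (S₀ * E⁻) * E
            ≈⟨ trans (solve 4 (λ a s i e → a :* (s :* i) :* e := a :* (s :* (e :* i))) refl _ S₀ E⁻ E) (*-congˡ (trans (*-congˡ E-unit) (*-identityʳ S₀))) ⟩
          (1# - ζ⁻) * S₀
            ≈⟨ *-congˡ (trans (theta-dissection ζ-sign ζ-sign-antiperiodic (proj₂ ζ-theta))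
                 (+-cong (+-cong (+-congˡ (inner (J-reflect 3 (s≤s (s≤s (s≤s z≤n)))))) (inner (J-reflect 2 (s≤s (s≤s z≤n))))) (inner (J-reflect 1 (s≤s z≤n))))) ⟩
          (1# - ζ⁻) * (0# + (- ζ⁻) ^ 2 * (q ^ 3 * d₁) + (- ζ⁻) ^ 1 * (q ^ 1 * d₂) + (- ζ) ^ 0 * (q ^ 0 * d₃) + (- ζ) ^ 1 * (q ^ 0 * d₃) + (- ζ) ^ 2 * (q ^ 1 * d₂) + (- ζ) ^ 3 * (q ^ 3 * d₁))
            ≈⟨ solve 6 (λ z w q d₁ d₂ d₃ → let c = z :+ w in
                 (con (+ 1) :- w) :* (con (+ 0) :+ (:- w) :^ 2 :* (q :^ 3 :* d₁) :+ (:- w) :^ 1 :* (q :^ 1 :* d₂) :+ (:- z) :^ 0 :* (q :^ 0 :* d₃) :+ (:- z) :^ 1 :* (q :^ 0 :* d₃) :+ (:- z) :^ 2 :* (q :^ 1 :* d₂) :+ (:- z) :^ 3 :* (q :^ 3 :* d₁)) :=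
                 (con (+ 2) :- c) :* (d₃ :+ q :* :- ((con (+ 1) :+ c) :* d₂) :+ q :^ 3 :* :- ((con (+ 1) :- c :- c :* c) :* d₁))
                 :+ (d₃ :- (z :+ con (+ 2)) :* (q :* d₂) :+ (z :* z :- con (+ 2) :+ con (+ 3) :* z :+ con (+ 3) :* w) :* (q :^ 3 :* d₁)) :* (z :* w :- con (+ 1))) refl ζ ζ⁻ q d₁ d₂ d₃ ⟩
          CI.w * (d₃ + q * - ((1# + c) * d₂) + q ^ 3 * - (CI.c₃ * d₁))
            + (d₃ - (ζ + (1# + 1#)) * (q * d₂) + (ζ * ζ - (1# + 1#) + (1# + (1# + 1#)) * ζ + (1# + (1# + 1#)) * ζ⁻) * (q ^ 3 * d₁)) * (ζ * ζ⁻ - 1#)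
            ≈⟨ modulo-ζ _ ⟩
          CI.w * (d₃ + q * - ((1# + c) * d₂) + q ^ 3 * - (CI.c₃ * d₁))
            ≈⟨ *-congˡ (+-cong (+-congˡ (*-congˡ scale-θ₁)) (*-congˡ scale-θ₃)) ⟨
          CI.w * (d₃ + q * (d₃ * hθ₁) + q ^ 3 * (d₃ * hθ₃))
            ≈⟨ *-congˡ (solve 5 (λ d q p a b → d :+ q :* (d :* a) :+ p :* (d :* b) := d :* (con (+ 1) :+ q :* a :+ p :* b)) refl _ _ _ _ _) ⟩
          CI.w * (he₃ * (1# + q * hθ₁ + q ^ 3 * hθ₃)) ∎
          where
          d₁ d₂ d₃ : Carrier
          d₁ = dil (J 7 1)
          d₂ = dil (J 7 2)
          d₃ = dil (J 7 3)
          inner : ∀ {x y a b} → x ≈ y → a * (b * dil x) ≈ a * (b * dil y)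
          inner e = *-congˡ (*-congˡ (dil-cong e))

        module _ (B : ℕ → Carrier) (B-form : ∀ i → i < 7 → CI.w * B i ≈ e₂₁ * (τ₃ * ρ̂ i)) where

          rhs : Carrier
          rhs = partial (λ i → q ^ i * dil (B i)) 7

          rhs*P*E : rhs * (P * E) ≈ Y * E
          rhs*P*E = begin
            rhs * (P * E)
              ≈⟨ *-congˡ P-form ⟩
            rhs * (CI.w * (he₃ * (1# + q * hθ₁ + q ^ 3 * hθ₃)))
              ≈⟨ solve 4 (λ r w d t → r :* (w :* (d :* t)) := w :* r :* d :* t) refl rhs CI.w he₃ _ ⟩
            CI.w * rhs * he₃ * (1# + q * hθ₁ + q ^ 3 * hθ₃)
              ≈⟨ *-congʳ (*-congʳ scaled) ⟩
            he * dil τ₃ * partial (λ i → q ^ i * dil (ρ̂ i)) 7 * he₃ * (1# + q * hθ₁ + q ^ 3 * hθ₃)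
              ≈⟨ solve 5 (λ e t r d x → e :* t :* r :* d :* x := e :* (d :* t) :* (r :* x)) refl he (dil τ₃) (partial (λ i → q ^ i * dil (ρ̂ i)) 7) he₃ _ ⟩
            he * (he₃ * dil τ₃) * (partial (λ i → q ^ i * dil (ρ̂ i)) 7 * (1# + q * hθ₁ + q ^ 3 * hθ₃))
              ≈⟨ *-cong (*-congˡ unit) dilated-classes ⟩
            he * he₇ * ((dil CI.α - q * dil β - q ^ 2 + q ^ 5 * dil γ) * (dil CI.Y₀ + q * dil CI.Y₁ + q ^ 2 * dil CI.Y₂ + q ^ 5 * dil CI.Y₅))
              ≈⟨ solve 4 (λ a b x y → a :* b :* (x :* y) := a :* y :* (b :* x)) refl he he₇ _ _ ⟩
            he * (dil CI.Y₀ + q * dil CI.Y₁ + q ^ 2 * dil CI.Y₂ + q ^ 5 * dil CI.Y₅) * (he₇ * (dil CI.α - q * dil β - q ^ 2 + q ^ 5 * dil γ))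
              ≈⟨ *-cong Y-form E-form ⟨
            Y * E ∎
            where
            scaled : CI.w * rhs ≈ he * dil τ₃ * partial (λ i → q ^ i * dil (ρ̂ i)) 7
            scaled = trans (sym (partial-*ˡ CI.w (λ i → q ^ i * dil (B i)) 7)) (trans (partial-cong 7 (λ i p → begin
              CI.w * (q ^ i * dil (B i))             ≈⟨ solve 3 (λ w q b → w :* (q :* b) := q :* (w :* b)) refl _ _ _ ⟩
              q ^ i * (CI.w * dil (B i))             ≈⟨ *-congˡ (trans (*-congʳ (sym dil-w)) (trans (sym (dil-* _ _)) (trans (dil-cong (B-form i p)) (trans (dil-* _ _) (*-congˡ (dil-* _ _)))))) ⟩
              q ^ i * (he * (dil τ₃ * dil (ρ̂ i)))    ≈⟨ solve 4 (λ q e t r → q :* (e :* (t :* r)) := e :* t :* (q :* r)) refl _ _ _ _ ⟩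
              he * dil τ₃ * (q ^ i * dil (ρ̂ i))      ∎)) (partial-*ˡ (he * dil τ₃) (λ i → q ^ i * dil (ρ̂ i)) 7))
            unit : he₃ * dil τ₃ ≈ he₇
            unit = trans (sym (dil-* _ _)) (dil-cong (trans (solve 3 (λ t e x → t :* e :* x := e :* (t :* x)) refl (t 3) e₇ τ₃) (trans (*-congˡ t₃-unit) (*-identityʳ e₇))))

          lambert-series : ∀ {T₁ T₂ S₁ S₂} → T₁ ⇓ℤ S₁ → T₂ ⇓ℤ S₂ → T₁ (+ 0) ≈ D 0 →
            (∀ p → 0 < p → fold T₁ p ≈ (q ^ cubic 2 0 p + q ^ cubic 4 0 p) * D (p ℕ.* 3 ℕ.+ 0)) →
            (∀ p → pair T₂ p ≈ q ^ cubic 4 1 p * D (p ℕ.* 3 ℕ.+ 1) + q ^ cubic 8 4 p * D (p ℕ.* 3 ℕ.+ 2)) →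
            E⁻ * (S₁ - S₂) ≈ rhs
          lambert-series {T₁} {T₂} {S₁} {S₂} sum₁ sum₂ T₁0 fold₁ pair₂ =
            *-cancel-unit {e = P} {e⁻ = C * (E⁻ * E⁻)} P-unit (*-cancel-unit {e = E} {e⁻ = E⁻} E-unit (begin
              E⁻ * (S₁ - S₂) * P * E         ≈⟨ solve 4 (λ i s p e → i :* s :* p :* e := (e :* i) :* (s :* p)) refl E⁻ (S₁ - S₂) P E ⟩
              E * E⁻ * ((S₁ - S₂) * P)       ≈⟨ trans (*-congʳ E-unit) (*-identityˡ _) ⟩
              (S₁ - S₂) * P                  ≈⟨ *-cancel-unit {e = E} {e⁻ = E⁻} E-unit product-identity ⟩
              Y * E                          ≈⟨ rhs*P*E ⟨
              rhs * (P * E)                  ≈⟨ *-assoc _ _ _ ⟨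
              rhs * P * E                    ∎))
            where
            v-null : (λ m → v m * D m) ⟶ 0#
            v-null N = suc (suc N) , λ { (suc m) (s≤s p) → ≈[]-trans
              (≈⇒≈[] (solve 4 (λ s t x d → s :* (t :* x) :* d := t :* (s :* x :* d)) refl _ (q ^ triangle (2 ℕ.+ m)) _ _))
              (≈[]-trans (*-cong[] (q-null N (triangle (2 ℕ.+ m)) (ℕP.≤-trans p (ℕP.≤-trans (ℕP.n≤1+n m) (k≤triangle[1+k] (suc m))))) (≈⇒≈[] refl)) (≈⇒≈[] (zeroˡ _))) }
            C : Carrier
            C = proj₁ (complete _ v-null)
            C-sum : (λ m → v m * D m) ⇓ C
            C-sum = proj₂ (complete _ v-null)
            CP≈EE : C * P ≈ E * E
            CP≈EE = partial-fractions D-inverse P-limit (⇓-cong (λ { zero → refl ; (suc m) → refl }) refl C-sum)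
            P-unit : P * (C * (E⁻ * E⁻)) ≈ 1#
            P-unit = trans (solve 3 (λ p c i → p :* (c :* (i :* i)) := c :* p :* (i :* i)) refl P C E⁻)
              (trans (*-congʳ CP≈EE) (trans (solve 2 (λ e i → e :* e :* (i :* i) := (e :* i) :* (e :* i)) refl E E⁻) (trans (*-cong E-unit E-unit) (*-identityˡ 1#))))
            open Columns E-sum using (lambert-product)
            product-identity : (S₁ - S₂) * P * E ≈ Y * E * E
            product-identity = begin
              (S₁ - S₂) * P * E     ≈⟨ solve 3 (λ s p e → s :* p :* e := e :* s :* p) refl (S₁ - S₂) P E ⟩
              E * (S₁ - S₂) * P     ≈⟨ *-congʳ (lambert-product Y-pairs C-sum sum₁ sum₂ T₁0 fold₁ pair₂) ⟨
              Y * C * P             ≈⟨ trans (*-assoc _ _ _) (*-congˡ CP≈EE) ⟩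
              Y * (E * E)           ≈⟨ *-assoc _ _ _ ⟨
              Y * E * E             ∎

module PSRing {c ℓ} (F : Field c ℓ) where

  open Field F
  open Series F hiding (_≋_)
  open Series F using () renaming (_≋_ to infix 4 _≋_)
  open RingTools commutativeRing using (solve; _:=_; _:+_; _:*_)
  open Relation.Binary.Reasoning.Setoid setoid

  sumTo-cong≤ : ∀ n {g h : ℕ → Carrier} → (∀ i → i ≤ n → g i ≈ h i) → sumTo n g ≈ sumTo n h
  sumTo-cong≤ zero e = e 0 z≤n
  sumTo-cong≤ (suc n) e = +-cong (sumTo-cong≤ n (λ i p → e i (ℕP.m≤n⇒m≤1+n p))) (e (suc n) ℕP.≤-refl)

  sumTo-cong : ∀ n {g h : ℕ → Carrier} → (∀ i → g i ≈ h i) → sumTo n g ≈ sumTo n h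
  sumTo-cong n e = sumTo-cong≤ n (λ i _ → e i)

  sumTo-head : ∀ n (h : ℕ → Carrier) → sumTo (suc n) h ≈ h 0 + sumTo n (λ i → h (suc i))
  sumTo-head zero h = refl
  sumTo-head (suc n) h = trans (+-congʳ (sumTo-head n h)) (+-assoc _ _ _)

  sumTo-0 : ∀ n {h : ℕ → Carrier} → (∀ i → i ≤ n → h i ≈ 0#) → sumTo n h ≈ 0#
  sumTo-0 zero e = e 0 z≤n
  sumTo-0 (suc n) e = trans (+-cong (sumTo-0 n (λ i p → e i (ℕP.m≤n⇒m≤1+n p))) (e (suc n) ℕP.≤-refl)) (+-identityˡ _)

  sumTo-+ : ∀ n (g h : ℕ → Carrier) → sumTo n (λ i → g i + h i) ≈ sumTo n g + sumTo n h
  sumTo-+ zero g h = refl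
  sumTo-+ (suc n) g h = trans (+-congʳ (sumTo-+ n g h))
    (solve 4 (λ a b x y → (a :+ b) :+ (x :+ y) := (a :+ x) :+ (b :+ y)) refl _ _ _ _)

  tail : PS → PS
  tail f n = f (suc n)

  ⊛-suc : ∀ f g n → (f ⊛ g) (suc n) ≈ f 0 * g (suc n) + (tail f ⊛ g) n
  ⊛-suc f g n = sumTo-head n (λ i → f i * g (suc n ∸ i))

  ⊛-cong : ∀ {f f′ g g′} → f ≋ f′ → g ≋ g′ → f ⊛ g ≋ f′ ⊛ g′
  ⊛-cong e e′ n = sumTo-cong n (λ i → *-cong (e i) (e′ (n ∸ i)))

  ⊛-distribʳ : ∀ h f g → (f ⊕ g) ⊛ h ≋ (f ⊛ h) ⊕ (g ⊛ h)
  ⊛-distribʳ h f g n = trans (sumTo-cong n (λ i → distribʳ _ _ _)) (sumTo-+ n _ _)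

  ·-⊛ : ∀ a f g → (a · f) ⊛ g ≋ a · (f ⊛ g)
  ·-⊛ a f g zero = *-assoc _ _ _
  ·-⊛ a f g (suc n) = begin
    ((a · f) ⊛ g) (suc n)                            ≈⟨ ⊛-suc (a · f) g n ⟩
    a * f 0 * g (suc n) + ((a · tail f) ⊛ g) n       ≈⟨ +-congˡ (·-⊛ a (tail f) g n) ⟩
    a * f 0 * g (suc n) + a * (tail f ⊛ g) n         ≈⟨ +-congʳ (*-assoc _ _ _) ⟩
    a * (f 0 * g (suc n)) + a * (tail f ⊛ g) n       ≈⟨ distribˡ _ _ _ ⟨
    a * (f 0 * g (suc n) + (tail f ⊛ g) n)           ≈⟨ *-congˡ (⊛-suc f g n) ⟨
    a * (f ⊛ g) (suc n)                              ∎

  ⊛-last : ∀ f g n → (f ⊛ g) (suc n) ≈ (f ⊛ tail g) n + f (suc n) * g 0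
  ⊛-last f g zero = refl
  ⊛-last f g (suc n) = begin
    (f ⊛ g) (suc (suc n))                                             ≈⟨ ⊛-suc f g (suc n) ⟩
    f 0 * g (suc (suc n)) + (tail f ⊛ g) (suc n)                      ≈⟨ +-congˡ (⊛-last (tail f) g n) ⟩
    f 0 * g (suc (suc n)) + ((tail f ⊛ tail g) n + f (suc (suc n)) * g 0)  ≈⟨ +-assoc _ _ _ ⟨
    f 0 * g (suc (suc n)) + (tail f ⊛ tail g) n + f (suc (suc n)) * g 0    ≈⟨ +-congʳ (⊛-suc f (tail g) n) ⟨
    (f ⊛ tail g) (suc n) + f (suc (suc n)) * g 0                      ∎

  ⊛-comm : ∀ f g → f ⊛ g ≋ g ⊛ f
  ⊛-comm f g zero = *-comm _ _
  ⊛-comm f g (suc n) = begin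
    (f ⊛ g) (suc n)                      ≈⟨ ⊛-suc f g n ⟩
    f 0 * g (suc n) + (tail f ⊛ g) n     ≈⟨ +-cong (*-comm _ _) (⊛-comm (tail f) g n) ⟩
    g (suc n) * f 0 + (g ⊛ tail f) n     ≈⟨ +-comm _ _ ⟩
    (g ⊛ tail f) n + g (suc n) * f 0     ≈⟨ ⊛-last g f n ⟨
    (g ⊛ f) (suc n)                      ∎

  ⊛-assoc : ∀ f g h → (f ⊛ g) ⊛ h ≋ f ⊛ (g ⊛ h)
  ⊛-assoc f g h zero = *-assoc _ _ _
  ⊛-assoc f g h (suc n) = begin
    ((f ⊛ g) ⊛ h) (suc n)
      ≈⟨ ⊛-suc (f ⊛ g) h n ⟩
    f 0 * g 0 * h (suc n) + (tail (f ⊛ g) ⊛ h) n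
      ≈⟨ +-congˡ (⊛-cong {g = h} (⊛-suc f g) (λ _ → refl) n) ⟩
    f 0 * g 0 * h (suc n) + (((f 0 · tail g) ⊕ (tail f ⊛ g)) ⊛ h) n
      ≈⟨ +-congˡ (⊛-distribʳ h (f 0 · tail g) (tail f ⊛ g) n) ⟩
    f 0 * g 0 * h (suc n) + (((f 0 · tail g) ⊛ h) n + ((tail f ⊛ g) ⊛ h) n)
      ≈⟨ +-congˡ (+-cong (·-⊛ (f 0) (tail g) h n) (⊛-assoc (tail f) g h n)) ⟩
    f 0 * g 0 * h (suc n) + (f 0 * (tail g ⊛ h) n + (tail f ⊛ (g ⊛ h)) n)
      ≈⟨ solve 5 (λ a b c d e → a :* b :* c :+ (a :* d :+ e) := a :* (b :* c :+ d) :+ e) refl _ _ _ _ _ ⟩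
    f 0 * (g 0 * h (suc n) + (tail g ⊛ h) n) + (tail f ⊛ (g ⊛ h)) n
      ≈⟨ +-congʳ (*-congˡ (⊛-suc g h n)) ⟨
    f 0 * (g ⊛ h) (suc n) + (tail f ⊛ (g ⊛ h)) n
      ≈⟨ ⊛-suc f (g ⊛ h) n ⟨
    (f ⊛ (g ⊛ h)) (suc n) ∎

  zeroPS : PS
  zeroPS _ = 0#

  zeroPS-⊛ : ∀ f → zeroPS ⊛ f ≋ zeroPS
  zeroPS-⊛ f n = sumTo-0 n (λ i _ → zeroˡ _)

  one-⊛ : ∀ f → one ⊛ f ≋ f
  one-⊛ f zero = *-identityˡ _
  one-⊛ f (suc n) = trans (⊛-suc one f n) (trans (+-cong (*-identityˡ _) (zeroPS-⊛ f n)) (+-identityʳ _))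

  negPS : PS → PS
  negPS f n = - f n

  ≋-isEquivalence : IsEquivalence _≋_
  ≋-isEquivalence = record { refl = λ _ → refl ; sym = λ e n → sym (e n) ; trans = λ e e′ n → trans (e n) (e′ n) }

  -- The ring operations of PSR are ⊕ and ⊛ themselves; only f ⊖ g is PSR's f - g after unfolding.
  PSR : CommutativeRing c ℓ
  PSR = record
    { Carrier = PS ; _≈_ = _≋_ ; _+_ = _⊕_ ; _*_ = _⊛_ ; -_ = negPS ; 0# = zeroPS ; 1# = one
    ; isCommutativeRing = record
      { isRing = record
        { +-isAbelianGroup = record
          { isGroup = record
            { isMonoid = record
              { isSemigroup = record
                { isMagma = record { isEquivalence = ≋-isEquivalence ; ∙-cong = λ e e′ n → +-cong (e n) (e′ n) }
                ; assoc = λ f g h n → +-assoc _ _ _ }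
              ; identity = (λ f n → +-identityˡ _) , (λ f n → +-identityʳ _) }
            ; inverse = (λ f n → -‿inverseˡ _) , (λ f n → -‿inverseʳ _)
            ; ⁻¹-cong = λ e n → -‿cong (e n) }
          ; comm = λ f g n → +-comm _ _ }
        ; *-cong = ⊛-cong
        ; *-assoc = ⊛-assoc
        ; *-identity = one-⊛ , (λ f n → trans (⊛-comm f one n) (one-⊛ f n))
        ; distrib = (λ h f g n → trans (⊛-comm h (f ⊕ g) n) (trans (⊛-distribʳ h f g n) (+-cong (⊛-comm f h n) (⊛-comm g h n))))
                  , ⊛-distribʳ }
      ; *-comm = ⊛-comm } }

module PSInstance {c ℓ} (F : Field c ℓ) where

  open PSRing F
  module K = Field F
  open Series F using (PS; _⊛_; _⊕_; _⊖_; _·_; one; shift; mono; sumTo; inv; invTab; prodTo; poch; dilate7; bisum; sum7)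
  open CommutativeRing PSR using (_≈_)

  infix 4 _≈⟦_⟧_
  _≈⟦_⟧_ : PS → ℕ → PS → Set ℓ
  f ≈⟦ N ⟧ g = ∀ n → n ≤ N → f n K.≈ g n

  PSF : FilteredRing c ℓ
  PSF = record
    { commutativeRing = PSR
    ; _≈[_]_ = _≈⟦_⟧_
    ; ≈⇒≈[] = λ e n _ → e n
    ; ≈[]-sym = λ e n p → K.sym (e n p)
    ; ≈[]-trans = λ e e′ n p → K.trans (e n p) (e′ n p)
    ; +-cong[] = λ e e′ n p → K.+-cong (e n p) (e′ n p)
    ; *-cong[] = λ e e′ n p → sumTo-cong≤ n λ i q → K.*-cong (e i (ℕP.≤-trans q p)) (e′ (n ∸ i) (ℕP.≤-trans (ℕP.m∸n≤m n i) p))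
    ; -‿cong[] = λ e n p → K.-‿cong (e n p)
    ; separated = λ h n → h n n ℕP.≤-refl }

  open FilteredRing PSF hiding (_≈_; _≈[_]_)
  open RingTools commutativeRing using (solve; _:=_; _:*_)
  open FiniteSums commutativeRing
  open Limits PSF
  open ZSums PSF
  open Exp semiring using (_^_)
  open Relation.Binary.Reasoning.Setoid setoid

  q : PS
  q = mono 1

  q-* : ∀ f → q ⊛ f ≈ shift 1 f
  q-* f zero = K.zeroˡ _
  q-* f (suc n) = K.trans (⊛-suc q f n) (K.trans (K.+-cong (K.zeroˡ _) (one-⊛ f n)) (K.+-identityˡ _))

  shift-suc : ∀ k f → shift (suc k) f ≈ shift 1 (shift k f)
  shift-suc k f zero = K.refl
  shift-suc k f (suc n) = K.refl

  shift-cong : ∀ k {f g} → f ≈ g → shift k f ≈ shift k g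
  shift-cong zero e = e
  shift-cong (suc k) e zero = K.refl
  shift-cong (suc k) e (suc n) = shift-cong k e n

  shift≈ : ∀ k f → shift k f ≈ q ^ k ⊛ f
  shift≈ zero f = sym (*-identityˡ f)
  shift≈ (suc k) f = trans (shift-suc k f) (trans (shift-cong 1 (shift≈ k f)) (trans (sym (q-* (q ^ k ⊛ f))) (sym (*-assoc q (q ^ k) f))))

  mono≈ : ∀ k → mono k ≈ q ^ k
  mono≈ k = trans (shift≈ k one) (*-identityʳ (q ^ k))

  shift-null : ∀ k f n → n < k → shift k f n K.≈ K.0#
  shift-null (suc k) f zero p = K.refl
  shift-null (suc k) f (suc n) (s≤s p) = shift-null k f n p

  q-null : ∀ N k → N < k → q ^ k ≈⟦ N ⟧ 0#
  q-null N k p n n≤N = K.trans (K.sym (mono≈ k n)) (shift-null k one n (ℕP.≤-<-trans n≤N p))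

  complete : ∀ T → T ⟶ 0# → ∃ λ S → T ⇓ S
  complete T null = S , λ N → bound N , λ M p n n≤N → stable n M (ℕP.≤-trans (bound-≥ N n n≤N) p)
    where
    b : ℕ → ℕ
    b N = proj₁ (null N)
    S : PS
    S n = partial T (b n) n
    bound : ℕ → ℕ
    bound zero = b 0
    bound (suc N) = bound N ⊔ b (suc N)
    bound-≥ : ∀ N n → n ≤ N → b n ≤ bound N
    bound-≥ zero zero _ = ℕP.≤-refl
    bound-≥ (suc N) n p with n ℕ.≟ suc N
    ... | yes ≡.refl = ℕP.m≤n⊔m (bound N) _
    ... | no n≢ = ℕP.≤-trans (bound-≥ N n (ℕ.s≤s⁻¹ (ℕP.≤∧≢⇒< p n≢))) (ℕP.m≤m⊔n _ _)
    stable : ∀ n M → b n ≤ M → partial T M n K.≈ S n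
    stable n M p = ≡.subst (λ m → partial T m n K.≈ S n) (ℕP.m+[n∸m]≡n p) (partial-stable (b n) (M ∸ b n) (proj₂ (null n)) n ℕP.≤-refl)

  invTab≈ : ∀ f n m → m ≤ n → invTab f n m ≡ inv f m
  invTab≈ f zero zero _ = ≡.refl
  invTab≈ f (suc n) m p with m ℕ.≤? n
  ... | yes q = invTab≈ f n m q
  ... | no m≰n with ℕP.≤-antisym p (ℕP.≰⇒> m≰n)
  ... | ≡.refl = ≡.sym (inv-suc n)
    where
    inv-suc : ∀ n → inv f (suc n) ≡ K.- ((f 0 K.⁻¹) K.* sumTo n (λ i → f (suc i) K.* invTab f n (n ∸ i)))
    inv-suc n with suc n ℕ.≤? n
    ... | yes q = ⊥-elim (ℕP.<-irrefl ≡.refl q)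
    ... | no _ = ≡.refl

  inv-suc : ∀ f n → inv f (suc n) K.≈ K.- ((f 0 K.⁻¹) K.* (tail f ⊛ inv f) n)
  inv-suc f n with suc n ℕ.≤? n
  ... | yes p = ⊥-elim (ℕP.<-irrefl ≡.refl p)
  ... | no _ = K.-‿cong (K.*-congˡ (sumTo-cong≤ n λ i p → K.*-congˡ (K.reflexive (invTab≈ f n (n ∸ i) (ℕP.m∸n≤m n i)))))

  *-inv : ∀ f → ¬ (f 0 K.≈ K.0#) → f ⊛ inv f ≈ one
  *-inv f f₀≉0 zero = K.⁻¹-inverse (f 0) f₀≉0
  *-inv f f₀≉0 (suc n) = K.trans (⊛-suc f (inv f) n) (K.trans (K.+-congʳ (K.*-congˡ (inv-suc f n)))
    (K.trans (K.+-congʳ cancel) (K.-‿inverseˡ _)))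
    where
    open Algebra.Properties.Ring K.ring using (-‿distribʳ-*)
    x = (tail f ⊛ inv f) n
    cancel : f 0 K.* K.- ((f 0 K.⁻¹) K.* x) K.≈ K.- x
    cancel = K.trans (K.sym (-‿distribʳ-* _ _)) (K.-‿cong (K.trans (K.sym (K.*-assoc _ _ _))
      (K.trans (K.*-congʳ (K.⁻¹-inverse (f 0) f₀≉0)) (K.*-identityˡ x))))

  1≉0 : ¬ (K.1# K.≈ K.0#)
  1≉0 e = K.0≉1 (K.sym e)

  ^-zero : ∀ k → 0 < k → (q ^ k) 0 K.≈ K.0#
  ^-zero k p = q-null 0 k p 0 z≤n

  1-0 : ∀ {x} → x K.≈ K.0# → K.1# K.+ K.- x K.≈ K.1#
  1-0 e = K.trans (K.+-congˡ (K.trans (K.-‿cong e) -0#≈0#)) (K.+-identityʳ _)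
    where open import Algebra.Properties.Ring K.ring using (-0#≈0#)

  u : ℕ → PS
  u i = inv (1# - q ^ suc i)

  u-inverse : ∀ i → (1# - q ^ suc i) ⊛ u i ≈ 1#
  u-inverse i = *-inv (1# - q ^ suc i) λ e → 1≉0 (K.trans (K.sym (1-0 (^-zero (suc i) (s≤s z≤n)))) e)

  poch-factor : ℕ → ℕ → ℕ → PS
  poch-factor a d i = 1# - q ^ (a ℕ.+ d ℕ.* i)

  prodTo≈ : ∀ a d n → prodTo n (λ i → one ⊖ mono (a ℕ.+ d ℕ.* i)) ≈ product (poch-factor a d) (suc n)
  prodTo≈ a d zero = trans (+-congˡ (-‿cong (mono≈ (a ℕ.+ d ℕ.* 0)))) (sym (*-identityˡ (poch-factor a d 0)))
  prodTo≈ a d (suc n) = *-cong (prodTo≈ a d n) (+-congˡ {one} (-‿cong (mono≈ (a ℕ.+ d ℕ.* suc n))))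

  poch-limit : ∀ a d → 1 ≤ a → 1 ≤ d → product (poch-factor a d) ⟶ poch a d
  poch-limit a d 1≤a 1≤d N = suc N , λ M p n n≤N →
    K.trans (≡.subst (λ m → product (poch-factor a d) m n K.≈ product (poch-factor a d) (suc n) n) (ℕP.m+[n∸m]≡n (ℕP.≤-trans (s≤s n≤N) p))
      (stable n (M ∸ suc n) n ℕP.≤-refl)) (K.sym (prodTo≈ a d n n))
    where
    exceeds : ∀ n k → n ≤ k → n < a ℕ.+ d ℕ.* k
    exceeds n k p = ℕP.≤-trans (s≤s (ℕP.≤-trans p (ℕP.m≤n*m k d ⦃ ℕ.>-nonZero 1≤d ⦄))) (ℕP.+-monoˡ-≤ (d ℕ.* k) 1≤a)
    stable : ∀ n k → product (poch-factor a d) (suc n ℕ.+ k) ≈⟦ n ⟧ product (poch-factor a d) (suc n)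
    stable n zero = ≈⇒≈[] (reflexive (≡.cong (product (poch-factor a d)) (ℕP.+-identityʳ (suc n))))
    stable n (suc k) = ≈[]-trans (≈⇒≈[] (reflexive (≡.cong (product (poch-factor a d)) (ℕP.+-suc (suc n) k))))
      (≈[]-trans (*-cong[] (stable n k) factor≈1) (≈⇒≈[] (*-identityʳ (product (poch-factor a d) (suc n)))))
      where
      factor≈1 : poch-factor a d (suc n ℕ.+ k) ≈⟦ n ⟧ 1#
      factor≈1 i i≤n = K.trans (K.+-congˡ (K.-‿cong (q-null n (a ℕ.+ d ℕ.* (suc n ℕ.+ k)) (exceeds n _ (ℕP.≤-trans (ℕP.n≤1+n n) (ℕP.m≤m+n (suc n) k))) i i≤n)))
        (K.trans (K.+-congˡ -0#≈0#) (K.+-identityʳ _))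
        where open import Algebra.Properties.Ring K.ring using (-0#≈0#)

  poch-invertible : ∀ a d → 1 ≤ a → 1 ≤ d → ∃ λ i → poch a d ⊛ i ≈ 1#
  poch-invertible a d 1≤a 1≤d = inv (poch a d) , *-inv (poch a d) λ e →
    1≉0 (K.trans (K.sym (1-0 (shift-null (a ℕ.+ d ℕ.* 0) one 0 (ℕP.≤-trans 1≤a (ℕP.m≤m+n a _))))) e)

  const : K.Carrier → PS
  const a = a · one

  const-* : ∀ a f → const a ⊛ f ≈ a · f
  const-* a f n = K.trans (·-⊛ a one f n) (K.*-congˡ (one-⊛ f n))

  const-cong : ∀ {a b} → a K.≈ b → const a ≈ const b
  const-cong e n = K.*-congʳ e

  const-+ : ∀ a b → const (a K.+ b) ≈ const a ⊕ const b
  const-+ a b n = K.distribʳ _ _ _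

  const-⊛ : ∀ a b → const (a K.* b) ≈ const a ⊛ const b
  const-⊛ a b n = K.trans (K.*-assoc _ _ _) (K.sym (const-* a (const b) n))

  const-neg : ∀ a → const (K.- a) ≈ negPS (const a)
  const-neg a n = K.sym (-‿distribˡ-* _ _)
    where open import Algebra.Properties.Ring K.ring using (-‿distribˡ-*)

  const-1 : const K.1# ≈ one
  const-1 n = K.*-identityˡ _

  const-0 : const K.0# ≈ 0#
  const-0 n = K.zeroˡ _

  private
    pick : PS → ℕ → ℕ → K.Carrier
    pick f r k with r ℕ.≟ 0
    ... | yes _ = f k
    ... | no _ = K.0#
    pick≡ : ∀ f n → dilate7 f n ≡ pick f (n % 7) (n / 7)
    pick≡ f n with n % 7 ℕ.≟ 0
    ... | yes _ = ≡.refl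
    ... | no _ = ≡.refl
    pick-tail : ∀ f r k → pick f r (suc k) ≡ pick (tail f) r k
    pick-tail f r k with r ℕ.≟ 0
    ... | yes _ = ≡.refl
    ... | no _ = ≡.refl

  dil-7+ : ∀ f n → dilate7 f (7 ℕ.+ n) ≡ dilate7 (tail f) n
  dil-7+ f n = ≡.trans (pick≡ f (7 ℕ.+ n)) (≡.trans
    (≡.cong₂ (pick f) (≡.trans (≡.cong (_% 7) (ℕP.+-comm 7 n)) (ℕD.[m+n]%n≡m%n n 7))
      (ℕD.m/n≡1+[m∸n]/n {7 ℕ.+ n} {7} (ℕP.m≤m+n 7 n)))
    (≡.trans (pick-tail f (n % 7) (n / 7)) (≡.sym (pick≡ (tail f) n))))

  dil-step : ∀ f → dilate7 f ≈ const (f 0) ⊕ shift 7 (dilate7 (tail f))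
  dil-step f 0 = K.sym (K.trans (K.+-identityʳ _) (K.*-identityʳ _))
  dil-step f 1 = K.sym (K.trans (K.+-identityʳ _) (K.zeroʳ _))
  dil-step f 2 = K.sym (K.trans (K.+-identityʳ _) (K.zeroʳ _))
  dil-step f 3 = K.sym (K.trans (K.+-identityʳ _) (K.zeroʳ _))
  dil-step f 4 = K.sym (K.trans (K.+-identityʳ _) (K.zeroʳ _))
  dil-step f 5 = K.sym (K.trans (K.+-identityʳ _) (K.zeroʳ _))
  dil-step f 6 = K.sym (K.trans (K.+-identityʳ _) (K.zeroʳ _))
  dil-step f (suc (suc (suc (suc (suc (suc (suc n))))))) = K.trans (K.reflexive (dil-7+ f n)) (K.sym (K.trans (K.+-congʳ (K.zeroʳ _)) (K.+-identityˡ _)))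

  dil-cong[] : ∀ {N f g} → f ≈⟦ N ⟧ g → dilate7 f ≈⟦ N ⟧ dilate7 g
  dil-cong[] {N} {f} {g} e n p with n % 7 ℕ.≟ 0
  ... | yes _ = e (n / 7) (ℕP.≤-trans (ℕD.m/n≤m n 7) p)
  ... | no _ = K.refl

  dil-cong : ∀ {f g} → f ≈ g → dilate7 f ≈ dilate7 g
  dil-cong e n = dil-cong[] {n} (λ i _ → e i) n ℕP.≤-refl

  dil-+ : ∀ f g → dilate7 (f ⊕ g) ≈ dilate7 f ⊕ dilate7 g
  dil-+ f g n with n % 7 ℕ.≟ 0
  ... | yes _ = K.refl
  ... | no _ = K.sym (K.+-identityʳ _)

  dil-neg : ∀ f → dilate7 (negPS f) ≈ negPS (dilate7 f)
  dil-neg f n with n % 7 ℕ.≟ 0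
  ... | yes _ = K.refl
  ... | no _ = K.sym -0#≈0#
    where open import Algebra.Properties.Ring K.ring using (-0#≈0#)

  dil-· : ∀ a f → dilate7 (a · f) ≈ a · dilate7 f
  dil-· a f n with n % 7 ℕ.≟ 0
  ... | yes _ = K.refl
  ... | no _ = K.sym (K.zeroʳ _)

  dil-0 : dilate7 0# ≈ 0#
  dil-0 n with n % 7 ℕ.≟ 0
  ... | yes _ = K.refl
  ... | no _ = K.refl

  dil-1 : dilate7 one ≈ one
  dil-1 = trans (dil-step one) (trans (+-cong const-1 (trans (shift-cong 7 dil-0) (trans (shift≈ 7 0#) (zeroʳ (q ^ 7))))) (+-identityʳ one))

  dil-const : ∀ a → dilate7 (const a) ≈ const a
  dil-const a = trans (dil-· a one) (λ n → K.*-congˡ (dil-1 n))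

  dil-q : dilate7 q ≈ q ^ 7
  dil-q = trans (dil-step q) (trans (+-cong const-0 (shift-cong 7 dil-1)) (trans (+-identityˡ (shift 7 one)) (mono≈ 7)))

  q^7-cong : ∀ {N f g} → f ≈⟦ N ⟧ g → shift 7 f ≈⟦ suc N ⟧ shift 7 g
  q^7-cong {N} {f} {g} e n p = go 6 n p
    where
    go : ∀ k n → n ≤ suc N → shift (suc k) f n K.≈ shift (suc k) g n
    go k zero _ = K.refl
    go zero (suc n) (s≤s p) = e n p
    go (suc k) (suc n) (s≤s p) = go k n (ℕP.m≤n⇒m≤1+n p)

  dil-*[] : ∀ N f g → dilate7 (f ⊛ g) ≈⟦ N ⟧ dilate7 f ⊛ dilate7 g
  dil-*[] N f g = ≈[]-trans (≈⇒≈[] expandˡ) (≈[]-trans (+-cong[] (≈⇒≈[] (refl {rest})) (induct N)) (≈⇒≈[] (sym expandʳ)))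
    where
    rest : PS
    rest = const (f 0 K.* g 0) ⊕ shift 7 (f 0 · dilate7 (tail g))
    shift-⊕ : ∀ x y → shift 7 (x ⊕ y) ≈ shift 7 x ⊕ shift 7 y
    shift-⊕ x y = trans (shift≈ 7 (x ⊕ y)) (trans (distribˡ (q ^ 7) x y) (sym (+-cong (shift≈ 7 x) (shift≈ 7 y))))
    expandˡ : dilate7 (f ⊛ g) ≈ rest ⊕ shift 7 (dilate7 (tail f ⊛ g))
    expandˡ = trans (dil-step (f ⊛ g)) (trans (+-congˡ (trans (shift-cong 7 (trans (dil-cong (⊛-suc f g)) (trans (dil-+ (f 0 · tail g) (tail f ⊛ g)) (+-congʳ (dil-· (f 0) (tail g))))))
      (shift-⊕ (f 0 · dilate7 (tail g)) (dilate7 (tail f ⊛ g))))) (sym (+-assoc (const (f 0 K.* g 0)) (shift 7 (f 0 · dilate7 (tail g))) (shift 7 (dilate7 (tail f ⊛ g))))))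
    expandʳ : dilate7 f ⊛ dilate7 g ≈ rest ⊕ shift 7 (dilate7 (tail f) ⊛ dilate7 g)
    expandʳ = trans (*-congʳ {dilate7 g} (dil-step f)) (trans (distribʳ (dilate7 g) (const (f 0)) (shift 7 (dilate7 (tail f))))
      (+-cong (trans (*-congˡ (dil-step g)) (trans (distribˡ (const (f 0)) (const (g 0)) (shift 7 (dilate7 (tail g))))
                 (+-cong (sym (const-⊛ (f 0) (g 0))) (trans (*-congˡ (shift≈ 7 (dilate7 (tail g)))) (trans (swap (const (f 0)) (q ^ 7) (dilate7 (tail g))) (trans (*-congˡ (const-* (f 0) (dilate7 (tail g)))) (sym (shift≈ 7 (f 0 · dilate7 (tail g))))))))))
              (trans (*-congʳ {dilate7 g} (shift≈ 7 (dilate7 (tail f)))) (trans (*-assoc (q ^ 7) (dilate7 (tail f)) (dilate7 g)) (sym (shift≈ 7 (dilate7 (tail f) ⊛ dilate7 g)))))))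
      where
      swap : ∀ x y z → x ⊛ (y ⊛ z) ≈ y ⊛ (x ⊛ z)
      swap = solve 3 (λ x y z → x :* (y :* z) := y :* (x :* z)) refl
    induct : ∀ N → shift 7 (dilate7 (tail f ⊛ g)) ≈⟦ N ⟧ shift 7 (dilate7 (tail f) ⊛ dilate7 g)
    induct zero zero _ = K.refl
    induct (suc N) = q^7-cong (dil-*[] N (tail f) g)

  dil-* : ∀ f g → dilate7 (f ⊛ g) ≈ dilate7 f ⊛ dilate7 g
  dil-* f g = separated λ N → dil-*[] N f g

  bisum-⇓ℤ : ∀ T → (∀ n N → N < ‖ n ‖ → T n N K.≈ K.0#) → T ⇓ℤ bisum T
  bisum-⇓ℤ T small .null N = suc N , λ n p i i≤N → small n i (ℕP.≤-<-trans i≤N p)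
  bisum-⇓ℤ T small .pairs N = suc N , λ M p n n≤N → K.trans
    (≡.subst (λ m → partial (pair T) m n K.≈ partial (pair T) (suc n) n) (ℕP.m+[n∸m]≡n (ℕP.≤-trans (s≤s n≤N) p))
      (partial-stable {n} (suc n) (M ∸ suc n) (λ k n<k i i≤n → K.trans (K.+-cong (small (+ k) i (ℕP.≤-<-trans i≤n n<k)) (small -[1+ k ] i (ℕP.≤-<-trans i≤n n<k))) (K.+-identityʳ _)) n ℕP.≤-refl))
    (K.trans (partial≈sumTo n n) (sumTo-+ n _ _))
    where
    partial≈sumTo : ∀ m n → partial (pair T) (suc m) n K.≈ sumTo m (λ k → T (+ k) n K.+ T -[1+ k ] n)
    partial≈sumTo zero n = K.+-identityˡ _
    partial≈sumTo (suc m) n = K.+-congʳ (partial≈sumTo m n)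

  sum7≈ : ∀ h → sum7 h ≈ partial h 7
  sum7≈ h n = K.sym (go 6)
    where
    go : ∀ m → partial h (suc m) n K.≈ sumTo m (λ i → h i n)
    go zero = K.+-identityˡ _
    go (suc m) = K.+-congʳ (go m)

module Proof {ℓ₁ ℓ₂ : Level} (F : Field ℓ₁ ℓ₂) (ζ : Field.Carrier F)
  (charZero : FieldNotions.CharZero F) (prim : FieldNotions.IsPrimitiveRoot F 7 ζ) where

  module K = Field F
  open Thm7 F ζ using (PS; _⊛_; _⊖_; _·_; one; mono; shift; inv; poch; theta; dilate7; bisum; sum7; pow; nat; ζ⁻¹; c₁; c₂; _/7; D; term₁; term₂; A; LHS; RHS)
  open FieldNotions.IsPrimitiveRoot prim
  open PSRing F
  open PSInstance F using (PSF; q; shift≈; shift-null; mono≈; q-null; complete; *-inv; u; u-inverse; poch-limit; poch-invertible; const; const-*; const-cong; const-+; const-⊛; const-neg; const-1; const-0; 1≉0; 1-0; dil-cong; dil-cong[]; dil-+; dil-*; dil-neg; dil-0; dil-1; dil-q; dil-const; bisum-⇓ℤ; sum7≈)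
  open FilteredRing PSF
  open RingTools commutativeRing
  open FiniteSums commutativeRing
  open ZSums PSF
  open Exp semiring using (_^_)
  open Relation.Binary.Reasoning.Setoid setoid
  module RK = RingTools K.commutativeRing
  module KR = Relation.Binary.Reasoning.Setoid K.setoid

  unit-nonzero : ∀ {x y} → x K.* y K.≈ K.1# → ¬ (x K.≈ K.0#)
  unit-nonzero xy≈1 x≈0 = K.0≉1 (K.trans (K.sym (K.zeroˡ _)) (K.trans (K.*-congʳ (K.sym x≈0)) xy≈1))

  unit-cancel : ∀ {x y z} → x K.* y K.≈ K.1# → x K.* z K.≈ K.0# → z K.≈ K.0#
  unit-cancel {x} {y} {z} xy≈1 xz≈0 = KR.begin
    z                  KR.≈⟨ K.trans (K.sym (K.*-identityˡ z)) (K.*-congʳ (K.sym xy≈1)) ⟩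
    x K.* y K.* z      KR.≈⟨ RK.solve 3 (λ x y z → x RK.:* y RK.:* z RK.:= y RK.:* (x RK.:* z)) K.refl x y z ⟩
    y K.* (x K.* z)    KR.≈⟨ K.trans (K.*-congˡ xz≈0) (K.zeroʳ y) ⟩
    K.0#               KR.∎

  ζζ⁶≈1 : ζ K.* pow ζ 6 K.≈ K.1#
  ζζ⁶≈1 = root

  ζζ⁻¹≈1 : ζ K.* ζ⁻¹ K.≈ K.1#
  ζζ⁻¹≈1 = K.⁻¹-inverse ζ (unit-nonzero ζζ⁶≈1)

  ζ⁻¹≈ζ⁶ : ζ⁻¹ K.≈ pow ζ 6
  ζ⁻¹≈ζ⁶ = KR.begin
    ζ⁻¹                        KR.≈⟨ K.trans (K.sym (K.*-identityʳ ζ⁻¹)) (K.*-congˡ (K.sym ζζ⁶≈1)) ⟩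
    ζ⁻¹ K.* (ζ K.* pow ζ 6)    KR.≈⟨ RK.solve 3 (λ i z w → i RK.:* (z RK.:* w) RK.:= z RK.:* i RK.:* w) K.refl ζ⁻¹ ζ (pow ζ 6) ⟩
    ζ K.* ζ⁻¹ K.* pow ζ 6      KR.≈⟨ K.trans (K.*-congʳ ζζ⁻¹≈1) (K.*-identityˡ _) ⟩
    pow ζ 6                    KR.∎

  difference-nonzero : ∀ {x y} → ¬ (x K.≈ y) → ¬ (x K.+ K.- y K.≈ K.0#)
  difference-nonzero {x} {y} x≉y e = x≉y (K.trans (RK.solve 2 (λ x y → x RK.:= (x RK.:- y) RK.:+ y) K.refl x y) (K.trans (K.+-congʳ e) (K.+-identityˡ y)))

  ζ≉1 : ¬ (K.1# K.≈ ζ)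
  ζ≉1 e = isPrimitive 1 (s≤s z≤n) (s≤s (s≤s z≤n)) (K.trans (K.*-identityʳ ζ) (K.sym e))

  1-ζ-unit : (K.1# K.+ K.- ζ) K.* ((K.1# K.+ K.- ζ) K.⁻¹) K.≈ K.1#
  1-ζ-unit = K.⁻¹-inverse _ (difference-nonzero ζ≉1)

  c : K.Carrier
  c = ζ K.+ ζ⁻¹

  c₁≈c : c₁ K.≈ c
  c₁≈c = K.+-congˡ (K.sym ζ⁻¹≈ζ⁶)

  private
    modulo-ζ : ∀ a {x} → x K.+ a K.* (ζ K.* ζ⁻¹ K.- K.1#) K.≈ x
    modulo-ζ a = K.trans (K.+-congˡ (K.trans (K.*-congˡ (K.trans (K.+-congʳ ζζ⁻¹≈1) (K.-‿inverseʳ K.1#))) (K.zeroʳ a))) (K.+-identityʳ _)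

  cyclotomic : K.1# K.+ ζ K.+ ζ K.* ζ K.+ ζ K.* ζ K.* ζ K.+ ζ K.* ζ K.* ζ K.* ζ K.+ ζ K.* ζ K.* ζ K.* ζ K.* ζ K.+ ζ K.* ζ K.* ζ K.* ζ K.* ζ K.* ζ K.≈ K.0#
  cyclotomic = unit-cancel 1-ζ-unit (K.trans
    (RK.solve 1 (λ z → let o = RK.con (+ 1) in (o RK.:- z) RK.:* (o RK.:+ z RK.:+ z RK.:* z RK.:+ z RK.:* z RK.:* z RK.:+ z RK.:* z RK.:* z RK.:* z RK.:+ z RK.:* z RK.:* z RK.:* z RK.:* z RK.:+ z RK.:* z RK.:* z RK.:* z RK.:* z RK.:* z) RK.:=
      o RK.:- z RK.:* (z RK.:* (z RK.:* (z RK.:* (z RK.:* (z RK.:* (z RK.:* o))))))) K.refl ζ)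
    (K.trans (K.+-congˡ (K.-‿cong root)) (K.-‿inverseʳ K.1#)))

  c-root : c K.* c K.* c K.+ c K.* c K.- (K.1# K.+ K.1#) K.* c K.- K.1# K.≈ K.0#
  c-root = KR.begin
    c K.* c K.* c K.+ c K.* c K.- (K.1# K.+ K.1#) K.* c K.- K.1#
      KR.≈⟨ RK.solve 2 (λ z w → let c = z RK.:+ w ; o = RK.con (+ 1) ; r = z RK.:* w RK.:- o in
          c RK.:* c RK.:* c RK.:+ c RK.:* c RK.:- RK.con (+ 2) RK.:* c RK.:- o RK.:=
          w RK.:* w RK.:* w RK.:* (o RK.:+ z RK.:+ z RK.:* z RK.:+ z RK.:* z RK.:* z RK.:+ z RK.:* z RK.:* z RK.:* z RK.:+ z RK.:* z RK.:* z RK.:* z RK.:* z RK.:+ z RK.:* z RK.:* z RK.:* z RK.:* z RK.:* z)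
          RK.:+ (RK.con (+ 3) RK.:* z RK.:+ RK.con (+ 3) RK.:* w RK.:+ RK.con (+ 2)
                 RK.:- w RK.:* w RK.:- w RK.:* (z RK.:* w RK.:+ o) RK.:- ((z RK.:* w) RK.:* (z RK.:* w) RK.:+ z RK.:* w RK.:+ o)
                 RK.:- z RK.:* ((z RK.:* w) RK.:* (z RK.:* w) RK.:+ z RK.:* w RK.:+ o)
                 RK.:- z RK.:* z RK.:* ((z RK.:* w) RK.:* (z RK.:* w) RK.:+ z RK.:* w RK.:+ o)
                 RK.:- z RK.:* z RK.:* z RK.:* ((z RK.:* w) RK.:* (z RK.:* w) RK.:+ z RK.:* w RK.:+ o)) RK.:* r) K.refl ζ ζ⁻¹ ⟩
    _ KR.≈⟨ modulo-ζ _ ⟩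
    _ KR.≈⟨ K.trans (K.*-congˡ cyclotomic) (K.zeroʳ _) ⟩
    K.0# KR.∎

  nat-unit : ∀ n → nat (suc n) K.* (nat (suc n) K.⁻¹) K.≈ K.1#
  nat-unit n = K.⁻¹-inverse _ (charZero n)

  c₂≈ : c₂ K.≈ c K.* c K.- (K.1# K.+ K.1#)
  c₂≈ = K.sym (KR.begin
    c K.* c K.- (K.1# K.+ K.1#)
      KR.≈⟨ RK.solve 2 (λ z w → (z RK.:+ w) RK.:* (z RK.:+ w) RK.:- RK.con (+ 2) RK.:= z RK.:* (z RK.:* RK.con (+ 1)) RK.:+ w RK.:* w RK.:+ RK.con (+ 2) RK.:* (z RK.:* w RK.:- RK.con (+ 1))) K.refl ζ ζ⁻¹ ⟩
    pow ζ 2 K.+ ζ⁻¹ K.* ζ⁻¹ K.+ (K.1# K.+ K.1#) K.* (ζ K.* ζ⁻¹ K.- K.1#)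
      KR.≈⟨ K.trans (modulo-ζ _) (K.+-congˡ (K.*-congʳ ζ⁻¹≈ζ⁶)) ⟩
    pow ζ 2 K.+ pow ζ 6 K.* ζ⁻¹
      KR.≈⟨ RK.solve 4 (λ z w x y → x RK.:+ z RK.:* y RK.:* w RK.:= x RK.:+ y RK.:+ y RK.:* (z RK.:* w RK.:- RK.con (+ 1))) K.refl ζ ζ⁻¹ (pow ζ 2) (pow ζ 5) ⟩
    pow ζ 2 K.+ pow ζ 5 K.+ pow ζ 5 K.* (ζ K.* ζ⁻¹ K.- K.1#)
      KR.≈⟨ modulo-ζ _ ⟩
    c₂ KR.∎)

  ζ̂ ζ̂⁻ ĉ ½ : PS
  ζ̂ = const ζ
  ζ̂⁻ = const ζ⁻¹
  ĉ = ζ̂ + ζ̂⁻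
  ½ = const (nat 2 K.⁻¹)

  half : ½ * (1# + 1#) ≈ 1#
  half = begin
    ½ * (1# + 1#)                        ≈⟨ solve 1 (λ h → h :* con (+ 2) := h :+ h) refl ½ ⟩
    ½ + ½                                ≈⟨ const-+ (nat 2 K.⁻¹) (nat 2 K.⁻¹) ⟨
    const (nat 2 K.⁻¹ K.+ nat 2 K.⁻¹)    ≈⟨ const-cong (K.trans (RK.solve 1 (λ h → h RK.:+ h RK.:= (RK.con (+ 1) RK.:+ (RK.con (+ 1) RK.:+ RK.con (+ 0))) RK.:* h) K.refl (nat 2 K.⁻¹)) (nat-unit 1)) ⟩
    const K.1#                           ≈⟨ const-1 ⟩
    1#                                   ∎

  S : SeriesAlgebra ℓ₁ ℓ₂
  S = record
    { filteredRing = PSF ; q = q ; q-null = q-null ; complete = complete ; ½ = ½ ; half = half ; u = u ; u-inverse = u-inverse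
    ; poch = poch ; poch-limit = poch-limit ; poch-invertible = poch-invertible
    ; dil = dilate7 ; dil-cong = dil-cong ; dil-cong[] = dil-cong[] ; dil-+ = dil-+ ; dil-* = dil-* ; dil-neg = dil-neg
    ; dil-0 = dil-0 ; dil-1 = dil-1 ; dil-q = dil-q }

  ζ̂ζ̂⁻≈1 : ζ̂ * ζ̂⁻ ≈ 1#
  ζ̂ζ̂⁻≈1 = trans (sym (const-⊛ ζ ζ⁻¹)) (trans (const-cong ζζ⁻¹≈1) const-1)

  const-^ : ∀ x n → const (pow x n) ≈ const x ^ n
  const-^ x zero = const-1
  const-^ x (suc n) = trans (const-⊛ x (pow x n)) (*-congˡ (const-^ x n))

  ζ̂⁷≈1 : ζ̂ ^ 7 ≈ 1#
  ζ̂⁷≈1 = trans (sym (const-^ ζ 7)) (trans (const-cong root) const-1)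

  ĉ≈ : const c ≈ ĉ
  ĉ≈ = const-+ ζ ζ⁻¹

  private
    infixl 6 _⟨+⟩_ _⟨-⟩_
    infixl 7 _⟨*⟩_
    _⟨+⟩_ : ∀ {x y x′ y′} → const x ≈ x′ → const y ≈ y′ → const (x K.+ y) ≈ x′ + y′
    _⟨+⟩_ {x} {y} p p′ = trans (const-+ x y) (+-cong p p′)
    _⟨*⟩_ : ∀ {x y x′ y′} → const x ≈ x′ → const y ≈ y′ → const (x K.* y) ≈ x′ * y′
    _⟨*⟩_ {x} {y} p p′ = trans (const-⊛ x y) (*-cong p p′)
    ⟨neg⟩ : ∀ {x x′} → const x ≈ x′ → const (K.- x) ≈ - x′
    ⟨neg⟩ {x} p = trans (const-neg x) (-‿cong p)
    _⟨-⟩_ : ∀ {x y x′ y′} → const x ≈ x′ → const y ≈ y′ → const (x K.- y) ≈ x′ - y′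
    p ⟨-⟩ p′ = p ⟨+⟩ ⟨neg⟩ p′
    const-2 : const (K.1# K.+ K.1#) ≈ 1# + 1#
    const-2 = const-1 ⟨+⟩ const-1

  ĉ-root : ĉ * ĉ * ĉ + ĉ * ĉ - (1# + 1#) * ĉ - 1# ≈ 0#
  ĉ-root = trans (sym (ĉ≈ ⟨*⟩ ĉ≈ ⟨*⟩ ĉ≈ ⟨+⟩ ĉ≈ ⟨*⟩ ĉ≈ ⟨-⟩ const-2 ⟨*⟩ ĉ≈ ⟨-⟩ const-1)) (trans (const-cong c-root) const-0)

  dil-ĉ : dilate7 ĉ ≈ ĉ
  dil-ĉ = trans (dil-+ ζ̂ ζ̂⁻) (+-cong (dil-const ζ) (dil-const ζ⁻¹))

  private
    module _ (m : ℕ) where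
      δ : PS
      δ = (one ⊖ ζ · mono m) ⊛ (one ⊖ ζ⁻¹ · mono m)
      δ≈ : δ ≈ 1# - ĉ * q ^ m + q ^ m * q ^ m
      δ≈ = begin
        δ
          ≈⟨ *-cong (+-congˡ {one} (-‿cong (scaled ζ))) (+-congˡ {one} (-‿cong (scaled ζ⁻¹))) ⟩
        (1# - ζ̂ * q ^ m) * (1# - ζ̂⁻ * q ^ m)
          ≈⟨ solve 3 (λ z w p → (con (+ 1) :- z :* p) :* (con (+ 1) :- w :* p) := con (+ 1) :- (z :+ w) :* p :+ (z :* w) :* (p :* p)) refl ζ̂ ζ̂⁻ (q ^ m) ⟩
        1# - ĉ * q ^ m + (ζ̂ * ζ̂⁻) * (q ^ m * q ^ m)
          ≈⟨ +-congˡ {1# - ĉ * q ^ m} (trans (*-congʳ {q ^ m * q ^ m} ζ̂ζ̂⁻≈1) (*-identityˡ (q ^ m * q ^ m))) ⟩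
        1# - ĉ * q ^ m + q ^ m * q ^ m ∎
        where
        scaled : ∀ a → a · mono m ≈ const a * q ^ m
        scaled a = trans (λ n → K.*-congˡ (mono≈ m n)) (sym (const-* a (q ^ m)))

    δ-nonzero : ∀ m → ¬ (δ m 0 K.≈ K.0#)
    δ-nonzero zero e = difference-nonzero ζ⁻¹≉1 (K.trans (K.+-congˡ (K.-‿cong (K.sym (K.*-identityʳ ζ⁻¹))))
      (unit-cancel 1-ζ-unit (K.trans (K.*-congʳ (K.+-congˡ (K.-‿cong (K.sym (K.*-identityʳ ζ))))) e)))
      where
      ζ⁻¹≉1 : ¬ (K.1# K.≈ ζ⁻¹)
      ζ⁻¹≉1 e = ζ≉1 (K.trans (K.sym ζζ⁻¹≈1) (K.trans (K.*-congˡ (K.sym e)) (K.*-identityʳ ζ)))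
    δ-nonzero (suc m) e = 1≉0 (K.trans (K.sym (K.trans (K.*-cong (1-0 (K.zeroʳ ζ)) (1-0 (K.zeroʳ ζ⁻¹))) (K.*-identityˡ K.1#))) e)

  D-inverse : ∀ m → D m * (1# - ĉ * q ^ m + q ^ m * q ^ m) ≈ 1#
  D-inverse m = trans (*-congˡ {D m} (sym (δ≈ m))) (trans (*-comm (D m) (δ m)) (*-inv (δ m) (δ-nonzero m)))

  open ThetaFunctions S using (t; j; e₇; e₂₁; τ₃)
  open Dissection S using (dil-^)
  open SeventhRoot.Period S ζ̂ ζ̂⁻ ζ̂ζ̂⁻≈1 ζ̂⁷≈1 using (module Real)
  open Real ĉ-root dil-ĉ using (module CI; ρ̂; form-0; form-1; form-2; form-3; form-4; form-5; form-6; module LambertSeries)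
  open LambertSeries D D-inverse using (lambert-series)
  open Lambert.LambertProduct S ĉ D D-inverse using (cubic)

  term₁-sum : term₁ ⇓ℤ bisum term₁
  term₁-sum = bisum-⇓ℤ term₁ λ
    { (+ n) N p → shift-null (3 ℕ.* n ℕ.* n ℕ.+ 2 ℕ.* n) (D (3 ℕ.* n)) N (ℕP.<-≤-trans p (ℕP.≤-trans (ℕP.m≤n*m n 2) (ℕP.m≤n+m (2 ℕ.* n) (3 ℕ.* n ℕ.* n))))
    ; -[1+ n ] N p → shift-null (3 ℕ.* suc n ℕ.* suc n ℕ.+ 4 ℕ.* suc n) (D (3 ℕ.* suc n)) N
        (ℕP.<-≤-trans p (ℕP.≤-trans (ℕP.n≤1+n n) (ℕP.≤-trans (ℕP.m≤n*m (suc n) 4) (ℕP.m≤n+m (4 ℕ.* suc n) (3 ℕ.* suc n ℕ.* suc n))))) }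

  term₂-sum : term₂ ⇓ℤ bisum term₂
  term₂-sum = bisum-⇓ℤ term₂ λ
    { (+ n) N p → shift-null (3 ℕ.* n ℕ.* n ℕ.+ 4 ℕ.* n ℕ.+ 1) (D (3 ℕ.* n ℕ.+ 1)) N
        (ℕP.<-≤-trans p (ℕP.≤-trans (ℕP.≤-trans (ℕP.m≤n*m n 4) (ℕP.m≤n+m (4 ℕ.* n) (3 ℕ.* n ℕ.* n))) (ℕP.m≤m+n _ 1)))
    ; -[1+ n ] N p → shift-null (3 ℕ.* suc n ℕ.* suc n ℕ.+ 2 ℕ.* suc n ∸ 1) (D (3 ℕ.* suc n ∸ 1)) N
        (ℕP.<-≤-trans p (ℕP.∸-monoˡ-≤ {suc n} {3 ℕ.* suc n ℕ.* suc n ℕ.+ 2 ℕ.* suc n} 1 (ℕP.≤-trans (ℕP.m≤n*m (suc n) 2) (ℕP.m≤n+m (2 ℕ.* suc n) (3 ℕ.* suc n ℕ.* suc n))))) }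

  private
    shifted : ∀ {k k′ m m′} → k ≡ k′ → m ≡ m′ → shift k (D m) ≈ q ^ k′ * D m′
    shifted {k} {m = m} ≡.refl ≡.refl = shift≈ k (D m)

  term₁-fold : ∀ p → 0 < p → fold term₁ p ≈ (q ^ cubic 2 0 p + q ^ cubic 4 0 p) * D (p ℕ.* 3 ℕ.+ 0)
  term₁-fold (suc p) _ = trans (+-cong (shifted (exponent 2 k) (index k)) (shifted (exponent 4 k) (index k)))
    (sym (distribʳ (D (k ℕ.* 3 ℕ.+ 0)) (q ^ cubic 2 0 k) (q ^ cubic 4 0 k)))
    where
    k = suc p
    exponent : ∀ a k → 3 ℕ.* k ℕ.* k ℕ.+ a ℕ.* k ≡ cubic a 0 k
    exponent a k = ≡.sym (ℕP.+-identityʳ _)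
    index : ∀ k → 3 ℕ.* k ≡ k ℕ.* 3 ℕ.+ 0
    index = ℕ-solve-∀

  term₂-pair : ∀ p → pair term₂ p ≈ q ^ cubic 4 1 p * D (p ℕ.* 3 ℕ.+ 1) + q ^ cubic 8 4 p * D (p ℕ.* 3 ℕ.+ 2)
  term₂-pair p = +-cong (shifted {cubic 4 1 p} ≡.refl (index₁ p)) (shifted (≡.cong (_∸ 1) (exponent p)) (≡.cong (_∸ 1) (index₂ p)))
    where
    index₁ : ∀ p → 3 ℕ.* p ℕ.+ 1 ≡ p ℕ.* 3 ℕ.+ 1
    index₁ = ℕ-solve-∀
    index₂ : ∀ p → 3 ℕ.* suc p ≡ suc (p ℕ.* 3 ℕ.+ 2)
    index₂ = ℕ-solve-∀
    exponent : ∀ p → 3 ℕ.* suc p ℕ.* suc p ℕ.+ 2 ℕ.* suc p ≡ suc (3 ℕ.* p ℕ.* p ℕ.+ 8 ℕ.* p ℕ.+ 4)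
    exponent = ℕ-solve-∀

  private
    2-c : K.Carrier
    2-c = K.1# K.+ K.1# K.- c

    modulo-root : ∀ a {x} → x K.+ a K.* (c K.* c K.* c K.+ c K.* c K.- (K.1# K.+ K.1#) K.* c K.- K.1#) K.≈ x
    modulo-root a = K.trans (K.+-congˡ (K.trans (K.*-congˡ c-root) (K.zeroʳ a))) (K.+-identityʳ _)

    Poly : Set
    Poly = RK.Polynomial 1
    natᵖ : ℕ → Poly
    natᵖ zero = RK.con (+ 0)
    natᵖ (suc n) = RK.con (+ 1) RK.:+ natᵖ n
    rootᵖ 2-cᵖ c₂ᵖ : Poly → Poly
    rootᵖ c = c RK.:* c RK.:* c RK.:+ c RK.:* c RK.:- RK.con (+ 2) RK.:* c RK.:- RK.con (+ 1)
    2-cᵖ c = RK.con (+ 2) RK.:- c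
    c₂ᵖ c = c RK.:* c RK.:- RK.con (+ 2)

  scale-/7 : ∀ {x y z} → x K.≈ y → 2-c K.* y K.≈ nat 7 K.* z → 2-c K.* (x /7) K.≈ z
  scale-/7 {x} {y} {z} e e′ = KR.begin
    2-c K.* (x K.* (nat 7 K.⁻¹))       KR.≈⟨ K.trans (K.sym (K.*-assoc _ _ _)) (K.*-congʳ (K.trans (K.*-congˡ e) e′)) ⟩
    nat 7 K.* z K.* (nat 7 K.⁻¹)       KR.≈⟨ RK.solve 3 (λ s z i → s RK.:* z RK.:* i RK.:= z RK.:* (s RK.:* i)) K.refl (nat 7) z (nat 7 K.⁻¹) ⟩
    z K.* (nat 7 K.* (nat 7 K.⁻¹))     KR.≈⟨ K.trans (K.*-congˡ (nat-unit 6)) (K.*-identityʳ z) ⟩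
    z                                  KR.∎

  k₀ k₁ k₂ k₃ k₄ k₆ : K.Carrier
  k₀ = (nat 6 K.+ nat 3 K.* c₁ K.+ c₂) /7
  k₁ = (K.- K.1# K.+ nat 3 K.* c₁ K.+ c₂) /7
  k₂ = (nat 5 K.- c₁ K.+ nat 2 K.* c₂) /7
  k₃ = (K.- nat 3 K.+ nat 2 K.* c₁ K.- nat 4 K.* c₂) /7
  k₄ = (nat 2 K.+ c₁ K.+ nat 5 K.* c₂) /7
  k₆ = (K.- nat 4 K.- nat 2 K.* c₁ K.- nat 3 K.* c₂) /7

  k₀≈ : 2-c K.* k₀ K.≈ K.1#
  k₀≈ = scale-/7 (K.+-cong (K.+-congˡ (K.*-congˡ c₁≈c)) c₂≈) (K.trans
    (RK.solve 1 (λ c → 2-cᵖ c RK.:* (natᵖ 6 RK.:+ natᵖ 3 RK.:* c RK.:+ c₂ᵖ c) RK.:= natᵖ 7 RK.:* RK.con (+ 1) RK.:+ RK.con -[1+ 0 ] RK.:* rootᵖ c) K.refl c) (modulo-root _))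

  k₁≈ : 2-c K.* k₁ K.≈ c K.- K.1#
  k₁≈ = scale-/7 (K.+-cong (K.+-congˡ (K.*-congˡ c₁≈c)) c₂≈) (K.trans
    (RK.solve 1 (λ c → 2-cᵖ c RK.:* (RK.:- RK.con (+ 1) RK.:+ natᵖ 3 RK.:* c RK.:+ c₂ᵖ c) RK.:= natᵖ 7 RK.:* (c RK.:- RK.con (+ 1)) RK.:+ RK.con -[1+ 0 ] RK.:* rootᵖ c) K.refl c) (modulo-root _))

  k₂≈ : 2-c K.* k₂ K.≈ c K.* c K.- c
  k₂≈ = scale-/7 (K.+-cong (K.+-congˡ (K.-‿cong c₁≈c)) (K.*-congˡ c₂≈)) (K.trans
    (RK.solve 1 (λ c → 2-cᵖ c RK.:* (natᵖ 5 RK.:- c RK.:+ natᵖ 2 RK.:* c₂ᵖ c) RK.:= natᵖ 7 RK.:* (c RK.:* c RK.:- c) RK.:+ RK.con -[1+ 1 ] RK.:* rootᵖ c) K.refl c) (modulo-root _))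

  k₃≈ : 2-c K.* k₃ K.≈ K.1# K.+ K.1# K.+ c K.- (K.1# K.+ K.1#) K.* (c K.* c)
  k₃≈ = scale-/7 (K.+-cong (K.+-congˡ (K.*-congˡ c₁≈c)) (K.-‿cong (K.*-congˡ c₂≈))) (K.trans
    (RK.solve 1 (λ c → 2-cᵖ c RK.:* (RK.:- natᵖ 3 RK.:+ natᵖ 2 RK.:* c RK.:- natᵖ 4 RK.:* c₂ᵖ c) RK.:=
      natᵖ 7 RK.:* (RK.con (+ 2) RK.:+ c RK.:- RK.con (+ 2) RK.:* (c RK.:* c)) RK.:+ RK.con (+ 4) RK.:* rootᵖ c) K.refl c) (modulo-root _))

  k₄≈ : 2-c K.* k₄ K.≈ K.- c K.- (K.1# K.- c K.- c K.* c) K.* 2-c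
  k₄≈ = scale-/7 (K.+-cong (K.+-congˡ c₁≈c) (K.*-congˡ c₂≈)) (K.trans
    (RK.solve 1 (λ c → 2-cᵖ c RK.:* (natᵖ 2 RK.:+ c RK.:+ natᵖ 5 RK.:* c₂ᵖ c) RK.:=
      natᵖ 7 RK.:* (RK.:- c RK.:- (RK.con (+ 1) RK.:- c RK.:- c RK.:* c) RK.:* 2-cᵖ c) RK.:+ RK.con (+ 2) RK.:* rootᵖ c) K.refl c) (modulo-root _))

  k₆≈ : 2-c K.* k₆ K.≈ K.- (c K.* c K.- (K.1# K.+ K.1#) K.+ K.1#)
  k₆≈ = scale-/7 (K.+-cong (K.+-congˡ (K.-‿cong (K.*-congˡ c₁≈c))) (K.-‿cong (K.*-congˡ c₂≈))) (K.trans
    (RK.solve 1 (λ c → 2-cᵖ c RK.:* (RK.:- natᵖ 4 RK.:- natᵖ 2 RK.:* c RK.:- natᵖ 3 RK.:* c₂ᵖ c) RK.:=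
      natᵖ 7 RK.:* (RK.:- (c₂ᵖ c RK.:+ RK.con (+ 1))) RK.:+ RK.con (+ 3) RK.:* rootᵖ c) K.refl c) (modulo-root _))

  private
    ĉ₂≈ : const c₂ ≈ CI.c₂
    ĉ₂≈ = trans (const-cong c₂≈) (ĉ≈ ⟨*⟩ ĉ≈ ⟨-⟩ const-2)
    ĉ₁≈ : const c₁ ≈ ĉ
    ĉ₁≈ = trans (const-cong c₁≈c) ĉ≈
    scaled-by : ∀ {k z z′} → 2-c K.* k K.≈ z → const z ≈ z′ → CI.w * const k ≈ z′
    scaled-by {k} e e′ = trans (*-congʳ {const k} (sym (const-2 ⟨-⟩ ĉ≈))) (trans (sym (const-⊛ 2-c k)) (trans (const-cong e) e′))
    ·≈ : ∀ {a a′ f g} → const a ≈ a′ → f ≈ g → a · f ≈ a′ * g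
    ·≈ {a} {f = f} e e′ = trans (sym (const-* a f)) (*-cong e e′)
    by-const : ∀ k f → k · f ≈ const k * f
    by-const k f = sym (const-* k f)

    theta-const : ∀ a p → 1 ≤ a → 1 ≤ p ∸ a → theta a p 0 K.≈ K.1#
    theta-const a p 1≤a 1≤p∸a = K.trans (K.*-cong (poch-const a p 1≤a) (poch-const (p ∸ a) p 1≤p∸a)) (K.*-identityˡ K.1#)
      where
      poch-const : ∀ a d → 1 ≤ a → poch a d 0 K.≈ K.1#
      poch-const a d 1≤a = 1-0 (shift-null (a ℕ.+ d ℕ.* 0) one 0 (ℕP.≤-trans 1≤a (ℕP.m≤m+n a _)))

    constant-1 : ∀ {f g} → f 0 K.≈ K.1# → g 0 K.≈ K.1# → (f ⊛ g) 0 K.≈ K.1#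
    constant-1 e e′ = K.trans (K.*-cong e e′) (K.*-identityˡ K.1#)

    invertible : ∀ {f} → f 0 K.≈ K.1# → f * inv f ≈ 1#
    invertible {f} e = *-inv f (λ e′ → 1≉0 (K.trans (K.sym e) e′))

    1≤ : ∀ {n} → 1 ≤ suc n
    1≤ = s≤s z≤n
    θ7 : ∀ a {n} → 1 ≤ a → 7 ∸ a ≡ suc n → theta a 7 0 K.≈ K.1#
    θ7 a 1≤a e = theta-const a 7 1≤a (≡.subst (1 ≤_) (≡.sym e) 1≤)
    θ21 : ∀ a {n} → 1 ≤ a → 21 ∸ a ≡ suc n → theta a 21 0 K.≈ K.1#
    θ21 a 1≤a e = theta-const a 21 1≤a (≡.subst (1 ≤_) (≡.sym e) 1≤)

    triple : ∀ {f g h} → f 0 K.≈ K.1# → g 0 K.≈ K.1# → h 0 K.≈ K.1# → f * g * h * inv (f * g * h) ≈ 1#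
    triple {f} {g} {h} e₁ e₂ e₃ = invertible {f * g * h} (constant-1 {f * g} {h} (constant-1 {f} {g} e₁ e₂) e₃)

  B : ℕ → PS
  B i = e₇ * A i

  B-form : ∀ i → i < 7 → CI.w * B i ≈ e₂₁ * (τ₃ * ρ̂ i)
  B-form 0 _ = trans (*-congˡ {CI.w} (*-congˡ {e₇} (+-cong (by-const k₀ (t 3 * i)) (-‿cong (·≈ (const-1 ⟨+⟩ ĉ₁≈) (shift≈ 2 i′))))))
    (form-0 {const k₀} {i} {i′} (scaled-by k₀≈ const-1) (invertible {t 1 * t 2} (constant-1 {t 1} {t 2} (θ7 1 1≤ ≡.refl) (θ7 2 1≤ ≡.refl)))
      (triple {j 6} {j 7} {j 8} (θ21 6 1≤ ≡.refl) (θ21 7 1≤ ≡.refl) (θ21 8 1≤ ≡.refl)))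
    where
    i i′ : PS
    i = inv (t 1 * t 2)
    i′ = inv (j 6 * j 7 * j 8)
  B-form 1 _ = trans (*-congˡ {CI.w} (*-congˡ {e₇} (by-const k₁ (inv (t 1)))))
    (form-1 {const k₁} {inv (t 1)} (scaled-by k₁≈ (ĉ≈ ⟨-⟩ const-1)) (invertible {t 1} (θ7 1 1≤ ≡.refl)))
  B-form 2 _ = trans (*-congˡ {CI.w} (*-congˡ {e₇} (+-cong (by-const k₂ (t 2 * i)) (-‿cong (·≈ (const-1 ⟨+⟩ ĉ₂≈) (trans (shift≈ 1 i′) (*-congʳ {i′} (*-identityʳ q))))))))
    (form-2 {const k₂} {i} {i′} (scaled-by k₂≈ (ĉ≈ ⟨*⟩ ĉ≈ ⟨-⟩ ĉ≈)) (invertible {t 1 * t 3} (constant-1 {t 1} {t 3} (θ7 1 1≤ ≡.refl) (θ7 3 1≤ ≡.refl)))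
      (triple {j 3} {j 7} {j 10} (θ21 3 1≤ ≡.refl) (θ21 7 1≤ ≡.refl) (θ21 10 1≤ ≡.refl)))
    where
    i i′ : PS
    i = inv (t 1 * t 3)
    i′ = inv (j 3 * j 7 * j 10)
  B-form 3 _ = trans (*-congˡ {CI.w} (*-congˡ {e₇} (by-const k₃ (inv (t 2)))))
    (form-3 {const k₃} {inv (t 2)} (scaled-by k₃≈ (const-2 ⟨+⟩ ĉ≈ ⟨-⟩ const-2 ⟨*⟩ (ĉ≈ ⟨*⟩ ĉ≈))) (invertible {t 2} (θ7 2 1≤ ≡.refl)))
  B-form 4 _ = trans (*-congˡ {CI.w} (*-congˡ {e₇} (by-const k₄ (inv (t 3)))))
    (form-4 {const k₄} {inv (t 3)} (scaled-by k₄≈ (⟨neg⟩ ĉ≈ ⟨-⟩ (const-1 ⟨-⟩ ĉ≈ ⟨-⟩ ĉ≈ ⟨*⟩ ĉ≈) ⟨*⟩ (const-2 ⟨-⟩ ĉ≈))) (invertible {t 3} (θ7 3 1≤ ≡.refl)))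
  B-form 5 _ = trans (*-congˡ {CI.w} (*-congˡ {e₇} (+-cong (·≈ ĉ₁≈ (refl {j 5 * i})) (·≈ ĉ₁≈ (shift≈ 2 (j 2 * i′))))))
    (form-5 {i} {i′}
      (invertible {j 3 * j 4 * j 7 * j 7} (constant-1 {j 3 * j 4 * j 7} {j 7} (constant-1 {j 3 * j 4} {j 7} (constant-1 {j 3} {j 4} (θ21 3 1≤ ≡.refl) (θ21 4 1≤ ≡.refl)) (θ21 7 1≤ ≡.refl)) (θ21 7 1≤ ≡.refl)))
      (invertible {j 3 * j 7 * j 7 * j 10} (constant-1 {j 3 * j 7 * j 7} {j 10} (constant-1 {j 3 * j 7} {j 7} (constant-1 {j 3} {j 7} (θ21 3 1≤ ≡.refl) (θ21 7 1≤ ≡.refl)) (θ21 7 1≤ ≡.refl)) (θ21 10 1≤ ≡.refl))))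
    where
    i i′ : PS
    i = inv (j 3 * j 4 * j 7 * j 7)
    i′ = inv (j 3 * j 7 * j 7 * j 10)
  B-form 6 _ = trans (*-congˡ {CI.w} (*-congˡ {e₇} (+-cong (by-const k₆ (t 1 * i)) (·≈ (const-1 ⟨+⟩ (const-1 ⟨+⟩ ĉ₂≈)) (refl {i′})))))
    (form-6 {const k₆} {i} {i′} (scaled-by k₆≈ (⟨neg⟩ (ĉ≈ ⟨*⟩ ĉ≈ ⟨-⟩ const-2 ⟨+⟩ const-1))) (invertible {t 2 * t 3} (constant-1 {t 2} {t 3} (θ7 2 1≤ ≡.refl) (θ7 3 1≤ ≡.refl)))
      (triple {j 2} {j 7} {j 9} (θ21 2 1≤ ≡.refl) (θ21 7 1≤ ≡.refl) (θ21 9 1≤ ≡.refl)))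
    where
    i i′ : PS
    i = inv (t 2 * t 3)
    i′ = inv (j 2 * j 7 * j 9)
  B-form (suc (suc (suc (suc (suc (suc (suc i))))))) (s≤s (s≤s (s≤s (s≤s (s≤s (s≤s (s≤s ())))))))

  open Limits PSF using (_⟶_; ⟶-unique; ⟶-cong)

  dil-poch : dilate7 e₇ ≈ poch 49 49
  dil-poch = ⟶-unique {λ M → dilate7 (product f M)} dilated (⟶-cong products refl (poch-limit 49 49 1≤ 1≤))
    where
    f g : ℕ → PS
    f i = 1# - q ^ (7 ℕ.+ 7 ℕ.* i)
    g i = 1# - q ^ (49 ℕ.+ 49 ℕ.* i)
    dilated : (λ M → dilate7 (product f M)) ⟶ dilate7 e₇
    dilated N = let (b , h) = poch-limit 7 7 1≤ 1≤ N in b , λ M p → dil-cong[] (h M p)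
    index : ∀ i → 7 ℕ.* (7 ℕ.+ 7 ℕ.* i) ≡ 49 ℕ.+ 49 ℕ.* i
    index = ℕ-solve-∀
    factor : ∀ i → dilate7 (f i) ≈ g i
    factor i = trans (dil-+ 1# (- (q ^ (7 ℕ.+ 7 ℕ.* i)))) (+-cong dil-1 (trans (dil-neg (q ^ (7 ℕ.+ 7 ℕ.* i))) (-‿cong (trans (dil-^ (7 ℕ.+ 7 ℕ.* i)) (reflexive (≡.cong (q ^_) (index i)))))))
    products : ∀ M → product g M ≈ dilate7 (product f M)
    products zero = sym dil-1
    products (suc M) = sym (trans (dil-* (product f M) (f M)) (*-cong (sym (products M)) (factor M)))

  RHS≈ : RHS ≈ partial (λ i → q ^ i * dilate7 (B i)) 7
  RHS≈ = begin
    poch 49 49 * sum7 (λ i → shift i (dilate7 (A i)))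
      ≈⟨ *-cong (sym dil-poch) (sum7≈ (λ i → shift i (dilate7 (A i)))) ⟩
    dilate7 e₇ * partial (λ i → shift i (dilate7 (A i))) 7
      ≈⟨ partial-*ˡ (dilate7 e₇) (λ i → shift i (dilate7 (A i))) 7 ⟨
    partial (λ i → dilate7 e₇ * shift i (dilate7 (A i))) 7
      ≈⟨ partial-cong 7 (λ i _ → trans (*-congˡ {dilate7 e₇} (shift≈ i (dilate7 (A i)))) (trans (swap (dilate7 e₇) (q ^ i) (dilate7 (A i))) (*-congˡ {q ^ i} (sym (dil-* e₇ (A i)))))) ⟩
    partial (λ i → q ^ i * dilate7 (B i)) 7 ∎
    where
    swap : ∀ x y z → x * (y * z) ≈ y * (x * z)
    swap = solve 3 (λ x y z → x :* (y :* z) := y :* (x :* z)) refl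

  theorem : LHS ≈ RHS
  theorem = trans (lambert-series B B-form term₁-sum term₂-sum refl term₁-fold term₂-pair) (sym RHS≈)

theorem7 : {c ℓ : Level} (F : Field c ℓ) → let open Field F in
    (ζ : Carrier) →
    FieldNotions.CharZero F →
    FieldNotions.IsPrimitiveRoot F 7 ζ →
    Thm7._≋_ F ζ (Thm7.LHS F ζ) (Thm7.RHS F ζ)
theorem7 F ζ charZero prim = Proof.theorem F ζ charZero prim
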